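{- For all integers $k\geq 1$ and $D\geq 1$ there is a constant $K=K(k,D)$ such that the following holds. Let $\mathcal{C}$ be a finite set of $n$ irreducible algebraic curves in $\mathbb{C}^2$, each of degree at most $D$. Then $$\sum_{p\in\mathbb{C}^2} m_{k,\mathcal{C}}(p)\leq K\, n^{\frac{k+2}{k+1}}.$$
   Context: A (complex plane) algebraic curve is a set $\gamma=\{(x,y)\in\mathbb{C}^2 : P(x,y)=0\}$ with $P\in\mathbb{C}[x,y]$ a non-zero (non-constant) polynomial. One can always choose $P$ square-free; then the degree of $\gamma$ is $\deg P$, and a point $p\in\gamma$ is called smooth if $\nabla P(p)\neq 0$. Tangency to order $\geq k$: let $\gamma,\tilde\gamma$ be algebraic curves in $\mathbb{C}^2$ and let $p=(x,y)$ be a smooth point of both $\gamma$ and $\tilde\gamma$. Applying a rotation if necessary, assume that neither curve has vertical tangent at $p$. In a neighborhood of $p$, parameterize $\gamma$ as $(t,h(t))$ and $\tilde\gamma$ as $(t,\tilde h(t))$, with $h,\tilde h$ holomorphic near $x$. Then $\gamma$ and $\tilde\gamma$ are tangent at $p$ to order $\geq k$ if $|h(t)-\tilde h(t)|=O(|t-x|^{k+1})$ as $t\to x$ (equivalently, $h^{(j)}(x)=\tilde h^{(j)}(x)$ for $j=0,1,\ldots,k$). Tangency is only defined at points that are smooth on both curves. For a set $\mathcal{C}$ of irreducible algebraic curves in $\mathbb{C}^2$, an integer $k\geq 1$ and $p\in\mathbb{C}^2$, define $$m_{k,\mathcal{C}}(p)=\big|\{\gamma\in\mathcal{C} : \text{there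 exists } \tilde\gamma\in\mathcal{C} \text{ with } \tilde\gamma\neq\gamma \text{ such that } \gamma \text{ and } \tilde\gamma \text{ are tangent to order}\geq k \text{ at } p\}\big|.$$ -}

module Defs where

open import Algebra.Bundles using (RawRing)
import Algebra.Definitions.RawSemiring as RawSemiringDefinitions
open import Axiom.ExcludedMiddle using (ExcludedMiddle)
open import Data.Fin.Base using (Fin)
open import Data.List.Base using (List; []; _∷_; map)
open import Data.Nat.Base as ℕ using (ℕ; zero; suc)
import Data.Nat.Properties as ℕ
open import Data.Product.Base using (∃; _×_; _,_; proj₁; proj₂)
open import Data.Rational.Base as ℚ using (ℚ; 0ℚ; 1ℚ; ½; ∣_∣)
import Data.Rational.Properties as ℚ
open import Data.Rational.Solver using (module +-*-Solver)
open import Data.Vec.Base using (allFin; count)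
open import Data.Product.Relation.Binary.Pointwise.NonDependent using (×-setoid)
open import Function.Bundles using (Func; _⇔_)
open import Level using (0ℓ)
open import Relation.Binary.Bundles using (Setoid)
open import Relation.Binary.PropositionalEquality
  using (_≡_; refl; sym; trans; cong; cong₂; subst)
open import Relation.Nullary.Negation.Core using (¬_)
open import Relation.Unary using (Decidable; Pred; _≐_)

open +-*-Solver using (solve; _:=_; _:+_; _:*_; :-_; _:-_)

private
  ½-pos : ∀ {ε} → 0ℚ ℚ.< ε → 0ℚ ℚ.< ½ ℚ.* ε
  ½-pos {ε} 0<ε =
    subst (ℚ._< ½ ℚ.* ε) (ℚ.*-zeroʳ ½) (ℚ.*-monoʳ-<-pos ½ 0<ε)

  ½+½ : ∀ ε → ½ ℚ.* ε ℚ.+ ½ ℚ.* ε ≡ ε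
  ½+½ ε = trans (sym (ℚ.*-distribʳ-+ ε ½ ½)) (ℚ.*-identityˡ ε)

  halves : ∀ {ε} a b → ∣ a ∣ ℚ.< ½ ℚ.* ε → ∣ b ∣ ℚ.< ½ ℚ.* ε → ∣ a ℚ.+ b ∣ ℚ.< ε
  halves {ε} a b a< b< = ℚ.≤-<-trans (ℚ.∣p+q∣≤∣p∣+∣q∣ a b)
    (subst (∣ a ∣ ℚ.+ ∣ b ∣ ℚ.<_) (½+½ ε) (ℚ.+-mono-< a< b<))

  ∣∣-swap : ∀ a b → ∣ a ℚ.- b ∣ ≡ ∣ b ℚ.- a ∣
  ∣∣-swap a b = trans (cong ∣_∣ (solve 2 (λ a b → a :- b := :- (b :- a)) refl a b))
                      (ℚ.∣-p∣≡∣p∣ (b ℚ.- a))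

  ∣∣-self : ∀ {ε} a → 0ℚ ℚ.< ε → ∣ a ℚ.- a ∣ ℚ.< ε
  ∣∣-self {ε} a = subst (ℚ._< ε) (cong ∣_∣ (sym (ℚ.+-inverseʳ a)))

  -- B * δ B ε = ε / 2
  δ : ∀ B → .{{ℚ.Positive B}} → ℚ → ℚ
  δ B ε = (ℚ.1/ B) {{ℚ.pos⇒nonZero B}} ℚ.* (½ ℚ.* ε)

  δ-pos : ∀ B → .{{_ : ℚ.Positive B}} → ∀ {ε} → 0ℚ ℚ.< ε → 0ℚ ℚ.< δ B ε
  δ-pos B {ε} 0<ε = subst (ℚ._< δ B ε) (ℚ.*-zeroʳ B⁻¹)
    (ℚ.*-monoʳ-<-pos B⁻¹ {{ℚ.1/pos⇒pos B}} (½-pos 0<ε))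
    where B⁻¹ = (ℚ.1/ B) {{ℚ.pos⇒nonZero B}}

  product-bound : ∀ B → .{{_ : ℚ.Positive B}} → ∀ {ε} a b →
    ∣ a ∣ ℚ.< B → ∣ b ∣ ℚ.< δ B ε → ∣ a ℚ.* b ∣ ℚ.< ½ ℚ.* ε
  product-bound B {ε} a b a<B b<δ = begin-strict
    ∣ a ℚ.* b ∣               ≡⟨ ℚ.∣p*q∣≡∣p∣*∣q∣ a b ⟩
    ∣ a ∣ ℚ.* ∣ b ∣           ≤⟨ ℚ.*-monoʳ-≤-nonNeg ∣ b ∣ {{ℚ.∣-∣-nonNeg b}} (ℚ.<⇒≤ a<B) ⟩
    B ℚ.* ∣ b ∣               <⟨ ℚ.*-monoʳ-<-pos B b<δ ⟩
    B ℚ.* (B⁻¹ ℚ.* (½ ℚ.* ε)) ≡⟨ sym (ℚ.*-assoc B B⁻¹ (½ ℚ.* ε)) ⟩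
    B ℚ.* B⁻¹ ℚ.* (½ ℚ.* ε)   ≡⟨ cong (ℚ._* (½ ℚ.* ε)) (ℚ.*-inverseʳ B {{ℚ.pos⇒nonZero B}}) ⟩
    1ℚ ℚ.* (½ ℚ.* ε)          ≡⟨ ℚ.*-identityˡ (½ ℚ.* ε) ⟩
    ½ ℚ.* ε                   ∎
    where
    open ℚ.≤-Reasoning
    B⁻¹ = (ℚ.1/ B) {{ℚ.pos⇒nonZero B}}

  product-close : ∀ B C → .{{_ : ℚ.Positive B}} → .{{_ : ℚ.Positive C}} →
    ∀ {ε} a b c d → ∣ a ∣ ℚ.< B → ∣ d ∣ ℚ.< C →
    ∣ c ℚ.- d ∣ ℚ.< δ B ε → ∣ a ℚ.- b ∣ ℚ.< δ C ε → ∣ a ℚ.* c ℚ.- b ℚ.* d ∣ ℚ.< ε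
  product-close B C {ε} a b c d a<B d<C c-d a-b = subst (λ e → ∣ e ∣ ℚ.< ε)
    (solve 4 (λ a b c d → a :* (c :- d) :+ d :* (a :- b) := a :* c :- b :* d) refl a b c d)
    (halves (a ℚ.* (c ℚ.- d)) (d ℚ.* (a ℚ.- b))
      (product-bound B {ε} a (c ℚ.- d) a<B c-d) (product-bound C {ε} d (a ℚ.- b) d<C a-b))

  ⊔-≤ˡ : ∀ {a b n} → a ℕ.⊔ b ℕ.≤ n → a ℕ.≤ n
  ⊔-≤ˡ {a} {b} = ℕ.≤-trans (ℕ.m≤m⊔n a b)

  ⊔-≤ʳ : ∀ {a b n} → a ℕ.⊔ b ℕ.≤ n → b ℕ.≤ n
  ⊔-≤ʳ {a} {b} = ℕ.≤-trans (ℕ.m≤n⊔m a b)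

IsCauchy : (ℕ → ℚ) → Set
IsCauchy s = ∀ ε → 0ℚ ℚ.< ε →
  ∃ λ N → ∀ m n → N ℕ.≤ m → N ℕ.≤ n → ∣ s m ℚ.- s n ∣ ℚ.< ε

record ℝ : Set where
  constructor mkℝ
  field
    seq    : ℕ → ℚ
    cauchy : IsCauchy seq

open ℝ

infix 4 _≈ℝ_ _<ℝ_ _≤ℝ_

_≈ℝ_ _<ℝ_ _≤ℝ_ : ℝ → ℝ → Set
x ≈ℝ y = ∀ ε → 0ℚ ℚ.< ε → ∃ λ N → ∀ n → N ℕ.≤ n → ∣ seq x n ℚ.- seq y n ∣ ℚ.< ε
x <ℝ y = ∃ λ ε → 0ℚ ℚ.< ε × ∃ λ N → ∀ n → N ℕ.≤ n → seq x n ℚ.+ ε ℚ.< seq y n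
x ≤ℝ y = ∀ ε → 0ℚ ℚ.< ε → ∃ λ N → ∀ n → N ℕ.≤ n → seq x n ℚ.< seq y n ℚ.+ ε

private abstract
  ≈ℝ-refl : ∀ {x} → x ≈ℝ x
  ≈ℝ-refl {x} ε 0<ε = 0 , λ n _ → ∣∣-self (seq x n) 0<ε

  ≈ℝ-sym : ∀ {x y} → x ≈ℝ y → y ≈ℝ x
  ≈ℝ-sym {x} {y} x≈y ε 0<ε =
    let N , close = x≈y ε 0<ε
    in N , λ n N≤n → subst (ℚ._< ε) (∣∣-swap (seq x n) (seq y n)) (close n N≤n)

  ≈ℝ-trans : ∀ {x y z} → x ≈ℝ y → y ≈ℝ z → x ≈ℝ z
  ≈ℝ-trans {x} {y} {z} x≈y y≈z ε 0<ε =
    let N₁ , close₁ = x≈y (½ ℚ.* ε) (½-pos 0<ε)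
        N₂ , close₂ = y≈z (½ ℚ.* ε) (½-pos 0<ε)
    in N₁ ℕ.⊔ N₂ , λ n N≤n → subst (λ d → ∣ d ∣ ℚ.< ε)
         (solve 3 (λ a b c → (a :- b) :+ (b :- c) := a :- c) refl
           (seq x n) (seq y n) (seq z n))
         (halves _ _ (close₁ n (⊔-≤ˡ N≤n)) (close₂ n (⊔-≤ʳ {N₁} N≤n)))

  const-cauchy : ∀ q → IsCauchy (λ _ → q)
  const-cauchy q ε 0<ε = 0 , λ _ _ _ _ → ∣∣-self q 0<ε

ℝ-setoid : Setoid 0ℓ 0ℓ
ℝ-setoid = record
  { Carrier       = ℝ
  ; _≈_           = _≈ℝ_
  ; isEquivalence = record
    { refl  = λ {x} → ≈ℝ-refl {x}
    ; sym   = λ {x} {y} → ≈ℝ-sym {x} {y}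
    ; trans = λ {x} {y} {z} → ≈ℝ-trans {x} {y} {z}
    }
  }

fromℚ : ℚ → ℝ
fromℚ q = mkℝ (λ _ → q) (const-cauchy q)

private
  Bounded : ℝ → Set
  Bounded x = ∃ λ B → ∃ λ N → ℚ.Positive B × (∀ n → N ℕ.≤ n → ∣ seq x n ∣ ℚ.< B)

private abstract
  +-cauchy : ∀ x y → IsCauchy (λ n → seq x n ℚ.+ seq y n)
  +-cauchy x y ε 0<ε =
    let N₁ , close₁ = cauchy x (½ ℚ.* ε) (½-pos 0<ε)
        N₂ , close₂ = cauchy y (½ ℚ.* ε) (½-pos 0<ε)
    in N₁ ℕ.⊔ N₂ , λ m n N≤m N≤n → subst (λ d → ∣ d ∣ ℚ.< ε)
         (solve 4 (λ a b c d → (a :- b) :+ (c :- d) := (a :+ c) :- (b :+ d)) refl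
           (seq x m) (seq x n) (seq y m) (seq y n))
         (halves _ _ (close₁ m n (⊔-≤ˡ N≤m) (⊔-≤ˡ N≤n))
                     (close₂ m n (⊔-≤ʳ {N₁} N≤m) (⊔-≤ʳ {N₁} N≤n)))

  neg-cauchy : ∀ x → IsCauchy (λ n → ℚ.- seq x n)
  neg-cauchy x ε 0<ε =
    let N , close = cauchy x ε 0<ε
    in N , λ m n N≤m N≤n → subst (ℚ._< ε)
         (trans (∣∣-swap (seq x m) (seq x n))
           (cong ∣_∣ (solve 2 (λ a b → b :- a := :- a :- :- b) refl (seq x m) (seq x n))))
         (close m n N≤m N≤n)

  bounded : ∀ x → Bounded x
  bounded x =
    let N , close = cauchy x 1ℚ (ℚ.positive⁻¹ 1ℚ)
        c = seq x N
    in 1ℚ ℚ.+ ∣ c ∣ , N , ℚ.pos+nonNeg⇒pos 1ℚ ∣ c ∣ {{ℚ.∣-∣-nonNeg c}} , λ n N≤n →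
      ℚ.≤-<-trans
        (subst (λ a → ∣ a ∣ ℚ.≤ ∣ seq x n ℚ.- c ∣ ℚ.+ ∣ c ∣)
          (solve 2 (λ a c → (a :- c) :+ c := a) refl (seq x n) c)
          (ℚ.∣p+q∣≤∣p∣+∣q∣ (seq x n ℚ.- c) c))
        (ℚ.+-monoˡ-< ∣ c ∣ (close n N N≤n ℕ.≤-refl))

  *-cauchy : ∀ x y → IsCauchy (λ n → seq x n ℚ.* seq y n)
  *-cauchy x y ε 0<ε = from-bounds (bounded x) (bounded y)
    where
    from-bounds : Bounded x → Bounded y → ∃ λ N → ∀ m n → N ℕ.≤ m → N ℕ.≤ n →
      ∣ seq x m ℚ.* seq y m ℚ.- seq x n ℚ.* seq y n ∣ ℚ.< ε
    from-bounds (B , N₁ , B>0 , x<B) (C , N₂ , C>0 , y<C) =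
      let N₃ , closeʸ = cauchy y (δ B {{B>0}} ε) (δ-pos B {{B>0}} {ε} 0<ε)
          N₄ , closeˣ = cauchy x (δ C {{C>0}} ε) (δ-pos C {{C>0}} {ε} 0<ε)
      in (N₁ ℕ.⊔ N₂) ℕ.⊔ (N₃ ℕ.⊔ N₄) , λ m n N≤m N≤n →
        product-close B C {{B>0}} {{C>0}} {ε} (seq x m) (seq x n) (seq y m) (seq y n)
          (x<B m (⊔-≤ˡ {N₁} (⊔-≤ˡ N≤m)))
          (y<C n (⊔-≤ʳ {N₁} (⊔-≤ˡ N≤n)))
          (closeʸ m n (⊔-≤ˡ {N₃} (⊔-≤ʳ {N₁ ℕ.⊔ N₂} N≤m)) (⊔-≤ˡ {N₃} (⊔-≤ʳ {N₁ ℕ.⊔ N₂} N≤n)))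
          (closeˣ m n (⊔-≤ʳ {N₃} (⊔-≤ʳ {N₁ ℕ.⊔ N₂} N≤m)) (⊔-≤ʳ {N₃} (⊔-≤ʳ {N₁ ℕ.⊔ N₂} N≤n)))

infixl 6 _+ℝ_
infixl 7 _*ℝ_

_+ℝ_ _*ℝ_ : ℝ → ℝ → ℝ
-ℝ_ : ℝ → ℝ

x +ℝ y = mkℝ (λ n → seq x n ℚ.+ seq y n) (+-cauchy x y)
-ℝ x   = mkℝ (λ n → ℚ.- seq x n) (neg-cauchy x)
x *ℝ y = mkℝ (λ n → seq x n ℚ.* seq y n) (*-cauchy x y)

0ℝ 1ℝ : ℝ
0ℝ = fromℚ 0ℚ
1ℝ = fromℚ 1ℚ

ℝ-rawRing : RawRing 0ℓ 0ℓ
ℝ-rawRing = record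
  { _≈_ = _≈ℝ_ ; _+_ = _+ℝ_ ; _*_ = _*ℝ_ ; -_ = -ℝ_ ; 0# = 0ℝ ; 1# = 1ℝ }

open RawSemiringDefinitions (RawRing.rawSemiring ℝ-rawRing) public
  using () renaming (_^_ to _^ℝ_)

ℂ-setoid : Setoid 0ℓ 0ℓ
ℂ-setoid = ×-setoid ℝ-setoid ℝ-setoid

ℂ : Set
ℂ = Setoid.Carrier ℂ-setoid

re im : ℂ → ℝ
re = proj₁
im = proj₂

fromℝ : ℝ → ℂ
fromℝ x = x , 0ℝ

ℂ-rawRing : RawRing 0ℓ 0ℓ
ℂ-rawRing = record
  { _≈_ = Setoid._≈_ ℂ-setoid
  ; _+_ = λ z w → re z +ℝ re w , im z +ℝ im w
  ; _*_ = λ z w → re z *ℝ re w +ℝ -ℝ (im z *ℝ im w) , re z *ℝ im w +ℝ im z *ℝ re w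
  ; -_  = λ z → -ℝ re z , -ℝ im z
  ; 0#  = fromℝ 0ℝ
  ; 1#  = fromℝ 1ℝ
  }

open RawRing ℂ-rawRing using (_≈_; _+_; _*_; -_; 0#)

infixl 6 _-_
_-_ : ℂ → ℂ → ℂ
z - w = z + (- w)

-- |z|².  Estimates on moduli are stated below after squaring both sides.
normSq : ℂ → ℝ
normSq z = re z *ℝ re z +ℝ im z *ℝ im z

Disc : ℂ → ℝ → Pred ℂ 0ℓ
Disc a r z = normSq (z - a) <ℝ r *ℝ r

HasDerivative : (ℂ → ℂ) → ℂ → ℂ → Set
HasDerivative f t d = ∀ ε → 0ℝ <ℝ ε → ∃ λ r → 0ℝ <ℝ r × ∀ s → Disc t r s →
  normSq (f s - f t - d * (s - t)) ≤ℝ ε *ℝ ε *ℝ normSq (s - t)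

HolomorphicNear : (ℂ → ℂ) → ℂ → Set
HolomorphicNear f a =
  ∃ λ r → 0ℝ <ℝ r × ∀ t → Disc a r t → ∃ λ d → HasDerivative f t d

-- Polynomials in one variable: lists of coefficients with the
-- constant term first; trailing zeros are allowed.
module Polynomial {c ℓ} (R : RawRing c ℓ) where

  open RawRing R
    renaming (_≈_ to _≈ᴿ_; _+_ to _+ᴿ_; _*_ to _*ᴿ_; -_ to -ᴿ_; 0# to 0ᴿ; 1# to 1ᴿ)

  coeff : List Carrier → ℕ → Carrier
  coeff []      _       = 0ᴿ
  coeff (a ∷ _) zero    = a
  coeff (_ ∷ p) (suc n) = coeff p n

  infixl 6 _⊕_
  infixl 7 _⊗_

  _⊕_ _⊗_ : List Carrier → List Carrier → List Carrier

  []      ⊕ q       = q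
  (a ∷ p) ⊕ []      = a ∷ p
  (a ∷ p) ⊕ (b ∷ q) = a +ᴿ b ∷ p ⊕ q

  []      ⊗ q = []
  (a ∷ p) ⊗ q = map (a *ᴿ_) q ⊕ (0ᴿ ∷ p ⊗ q)

  eval : List Carrier → Carrier → Carrier
  eval []      x = 0ᴿ
  eval (a ∷ p) x = a +ᴿ x *ᴿ eval p x

  -- (a + X p)′ = p + X p′
  derivative : List Carrier → List Carrier
  derivative []      = []
  derivative (_ ∷ p) = p ⊕ (0ᴿ ∷ derivative p)

  rawRing : RawRing c ℓ
  rawRing = record
    { Carrier = List Carrier
    ; _≈_     = λ p q → ∀ n → coeff p n ≈ᴿ coeff q n
    ; _+_     = _⊕_
    ; _*_     = _⊗_
    ; -_      = map -ᴿ_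
    ; 0#      = []
    ; 1#      = 1ᴿ ∷ []
    }

-- ℂ[x,y] is taken to be ℂ[x][y].
private
  module ℂ[x]    = Polynomial ℂ-rawRing
  module ℂ[x][y] = Polynomial ℂ[x].rawRing

ℂ[x,y]-rawRing : RawRing 0ℓ 0ℓ
ℂ[x,y]-rawRing = ℂ[x][y].rawRing

ℂ[x,y] : Set
ℂ[x,y] = RawRing.Carrier ℂ[x,y]-rawRing

open RawSemiringDefinitions (RawRing.rawSemiring ℂ[x,y]-rawRing)
  using (_∣_) renaming (Irreducible to IrreduciblePolynomial)

open RawRing ℂ[x,y]-rawRing using () renaming (_*_ to _·_; 1# to 1ₚ)

-- The coefficient of xⁱ yʲ.
coefficient : ℂ[x,y] → ℕ → ℕ → ℂ
coefficient P i j = ℂ[x].coeff (ℂ[x][y].coeff P j) i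

_HasDegree≤_ : ℂ[x,y] → ℕ → Set
P HasDegree≤ d = ∀ i j → d ℕ.< i ℕ.+ j → coefficient P i j ≈ 0#

∂x ∂y : ℂ[x,y] → ℂ[x,y]
∂x = map ℂ[x].derivative
∂y = ℂ[x][y].derivative

ℂ²-setoid : Setoid 0ℓ 0ℓ
ℂ²-setoid = ×-setoid ℂ-setoid ℂ-setoid

ℂ² : Set
ℂ² = Setoid.Carrier ℂ²-setoid

_⟨_⟩ : ℂ[x,y] → ℂ² → ℂ
P ⟨ x , y ⟩ = ℂ[x].eval (map (λ p → ℂ[x].eval p x) P) y

-- A curve is given by a square-free equation.  Two curves are equal when
-- their sets of points are, which determines the equation only up to a
-- scalar; see _≈ᶜ_.
record Curve : Set where
  field
    equation    : ℂ[x,y]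
    nonConstant : ¬ (equation HasDegree≤ 0)
    squareFree  : ∀ f → f · f ∣ equation → f ∣ 1ₚ

open Curve

points : Curve → Pred ℂ² 0ℓ
points γ p = equation γ ⟨ p ⟩ ≈ 0#

infix 4 _≈ᶜ_
_≈ᶜ_ : Curve → Curve → Set
γ ≈ᶜ γ̃ = points γ ≐ points γ̃

Degree≤ : ℕ → Curve → Set
Degree≤ D γ = equation γ HasDegree≤ D

Irreducible : Curve → Set
Irreducible γ = IrreduciblePolynomial (equation γ)

gradient : Curve → ℂ² → ℂ²
gradient γ p = ∂x (equation γ) ⟨ p ⟩ , ∂y (equation γ) ⟨ p ⟩

SmoothPoint : Curve → ℂ² → Set
SmoothPoint γ p = points γ p × ¬ (Setoid._≈_ ℂ²-setoid (gradient γ p) (0# , 0#))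

record Rotation : Set where
  field
    cosine sine : ℝ
    unit        : cosine *ℝ cosine +ℝ sine *ℝ sine ≈ℝ 1ℝ

open Rotation

rotate rotate⁻¹ : Rotation → ℂ² → ℂ²
rotate R (x , y) = c * x - s * y , s * x + c * y
  where c = fromℝ (cosine R)
        s = fromℝ (sine R)
rotate⁻¹ R (x , y) = c * x + s * y , c * y - s * x
  where c = fromℝ (cosine R)
        s = fromℝ (sine R)

-- The image of γ under R.
rotated : Rotation → Curve → Pred ℂ² 0ℓ
rotated R γ q = points γ (rotate⁻¹ R q)

-- The tangent line of γ at a smooth point p is spanned by (-∂yP, ∂xP).
VerticalAfter : Rotation → Curve → ℂ² → Set
VerticalAfter R γ p = let Px , Py = gradient γ p in
  proj₁ (rotate R (- Py , Px)) ≈ 0#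

-- In a neighbourhood of (a , b), S is the graph of h, and h is holomorphic
-- near a.  The values of h away from a are irrelevant.
record LocalGraph (S : Pred ℂ² 0ℓ) (q : ℂ²) (h : ℂ → ℂ) : Set where
  private
    a = proj₁ q
    b = proj₂ q
  field
    holomorphic : HolomorphicNear h a
    graph       : ∃ λ r → 0ℝ <ℝ r × ∀ t u → Disc a r t → Disc b r u →
                  S (t , u) ⇔ u ≈ h t

-- |h(t) - h̃(t)| = O(|t - a|ᵉ) as t → a
AgreeToOrder : ℕ → (h h̃ : ℂ → ℂ) → ℂ → Set
AgreeToOrder e h h̃ a = ∃ λ A → ∃ λ r → 0ℝ <ℝ r × ∀ t → Disc a r t →
  normSq (h t - h̃ t) ≤ℝ A *ℝ normSq (t - a) ^ℝ e

record GraphsTangent (k : ℕ) (S S̃ : Pred ℂ² 0ℓ) (q : ℂ²) : Set where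
  field
    h h̃    : Func ℂ-setoid ℂ-setoid
    S-is-h  : LocalGraph S q (Func.to h)
    S̃-is-h̃  : LocalGraph S̃ q (Func.to h̃)
    agree   : AgreeToOrder (suc k) (Func.to h) (Func.to h̃) (proj₁ q)

TangentToOrder≥ : ℕ → Curve → Curve → ℂ² → Set
TangentToOrder≥ k γ γ̃ p =
  SmoothPoint γ p × SmoothPoint γ̃ p ×
  ∃ λ R → ¬ VerticalAfter R γ p × ¬ VerticalAfter R γ̃ p ×
          GraphsTangent k (rotated R γ) (rotated R γ̃) (rotate R p)

TangentToAnother : ℕ → ∀ {n} → (Fin n → Curve) → ℂ² → Fin n → Set
TangentToAnother k 𝒞 p i = ∃ λ j → ¬ (𝒞 j ≈ᶜ 𝒞 i) × TangentToOrder≥ k (𝒞 i) (𝒞 j) p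

-- m_{k,𝒞}(p), for 𝒞 enumerated without repetition; excluded middle is
-- what makes the cardinality of an arbitrary subset of 𝒞 a number.
multiplicity : ExcludedMiddle 0ℓ → ℕ → ∀ {n} → (Fin n → Curve) → ℂ² → ℕ
multiplicity em k {n} 𝒞 p = count tangent? (allFin n)
  where
  tangent? : Decidable (TangentToAnother k 𝒞 p)
  tangent? i = em {TangentToAnother k 𝒞 p i}

{-# OPTIONS --safe #-}
module Submission where

-- After a shear, all tangents at the given points are non-vertical and the points have distinct
-- abscissas, so near such a point a curve is the graph of a branch y(x).  The points
-- (x , y , y′ , … , y⁽ᵏ⁾) of its jet are the same for two curves which are tangent to order k.
--
-- Suppose that every one of n curves has more than M = C e tangencies.  If n (M + 1) < e^(k+2), there
-- is a nonzero polynomial Q in k + 2 variables, of degree less than e in each of them, which vanishes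
-- at the jets of M + 1 tangencies on every curve.  On a curve, Q becomes a polynomial in x and y of
-- degree O(e), so by Bézout it vanishes along the whole branch.  Comparing the first coefficients at
-- which two tangent branches differ, the derivative of Q in its last variable vanishes at the chosen
-- jets as well.  Iterating this over all the variables yields Q = 0.  So with e^(k+1) of order n, some
-- curve has at most M tangencies; removing it and repeating bounds the sum by 2 M n.
--
-- Branches are expanded in Hurwitz series, whose entries are the successive derivatives.

-- The comparison at a tangency needs `Q` to vanish along both branches, so the partner too must
-- carry more than `M` tangencies. Hence the argument is applied to subfamilies in which every curve
-- does, and a poor curve is removed whenever there is one. That may take away tangencies of other
-- curves; the loss is affordable because agreement of branches is transitive. The exponent depends
-- on `M` being linear in `e`: about `n e` conditions are imposed on `e^(k+2)` coefficients.
-- Elimination therefore goes by pseudo-division with degrees tracked, crude in the degree of the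
-- curve but linear in that of the other polynomial. Tangency is defined by holomorphic functions in
-- coordinates rotated for the pair at hand, whereas the argument wants formal branches in
-- coordinates common to all curves. Holomorphy enters as continuity at the point. The truncated
-- expansion of one branch is a polynomial arc, and the equation of the other curve is shown to
-- vanish along it to order k + 1.

open import Algebra.Bundles using (CommutativeRing; RawRing)
import Algebra.Definitions.RawMagma
import Algebra.Definitions.RawSemiring
import Algebra.Properties.AbelianGroup
import Algebra.Properties.CommutativeSemigroup
import Algebra.Properties.Group
import Algebra.Properties.Ring
import Algebra.Properties.Semiring.Mult
import Algebra.Properties.Semiring.Mult.TCOptimised
import Algebra.Solver.Ring
open import Algebra.Solver.Ring.AlmostCommutativeRing
open import Algebra.Structures using (IsCommutativeRing)
open import Axiom.ExcludedMiddle using (ExcludedMiddle)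
open import Data.Empty using (⊥-elim)
open import Data.Fin.Base as Fin using (Fin; zero; suc; toℕ; combine; remQuot; punchIn; punchOut)
import Data.Fin.Properties as Fin
import Data.Integer.Base as ℤ
import Data.Integer.Properties as ℤ
open import Data.List.Base using (List; []; _∷_; map; tabulate; length)
open import Data.List.Membership.Propositional using (_∈_)
import Data.List.Properties as List
open import Data.List.Relation.Unary.All as All using (All; []; _∷_)
open import Data.List.Relation.Unary.AllPairs as AllPairs using (AllPairs; []; _∷_)
open import Data.List.Relation.Unary.Any using (here; there)
open import Data.Maybe.Base using (Maybe; just; nothing)
open import Data.Nat.Base as ℕ using (ℕ; zero; suc; s≤s; z≤n; _∸_)
import Data.Nat.Properties as ℕ
open import Data.Nat.ListAction using (sum)
open import Data.Nat.Solver using (module +-*-Solver)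
open import Data.Product.Base using (∃; _×_; _,_; proj₁; proj₂)
open import Data.Rational.Base as ℚ using (ℚ; 0ℚ; 1ℚ; ½; ∣_∣)
import Data.Rational.Properties as ℚ
open import Data.Rational.Solver using () renaming (module +-*-Solver to ℚ-Solver)
open import Data.Sum.Base using (_⊎_; inj₁; inj₂; [_,_]′)
open import Data.Unit.Base using (⊤; tt)
open import Data.Vec.Base as Vec using (count; allFin)
open import Function.Base using (_∘_)
open import Function.Bundles using (Func; Equivalence)
open import Function.Definitions using (Injective)
open import Level using (0ℓ)
open import Relation.Binary.Bundles using (Setoid)
import Relation.Binary.PropositionalEquality as ≡
open ≡ using (_≡_; _≢_)
import Relation.Binary.Reasoning.Setoid
open import Relation.Nullary.Decidable.Core using (Dec; yes; no; toWitness)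
open import Relation.Nullary.Negation.Core using (¬_)

open import Defs using (module Polynomial)

-- Polynomial rings

-- The ring solver wants coefficients with a partial test for equality. An arbitrary commutative
-- ring has none, so integers serve as coefficients and are mapped into the ring.
module Integers (R : CommutativeRing 0ℓ 0ℓ) where
  open CommutativeRing R
  open Algebra.Properties.Ring ring
  open Algebra.Properties.AbelianGroup +-abelianGroup using (⁻¹-∙-comm)
  open Algebra.Properties.CommutativeSemigroup +-commutativeSemigroup using (interchange)
  open Algebra.Properties.Semiring.Mult semiring using (×-homo-+; ×1-homo-*) renaming (_×_ to _·_)
  open Algebra.Properties.Semiring.Mult.TCOptimised semiring using (×ᵤ≈×) renaming (_×_ to _×′_)
  open Relation.Binary.Reasoning.Setoid setoid

  ⟦_⟧ : ℤ.ℤ → Carrier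
  ⟦ ℤ.+ n ⟧      = n ×′ 1#
  ⟦ ℤ.-[1+ n ] ⟧ = - (suc n ×′ 1#)

  private
    ⟦+⟧ : ∀ n → ⟦ ℤ.+ n ⟧ ≈ n · 1#
    ⟦+⟧ n = sym (×ᵤ≈× n 1#)

    ⟦-⟧ : ∀ n → ⟦ ℤ.- (ℤ.+ n) ⟧ ≈ - (n · 1#)
    ⟦-⟧ zero    = sym -0#≈0#
    ⟦-⟧ (suc n) = -‿cong (⟦+⟧ (suc n))

    ⟦⊖⟧ : ∀ m n → ⟦ m ℤ.⊖ n ⟧ ≈ m · 1# - n · 1#
    ⟦⊖⟧ m       zero    = begin
      ⟦ ℤ.+ m ⟧        ≈⟨ ⟦+⟧ m ⟩
      m · 1#           ≈⟨ +-identityʳ _ ⟨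
      m · 1# + 0#      ≈⟨ +-congˡ -0#≈0# ⟨
      m · 1# - 0#      ∎
    ⟦⊖⟧ zero    (suc n) = begin
      - (suc n ×′ 1#)    ≈⟨ ⟦-⟧ (suc n) ⟩
      - (suc n · 1#)     ≈⟨ +-identityˡ _ ⟨
      0# - suc n · 1#    ∎
    ⟦⊖⟧ (suc m) (suc n) = begin
      ⟦ suc m ℤ.⊖ suc n ⟧                  ≡⟨ ≡.cong ⟦_⟧ (ℤ.[1+m]⊖[1+n]≡m⊖n m n) ⟩
      ⟦ m ℤ.⊖ n ⟧                          ≈⟨ ⟦⊖⟧ m n ⟩
      m · 1# - n · 1#                      ≈⟨ +-identityˡ _ ⟨
      0# + (m · 1# - n · 1#)               ≈⟨ +-congʳ (-‿inverseʳ 1#) ⟨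
      (1# - 1#) + (m · 1# - n · 1#)        ≈⟨ interchange _ _ _ _ ⟩
      suc m · 1# + (- 1# - n · 1#)         ≈⟨ +-congˡ (⁻¹-∙-comm 1# (n · 1#)) ⟩
      suc m · 1# - suc n · 1#              ∎

    ⟦+-homo⟧ : ∀ i j → ⟦ i ℤ.+ j ⟧ ≈ ⟦ i ⟧ + ⟦ j ⟧
    ⟦+-homo⟧ (ℤ.+ m) (ℤ.+ n) = begin
      ⟦ ℤ.+ (m ℕ.+ n) ⟧       ≈⟨ ⟦+⟧ (m ℕ.+ n) ⟩
      (m ℕ.+ n) · 1#          ≈⟨ ×-homo-+ 1# m n ⟩
      m · 1# + n · 1#         ≈⟨ +-cong (⟦+⟧ m) (⟦+⟧ n) ⟨
      ⟦ ℤ.+ m ⟧ + ⟦ ℤ.+ n ⟧   ∎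
    ⟦+-homo⟧ (ℤ.+ m) ℤ.-[1+ n ] =
      trans (⟦⊖⟧ m (suc n)) (sym (+-cong (⟦+⟧ m) (⟦-⟧ (suc n))))
    ⟦+-homo⟧ ℤ.-[1+ m ] (ℤ.+ n) =
      trans (⟦⊖⟧ n (suc m)) (trans (+-comm _ _) (sym (+-cong (⟦-⟧ (suc m)) (⟦+⟧ n))))
    ⟦+-homo⟧ ℤ.-[1+ m ] ℤ.-[1+ n ] = begin
      ⟦ ℤ.-[1+ suc (m ℕ.+ n) ] ⟧           ≈⟨ ⟦-⟧ (suc (suc (m ℕ.+ n))) ⟩
      - (suc (suc (m ℕ.+ n)) · 1#)         ≡⟨ ≡.cong (λ l → - (l · 1#)) (≡.sym (ℕP.+-suc (suc m) n)) ⟩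
      - ((suc m ℕ.+ suc n) · 1#)           ≈⟨ -‿cong (×-homo-+ 1# (suc m) (suc n)) ⟩
      - (suc m · 1# + suc n · 1#)          ≈⟨ ⁻¹-∙-comm _ _ ⟨
      - (suc m · 1#) - suc n · 1#          ≈⟨ +-cong (⟦-⟧ (suc m)) (⟦-⟧ (suc n)) ⟨
      ⟦ ℤ.-[1+ m ] ⟧ + ⟦ ℤ.-[1+ n ] ⟧      ∎
      where import Data.Nat.Properties as ℕP

    ⟦-homo⟧ : ∀ i → ⟦ ℤ.- i ⟧ ≈ - ⟦ i ⟧
    ⟦-homo⟧ (ℤ.+ n)    = trans (⟦-⟧ n) (-‿cong (sym (⟦+⟧ n)))
    ⟦-homo⟧ ℤ.-[1+ n ] = sym (-‿involutive _)

    ⟦*⟧ : ∀ m n → ⟦ ℤ.+ m ℤ.* ℤ.+ n ⟧ ≈ ⟦ ℤ.+ m ⟧ * ⟦ ℤ.+ n ⟧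
    ⟦*⟧ m n = begin
      ⟦ ℤ.+ m ℤ.* ℤ.+ n ⟧     ≡⟨ ≡.cong ⟦_⟧ (ℤ.pos-* m n) ⟨
      ⟦ ℤ.+ (m ℕ.* n) ⟧       ≈⟨ ⟦+⟧ (m ℕ.* n) ⟩
      (m ℕ.* n) · 1#          ≈⟨ ×1-homo-* m n ⟩
      (m · 1#) * (n · 1#)     ≈⟨ *-cong (⟦+⟧ m) (⟦+⟧ n) ⟨
      ⟦ ℤ.+ m ⟧ * ⟦ ℤ.+ n ⟧   ∎

    ⟦neg*⟧ : ∀ i j → ⟦ i ℤ.* j ⟧ ≈ ⟦ i ⟧ * ⟦ j ⟧ → ⟦ ℤ.- i ℤ.* j ⟧ ≈ ⟦ ℤ.- i ⟧ * ⟦ j ⟧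
    ⟦neg*⟧ i j eq = begin
      ⟦ ℤ.- i ℤ.* j ⟧    ≡⟨ ≡.cong ⟦_⟧ (≡.sym (ℤ.neg-distribˡ-* i j)) ⟩
      ⟦ ℤ.- (i ℤ.* j) ⟧  ≈⟨ ⟦-homo⟧ (i ℤ.* j) ⟩
      - ⟦ i ℤ.* j ⟧      ≈⟨ -‿cong eq ⟩
      - (⟦ i ⟧ * ⟦ j ⟧)  ≈⟨ -‿distribˡ-* _ _ ⟩
      - ⟦ i ⟧ * ⟦ j ⟧    ≈⟨ *-congʳ (⟦-homo⟧ i) ⟨
      ⟦ ℤ.- i ⟧ * ⟦ j ⟧  ∎

    ⟦*neg⟧ : ∀ i j → ⟦ i ℤ.* j ⟧ ≈ ⟦ i ⟧ * ⟦ j ⟧ → ⟦ i ℤ.* ℤ.- j ⟧ ≈ ⟦ i ⟧ * ⟦ ℤ.- j ⟧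
    ⟦*neg⟧ i j eq = begin
      ⟦ i ℤ.* ℤ.- j ⟧    ≡⟨ ≡.cong ⟦_⟧ (ℤ.*-comm i (ℤ.- j)) ⟩
      ⟦ ℤ.- j ℤ.* i ⟧    ≈⟨ ⟦neg*⟧ j i (trans (reflexive (≡.cong ⟦_⟧ (ℤ.*-comm j i))) (trans eq (*-comm _ _))) ⟩
      ⟦ ℤ.- j ⟧ * ⟦ i ⟧  ≈⟨ *-comm _ _ ⟩
      ⟦ i ⟧ * ⟦ ℤ.- j ⟧  ∎

    ⟦*-homo⟧ : ∀ i j → ⟦ i ℤ.* j ⟧ ≈ ⟦ i ⟧ * ⟦ j ⟧
    ⟦*-homo⟧ (ℤ.+ m)    (ℤ.+ n)    = ⟦*⟧ m n
    ⟦*-homo⟧ (ℤ.+ m)    ℤ.-[1+ n ] = ⟦*neg⟧ (ℤ.+ m) (ℤ.+ suc n) (⟦*⟧ m (suc n))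
    ⟦*-homo⟧ ℤ.-[1+ m ] (ℤ.+ n)    = ⟦neg*⟧ (ℤ.+ suc m) (ℤ.+ n) (⟦*⟧ (suc m) n)
    ⟦*-homo⟧ ℤ.-[1+ m ] ℤ.-[1+ n ] = ⟦neg*⟧ (ℤ.+ suc m) ℤ.-[1+ n ]
      (⟦*neg⟧ (ℤ.+ suc m) (ℤ.+ suc n) (⟦*⟧ (suc m) (suc n)))

    ⟦_⟧≟⟦_⟧ : ∀ i j → Maybe (⟦ i ⟧ ≈ ⟦ j ⟧)
    ⟦ i ⟧≟⟦ j ⟧ with i ℤ.≟ j
    ... | yes eq = just (reflexive (≡.cong ⟦_⟧ eq))
    ... | no _   = nothing

  private
    homomorphism : ℤ.+-*-rawRing -Raw-AlmostCommutative⟶ fromCommutativeRing R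
    homomorphism = record
      { ⟦_⟧ = ⟦_⟧ ; +-homo = ⟦+-homo⟧ ; *-homo = ⟦*-homo⟧ ; -‿homo = ⟦-homo⟧
      ; 0-homo = refl ; 1-homo = refl }

  module Solver = Algebra.Solver.Ring ℤ.+-*-rawRing (fromCommutativeRing R) homomorphism ⟦_⟧≟⟦_⟧

  open Solver public using (solve; _:=_; _:+_; _:*_; :-_; _:-_; con)
  infix 10 :#_
  :#_ : ∀ {m} → ℕ → Solver.Polynomial m
  :# n = con (ℤ.+ n)

CRing : Set₁
CRing = CommutativeRing 0ℓ 0ℓ

∣_∣ᶜ : CRing → Set
∣ R ∣ᶜ = CommutativeRing.Carrier R

module Poly (R : CRing) where
  open CommutativeRing R
  open Polynomial rawRing public using (coeff; _⊕_; _⊗_; eval; derivative)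
  open Integers R
  open Relation.Binary.Reasoning.Setoid setoid

  infix 4 _≋_
  -- A record, since the bare function type would be unfolded and the two polynomials could not be
  -- inferred from an equation between them. The equalities of series, complex numbers and reals are
  -- wrapped for the same reason.
  record _≋_ (p q : List Carrier) : Set where
    constructor mk≋
    field at : ∀ n → coeff p n ≈ coeff q n
  open _≋_ public

  coeff-⊕ : ∀ p q n → coeff (p ⊕ q) n ≈ coeff p n + coeff q n
  coeff-⊕ []      q       n       = sym (+-identityˡ _)
  coeff-⊕ (a ∷ p) []      n       = sym (+-identityʳ _)
  coeff-⊕ (a ∷ p) (b ∷ q) zero    = refl
  coeff-⊕ (a ∷ p) (b ∷ q) (suc n) = coeff-⊕ p q n

  coeff-map : ∀ (f : Carrier → Carrier) → f 0# ≈ 0# → ∀ p n → coeff (map f p) n ≈ f (coeff p n)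
  coeff-map f f0 []      n       = sym f0
  coeff-map f f0 (a ∷ p) zero    = refl
  coeff-map f f0 (a ∷ p) (suc n) = coeff-map f f0 p n

  coeff-* : ∀ a p n → coeff (map (a *_) p) n ≈ a * coeff p n
  coeff-* a = coeff-map (a *_) (zeroʳ a)

  coeff-neg : ∀ p n → coeff (map -_ p) n ≈ - coeff p n
  coeff-neg = coeff-map -_ (solve 0 (:- :# 0 := :# 0) refl)

  ∷-cong : ∀ {a b p q} → a ≈ b → p ≋ q → a ∷ p ≋ b ∷ q
  ∷-cong eq eqs .at zero    = eq
  ∷-cong eq eqs .at (suc n) = eqs .at n

  coeff-∷⊗ : ∀ a p q n → coeff ((a ∷ p) ⊗ q) n ≈ a * coeff q n + coeff (0# ∷ p ⊗ q) n
  coeff-∷⊗ a p q n = trans (coeff-⊕ (map (a *_) q) (0# ∷ p ⊗ q) n) (+-congʳ (coeff-* a q n))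

  private
    via : ∀ {p q} (f g : ℕ → Carrier) → (∀ n → coeff p n ≈ f n) → (∀ n → coeff q n ≈ g n) →
          (∀ n → f n ≈ g n) → p ≋ q
    via f g p≈f q≈g f≈g .at n = trans (p≈f n) (trans (f≈g n) (sym (q≈g n)))

    ≋-refl : ∀ {p} → p ≋ p
    ≋-refl .at n = refl

    ≋-sym : ∀ {p q} → p ≋ q → q ≋ p
    ≋-sym eq .at n = sym (eq .at n)

    ≋-trans : ∀ {p q r} → p ≋ q → q ≋ r → p ≋ r
    ≋-trans eq eq′ .at n = trans (eq .at n) (eq′ .at n)

    ⊕-cong : ∀ {p p′ q q′} → p ≋ p′ → q ≋ q′ → p ⊕ q ≋ p′ ⊕ q′
    ⊕-cong {p} {p′} {q} {q′} eq eq′ = via _ _ (coeff-⊕ p q) (coeff-⊕ p′ q′)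
      λ n → +-cong (eq .at n) (eq′ .at n)

    ⊕-assoc : ∀ p q r → (p ⊕ q) ⊕ r ≋ p ⊕ (q ⊕ r)
    ⊕-assoc p q r = via _ _
      (λ n → trans (coeff-⊕ (p ⊕ q) r n) (+-congʳ (coeff-⊕ p q n)))
      (λ n → trans (coeff-⊕ p (q ⊕ r) n) (+-congˡ (coeff-⊕ q r n)))
      (λ n → +-assoc _ _ _)

    ⊕-comm : ∀ p q → p ⊕ q ≋ q ⊕ p
    ⊕-comm p q = via _ _ (coeff-⊕ p q) (coeff-⊕ q p) (λ n → +-comm _ _)

    ⊕-identityʳ : ∀ p → p ⊕ [] ≋ p
    ⊕-identityʳ p .at n = trans (coeff-⊕ p [] n) (+-identityʳ _)

    neg-cong : ∀ {p q} → p ≋ q → map -_ p ≋ map -_ q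
    neg-cong {p} {q} eq = via _ _ (coeff-neg p) (coeff-neg q) (λ n → -‿cong (eq .at n))

    neg-inverseʳ : ∀ p → p ⊕ map -_ p ≋ []
    neg-inverseʳ p .at n = trans (coeff-⊕ p (map -_ p) n)
      (trans (+-congˡ (coeff-neg p n)) (-‿inverseʳ _))

    map-cong : ∀ {p q} a → p ≋ q → map (a *_) p ≋ map (a *_) q
    map-cong {p} {q} a eq = via _ _ (coeff-* a p) (coeff-* a q) (λ n → *-congˡ (eq .at n))

    ⊗-congˡ : ∀ p {q q′} → q ≋ q′ → p ⊗ q ≋ p ⊗ q′
    ⊗-congˡ []      eq = ≋-refl
    ⊗-congˡ (a ∷ p) eq = ⊕-cong (map-cong a eq) (∷-cong refl (⊗-congˡ p eq))

    ⊗-zeroʳ : ∀ p → p ⊗ [] ≋ []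
    ⊗-zeroʳ []      = ≋-refl
    ⊗-zeroʳ (a ∷ p) .at zero    = refl
    ⊗-zeroʳ (a ∷ p) .at (suc n) = ⊗-zeroʳ p .at n

    ⊗-∷ : ∀ p b q → p ⊗ (b ∷ q) ≋ map (b *_) p ⊕ (0# ∷ p ⊗ q)
    ⊗-∷ []      b q .at zero    = refl
    ⊗-∷ []      b q .at (suc n) = refl
    ⊗-∷ (a ∷ p) b q .at zero    = +-congʳ (*-comm a b)
    ⊗-∷ (a ∷ p) b q .at (suc n) = begin
      coeff (map (a *_) q ⊕ p ⊗ (b ∷ q)) n
        ≈⟨ coeff-⊕ (map (a *_) q) _ n ⟩
      coeff (map (a *_) q) n + coeff (p ⊗ (b ∷ q)) n
        ≈⟨ +-cong (coeff-* a q n) (⊗-∷ p b q .at n) ⟩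
      a * coeff q n + coeff (map (b *_) p ⊕ (0# ∷ p ⊗ q)) n
        ≈⟨ +-congˡ (coeff-⊕ (map (b *_) p) _ n) ⟩
      a * coeff q n + (coeff (map (b *_) p) n + coeff (0# ∷ p ⊗ q) n)
        ≈⟨ solve 3 (λ u v w → u :+ (v :+ w) := v :+ (u :+ w)) refl _ _ _ ⟩
      coeff (map (b *_) p) n + (a * coeff q n + coeff (0# ∷ p ⊗ q) n)
        ≈⟨ +-congˡ (coeff-∷⊗ a p q n) ⟨
      coeff (map (b *_) p) n + coeff ((a ∷ p) ⊗ q) n
        ≈⟨ coeff-⊕ (map (b *_) p) _ n ⟨
      coeff (map (b *_) p ⊕ (a ∷ p) ⊗ q) n ∎

    ⊗-comm : ∀ p q → p ⊗ q ≋ q ⊗ p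
    ⊗-comm []      q = ≋-sym (⊗-zeroʳ q)
    ⊗-comm (a ∷ p) q = ≋-trans (⊕-cong ≋-refl (∷-cong refl (⊗-comm p q))) (≋-sym (⊗-∷ q a p))

    ⊗-cong : ∀ {p p′ q q′} → p ≋ p′ → q ≋ q′ → p ⊗ q ≋ p′ ⊗ q′
    ⊗-cong {p} {p′} {q} {q′} eq eq′ = ≋-trans (⊗-congˡ p eq′)
      (≋-trans (⊗-comm p q′) (≋-trans (⊗-congˡ q′ eq) (⊗-comm q′ p′)))

    ⊗-distribʳ : ∀ q p p′ → (p ⊕ p′) ⊗ q ≋ p ⊗ q ⊕ p′ ⊗ q
    ⊗-distribʳ q []      p′       = ≋-refl
    ⊗-distribʳ q (a ∷ p) []       = ≋-sym (⊕-identityʳ _)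
    ⊗-distribʳ q (a ∷ p) (b ∷ p′) = via _ _
      (coeff-∷⊗ (a + b) (p ⊕ p′) q)
      (λ n → trans (coeff-⊕ ((a ∷ p) ⊗ q) _ n) (+-cong (coeff-∷⊗ a p q n) (coeff-∷⊗ b p′ q n)))
      λ n → trans (+-congˡ (tails n))
        (solve 5 (λ a b c d e → (a :+ b) :* c :+ (d :+ e) := (a :* c :+ d) :+ (b :* c :+ e)) refl _ _ _ _ _)
      where
      tails : ∀ n → coeff (0# ∷ (p ⊕ p′) ⊗ q) n ≈ coeff (0# ∷ p ⊗ q) n + coeff (0# ∷ p′ ⊗ q) n
      tails zero    = sym (+-identityˡ _)
      tails (suc n) = trans (⊗-distribʳ q p p′ .at n) (coeff-⊕ (p ⊗ q) _ n)

    ⊗-distribˡ : ∀ q p p′ → q ⊗ (p ⊕ p′) ≋ q ⊗ p ⊕ q ⊗ p′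
    ⊗-distribˡ q p p′ = ≋-trans (⊗-comm q (p ⊕ p′))
      (≋-trans (⊗-distribʳ q p p′) (⊕-cong (⊗-comm p q) (⊗-comm p′ q)))

    map-⊗ : ∀ a p q → map (a *_) p ⊗ q ≋ map (a *_) (p ⊗ q)
    map-⊗ a []      q = ≋-refl
    map-⊗ a (b ∷ p) q = via _ _
      (coeff-∷⊗ (a * b) (map (a *_) p) q)
      (λ n → trans (coeff-* a ((b ∷ p) ⊗ q) n) (*-congˡ (coeff-∷⊗ b p q n)))
      λ n → trans (+-congˡ (tails n))
        (solve 4 (λ a b c d → a :* b :* c :+ a :* d := a :* (b :* c :+ d)) refl _ _ _ _)
      where
      tails : ∀ n → coeff (0# ∷ map (a *_) p ⊗ q) n ≈ a * coeff (0# ∷ p ⊗ q) n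
      tails zero    = sym (zeroʳ a)
      tails (suc n) = trans (map-⊗ a p q .at n) (coeff-* a (p ⊗ q) n)

  0∷-⊗ : ∀ p q → (0# ∷ p) ⊗ q ≋ 0# ∷ p ⊗ q
  0∷-⊗ p q .at n = trans (coeff-∷⊗ 0# p q n) (trans (+-congʳ (zeroˡ _)) (+-identityˡ _))

  private
    ⊗-assoc : ∀ p q r → (p ⊗ q) ⊗ r ≋ p ⊗ (q ⊗ r)
    ⊗-assoc []      q r = ≋-refl
    ⊗-assoc (a ∷ p) q r = ≋-trans (⊗-distribʳ r (map (a *_) q) (0# ∷ p ⊗ q))
      (⊕-cong (map-⊗ a q r) (≋-trans (0∷-⊗ (p ⊗ q) r) (∷-cong refl (⊗-assoc p q r))))

    ⊗-identityˡ : ∀ p → (1# ∷ []) ⊗ p ≋ p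
    ⊗-identityˡ p .at n = trans (coeff-∷⊗ 1# [] p n)
      (trans (+-cong (*-identityˡ _) (zeros n)) (+-identityʳ _))
      where
      zeros : ∀ n → coeff (0# ∷ []) n ≈ 0#
      zeros zero    = refl
      zeros (suc n) = refl

  private
    abstract
      isCommutativeRing[X] : IsCommutativeRing _≋_ _⊕_ _⊗_ (map (λ a → - a)) [] (1# ∷ [])
      isCommutativeRing[X] = record
        { isRing = record
          { +-isAbelianGroup = record
            { isGroup = record
              { isMonoid = record
                { isSemigroup = record
                  { isMagma = record
                    { isEquivalence = record { refl = ≋-refl ; sym = ≋-sym ; trans = ≋-trans }
                    ; ∙-cong = ⊕-cong }
                  ; assoc = ⊕-assoc }
                ; identity = (λ _ → ≋-refl) , ⊕-identityʳ }
              ; inverse = (λ p → ≋-trans (⊕-comm (map -_ p) p) (neg-inverseʳ p)) , neg-inverseʳ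
              ; ⁻¹-cong = neg-cong }
            ; comm = ⊕-comm }
          ; *-cong = ⊗-cong
          ; *-assoc = ⊗-assoc
          ; *-identity = ⊗-identityˡ , λ p → ≋-trans (⊗-comm p (1# ∷ [])) (⊗-identityˡ p)
          ; distrib = ⊗-distribˡ , ⊗-distribʳ }
        ; *-comm = ⊗-comm }

  ring[X] : CRing
  ring[X] = record
    { Carrier = List Carrier ; _≈_ = _≋_ ; _+_ = _⊕_ ; _*_ = _⊗_ ; -_ = map (λ a → - a) ; 0# = [] ; 1# = 1# ∷ []
    ; isCommutativeRing = isCommutativeRing[X] }

  scalar-⊗ : ∀ a p n → coeff ((a ∷ []) ⊗ p) n ≈ a * coeff p n
  scalar-⊗ a p n = trans (coeff-∷⊗ a [] p n) (trans (+-congˡ (zeros n)) (+-identityʳ _))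
    where
    zeros : ∀ n → coeff (0# ∷ []) n ≈ 0#
    zeros zero    = refl
    zeros (suc n) = refl

  X : List Carrier
  X = 0# ∷ 1# ∷ []

  ∷-as-sum : ∀ a p → a ∷ p ≋ (a ∷ []) ⊕ X ⊗ p
  ∷-as-sum a p .at zero = sym (trans (coeff-⊕ (a ∷ []) (X ⊗ p) 0)
    (trans (+-congˡ (0∷-⊗ (1# ∷ []) p .at 0)) (+-identityʳ _)))
  ∷-as-sum a p .at (suc n) = sym (trans (coeff-⊕ (a ∷ []) (X ⊗ p) (suc n))
    (trans (+-identityˡ _) (trans (0∷-⊗ (1# ∷ []) p .at (suc n)) (⊗-identityˡ p .at n))))

-- Homomorphisms and evaluation of polynomials

record Hom (A B : CRing) : Set where
  private
    module A = CommutativeRing A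
    module B = CommutativeRing B
  field
    fun    : A.Carrier → B.Carrier
    cong   : ∀ {x y} → x A.≈ y → fun x B.≈ fun y
    +-homo : ∀ x y → fun (x A.+ y) B.≈ fun x B.+ fun y
    *-homo : ∀ x y → fun (x A.* y) B.≈ fun x B.* fun y
    1-homo : fun A.1# B.≈ B.1#

  0-homo : fun A.0# B.≈ B.0#
  0-homo = identityˡ-unique (fun A.0#) (fun A.0#)
    (B.trans (B.sym (+-homo A.0# A.0#)) (cong (A.+-identityˡ A.0#)))
    where open Algebra.Properties.Group B.+-group

  neg-homo : ∀ x → fun (A.- x) B.≈ B.- fun x
  neg-homo x = inverseˡ-unique (fun (A.- x)) (fun x)
    (B.trans (B.sym (+-homo (A.- x) x)) (B.trans (cong (A.-‿inverseˡ x)) 0-homo))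
    where open Algebra.Properties.Group B.+-group

  sub-homo : ∀ x y → fun (x A.- y) B.≈ fun x B.- fun y
  sub-homo x y = B.trans (+-homo x (A.- y)) (B.+-congˡ (neg-homo y))

open Hom public using () renaming (fun to _⟪_⟫)

idHom : ∀ {A} → Hom A A
idHom {A} = record { fun = λ x → x ; cong = λ eq → eq ; +-homo = λ _ _ → refl ; *-homo = λ _ _ → refl ; 1-homo = refl }
  where open CommutativeRing A

infixr 9 _∘H_
_∘H_ : ∀ {A B C} → Hom B C → Hom A B → Hom A C
_∘H_ {C = C} g f = record
  { fun    = λ x → g.fun (f.fun x)
  ; cong   = λ eq → g.cong (f.cong eq)
  ; +-homo = λ x y → trans (g.cong (f.+-homo x y)) (g.+-homo _ _)
  ; *-homo = λ x y → trans (g.cong (f.*-homo x y)) (g.*-homo _ _)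
  ; 1-homo = trans (g.cong f.1-homo) g.1-homo
  }
  where
  module f = Hom f
  module g = Hom g
  open CommutativeRing C

constant : ∀ R → Hom R (Poly.ring[X] R)
constant R = record
  { fun    = _∷ []
  ; cong   = λ eq → ∷-cong eq (P.refl {[]})
  ; +-homo = λ _ _ → P.refl
  ; *-homo = λ a b → mk≋ λ { zero → sym (+-identityʳ _) ; (suc n) → refl }
  ; 1-homo = P.refl
  }
  where
  open CommutativeRing R
  open Poly R
  module P = CommutativeRing ring[X]

module Evaluation (A : CRing) where
  open CommutativeRing A
  open Poly A
  open Integers A
  open Relation.Binary.Reasoning.Setoid setoid
  private module P = CommutativeRing ring[X]

  eval-zero : ∀ p z → p ≋ [] → eval p z ≈ 0#
  eval-zero []      z eq = refl
  eval-zero (a ∷ p) z eq = trans (+-cong (eq .at 0) (*-congˡ (eval-zero p z (mk≋ λ n → eq .at (suc n)))))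
    (solve 1 (λ z → :# 0 :+ z :* :# 0 := :# 0) refl z)

  eval-cong : ∀ {p q z w} → p ≋ q → z ≈ w → eval p z ≈ eval q w
  eval-cong {[]}    {q}     {w = w} eq eq′ = sym (eval-zero q w (P.sym eq))
  eval-cong {a ∷ p} {[]}    {z = z} eq eq′ = eval-zero (a ∷ p) z eq
  eval-cong {a ∷ p} {b ∷ q} eq eq′ = +-cong (eq .at 0)
    (*-cong eq′ (eval-cong {p} {q} (mk≋ λ n → eq .at (suc n)) eq′))

  eval-⊕ : ∀ p q z → eval (p ⊕ q) z ≈ eval p z + eval q z
  eval-⊕ []      q       z = sym (+-identityˡ _)
  eval-⊕ (a ∷ p) []      z = sym (+-identityʳ _)
  eval-⊕ (a ∷ p) (b ∷ q) z = trans (+-congˡ (*-congˡ (eval-⊕ p q z)))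
    (solve 5 (λ a b z u v → a :+ b :+ z :* (u :+ v) := a :+ z :* u :+ (b :+ z :* v)) refl _ _ _ _ _)

  eval-scale : ∀ a p z → eval (map (a *_) p) z ≈ a * eval p z
  eval-scale a []      z = sym (zeroʳ a)
  eval-scale a (b ∷ p) z = trans (+-congˡ (*-congˡ (eval-scale a p z)))
    (solve 4 (λ a b z u → a :* b :+ z :* (a :* u) := a :* (b :+ z :* u)) refl _ _ _ _)

  eval-⊗ : ∀ p q z → eval (p ⊗ q) z ≈ eval p z * eval q z
  eval-⊗ []      q z = sym (zeroˡ _)
  eval-⊗ (a ∷ p) q z = trans (eval-⊕ (map (a *_) q) (0# ∷ p ⊗ q) z)
    (trans (+-cong (eval-scale a q z) (+-congˡ (*-congˡ (eval-⊗ p q z))))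
      (solve 4 (λ a u v z → a :* v :+ (:# 0 :+ z :* (u :* v)) := (a :+ z :* u) :* v) refl _ _ _ _))

  at-point : Carrier → Hom ring[X] A
  at-point z = record
    { fun = λ p → eval p z ; cong = λ eq → eval-cong eq refl
    ; +-homo = λ p q → eval-⊕ p q z ; *-homo = λ p q → eval-⊗ p q z
    ; 1-homo = solve 1 (λ z → :# 1 :+ z :* :# 0 := :# 1) refl z }

  eval-X : ∀ z → eval X z ≈ z
  eval-X = solve 1 (λ z → :# 0 :+ z :* (:# 1 :+ z :* :# 0) := z) refl

  eval-const : ∀ a z → eval (a ∷ []) z ≈ a
  eval-const = solve 2 (λ a z → a :+ z :* :# 0 := a) refl

  -- p(z) - p(w) = (z - w) · dd p z w
  dd : List Carrier → Carrier → Carrier → Carrier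
  dd []      z w = 0#
  dd (a ∷ p) z w = eval p z + w * dd p z w

  dd-difference : ∀ p z w → eval p z - eval p w ≈ (z - w) * dd p z w
  dd-difference []      z w = solve 2 (λ z w → :# 0 :- :# 0 := (z :- w) :* :# 0) refl z w
  dd-difference (a ∷ p) z w = begin
    (a + z * eval p z) - (a + w * eval p w)
      ≈⟨ solve 5 (λ a z w u v → (a :+ z :* u) :- (a :+ w :* v) := (z :- w) :* u :+ w :* (u :- v)) refl _ _ _ _ _ ⟩
    (z - w) * eval p z + w * (eval p z - eval p w)
      ≈⟨ +-congˡ (*-congˡ (dd-difference p z w)) ⟩
    (z - w) * eval p z + w * ((z - w) * dd p z w)
      ≈⟨ solve 4 (λ z w u d → (z :- w) :* u :+ w :* ((z :- w) :* d) := (z :- w) :* (u :+ w :* d)) refl _ _ _ _ ⟩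
    (z - w) * dd (a ∷ p) z w ∎

  dd-cong : ∀ p {z z′ w w′} → z ≈ z′ → w ≈ w′ → dd p z w ≈ dd p z′ w′
  dd-cong []      eq eq′ = refl
  dd-cong (a ∷ p) eq eq′ = +-cong (eval-cong (P.refl {p}) eq) (*-cong eq′ (dd-cong p eq eq′))

  -- Divided differences take the place of Taylor expansions: a difference of two values is an exact
  -- product, whose second factor becomes the derivative where the arguments meet.
  dd-diagonal : ∀ p z → dd p z z ≈ eval (derivative p) z
  dd-diagonal []      z = refl
  dd-diagonal (a ∷ p) z = sym (trans (eval-⊕ p (0# ∷ derivative p) z)
    (+-congˡ (trans (+-identityˡ _) (*-congˡ (sym (dd-diagonal p z))))))

module _ {A B : CRing} (φ : Hom A B) where
  private
    module A = CommutativeRing A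
    module B = CommutativeRing B
    module PA = Poly A
    module PB = Poly B
    module EA = Evaluation A
    module EB = Evaluation B
    open Hom φ

  eval-natural : ∀ p z → φ ⟪ PA.eval p z ⟫ B.≈ PB.eval (map fun p) (φ ⟪ z ⟫)
  eval-natural []      z = 0-homo
  eval-natural (a ∷ p) z = B.trans (+-homo _ _)
    (B.+-congˡ (B.trans (*-homo _ _) (B.*-congˡ (eval-natural p z))))

  dd-natural : ∀ p z w → φ ⟪ EA.dd p z w ⟫ B.≈ EB.dd (map fun p) (φ ⟪ z ⟫) (φ ⟪ w ⟫)
  dd-natural []      z w = 0-homo
  dd-natural (a ∷ p) z w = B.trans (+-homo _ _)
    (B.+-cong (eval-natural p z) (B.trans (*-homo _ _) (B.*-congˡ (dd-natural p z w))))

  derivative-natural : ∀ p → map fun (PA.derivative p) PB.≋ PB.derivative (map fun p)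
  derivative-natural [] = PB.mk≋ λ n → B.refl
  derivative-natural (a ∷ p) .PB.at n = begin
    PB.coeff (map fun (p PA.⊕ (A.0# ∷ PA.derivative p))) n ≈⟨ PBc (p PA.⊕ (A.0# ∷ PA.derivative p)) n ⟩
    fun (PA.coeff (p PA.⊕ (A.0# ∷ PA.derivative p)) n)     ≈⟨ cong (PA.coeff-⊕ p _ n) ⟩
    fun (PA.coeff p n A.+ PA.coeff (A.0# ∷ PA.derivative p) n) ≈⟨ +-homo _ _ ⟩
    fun (PA.coeff p n) B.+ fun (PA.coeff (A.0# ∷ PA.derivative p) n) ≈⟨ B.+-cong (B.sym (PBc p n)) (step n) ⟩
    PB.coeff (map fun p) n B.+ PB.coeff (B.0# ∷ PB.derivative (map fun p)) n ≈⟨ PB.coeff-⊕ (map fun p) _ n ⟨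
    PB.coeff (PB.derivative (map fun (a ∷ p))) n ∎
    where
    open Relation.Binary.Reasoning.Setoid B.setoid
    PBc : ∀ p n → PB.coeff (map fun p) n B.≈ fun (PA.coeff p n)
    PBc []      n       = B.sym 0-homo
    PBc (a ∷ p) zero    = B.refl
    PBc (a ∷ p) (suc n) = PBc p n
    step : ∀ n → fun (PA.coeff (A.0# ∷ PA.derivative p) n) B.≈ PB.coeff (B.0# ∷ PB.derivative (map fun p)) n
    step zero    = 0-homo
    step (suc n) = B.trans (B.sym (PBc (PA.derivative p) n)) (derivative-natural p .PB.at n)

  coeff-mapHom : ∀ p n → PB.coeff (map fun p) n B.≈ fun (PA.coeff p n)
  coeff-mapHom []      n       = B.sym 0-homo
  coeff-mapHom (a ∷ p) zero    = B.refl
  coeff-mapHom (a ∷ p) (suc n) = coeff-mapHom p n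

  mapHom : Hom PA.ring[X] PB.ring[X]
  mapHom = record
    { fun    = map fun
    ; cong   = λ {p} {q} eq → PB.mk≋ λ n → B.trans (coeff-mapHom p n) (B.trans (cong (eq .PA.at n)) (B.sym (coeff-mapHom q n)))
    ; +-homo = λ p q → PB.mk≋ (plus p q)
    ; *-homo = times
    ; 1-homo = PB.∷-cong 1-homo (PB.mk≋ λ n → B.refl)
    }
    where
    plus : ∀ p q n → PB.coeff (map fun (p PA.⊕ q)) n B.≈ PB.coeff (map fun p PB.⊕ map fun q) n
    plus p q n = B.trans (coeff-mapHom (p PA.⊕ q) n) (B.trans (cong (PA.coeff-⊕ p q n))
      (B.trans (+-homo _ _) (B.trans (B.+-cong (B.sym (coeff-mapHom p n)) (B.sym (coeff-mapHom q n)))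
        (B.sym (PB.coeff-⊕ (map fun p) _ n)))))
    times : ∀ p q → map fun (p PA.⊗ q) PB.≋ map fun p PB.⊗ map fun q
    times []      q .PB.at n = B.refl
    times (a ∷ p) q .PB.at n = B.trans (coeff-mapHom ((a ∷ p) PA.⊗ q) n) (B.trans (cong (PA.coeff-∷⊗ a p q n))
      (B.trans (+-homo _ _) (B.trans (B.+-cong
          (B.trans (*-homo _ _) (B.*-congˡ (B.sym (coeff-mapHom q n)))) (tail n))
        (B.sym (PB.coeff-∷⊗ (fun a) (map fun p) (map fun q) n)))))
      where
      tail : ∀ n → fun (PA.coeff (A.0# ∷ p PA.⊗ q) n) B.≈ PB.coeff (B.0# ∷ map fun p PB.⊗ map fun q) n
      tail zero    = 0-homo
      tail (suc n) = B.trans (B.sym (coeff-mapHom (p PA.⊗ q) n)) (times p q .PB.at n)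

  evalHom : ∣ B ∣ᶜ → Hom PA.ring[X] B
  evalHom z = EB.at-point z ∘H mapHom

-- Applied to the identity, it presents a polynomial as its own value at the variable. The factor
-- theorem and the invertibility of shears rest on this.
eval-unique : ∀ {A B} (φ : Hom (Poly.ring[X] A) B) (ψ : Hom A B) z →
  (∀ a → CommutativeRing._≈_ B (φ ⟪ a ∷ [] ⟫) (ψ ⟪ a ⟫)) → CommutativeRing._≈_ B (φ ⟪ Poly.X A ⟫) z →
  ∀ p → CommutativeRing._≈_ B (φ ⟪ p ⟫) (evalHom ψ z ⟪ p ⟫)
eval-unique {A} {B} φ ψ z consts x []      = Hom.0-homo φ
eval-unique {A} {B} φ ψ z consts x (a ∷ p) = trans (cong (∷-as-sum a p))
  (trans (+-homo _ _) (+-cong (consts a) (trans (*-homo _ _) (*-cong x (eval-unique φ ψ z consts x p)))))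
  where
  open CommutativeRing B
  open Poly A using (∷-as-sum)
  open Hom φ using (cong; +-homo; *-homo)

-- An abstract degree bound, so that one pseudo-division serves both for coefficients in a field,
-- where nothing is bounded, and for coefficients in F[x], where the degree in x is. Zero lies in
-- every step, which spares it a degree of its own.
record Filtration (R : CRing) : Set₁ where
  open CommutativeRing R
  field
    Fil    : ℕ → Carrier → Set
    resp   : ∀ {n a b} → a ≈ b → Fil n a → Fil n b
    mono   : ∀ {m n a} → m ℕ.≤ n → Fil m a → Fil n a
    zero∈  : ∀ {n} → Fil n 0#
    one∈   : Fil 0 1#
    +-∈    : ∀ {n a b} → Fil n a → Fil n b → Fil n (a + b)
    neg-∈  : ∀ {n a} → Fil n a → Fil n (- a)
    *-∈    : ∀ {m n a b} → Fil m a → Fil n b → Fil (m ℕ.+ n) (a * b)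

module _ (R : CRing) where
  open CommutativeRing R
  open Poly R
  open Integers R
  private module P = CommutativeRing ring[X]

  Degree : ℕ → List Carrier → Set
  Degree n p = ∀ m → n ℕ.< m → coeff p m ≈ 0#

  private
    degree-⊗ : ∀ {m n} p q → Degree m p → Degree n q → Degree (m ℕ.+ n) (p ⊗ q)
    degree-⊗ []      q p< q< l _ = refl
    degree-⊗ {zero} {n} (a ∷ p) q p< q< l n<l = trans (coeff-∷⊗ a p q l)
      (trans (+-cong (trans (*-congˡ (q< l n<l)) (zeroʳ a)) (tail l)) (+-identityʳ _))
      where
      tail : ∀ l → coeff (0# ∷ p ⊗ q) l ≈ 0#
      tail zero    = refl
      tail (suc l) = P.*-congʳ {q} {p} {[]} (mk≋ λ n → p< (suc n) (s≤s z≤n)) .at l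
    degree-⊗ {suc m} {n} (a ∷ p) q p< q< (suc l) (s≤s m+n<l) = trans (coeff-∷⊗ a p q (suc l))
      (trans (+-cong (trans (*-congˡ (q< (suc l) (ℕ.≤-trans (s≤s (ℕ.m≤n+m n m)) (ℕ.m≤n⇒m≤1+n m+n<l)))) (zeroʳ a))
        (degree-⊗ p q (λ i m<i → p< (suc i) (s≤s m<i)) q< l m+n<l)) (+-identityʳ _))

  degree-filtration : Filtration ring[X]
  degree-filtration = record
    { Fil   = Degree
    ; resp  = λ eq d m n<m → trans (sym (eq .at m)) (d m n<m)
    ; mono  = λ m≤n d l n<l → d l (ℕ.≤-<-trans m≤n n<l)
    ; zero∈ = λ _ _ → refl
    ; one∈  = λ { (suc m) _ → refl }
    ; +-∈   = λ {n} {p} {q} d e m n<m → trans (coeff-⊕ p q m) (trans (+-cong (d m n<m) (e m n<m)) (+-identityʳ _))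
    ; neg-∈ = λ {n} {p} d m n<m → trans (coeff-neg p m) (trans (-‿cong (d m n<m)) (solve 0 (:- :# 0 := :# 0) refl))
    ; *-∈   = λ {m} {n} {p} {q} → degree-⊗ p q
    }

  module _ (𝓕 : Filtration R) where
    open Filtration 𝓕

    Coefficientwise : ℕ → List Carrier → Set
    Coefficientwise n p = ∀ m → Fil n (coeff p m)

    private
      coefficientwise-⊗ : ∀ {m n} p q → Coefficientwise m p → Coefficientwise n q → Coefficientwise (m ℕ.+ n) (p ⊗ q)
      coefficientwise-⊗ []      q p∈ q∈ l = zero∈
      coefficientwise-⊗ {m} {n} (a ∷ p) q p∈ q∈ l = resp (sym (coeff-∷⊗ a p q l))
        (+-∈ (*-∈ (p∈ 0) (q∈ l)) (tail l))
        where
        tail : ∀ l → Fil (m ℕ.+ n) (coeff (0# ∷ p ⊗ q) l)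
        tail zero    = zero∈
        tail (suc l) = coefficientwise-⊗ p q (λ i → p∈ (suc i)) q∈ l

    coefficientwise-filtration : Filtration ring[X]
    coefficientwise-filtration = record
      { Fil   = Coefficientwise
      ; resp  = λ eq d m → resp (eq .at m) (d m)
      ; mono  = λ m≤n d l → mono m≤n (d l)
      ; zero∈ = λ _ → zero∈
      ; one∈  = λ { zero → one∈ ; (suc m) → zero∈ }
      ; +-∈   = λ {n} {p} {q} d e m → resp (sym (coeff-⊕ p q m)) (+-∈ (d m) (e m))
      ; neg-∈ = λ {n} {p} d m → resp (sym (coeff-neg p m)) (neg-∈ (d m))
      ; *-∈   = λ {m} {n} {p} {q} → coefficientwise-⊗ p q
      }

_∧ᶠ_ : ∀ {R} → Filtration R → Filtration R → Filtration R
𝓕 ∧ᶠ 𝓖 = record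
  { Fil   = λ n a → F.Fil n a × G.Fil n a
  ; resp  = λ eq (f , g) → F.resp eq f , G.resp eq g
  ; mono  = λ m≤n (f , g) → F.mono m≤n f , G.mono m≤n g
  ; zero∈ = F.zero∈ , G.zero∈
  ; one∈  = F.one∈ , G.one∈
  ; +-∈   = λ (f , g) (f′ , g′) → F.+-∈ f f′ , G.+-∈ g g′
  ; neg-∈ = λ (f , g) → F.neg-∈ f , G.neg-∈ g
  ; *-∈   = λ (f , g) (f′ , g′) → F.*-∈ f f′ , G.*-∈ g g′
  }
  where
  module F = Filtration 𝓕
  module G = Filtration 𝓖

-- Pseudo-division, Gauss’s lemma and elimination

Unit : (R : CRing) → ∣ R ∣ᶜ → Set
Unit R a = ∃ λ k → k * a ≈ 1#
  where open CommutativeRing R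

record Irreducibleᴿ (R : CRing) (p : ∣ R ∣ᶜ) : Set where
  open CommutativeRing R
  field
    nonunit : ¬ Unit R p
    split   : ∀ x y → p ≈ x * y → Unit R x ⊎ Unit R y

record Domain : Set₁ where
  field
    cring : CRing
  open CommutativeRing cring
  field
    1≉0     : ¬ 1# ≈ 0#
    *-zeros : ∀ a b → a * b ≈ 0# → a ≈ 0# ⊎ b ≈ 0#

  *-nonzero : ∀ {a b} → ¬ a ≈ 0# → ¬ b ≈ 0# → ¬ a * b ≈ 0#
  *-nonzero {a} {b} a≉0 b≉0 eq = [ a≉0 , b≉0 ]′ (*-zeros a b eq)

  *-cancel : ∀ {a b c} → ¬ a ≈ 0# → a * b ≈ a * c → b ≈ c
  *-cancel {a} {b} {c} a≉0 eq = [ (λ a≈0 → ⊥-elim (a≉0 a≈0)) , from-zero ]′ (*-zeros a (b - c) zero-product)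
    where
    open Integers cring
    from-zero : b - c ≈ 0# → b ≈ c
    from-zero eq = trans (solve 2 (λ b c → b := (b :- c) :+ c) refl b c) (trans (+-congʳ eq) (+-identityˡ c))
    zero-product : a * (b - c) ≈ 0#
    zero-product = trans (solve 3 (λ a b c → a :* (b :- c) := a :* b :- a :* c) refl a b c)
      (trans (+-congʳ eq) (-‿inverseʳ _))

record Field : Set₁ where
  field
    cring : CRing
  open CommutativeRing cring
  open Algebra.Properties.Semiring.Mult semiring using () renaming (_×_ to _·_)
  field
    1≉0     : ¬ 1# ≈ 0#
    inverse : ∀ a → ¬ a ≈ 0# → ∃ λ b → b * a ≈ 1#
    char-0  : ∀ n → ¬ (suc n · 1#) ≈ 0#

module WithEM (em : ExcludedMiddle 0ℓ) where

  fieldDomain : Field → Domain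
  fieldDomain F = record { cring = cring ; 1≉0 = 1≉0 ; *-zeros = zeros }
    where
    open Field F
    open CommutativeRing cring
    zeros : ∀ a b → a * b ≈ 0# → a ≈ 0# ⊎ b ≈ 0#
    zeros a b eq with em {a ≈ 0#}
    ... | yes a≈0 = inj₁ a≈0
    ... | no a≉0  = let k , ka≈1 = inverse a a≉0 in
      inj₂ (trans (sym (*-identityˡ b)) (trans (*-congʳ (sym ka≈1))
        (trans (*-assoc k a b) (trans (*-congˡ eq) (zeroʳ k)))))

  trivial-filtration : ∀ R → Filtration R
  trivial-filtration R = record
    { Fil = λ _ _ → ⊤ ; resp = λ _ _ → tt ; mono = λ _ _ → tt ; zero∈ = tt ; one∈ = tt
    ; +-∈ = λ _ _ → tt ; neg-∈ = λ _ → tt ; *-∈ = λ _ _ → tt }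

  module OverDomain (𝓒 : Domain) where
    open Domain 𝓒
    open CommutativeRing cring
    open Poly cring
    private
      module P = CommutativeRing ring[X]
      module PS = Integers ring[X]
      module S = Integers cring

    Degree< : ℕ → List Carrier → Set
    Degree< n p = ∀ m → n ℕ.≤ m → coeff p m ≈ 0#

    record HasDegree (d : ℕ) (p : List Carrier) : Set where
      constructor _,_
      field
        leading : ¬ coeff p d ≈ 0#
        above   : Degree cring d p
    open HasDegree public

    -- Trailing zeros are allowed, so the length of the list only bounds the degree; excluded middle
    -- decides from where on the coefficients vanish.
    degree : ∀ p → ¬ p ≋ [] → ∃ λ d → HasDegree d p
    degree []      p≉0 = ⊥-elim (p≉0 P.refl)
    degree (a ∷ p) p≉0 with em {p ≋ []}
    ... | yes p≈0 = 0 , (λ a≈0 → p≉0 (mk≋ λ { zero → a≈0 ; (suc n) → p≈0 .at n })) , λ { (suc m) _ → p≈0 .at m }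
    ... | no p≉0′ = let d , l , u = degree p p≉0′ in suc d , l , λ { (suc m) (s≤s d<m) → u m d<m }

    HasDegree⇒≉0 : ∀ {d p} → HasDegree d p → ¬ p ≋ []
    HasDegree⇒≉0 {d} h eq = leading h (eq .at d)

    HasDegree⇒≤ : ∀ {d n p} → HasDegree d p → Degree cring n p → d ℕ.≤ n
    HasDegree⇒≤ {d} {n} h p≤n with d ℕ.≤? n
    ... | yes d≤n = d≤n
    ... | no d≰n  = ⊥-elim (leading h (p≤n d (ℕ.≰⇒> d≰n)))

    degree<⇒< : ∀ {d n p} → HasDegree d p → Degree< n p → d ℕ.< n
    degree<⇒< {d} {n} h p<n with d ℕ.<? n
    ... | yes d<n = d<n
    ... | no d≮n  = ⊥-elim (leading h (p<n d (ℕ.≮⇒≥ d≮n)))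

    HasDegree-resp : ∀ {d p q} → p ≋ q → HasDegree d p → HasDegree d q
    HasDegree-resp {d} eq (l , u) = (λ z → l (trans (eq .at d) z)) , λ m d<m → trans (sym (eq .at m)) (u m d<m)

    coeff-top : ∀ {m n} p q → Degree cring m p → Degree cring n q → coeff (p ⊗ q) (m ℕ.+ n) ≈ coeff p m * coeff q n
    coeff-top []      q p< q< = sym (zeroˡ _)
    coeff-top {zero} {n} (a ∷ p) q p< q< = trans (coeff-∷⊗ a p q n)
      (trans (+-congˡ (tail n)) (+-identityʳ _))
      where
      tail : ∀ l → coeff (0# ∷ p ⊗ q) l ≈ 0#
      tail zero    = refl
      tail (suc l) = P.*-congʳ {q} {p} {[]} (mk≋ λ n → p< (suc n) (s≤s z≤n)) .at l
    coeff-top {suc m} {n} (a ∷ p) q p< q< = trans (coeff-∷⊗ a p q (suc (m ℕ.+ n)))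
      (trans (+-cong (trans (*-congˡ (q< _ (s≤s (ℕ.m≤n+m n m)))) (zeroʳ a))
        (coeff-top p q (λ i m<i → p< (suc i) (s≤s m<i)) q<)) (+-identityˡ _))

    HasDegree-⊗ : ∀ {m n p q} → HasDegree m p → HasDegree n q → HasDegree (m ℕ.+ n) (p ⊗ q)
    HasDegree-⊗ {p = p} {q} (l , u) (l′ , u′) =
      (λ eq → *-nonzero l l′ (trans (sym (coeff-top p q u u′)) eq)) ,
      Filtration.*-∈ (degree-filtration cring) {a = p} {b = q} u u′

    polyDomain : Domain
    polyDomain = record
      { cring = ring[X] ; 1≉0 = λ eq → 1≉0 (eq .at 0) ; *-zeros = zeros }
      where
      zeros : ∀ p q → p ⊗ q ≋ [] → p ≋ [] ⊎ q ≋ []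
      zeros p q eq with em {p ≋ []} | em {q ≋ []}
      ... | yes p≈0 | _       = inj₁ p≈0
      ... | no _    | yes q≈0 = inj₂ q≈0
      ... | no p≉0  | no q≉0  = let m , hp = degree p p≉0 ; n , hq = degree q q≉0 in
        ⊥-elim (HasDegree⇒≉0 (HasDegree-⊗ hp hq) eq)

    unit-degree : ∀ {p} → Unit ring[X] p → HasDegree 0 p
    unit-degree {p} (k , kp≈1) = via-degrees (degree k k≉0) (degree p p≉0)
      where
      one≉0 : ¬ (1# ∷ []) ≋ []
      one≉0 eq = 1≉0 (eq .at 0)
      k≉0 : ¬ k ≋ []
      k≉0 eq = one≉0 (P.trans (P.sym kp≈1) (P.trans (P.*-congʳ eq) (P.zeroˡ p)))
      p≉0 : ¬ p ≋ []
      p≉0 eq = one≉0 (P.trans (P.sym kp≈1) (P.trans (P.*-congˡ {k} eq) (P.zeroʳ k)))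
      via-degrees : ∃ (λ m → HasDegree m k) → ∃ (λ n → HasDegree n p) → HasDegree 0 p
      via-degrees (m , hk) (n , hp) with
        HasDegree⇒≤ {n = 0} (HasDegree-resp kp≈1 (HasDegree-⊗ hk hp)) (λ { (suc _) _ → refl })
      via-degrees (zero , hk) (zero , hp) | _ = hp

    HasDegree-0 : ∀ {p} → HasDegree 0 p → p ≋ coeff p 0 ∷ []
    HasDegree-0 h .at zero    = refl
    HasDegree-0 h .at (suc n) = above h (suc n) (s≤s z≤n)

    shift : ℕ → List Carrier → List Carrier
    shift zero    p = p
    shift (suc j) p = 0# ∷ shift j p

    private
      coeff-shift : ∀ j p m → coeff (shift j p) (j ℕ.+ m) ≈ coeff p m
      coeff-shift zero    p m = refl
      coeff-shift (suc j) p m = coeff-shift j p m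

      shift-⊗ : ∀ j p q → shift j p ⊗ q ≋ shift j (p ⊗ q)
      shift-⊗ zero    p q = P.refl
      shift-⊗ (suc j) p q = P.trans (0∷-⊗ (shift j p) q) (∷-cong refl (shift-⊗ j p q))

    module _ (𝓕 : Filtration cring) where
      open Filtration 𝓕

      record PseudoDivision (A S : List Carrier) (s e : ℕ) : Set where
        constructor pseudo
        field
          c         : Carrier
          c≉0       : ¬ c ≈ 0#
          q R       : List Carrier
          equation  : (c ∷ []) ⊗ A ≋ q ⊗ S ⊕ R
          degree-R  : Degree< s R
          R∈        : Coefficientwise cring 𝓕 e R

      private
        shift-∈ : ∀ {n} j p → Coefficientwise cring 𝓕 n p → Coefficientwise cring 𝓕 n (shift j p)
        shift-∈ zero    p p∈ m       = p∈ m
        shift-∈ (suc j) p p∈ zero    = zero∈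
        shift-∈ (suc j) p p∈ (suc m) = shift-∈ j p p∈ m

      -- Long division without inverses: each step first multiplies by the leading coefficient of
      -- `S`, so that the top terms cancel while the coefficients move up the filtration by `b`.
      -- There are at most `n` steps, whence the term `n * b`.
      pseudo-divide : ∀ n {a b s} A S → HasDegree s S → Degree< n A →
        Coefficientwise cring 𝓕 a A → Coefficientwise cring 𝓕 b S →
        PseudoDivision A S s (a ℕ.+ n ℕ.* b)
      pseudo-divide n {a} {b} {s} A S hS A<n A∈ S∈ with n ℕ.≤? s
      ... | yes n≤s = pseudo 1# 1≉0 [] A (P.*-identityˡ A) (λ m s≤m → A<n m (ℕ.≤-trans n≤s s≤m))
              (λ m → mono (ℕ.m≤m+n a _) (A∈ m))
      pseudo-divide zero    A S hS A<n A∈ S∈ | no n≰s = ⊥-elim (n≰s z≤n)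
      pseudo-divide (suc n) {a} {b} {s} A S hS A<n A∈ S∈ | no n≰s =
        from (pseudo-divide n A₁ S hS A₁<n A₁∈ S∈)
        where
        s≤n : s ℕ.≤ n
        s≤n = ℕ.s≤s⁻¹ (ℕ.≰⇒> n≰s)
        σ = coeff S s
        α = coeff A n
        j = n ∸ s
        j+s≡n : j ℕ.+ s ≡.≡ n
        j+s≡n = ℕ.m∸n+n≡m s≤n
        -- Both `σ A` and `T S` have `σ α` as coefficient of index `n`, so their difference loses
        -- it.
        T  = shift j (α ∷ [])
        A₁ = (σ ∷ []) ⊗ A P.- T ⊗ S
        TS : ∀ l → coeff (T ⊗ S) (j ℕ.+ l) ≈ α * coeff S l
        TS l = trans (shift-⊗ j (α ∷ []) S .at (j ℕ.+ l))
          (trans (coeff-shift j ((α ∷ []) ⊗ S) l) (scalar-⊗ α S l))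
        coeff-A₁ : ∀ l → coeff A₁ (j ℕ.+ l) ≈ σ * coeff A (j ℕ.+ l) - α * coeff S l
        coeff-A₁ l = trans (coeff-⊕ ((σ ∷ []) ⊗ A) (P.- (T ⊗ S)) (j ℕ.+ l))
          (+-cong (scalar-⊗ σ A _) (trans (coeff-neg (T ⊗ S) (j ℕ.+ l)) (-‿cong (TS l))))
        A₁-vanish : ∀ l → s ℕ.≤ l → coeff A₁ (j ℕ.+ l) ≈ 0#
        A₁-vanish l s≤l with s ℕ.≟ l
        ... | yes ≡.refl = trans (coeff-A₁ s)
          (trans (+-congʳ (*-congˡ (reflexive (≡.cong (coeff A) j+s≡n))))
            (S.solve 2 (λ σ α → σ S.:* α S.:- α S.:* σ S.:= S.:# 0) refl σ α))
        ... | no s≢l = trans (coeff-A₁ l)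
          (trans (+-cong (*-congˡ (A<n (j ℕ.+ l) (≡.subst (ℕ._< j ℕ.+ l) j+s≡n (ℕ.+-monoʳ-< j s<l))))
                         (-‿cong (*-congˡ (above hS l s<l))))
            (S.solve 2 (λ σ α → σ S.:* S.:# 0 S.:- α S.:* S.:# 0 S.:= S.:# 0) refl σ α))
          where s<l = ℕ.≤∧≢⇒< s≤l s≢l
        A₁<n : Degree< n A₁
        A₁<n m n≤m = ≡.subst (λ i → coeff A₁ i ≈ 0#) j+l≡m
          (A₁-vanish (m ∸ j) (ℕ.≤-trans (ℕ.≤-reflexive (≡.sym (≡.trans (≡.cong (_∸ j) (≡.sym j+s≡n)) (ℕ.m+n∸m≡n j s))))
            (ℕ.∸-monoˡ-≤ j n≤m)))
          where
          j+l≡m : j ℕ.+ (m ∸ j) ≡.≡ m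
          j+l≡m = ℕ.m+[n∸m]≡n (ℕ.≤-trans (ℕ.m∸n≤m n s) n≤m)
        A₁∈ : Coefficientwise cring 𝓕 (a ℕ.+ b) A₁
        A₁∈ m = resp (sym (trans (coeff-⊕ ((σ ∷ []) ⊗ A) (P.- (T ⊗ S)) m)
                   (+-cong (scalar-⊗ σ A m) (coeff-neg (T ⊗ S) m))))
          (+-∈ (≡.subst (λ i → Fil i (σ * coeff A m)) (ℕ.+-comm b a) (*-∈ (S∈ s) (A∈ m)))
            (neg-∈ (resp (sym (shift-⊗ j (α ∷ []) S .at m))
              (shift-∈ j ((α ∷ []) ⊗ S) (λ l → resp (sym (scalar-⊗ α S l)) (*-∈ (A∈ n) (S∈ l))) m))))
        from : PseudoDivision A₁ S s (a ℕ.+ b ℕ.+ n ℕ.* b) → PseudoDivision A S s (a ℕ.+ suc n ℕ.* b)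
        from (pseudo c c≉0 q R eq R<s R∈) = pseudo (c * σ) (*-nonzero c≉0 (leading hS))
          (q ⊕ (c ∷ []) ⊗ T) R equation′ R<s
          (≡.subst (λ i → Coefficientwise cring 𝓕 i R) (ℕ.+-assoc a b (n ℕ.* b)) R∈)
          where
          open Relation.Binary.Reasoning.Setoid P.setoid
          equation′ : (c * σ ∷ []) ⊗ A ≋ (q ⊕ (c ∷ []) ⊗ T) ⊗ S ⊕ R
          equation′ = begin
            (c * σ ∷ []) ⊗ A
              ≈⟨ P.*-congʳ (Hom.*-homo (constant cring) c σ) ⟩
            (c ∷ []) ⊗ (σ ∷ []) ⊗ A
              ≈⟨ PS.solve 5 (λ c σ A T S → c PS.:* σ PS.:* A PS.:= c PS.:* (σ PS.:* A PS.:- T PS.:* S) PS.:+ c PS.:* T PS.:* S)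
                   P.refl (c ∷ []) (σ ∷ []) A T S ⟩
            (c ∷ []) ⊗ A₁ ⊕ (c ∷ []) ⊗ T ⊗ S
              ≈⟨ P.+-congʳ eq ⟩
            q ⊗ S ⊕ R ⊕ (c ∷ []) ⊗ T ⊗ S
              ≈⟨ PS.solve 5 (λ c q T S R → q PS.:* S PS.:+ R PS.:+ c PS.:* T PS.:* S PS.:= (q PS.:+ c PS.:* T) PS.:* S PS.:+ R)
                   P.refl (c ∷ []) q T S R ⟩
            (q ⊕ (c ∷ []) ⊗ T) ⊗ S ⊕ R ∎

-- Gauss's lemma for F[x][y]

module Gauss (em : ExcludedMiddle 0ℓ) (𝔽 : Field) where
  open WithEM em
  open Field 𝔽
  open CommutativeRing cring

  private
    module F where
      open Poly cring public
      open OverDomain (fieldDomain 𝔽) public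
    module C = CommutativeRing F.ring[X]
    module CS = Integers F.ring[X]

  open F using () renaming (HasDegree to HasDegreeˣ; Degree< to Degree<ˣ) public

  record GCD (a b : List Carrier) : Set where
    field
      g k l u v : List Carrier
      k*g≈a  : k C.* g C.≈ a
      l*g≈b  : l C.* g C.≈ b
      bezout : u C.* a C.+ v C.* b C.≈ g

  private
    degree<length : ∀ p → Degree<ˣ (length p) p
    degree<length []      m       _         = refl
    degree<length (_ ∷ p) (suc m) (s≤s l≤m) = degree<length p m l≤m

  -- Euclid's algorithm, in which `n` bounds the degree of the second argument. Pseudo-division
  -- leaves a constant `c` in front of `a`; over a field it is inverted when the cofactor of `a` is
  -- assembled.
  gcd : ∀ n a b → Degree<ˣ n b → GCD a b
  gcd n a b b<n with em {b C.≈ C.0#}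
  ... | yes b≈0 = record { g = a ; k = C.1# ; l = C.0# ; u = C.1# ; v = C.0# ; k*g≈a = C.*-identityˡ a
                         ; l*g≈b = C.sym b≈0 ; bezout = C.trans (C.+-identityʳ _) (C.*-identityˡ a) }
  gcd zero a b b<n | no b≉0 = ⊥-elim (b≉0 (F.mk≋ λ m → b<n m z≤n))
  gcd (suc n) a b b<n | no b≉0 = divide (F.degree b b≉0)
    where
    divide : ∃ (λ s → HasDegreeˣ s b) → GCD a b
    divide (s , hb) = from (F.pseudo-divide (trivial-filtration cring) (length a) {a = 0} {b = 0} a b hb (degree<length a) (λ _ → tt) (λ _ → tt))
      where
      from : F.PseudoDivision (trivial-filtration cring) a b s _ → GCD a b
      from (F.pseudo c c≉0 q r eq r<s _) = record
        { g = g ; k = (c⁻¹ ∷ []) C.* (q C.* k C.+ l) ; l = k ; u = v C.* (c ∷ []) ; v = u C.- v C.* q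
        ; k*g≈a = begin
            (c⁻¹ ∷ []) C.* (q C.* k C.+ l) C.* g
              ≈⟨ CS.solve 5 (λ c q k l g → c CS.:* (q CS.:* k CS.:+ l) CS.:* g CS.:= c CS.:* (q CS.:* (k CS.:* g) CS.:+ l CS.:* g))
                   C.refl (c⁻¹ ∷ []) q k l g ⟩
            (c⁻¹ ∷ []) C.* (q C.* (k C.* g) C.+ l C.* g)
              ≈⟨ C.*-congˡ {c⁻¹ ∷ []} (C.trans (C.+-cong (C.*-congˡ {q} k*g≈a) l*g≈b) (C.sym eq)) ⟩
            (c⁻¹ ∷ []) C.* ((c ∷ []) C.* a)
              ≈⟨ C.*-assoc (c⁻¹ ∷ []) (c ∷ []) a ⟨
            (c⁻¹ ∷ []) C.* (c ∷ []) C.* a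
              ≈⟨ C.*-congʳ {a} (Hom.*-homo (constant cring) c⁻¹ c) ⟨
            (c⁻¹ * c ∷ []) C.* a
              ≈⟨ C.*-congʳ {a} (Hom.cong (constant cring) c⁻¹c≈1) ⟩
            C.1# C.* a
              ≈⟨ C.*-identityˡ a ⟩
            a ∎
        ; l*g≈b = k*g≈a
        ; bezout = begin
            v C.* (c ∷ []) C.* a C.+ (u C.- v C.* q) C.* b
              ≈⟨ CS.solve 6 (λ u v c q a b → v CS.:* c CS.:* a CS.:+ (u CS.:- v CS.:* q) CS.:* b
                              CS.:= u CS.:* b CS.:+ v CS.:* (c CS.:* a CS.:- q CS.:* b)) C.refl u v (c ∷ []) q a b ⟩
            u C.* b C.+ v C.* ((c ∷ []) C.* a C.- q C.* b)
              ≈⟨ C.+-congˡ {u C.* b} (C.*-congˡ {v} (C.trans (C.+-congʳ {C.- (q C.* b)} eq)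
                   (CS.solve 2 (λ x r → x CS.:+ r CS.:- x CS.:= r) C.refl (q C.* b) r))) ⟩
            u C.* b C.+ v C.* r
              ≈⟨ bezout ⟩
            g ∎
        }
        where
        open Relation.Binary.Reasoning.Setoid C.setoid
        s≤n : s ℕ.≤ n
        s≤n = ℕ.s≤s⁻¹ (F.degree<⇒< hb b<n)
        open GCD (gcd n b r (λ m n≤m → r<s m (ℕ.≤-trans s≤n n≤m)))
        c⁻¹ = proj₁ (inverse c c≉0)
        c⁻¹c≈1 = proj₂ (inverse c c≉0)

  _∣ˣ_ : List Carrier → List Carrier → Set
  a ∣ˣ b = ∃ λ k → k C.* a C.≈ b

  record Primeˣ (π : List Carrier) : Set where
    field
      nonzero   : ¬ π C.≈ C.0#
      nonunit   : ¬ Unit F.ring[X] π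
      split     : ∀ a b → π ∣ˣ (a C.* b) → π ∣ˣ a ⊎ π ∣ˣ b

  degree0-unit : ∀ {p} → HasDegreeˣ 0 p → Unit F.ring[X] p
  degree0-unit {p} h = let k , kp≈1 = inverse _ (F.leading h) in
    (k ∷ []) , C.trans (C.*-congˡ {k ∷ []} (F.HasDegree-0 h))
      (C.trans (C.sym (Hom.*-homo (constant cring) k _)) (Hom.cong (constant cring) kp≈1))

  -- Irreducibility is applied to the factorization of `π` through its greatest common divisor with
  -- `a`. If the cofactor is a unit, `π` divides `a`; if the divisor is, Bézout's identity
  -- multiplied by `b` shows that `π` divides `b`.
  irreducible⇒prime : ∀ {π} → ¬ π C.≈ C.0# → Irreducibleᴿ F.ring[X] π → Primeˣ π
  irreducible⇒prime {π} π≉0 irr = record { nonzero = π≉0 ; nonunit = nonunit ; split = prime }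
    where
    open Irreducibleᴿ irr
    open Relation.Binary.Reasoning.Setoid C.setoid
    prime : ∀ a b → π ∣ˣ (a C.* b) → π ∣ˣ a ⊎ π ∣ˣ b
    prime a b (h , hπ≈ab) = by-cases (split k g (C.sym k*g≈a))
      where
      open GCD (gcd (length a) π a (degree<length a))
      by-cases : Unit F.ring[X] k ⊎ Unit F.ring[X] g → π ∣ˣ a ⊎ π ∣ˣ b
      by-cases (inj₁ (k⁻¹ , eq)) = inj₁ (l C.* k⁻¹ , (begin
        l C.* k⁻¹ C.* π          ≈⟨ C.*-congˡ {l C.* k⁻¹} k*g≈a ⟨
        l C.* k⁻¹ C.* (k C.* g)  ≈⟨ CS.solve 4 (λ l i k g → l CS.:* i CS.:* (k CS.:* g) CS.:= l CS.:* (i CS.:* k CS.:* g)) C.refl l k⁻¹ k g ⟩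
        l C.* (k⁻¹ C.* k C.* g)  ≈⟨ C.*-congˡ {l} (C.trans (C.*-congʳ {g} eq) (C.*-identityˡ g)) ⟩
        l C.* g                  ≈⟨ l*g≈b ⟩
        a ∎))
      by-cases (inj₂ (i , eq)) = inj₂ (i C.* (u C.* b C.+ v C.* h) , (begin
        i C.* (u C.* b C.+ v C.* h) C.* π
          ≈⟨ CS.solve 6 (λ i u b v h π → i CS.:* (u CS.:* b CS.:+ v CS.:* h) CS.:* π
               CS.:= i CS.:* (u CS.:* b CS.:* π CS.:+ v CS.:* (h CS.:* π))) C.refl i u b v h π ⟩
        i C.* (u C.* b C.* π C.+ v C.* (h C.* π))
          ≈⟨ C.*-congˡ {i} (C.+-congˡ {u C.* b C.* π} (C.*-congˡ {v} hπ≈ab)) ⟩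
        i C.* (u C.* b C.* π C.+ v C.* (a C.* b))
          ≈⟨ CS.solve 6 (λ i u b v a π → i CS.:* (u CS.:* b CS.:* π CS.:+ v CS.:* (a CS.:* b))
               CS.:= i CS.:* (u CS.:* π CS.:+ v CS.:* a) CS.:* b) C.refl i u b v a π ⟩
        i C.* (u C.* π C.+ v C.* a) C.* b
          ≈⟨ C.*-congʳ {b} (C.trans (C.*-congˡ {i} bezout) eq) ⟩
        C.1# C.* b
          ≈⟨ C.*-identityˡ b ⟩
        b ∎))

  -- Unless `c` is irreducible, excluded middle provides two nonunit factors. Both have positive
  -- degree, so the first has smaller degree than `c` and the search continues in it; `n` bounds its
  -- depth.
  prime-factor : ∀ n c d → d ℕ.≤ n → HasDegreeˣ (suc d) c → ∃ λ π → Primeˣ π × π ∣ˣ c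
  prime-factor n c d d≤n hc with em {∃ λ g → ∃ λ h → g C.* h C.≈ c × ¬ Unit F.ring[X] g × ¬ Unit F.ring[X] h}
  ... | no irr = c , irreducible⇒prime (F.HasDegree⇒≉0 hc) (record { nonunit = nonunit ; split = split }) ,
                 C.1# , C.*-identityˡ c
    where
    nonunit : ¬ Unit F.ring[X] c
    nonunit u = F.leading hc (F.above (F.unit-degree u) (suc d) (s≤s z≤n))
    split : ∀ x y → c C.≈ x C.* y → Unit F.ring[X] x ⊎ Unit F.ring[X] y
    split x y eq with em {Unit F.ring[X] x} | em {Unit F.ring[X] y}
    ... | yes ux | _      = inj₁ ux
    ... | no _   | yes uy = inj₂ uy
    ... | no ¬ux | no ¬uy = ⊥-elim (irr (x , y , C.sym eq , ¬ux , ¬uy))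
  ... | yes (g , h , gh≈c , ¬ug , ¬uh) = recurse n d≤n (F.degree g g≉0) (F.degree h h≉0)
    where
    c≉0 = F.HasDegree⇒≉0 hc
    g≉0 : ¬ g C.≈ C.0#
    g≉0 eq = c≉0 (C.trans (C.sym gh≈c) (C.trans (C.*-congʳ {h} eq) (C.zeroˡ h)))
    h≉0 : ¬ h C.≈ C.0#
    h≉0 eq = c≉0 (C.trans (C.sym gh≈c) (C.trans (C.*-congˡ {g} eq) (C.zeroʳ g)))
    recurse : ∀ n → d ℕ.≤ n → ∃ (λ i → HasDegreeˣ i g) → ∃ (λ j → HasDegreeˣ j h) → ∃ λ π → Primeˣ π × π ∣ˣ c
    recurse _ _ (zero , hg) _ = ⊥-elim (¬ug (degree0-unit hg))
    recurse _ _ (suc i , hg) (zero , hh) = ⊥-elim (¬uh (degree0-unit hh))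
    recurse n d≤n (suc i , hg) (suc j , hh) = smaller n (ℕ.≤-trans 1+i≤d d≤n)
      where
      1+i≤d : suc i ℕ.≤ d
      1+i≤d = ℕ.≤-trans (s≤s (ℕ.m≤m+n i j)) (ℕ.≤-trans (ℕ.≤-reflexive (≡.sym (ℕ.+-suc i j)))
        (ℕ.s≤s⁻¹ (F.HasDegree⇒≤ (F.HasDegree-resp gh≈c (F.HasDegree-⊗ hg hh)) (F.above hc))))
      smaller : ∀ n → suc i ℕ.≤ n → ∃ λ π → Primeˣ π × π ∣ˣ c
      smaller (suc n) (s≤s i≤n) = let π , pr , k , kπ≈g = prime-factor n g i i≤n hg in
        π , pr , h C.* k , C.trans (CS.solve 3 (λ h k π → h CS.:* k CS.:* π CS.:= k CS.:* π CS.:* h) C.refl h k π)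
          (C.trans (C.*-congʳ {h} kπ≈g) gh≈c)

  module FX where
    open Poly F.ring[X] public
    open OverDomain F.polyDomain public
  private
    module P = CommutativeRing FX.ring[X]
    module PS = Integers FX.ring[X]

  -- F[x][y], in which [ c ] is the polynomial c ∈ F[x].
  [_] : List Carrier → List (List Carrier)
  [ c ] = c ∷ []

  private
    all-divisible : ∀ π A → (∀ n → π ∣ˣ FX.coeff A n) → ∃ λ A′ → A P.≈ [ π ] P.* A′
    all-divisible π []      _   = [] , P.sym (P.zeroʳ [ π ])
    all-divisible π (a ∷ A) div with div 0 | all-divisible π A (λ n → div (suc n))
    ... | k , kπ≈a | A′ , eq = (k ∷ A′) , FX.mk≋ λ n → C.trans (coefficients n) (C.sym (FX.scalar-⊗ π (k ∷ A′) n))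
      where
      coefficients : ∀ n → FX.coeff (a ∷ A) n C.≈ π C.* FX.coeff (k ∷ A′) n
      coefficients zero    = C.trans (C.sym kπ≈a) (C.*-comm k π)
      coefficients (suc n) = C.trans (eq .FX.at n) (FX.scalar-⊗ π A′ n)

    _∣∣_ : List Carrier → List (List Carrier) → Set
    π ∣∣ A = ∀ n → π ∣ˣ FX.coeff A n

    ∣ˣ-resp : ∀ {π a b} → a C.≈ b → π ∣ˣ a → π ∣ˣ b
    ∣ˣ-resp eq (k , eq′) = k , C.trans eq′ eq

    ∣ˣ-∷ : ∀ {π a A} → π ∣ˣ a → π ∣∣ A → π ∣∣ (a ∷ A)
    ∣ˣ-∷ d ds zero    = d
    ∣ˣ-∷ d ds (suc n) = ds n

    ∣-cancel : ∀ π a b c → π ∣ˣ a → π ∣ˣ (a C.* b C.+ c) → π ∣ˣ c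
    ∣-cancel π a b c (k , kπ≈a) (l , lπ≈) = l C.- k C.* b , (begin
      (l C.- k C.* b) C.* π
        ≈⟨ CS.solve 4 (λ l k b π → (l CS.:- k CS.:* b) CS.:* π CS.:= l CS.:* π CS.:- k CS.:* π CS.:* b) C.refl l k b π ⟩
      l C.* π C.- k C.* π C.* b
        ≈⟨ C.+-cong lπ≈ (C.-‿cong (C.*-congʳ {b} kπ≈a)) ⟩
      a C.* b C.+ c C.- a C.* b
        ≈⟨ CS.solve 2 (λ x c → x CS.:+ c CS.:- x CS.:= c) C.refl (a C.* b) c ⟩
      c ∎)
      where open Relation.Binary.Reasoning.Setoid C.setoid

  content-split : ∀ {π} → Primeˣ π → ∀ A B → π ∣∣ (A P.* B) → π ∣∣ A ⊎ π ∣∣ B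
  content-split {π} pr []      B       div = inj₁ λ n → C.0# , C.zeroˡ π
  content-split {π} pr (a ∷ A) []      div = inj₂ λ n → C.0# , C.zeroˡ π
  content-split {π} pr (a ∷ A) (b ∷ B) div =
    decide (content-split pr A (b ∷ B)) (content-split pr (a ∷ A) B) em em
    where
    decide : (π ∣∣ (A P.* (b ∷ B)) → π ∣∣ A ⊎ π ∣∣ (b ∷ B)) →
             (π ∣∣ ((a ∷ A) P.* B) → π ∣∣ (a ∷ A) ⊎ π ∣∣ B) →
             Dec (π ∣ˣ a) → Dec (π ∣ˣ b) → π ∣∣ (a ∷ A) ⊎ π ∣∣ (b ∷ B)
    decide recurseA recurseB (yes π∣a) _ = [ (λ d → inj₁ (∣ˣ-∷ π∣a d)) , inj₂ ]′ (recurseA λ n →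
      ∣-cancel π a (FX.coeff (b ∷ B) (suc n)) _ π∣a (∣ˣ-resp (FX.coeff-∷⊗ a A (b ∷ B) (suc n)) (div (suc n))))
    decide recurseA recurseB (no _) (yes π∣b) = [ inj₁ , (λ d → inj₂ (∣ˣ-∷ π∣b d)) ]′ (recurseB λ n →
      ∣ˣ-resp (P.*-comm B (a ∷ A) .FX.at n) (∣-cancel π b (FX.coeff (a ∷ A) (suc n)) _ π∣b
        (∣ˣ-resp (C.trans (P.*-comm (a ∷ A) (b ∷ B) .FX.at (suc n)) (FX.coeff-∷⊗ b B (a ∷ A) (suc n))) (div (suc n)))))
    decide recurseA recurseB (no π∤a) (no π∤b) = ⊥-elim ([ π∤a , π∤b ]′ (Primeˣ.split pr a b
      (∣ˣ-resp (C.trans (FX.coeff-∷⊗ a A (b ∷ B) 0) (C.+-identityʳ (a C.* b))) (div 0))))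

  [-]-cancel : ∀ {π A B} → ¬ π C.≈ C.0# → [ π ] P.* A P.≈ [ π ] P.* B → A P.≈ B
  [-]-cancel {π} {A} {B} π≉0 = Domain.*-cancel FX.polyDomain {[ π ]} {A} {B} (λ eq → π≉0 (eq .FX.at 0))

  -- The outcome of Gauss's lemma: a factorization of `P` over the fraction field F(x), given as
  -- `c P = A B`, becomes one over F[x]. The factors change only by polynomials in x, so their
  -- degrees in y can be read off from `A` and `B`.
  record Factorization (P A B : List (List Carrier)) : Set where
    field
      c₁ c₂ : List Carrier
      A′ B′ : List (List Carrier)
      A≈    : A P.≈ [ c₁ ] P.* A′
      B≈    : B P.≈ [ c₂ ] P.* B′
      P≈    : P P.≈ A′ P.* B′

  cancel-constant : ∀ c P A B → HasDegreeˣ 0 c → [ c ] P.* P P.≈ A P.* B → Factorization P A B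
  cancel-constant c P A B hc eq = let k , kc≈1 = degree0-unit hc in record
    { c₁ = C.1# ; c₂ = c ; A′ = A ; B′ = [ k ] P.* B
    ; A≈ = P.sym (P.*-identityˡ A)
    ; B≈ = P.sym (P.trans (P.sym (P.*-assoc [ c ] [ k ] B)) (P.trans (P.*-congʳ {B}
             (P.trans (P.sym (Hom.*-homo (constant F.ring[X]) c k)) (Hom.cong (constant F.ring[X]) (C.trans (C.*-comm c k) kc≈1))))
             (P.*-identityˡ B)))
    ; P≈ = begin
        P                          ≈⟨ P.*-identityˡ P ⟨
        P.1# P.* P                 ≈⟨ P.*-congʳ {P} (Hom.cong (constant F.ring[X]) kc≈1) ⟨
        [ k C.* c ] P.* P          ≈⟨ P.*-congʳ {P} (Hom.*-homo (constant F.ring[X]) k c) ⟩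
        [ k ] P.* [ c ] P.* P      ≈⟨ P.*-assoc [ k ] [ c ] P ⟩
        [ k ] P.* ([ c ] P.* P)    ≈⟨ P.*-congˡ {[ k ]} eq ⟩
        [ k ] P.* (A P.* B)        ≈⟨ PS.solve 3 (λ k A B → k PS.:* (A PS.:* B) PS.:= A PS.:* (k PS.:* B)) P.refl [ k ] A B ⟩
        A P.* ([ k ] P.* B)        ∎ }
    where open Relation.Binary.Reasoning.Setoid P.setoid

  private
    cofactor-degree : ∀ {π c c′ d} → Primeˣ π → c′ C.* π C.≈ c → HasDegreeˣ (suc d) c → ∃ λ e → HasDegreeˣ e c′ × e ℕ.≤ d
    cofactor-degree {π} {c} {c′} {d} pr c′π≈c hc = below (F.degree c′ c′≉0) (F.degree π (Primeˣ.nonzero pr))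
      where
      c′≉0 : ¬ c′ C.≈ C.0#
      c′≉0 z = F.HasDegree⇒≉0 hc (C.trans (C.sym c′π≈c) (C.trans (C.*-congʳ {π} z) (C.zeroˡ π)))
      below : ∃ (λ e → HasDegreeˣ e c′) → ∃ (λ e → HasDegreeˣ e π) → ∃ λ e → HasDegreeˣ e c′ × e ℕ.≤ d
      below (e , h) (zero , hπ)  = ⊥-elim (Primeˣ.nonunit pr (degree0-unit hπ))
      below (e , h) (suc f , hπ) = e , h , ℕ.≤-trans (ℕ.m≤m+n e f)
        (ℕ.s≤s⁻¹ (ℕ.≤-trans (ℕ.≤-reflexive (≡.sym (ℕ.+-suc e f)))
          (F.HasDegree⇒≤ (F.HasDegree-resp c′π≈c (F.HasDegree-⊗ h hπ)) (F.above hc))))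

  cancel-prime : ∀ {π c c′} P A B → Primeˣ π → c′ C.* π C.≈ c → [ c ] P.* P P.≈ A P.* B →
    (∀ A B → [ c′ ] P.* P P.≈ A P.* B → Factorization P A B) → Factorization P A B
  cancel-prime {π} {c} {c′} P A B pr c′π≈c eq recurse = by-cases (content-split pr A B divides)
    where
    open Relation.Binary.Reasoning.Setoid P.setoid
    [c]≈ : [ c ] P.≈ [ π ] P.* [ c′ ]
    [c]≈ = P.trans (Hom.cong (constant F.ring[X]) (C.trans (C.sym c′π≈c) (C.*-comm c′ π))) (Hom.*-homo (constant F.ring[X]) π c′)
    divides : π ∣∣ (A P.* B)
    divides n = c′ C.* FX.coeff P n , C.trans (CS.solve 3 (λ c p π → c CS.:* p CS.:* π CS.:= c CS.:* π CS.:* p) C.refl c′ (FX.coeff P n) π)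
      (C.trans (C.*-congʳ {FX.coeff P n} c′π≈c) (C.trans (C.sym (FX.scalar-⊗ c P n)) (eq .FX.at n)))
    by-cases : π ∣∣ A ⊎ π ∣∣ B → Factorization P A B
    by-cases (inj₁ π∣A) = record
      { c₁ = π C.* R.c₁ ; c₂ = R.c₂ ; A′ = R.A′ ; B′ = R.B′
      ; A≈ = P.trans A≈πA₁ (P.trans (P.*-congˡ {[ π ]} R.A≈) (P.trans (P.sym (P.*-assoc [ π ] [ R.c₁ ] R.A′))
               (P.*-congʳ {R.A′} (P.sym (Hom.*-homo (constant F.ring[X]) π R.c₁)))))
      ; B≈ = R.B≈ ; P≈ = R.P≈ }
      where
      A₁ = proj₁ (all-divisible π A π∣A)
      A≈πA₁ = proj₂ (all-divisible π A π∣A)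
      module R = Factorization (recurse A₁ B
        ([-]-cancel {π} {[ c′ ] P.* P} {A₁ P.* B} (Primeˣ.nonzero pr) (begin
          [ π ] P.* ([ c′ ] P.* P)  ≈⟨ P.*-assoc [ π ] [ c′ ] P ⟨
          [ π ] P.* [ c′ ] P.* P    ≈⟨ P.*-congʳ {P} [c]≈ ⟨
          [ c ] P.* P               ≈⟨ eq ⟩
          A P.* B                   ≈⟨ P.*-congʳ {B} A≈πA₁ ⟩
          [ π ] P.* A₁ P.* B        ≈⟨ P.*-assoc [ π ] A₁ B ⟩
          [ π ] P.* (A₁ P.* B)      ∎)))
    by-cases (inj₂ π∣B) = record
      { c₁ = R.c₁ ; c₂ = π C.* R.c₂ ; A′ = R.A′ ; B′ = R.B′
      ; B≈ = P.trans B≈πB₁ (P.trans (P.*-congˡ {[ π ]} R.B≈) (P.trans (P.sym (P.*-assoc [ π ] [ R.c₂ ] R.B′))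
               (P.*-congʳ {R.B′} (P.sym (Hom.*-homo (constant F.ring[X]) π R.c₂)))))
      ; A≈ = R.A≈ ; P≈ = R.P≈ }
      where
      B₁ = proj₁ (all-divisible π B π∣B)
      B≈πB₁ = proj₂ (all-divisible π B π∣B)
      module R = Factorization (recurse A B₁
        ([-]-cancel {π} {[ c′ ] P.* P} {A P.* B₁} (Primeˣ.nonzero pr) (begin
          [ π ] P.* ([ c′ ] P.* P)  ≈⟨ P.*-assoc [ π ] [ c′ ] P ⟨
          [ π ] P.* [ c′ ] P.* P    ≈⟨ P.*-congʳ {P} [c]≈ ⟨
          [ c ] P.* P               ≈⟨ eq ⟩
          A P.* B                   ≈⟨ P.*-congˡ {A} B≈πB₁ ⟩
          A P.* ([ π ] P.* B₁)      ≈⟨ PS.solve 3 (λ π A B → A PS.:* (π PS.:* B) PS.:= π PS.:* (A PS.:* B)) P.refl [ π ] A B₁ ⟩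
          [ π ] P.* (A P.* B₁)      ∎)))

  -- The prime factors of `c` are removed one at a time: each divides all coefficients of `A` or all
  -- of `B` and is taken out there. Once `c` is constant, it is inverted.
  gauss : ∀ n c d P A B → d ℕ.≤ n → HasDegreeˣ d c → [ c ] P.* P P.≈ A P.* B → Factorization P A B
  gauss n       c zero    P A B _         hc eq = cancel-constant c P A B hc eq
  gauss (suc n) c (suc d) P A B (s≤s d≤n) hc eq =
    let π , pr , c′ , c′π≈c = prime-factor d c d ℕ.≤-refl hc
        e , hc′ , e≤d = cofactor-degree {c′ = c′} pr c′π≈c hc
    in cancel-prime {c′ = c′} P A B pr c′π≈c eq (λ A B → gauss n c′ e P A B (ℕ.≤-trans e≤d d≤n) hc′)

-- Elimination of y

module Resultants (em : ExcludedMiddle 0ℓ) (𝔽 : Field) where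
  open WithEM em
  open Field 𝔽
  open Gauss em 𝔽

  private
    module F where
      open Poly cring public
      open OverDomain (fieldDomain 𝔽) public
    module C = CommutativeRing F.ring[X]
    module P = CommutativeRing FX.ring[X]
    module PS = Integers FX.ring[X]

  𝓓ˣ : Filtration F.ring[X]
  𝓓ˣ = degree-filtration cring

  Degreeˣ : ℕ → List (List (CommutativeRing.Carrier cring)) → Set
  Degreeˣ = Coefficientwise F.ring[X] 𝓓ˣ

  -- A nonzero combination free of y plays the part of the resultant. The bounds obtained for its
  -- degree are exponential in the degree of the curve, which is fixed, but linear in that of the
  -- other polynomial.
  record Elimination (A B : List (List (CommutativeRing.Carrier cring))) (e : ℕ) : Set where
    field
      r     : List (CommutativeRing.Carrier cring)
      r≉0   : ¬ r C.≈ C.0#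
      r≤e   : Degree cring e r
      u v   : List (List (CommutativeRing.Carrier cring))
      bezout : [ r ] P.≈ u P.* A P.+ v P.* B

  private
    -- By Gauss's lemma an exact division would factor `P` itself, one factor having the degree of
    -- `S` in y, which is positive and smaller than that of `P`.
    no-common-factor : ∀ {c q P S d s} → Irreducibleᴿ FX.ring[X] P → FX.HasDegree d P → FX.HasDegree (suc s) S →
      suc s ℕ.< d → ¬ c C.≈ C.0# → ¬ ([ c ] P.* P P.≈ q P.* S)
    no-common-factor {c} {q} {P} {S} {d} {s} irr hP hS s<d c≉0 eq =
      [ q′-unit , S′-unit ]′ (Irreducibleᴿ.split irr A′ B′ P≈)
      where
      open Factorization (gauss (proj₁ (F.degree c c≉0)) c _ P q S ℕ.≤-refl (proj₂ (F.degree c c≉0)) eq)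
      S′-unit : ¬ Unit FX.ring[X] B′
      S′-unit u = FX.leading hS (C.trans (B≈ .FX.at (suc s)) (C.trans (FX.scalar-⊗ c₂ B′ (suc s))
        (C.trans (C.*-congˡ {c₂} (FX.above (FX.unit-degree u) (suc s) (s≤s z≤n))) (C.zeroʳ c₂))))
      q′-unit : ¬ Unit FX.ring[X] A′
      q′-unit u = ℕ.<⇒≱ s<d (FX.HasDegree⇒≤ {d} {suc s} hP λ m s<m → C.trans
        (P.trans P≈ (P.*-congʳ {B′} (FX.HasDegree-0 (FX.unit-degree u))) .FX.at m)
        (C.trans (FX.scalar-⊗ a₀ B′ m) (C.trans (C.*-congˡ {a₀} (B′≤ m s<m)) (C.zeroʳ a₀))))
        where
        a₀ = FX.coeff A′ 0
        S≉0 = FX.HasDegree⇒≉0 hS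
        c₂≉0 : ¬ c₂ C.≈ C.0#
        c₂≉0 z = S≉0 (P.trans B≈ (P.trans (P.*-congʳ {B′} {[ c₂ ]} {P.0#} (FX.mk≋ λ { zero → z ; (suc _) → C.refl })) (P.zeroˡ B′)))
        B′≤ : ∀ m → suc s ℕ.< m → FX.coeff B′ m C.≈ C.0#
        B′≤ m s<m = [ (λ z → ⊥-elim (c₂≉0 z)) , (λ z → z) ]′ (Domain.*-zeros F.polyDomain c₂ (FX.coeff B′ m)
          (C.trans (C.sym (FX.scalar-⊗ c₂ B′ m)) (C.trans (C.sym (B≈ .FX.at m)) (FX.above hS m s<m))))

  module _ {P : List (List (CommutativeRing.Carrier cring))} {d D : ℕ}
           (irr : Irreducibleᴿ FX.ring[X] P) (hP : FX.HasDegree d P) (P∈ : Degreeˣ D P) (d≤D : d ℕ.≤ D) where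

    private
      E : ℕ
      E = suc (2 ℕ.* D)
      instance
        _ = ℕ.≢-nonZero {E} (λ ())

      extend : ∀ {S R c q e} → [ c ] P.* P P.≈ q P.* S P.+ R → Elimination P R e → Elimination P S e
      extend {S} {R} {c} {q} eq el = record
        { r = r ; r≉0 = r≉0 ; r≤e = r≤e ; u = u P.+ v P.* [ c ] ; v = P.- (v P.* q)
        ; bezout = P.trans bezout (P.trans (P.+-congˡ {u P.* P} (P.*-congˡ {v} R≈))
            (PS.solve 6 (λ u v c q P S → u PS.:* P PS.:+ v PS.:* (c PS.:* P PS.:- q PS.:* S)
               PS.:= (u PS.:+ v PS.:* c) PS.:* P PS.:+ PS.:- (v PS.:* q) PS.:* S) P.refl u v [ c ] q P S)) }
        where
        open Elimination el
        R≈ : R P.≈ [ c ] P.* P P.- q P.* S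
        R≈ = P.trans (PS.solve 2 (λ x R → R PS.:= x PS.:+ R PS.:- x) P.refl (q P.* S) R)
               (P.+-congʳ {P.- (q P.* S)} (P.sym eq))

      weaken : ∀ {S e e′} → e ℕ.≤ e′ → Elimination P S e → Elimination P S e′
      weaken e≤e′ el = record { Elimination el ; r≤e = λ m e′<m → Elimination.r≤e el m (ℕ.≤-<-trans e≤e′ e′<m) }

      grow : ∀ {a} → 1 ℕ.≤ a → D ℕ.+ suc d ℕ.* a ℕ.≤ E ℕ.* a
      grow {a} 1≤a = begin
        D ℕ.+ suc d ℕ.* a              ≤⟨ ℕ.+-monoʳ-≤ D (ℕ.*-monoˡ-≤ a (s≤s d≤D)) ⟩
        D ℕ.+ suc D ℕ.* a              ≤⟨ ℕ.+-monoˡ-≤ (suc D ℕ.* a) (ℕ.≤-trans (ℕ.≤-reflexive (≡.sym (ℕ.*-identityʳ D))) (ℕ.*-monoʳ-≤ D 1≤a)) ⟩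
        D ℕ.* a ℕ.+ suc D ℕ.* a        ≡⟨ solve 2 (λ D a → D :* a :+ (con 1 :+ D) :* a := (con 1 :+ con 2 :* D) :* a) ≡.refl D a ⟩
        E ℕ.* a                        ∎
        where
        open ℕ.≤-Reasoning
        open +-*-Solver

    -- The dividend is always `P`, not the previous divisor as in Euclid's algorithm. Irreducibility
    -- then excludes a zero remainder as long as the divisor involves y, and by `grow` each division
    -- multiplies the degree bound in x by at most `E`.
    eliminate : ∀ n {a s} S → s ℕ.≤ n → s ℕ.< d → FX.HasDegree s S → Degreeˣ a S → 1 ℕ.≤ a →
      Elimination P S (E ℕ.^ n ℕ.* a)
    eliminate n {a} {zero} S _ _ hS S∈ _ = weaken (ℕ.m≤n*m a (E ℕ.^ n) {{ℕ.m^n≢0 E n}}) (record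
      { r = FX.coeff S 0 ; r≉0 = FX.leading hS ; r≤e = S∈ 0 ; u = P.0# ; v = P.1#
      ; bezout = P.trans (P.sym (FX.HasDegree-0 hS)) (P.sym (P.*-identityˡ S)) })
    eliminate (suc n) {a} {suc s} S (s≤s s≤n) s<d hS S∈ 1≤a =
      from (FX.pseudo-divide 𝓓ˣ (suc d) P S hS (λ m d<m → FX.above hP m d<m) P∈ S∈)
      where
      from : FX.PseudoDivision 𝓓ˣ P S (suc s) _ → Elimination P S (E ℕ.^ suc n ℕ.* a)
      from (FX.pseudo c c≉0 q R eq R<s R∈) = by-cases em
        where
        bound : E ℕ.^ n ℕ.* (D ℕ.+ suc d ℕ.* a) ℕ.≤ E ℕ.^ suc n ℕ.* a
        bound = ℕ.≤-trans (ℕ.*-monoʳ-≤ (E ℕ.^ n) (grow 1≤a))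
          (ℕ.≤-reflexive (≡.trans (≡.sym (ℕ.*-assoc (E ℕ.^ n) E a)) (≡.cong (ℕ._* a) (ℕ.*-comm (E ℕ.^ n) E))))
        by-cases : Dec (R P.≈ P.0#) → Elimination P S (E ℕ.^ suc n ℕ.* a)
        by-cases (yes R≈0) = ⊥-elim (no-common-factor {c} {q} {P} {S} irr hP hS s<d c≉0
          (P.trans eq (P.trans (P.+-congˡ {q P.* S} R≈0) (P.+-identityʳ (q P.* S)))))
        by-cases (no R≉0) with FX.degree R R≉0
        ... | t , hR = weaken bound (extend {S} {R} {c} {q} eq
              (eliminate n R (ℕ.≤-trans (ℕ.s≤s⁻¹ t<1+s) s≤n) (ℕ.<-trans t<1+s s<d) hR R∈
                (ℕ.≤-trans 1≤a (ℕ.≤-trans (ℕ.m≤m+n a (d ℕ.* a)) (ℕ.m≤n+m _ D)))))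
          where t<1+s = FX.degree<⇒< hR R<s

    record Multiple (G : List (List (CommutativeRing.Carrier cring))) : Set where
      field
        c     : List (CommutativeRing.Carrier cring)
        c≉0   : ¬ c C.≈ C.0#
        q     : List (List (CommutativeRing.Carrier cring))
        c*G≈  : [ c ] P.* G P.≈ q P.* P

    -- A first division lowers the degree of `G` in y below that of `P`, at the price of one more
    -- factor `E`. Geometrically, either `G` vanishes on the whole curve or the two meet over
    -- finitely many abscissas.
    multiple-or-elimination : ∀ {g} G → 1 ℕ.≤ g → Degreeˣ g G → Degree F.ring[X] g G →
      Multiple G ⊎ Elimination P G (E ℕ.^ suc D ℕ.* g)
    multiple-or-elimination {g} G 1≤g G∈ G≤g =
      from (FX.pseudo-divide 𝓓ˣ (suc g) G P hP (λ m g<m → G≤g m g<m) G∈ P∈)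
      where
      1≤E*g : 1 ℕ.≤ E ℕ.* g
      1≤E*g = ℕ.≤-trans 1≤g (ℕ.m≤n*m g E)
      size : g ℕ.+ suc g ℕ.* D ℕ.≤ E ℕ.* g
      size = begin
        g ℕ.+ suc g ℕ.* D              ≡⟨ solve 2 (λ g D → g :+ (con 1 :+ g) :* D := g :+ g :* D :+ D) ≡.refl g D ⟩
        g ℕ.+ g ℕ.* D ℕ.+ D            ≤⟨ ℕ.+-monoʳ-≤ (g ℕ.+ g ℕ.* D) (ℕ.≤-trans (ℕ.≤-reflexive (≡.sym (ℕ.*-identityʳ D))) (ℕ.*-monoʳ-≤ D 1≤g)) ⟩
        g ℕ.+ g ℕ.* D ℕ.+ D ℕ.* g      ≡⟨ solve 2 (λ g D → g :+ g :* D :+ D :* g := (con 1 :+ con 2 :* D) :* g) ≡.refl g D ⟩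
        E ℕ.* g                        ∎
        where
        open ℕ.≤-Reasoning
        open +-*-Solver
      from : FX.PseudoDivision 𝓓ˣ G P d _ → Multiple G ⊎ Elimination P G (E ℕ.^ suc D ℕ.* g)
      from (FX.pseudo c c≉0 q R eq R<d R∈) = by-cases em
        where
        by-cases : Dec (R P.≈ P.0#) → Multiple G ⊎ Elimination P G (E ℕ.^ suc D ℕ.* g)
        by-cases (yes R≈0) = inj₁ (record { c = c ; c≉0 = c≉0 ; q = q
          ; c*G≈ = P.trans eq (P.trans (P.+-congˡ {q P.* P} R≈0) (P.+-identityʳ (q P.* P))) })
        by-cases (no R≉0) = with-degree (FX.degree R R≉0)
          where
          with-degree : ∃ (λ t → FX.HasDegree t R) → Multiple G ⊎ Elimination P G (E ℕ.^ suc D ℕ.* g)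
          with-degree (t , hR) = inj₂ (weaken
            (ℕ.≤-reflexive (≡.trans (≡.sym (ℕ.*-assoc (E ℕ.^ D) E g)) (≡.cong (ℕ._* g) (ℕ.*-comm (E ℕ.^ D) E))))
            (record
              { r = r ; r≉0 = r≉0 ; r≤e = r≤e ; u = u P.- v P.* q ; v = v P.* [ c ]
              ; bezout = P.trans bezout (P.trans (P.+-congˡ {u P.* P} (P.*-congˡ {v} R≈))
                  (PS.solve 6 (λ u v c q P G → u PS.:* P PS.:+ v PS.:* (c PS.:* G PS.:- q PS.:* P)
                     PS.:= (u PS.:- v PS.:* q) PS.:* P PS.:+ v PS.:* c PS.:* G) P.refl u v [ c ] q P G)) }))
            where
            t<d = FX.degree<⇒< hR R<d
            open Elimination (eliminate D {E ℕ.* g} R (ℕ.≤-trans (ℕ.<⇒≤ t<d) d≤D) t<d hR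
              (λ m → Filtration.mono 𝓓ˣ {a = FX.coeff R m} size (R∈ m)) 1≤E*g)
            R≈ : R P.≈ [ c ] P.* G P.- q P.* P
            R≈ = P.trans (PS.solve 2 (λ x R → R PS.:= x PS.:+ R PS.:- x) P.refl (q P.* P) R)
                   (P.+-congʳ {P.- (q P.* P)} (P.sym eq))

    -- After Gauss's lemma, `G` and `P` are both multiples of one `B′` that involves y and so is not
    -- a unit. Irreducibility of each then makes the other factor a unit.
    multiple⇒associated : ∀ {G} → Irreducibleᴿ FX.ring[X] G → 1 ℕ.≤ d → Multiple G →
      ∃ λ w → Unit FX.ring[X] w × G P.≈ w P.* P
    multiple⇒associated {G} irrG 1≤d mult = [ A′-unit , (λ u → ⊥-elim (B′-nonunit u)) ]′ (Irreducibleᴿ.split irrG A′ B′ P≈)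
      where
      open Multiple mult
      open Factorization (gauss (proj₁ (F.degree c c≉0)) c _ G q P ℕ.≤-refl (proj₂ (F.degree c c≉0)) c*G≈)
      B′-nonunit : ¬ Unit FX.ring[X] B′
      B′-nonunit u = FX.leading hP (C.trans (B≈ .FX.at d) (C.trans (FX.scalar-⊗ c₂ B′ d)
        (C.trans (C.*-congˡ {c₂} (FX.above (FX.unit-degree u) d 1≤d)) (C.zeroʳ c₂))))
      A′-unit : Unit FX.ring[X] A′ → ∃ λ w → Unit FX.ring[X] w × G P.≈ w P.* P
      A′-unit (a , aA≈1) = from ([ (λ u → u) , (λ u → ⊥-elim (B′-nonunit u)) ]′ (Irreducibleᴿ.split irr [ c₂ ] B′ B≈))
        where
        open Relation.Binary.Reasoning.Setoid P.setoid
        from : Unit FX.ring[X] [ c₂ ] → ∃ λ w → Unit FX.ring[X] w × G P.≈ w P.* P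
        from (k , kc≈1) = A′ P.* k , ([ c₂ ] P.* a , (begin
            [ c₂ ] P.* a P.* (A′ P.* k)  ≈⟨ PS.solve 4 (λ c a A k → c PS.:* a PS.:* (A PS.:* k) PS.:= (k PS.:* c) PS.:* (a PS.:* A)) P.refl [ c₂ ] a A′ k ⟩
            (k P.* [ c₂ ]) P.* (a P.* A′) ≈⟨ P.*-cong kc≈1 aA≈1 ⟩
            P.1# P.* P.1#                 ≈⟨ P.*-identityˡ P.1# ⟩
            P.1# ∎)) , (begin
            G                             ≈⟨ P≈ ⟩
            A′ P.* B′                     ≈⟨ P.*-congˡ {A′} (P.trans (P.sym (P.*-identityˡ B′)) (P.*-congʳ {B′} (P.sym kc≈1))) ⟩
            A′ P.* (k P.* [ c₂ ] P.* B′)  ≈⟨ PS.solve 4 (λ A k c B → A PS.:* (k PS.:* c PS.:* B) PS.:= A PS.:* k PS.:* (c PS.:* B)) P.refl A′ k [ c₂ ] B′ ⟩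
            A′ P.* k P.* ([ c₂ ] P.* B′)  ≈⟨ P.*-congˡ {A′ P.* k} B≈ ⟨
            A′ P.* k P.* P                ∎)

-- Branches of curves as Hurwitz series

evalHom-natural : ∀ {A B B′} (φ : Hom A B) (ψ : Hom B B′) (χ : Hom A B′) z {w} →
  (∀ a → CommutativeRing._≈_ B′ (ψ ⟪ φ ⟪ a ⟫ ⟫) (χ ⟪ a ⟫)) → CommutativeRing._≈_ B′ (ψ ⟪ z ⟫) w →
  ∀ p → CommutativeRing._≈_ B′ (ψ ⟪ evalHom φ z ⟪ p ⟫ ⟫) (evalHom χ w ⟪ p ⟫)
evalHom-natural φ ψ χ z eq eqz []      = Hom.0-homo ψ
evalHom-natural {B′ = B′} φ ψ χ z eq eqz (a ∷ p) = trans (Hom.+-homo ψ _ _)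
  (+-cong (eq a) (trans (Hom.*-homo ψ _ _) (*-cong eqz (evalHom-natural φ ψ χ z eq eqz p))))
  where open CommutativeRing B′

evalHom-id : ∀ {A} z p → CommutativeRing._≈_ A (evalHom (idHom {A}) z ⟪ p ⟫) (Poly.eval A p z)
evalHom-id {A} z []      = CommutativeRing.refl A
evalHom-id {A} z (a ∷ p) = +-congˡ (*-congˡ (evalHom-id {A} z p))
  where open CommutativeRing A

evalHom-cong : ∀ {A B} (φ : Hom A B) {z w} → CommutativeRing._≈_ B z w → ∀ p →
  CommutativeRing._≈_ B (evalHom φ z ⟪ p ⟫) (evalHom φ w ⟪ p ⟫)
evalHom-cong {B = B} φ eq p = Evaluation.eval-cong B (CommutativeRing.refl (Poly.ring[X] B) {map (Hom.fun φ) p}) eq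

module Hurwitz (R : CRing) where
  open CommutativeRing R
  open Algebra.Properties.Semiring.Mult semiring using () renaming (_×_ to _·_)
  private module S = Integers R

  Series : Set
  Series = ℕ → Carrier

  infix 4 _≈ˢ_
  record _≈ˢ_ (a b : Series) : Set where
    constructor mk≈
    field at : ∀ n → a n ≈ b n
  open _≈ˢ_ public

  -- The product is the Leibniz rule for higher derivatives: entry n of a series stands for the
  -- value of its n-th derivative, and tail is the derivation.
  tail : Series → Series
  tail a n = a (suc n)

  infixl 6 _⊞_
  infixl 7 _⊠_
  _⊞_ _⊠_ : Series → Series → Series
  (a ⊞ b) n       = a n + b n
  (a ⊠ b) zero    = a 0 * b 0
  (a ⊠ b) (suc n) = (tail a ⊠ b) n + (a ⊠ tail b) n

  ι : Carrier → Series
  ι c zero    = c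
  ι c (suc n) = 0#

  ⊠-cong≤ : ∀ {a a′ b b′} n → (∀ i → i ℕ.≤ n → a i ≈ a′ i) → (∀ i → i ℕ.≤ n → b i ≈ b′ i) → (a ⊠ b) n ≈ (a′ ⊠ b′) n
  ⊠-cong≤ zero    eq eq′ = *-cong (eq 0 z≤n) (eq′ 0 z≤n)
  ⊠-cong≤ (suc n) eq eq′ = +-cong
    (⊠-cong≤ n (λ i i≤n → eq (suc i) (s≤s i≤n)) (λ i i≤n → eq′ i (ℕ.m≤n⇒m≤1+n i≤n)))
    (⊠-cong≤ n (λ i i≤n → eq i (ℕ.m≤n⇒m≤1+n i≤n)) (λ i i≤n → eq′ (suc i) (s≤s i≤n)))

  ⊠-zero< : ∀ v {a} b → (∀ i → i ℕ.< v → a i ≈ 0#) → ∀ n → n ℕ.< v → (a ⊠ b) n ≈ 0#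
  ⊠-zero< v       b a< zero    0<v       = trans (*-congʳ (a< 0 0<v)) (zeroˡ _)
  ⊠-zero< (suc v) b a< (suc n) (s≤s n<v) = trans (+-cong
    (⊠-zero< v b (λ i i<v → a< (suc i) (s≤s i<v)) n n<v)
    (⊠-zero< (suc v) (tail b) a< n (ℕ.m≤n⇒m≤1+n n<v))) (+-identityˡ _)

  -- The only surviving term of Leibniz's rule has binomial coefficient 1, so comparing lowest
  -- entries brings in no factorials.
  ⊠-first : ∀ v {a} b → (∀ i → i ℕ.< v → a i ≈ 0#) → (a ⊠ b) v ≈ a v * b 0
  ⊠-first zero    b a< = refl
  ⊠-first (suc v) b a< = trans (+-cong
    (⊠-first v b (λ i i<v → a< (suc i) (s≤s i<v)))
    (⊠-zero< (suc v) (tail b) a< v ℕ.≤-refl)) (+-identityʳ _)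

  private
    ⊠-comm : ∀ a b n → (a ⊠ b) n ≈ (b ⊠ a) n
    ⊠-comm a b zero    = *-comm _ _
    ⊠-comm a b (suc n) = trans (+-comm _ _) (+-cong (⊠-comm a (tail b) n) (⊠-comm (tail a) b n))

    ⊠-distribʳ : ∀ c a b n → ((a ⊞ b) ⊠ c) n ≈ (a ⊠ c) n + (b ⊠ c) n
    ⊠-distribʳ c a b zero    = distribʳ _ _ _
    ⊠-distribʳ c a b (suc n) = trans (+-cong (⊠-distribʳ c (tail a) (tail b) n) (⊠-distribʳ (tail c) a b n))
      (S.solve 4 (λ x y z w → (x S.:+ y) S.:+ (z S.:+ w) S.:= (x S.:+ z) S.:+ (y S.:+ w)) refl _ _ _ _)

    ⊠-distribˡ : ∀ c a b n → (c ⊠ (a ⊞ b)) n ≈ (c ⊠ a) n + (c ⊠ b) n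
    ⊠-distribˡ c a b n = trans (⊠-comm c (a ⊞ b) n) (trans (⊠-distribʳ c a b n) (+-cong (⊠-comm a c n) (⊠-comm b c n)))

    ⊠-assoc : ∀ a b c n → ((a ⊠ b) ⊠ c) n ≈ (a ⊠ (b ⊠ c)) n
    ⊠-assoc a b c zero    = *-assoc _ _ _
    ⊠-assoc a b c (suc n) = trans
      (+-cong (trans (⊠-distribʳ c (tail a ⊠ b) (a ⊠ tail b) n) (+-cong (⊠-assoc (tail a) b c n) (⊠-assoc a (tail b) c n)))
              (⊠-assoc a b (tail c) n))
      (trans (+-assoc _ _ _) (+-congˡ (sym (⊠-distribˡ a (tail b ⊠ c) (b ⊠ tail c) n))))

    ⊠-identityˡ : ∀ b n → (ι 1# ⊠ b) n ≈ b n
    ⊠-identityˡ b zero    = *-identityˡ _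
    ⊠-identityˡ b (suc n) = trans (+-cong (⊠-zero< (suc n) b (λ _ _ → refl) n ℕ.≤-refl) (⊠-identityˡ (tail b) n)) (+-identityˡ _)

    abstract
      isCommutativeRingˢ : IsCommutativeRing _≈ˢ_ _⊞_ _⊠_ (λ a n → - a n) (λ _ → 0#) (ι 1#)
      isCommutativeRingˢ = record
        { isRing = record
          { +-isAbelianGroup = record
            { isGroup = record
              { isMonoid = record
                { isSemigroup = record
                  { isMagma = record
                    { isEquivalence = record { refl = mk≈ λ _ → refl ; sym = λ eq → mk≈ λ n → sym (eq .at n)
                                             ; trans = λ eq eq′ → mk≈ λ n → trans (eq .at n) (eq′ .at n) }
                    ; ∙-cong = λ eq eq′ → mk≈ λ n → +-cong (eq .at n) (eq′ .at n) }
                  ; assoc = λ _ _ _ → mk≈ λ _ → +-assoc _ _ _ }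
                ; identity = (λ _ → mk≈ λ _ → +-identityˡ _) , (λ _ → mk≈ λ _ → +-identityʳ _) }
              ; inverse = (λ _ → mk≈ λ _ → -‿inverseˡ _) , (λ _ → mk≈ λ _ → -‿inverseʳ _)
              ; ⁻¹-cong = λ eq → mk≈ λ n → -‿cong (eq .at n) }
            ; comm = λ _ _ → mk≈ λ _ → +-comm _ _ }
          ; *-cong = λ eq eq′ → mk≈ λ n → ⊠-cong≤ n (λ i _ → eq .at i) (λ i _ → eq′ .at i)
          ; *-assoc = λ a b c → mk≈ (⊠-assoc a b c)
          ; *-identity = (λ b → mk≈ (⊠-identityˡ b)) , (λ b → mk≈ λ n → trans (⊠-comm b (ι 1#) n) (⊠-identityˡ b n))
          ; distrib = (λ c a b → mk≈ (⊠-distribˡ c a b)) , (λ c a b → mk≈ (⊠-distribʳ c a b)) }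
        ; *-comm = λ a b → mk≈ (⊠-comm a b) }

  series : CRing
  series = record
    { Carrier = Series ; _≈_ = _≈ˢ_ ; _+_ = _⊞_ ; _*_ = _⊠_ ; -_ = λ a n → - a n ; 0# = λ _ → 0# ; 1# = ι 1#
    ; isCommutativeRing = isCommutativeRingˢ }

  private
    module H = CommutativeRing series
    module HS = Integers series
    module PH = Poly series
    module EH = Evaluation series
    module HP = CommutativeRing PH.ring[X]

  ιHom : Hom R series
  ιHom = record
    { fun = ι ; cong = λ eq → mk≈ λ { zero → eq ; (suc n) → refl }
    ; +-homo = λ _ _ → mk≈ λ { zero → refl ; (suc n) → sym (+-identityˡ _) }
    ; *-homo = λ a b → mk≈ λ { zero → refl ; (suc n) → sym (products a b n) } ; 1-homo = H.refl }
    where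
    products : ∀ a b n → (ι a ⊠ ι b) (suc n) ≈ 0#
    products a b n = trans (+-cong (⊠-zero< (suc n) (ι b) (λ _ _ → refl) n ℕ.≤-refl)
      (trans (⊠-comm (ι a) (tail (ι b)) n) (⊠-zero< (suc n) (ι a) (λ _ _ → refl) n ℕ.≤-refl))) (+-identityˡ _)

  at-0 : Hom series R
  at-0 = record { fun = λ a → a 0 ; cong = λ eq → eq .at 0 ; +-homo = λ _ _ → refl ; *-homo = λ _ _ → refl ; 1-homo = refl }

  infix 4 _≈[_]_
  record _≈[_]_ (a : Series) (n : ℕ) (b : Series) : Set where
    constructor mk≈<
    field below : ∀ i → i ℕ.< n → a i ≈ b i
  open _≈[_]_ public

  ≈ˢ⇒≈< : ∀ {n a b} → a ≈ˢ b → a ≈[ n ] b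
  ≈ˢ⇒≈< eq .below i _ = eq .at i

  ≈<-sym : ∀ {n a b} → a ≈[ n ] b → b ≈[ n ] a
  ≈<-sym eq .below i i<n = sym (eq .below i i<n)

  ≈<-trans : ∀ {n a b c} → a ≈[ n ] b → b ≈[ n ] c → a ≈[ n ] c
  ≈<-trans eq eq′ .below i i<n = trans (eq .below i i<n) (eq′ .below i i<n)

  ⊞-cong< : ∀ {n a a′ b b′} → a ≈[ n ] a′ → b ≈[ n ] b′ → a ⊞ b ≈[ n ] a′ ⊞ b′
  ⊞-cong< eq eq′ .below i i<n = +-cong (eq .below i i<n) (eq′ .below i i<n)

  ⊠-cong< : ∀ {n a a′ b b′} → a ≈[ n ] a′ → b ≈[ n ] b′ → a ⊠ b ≈[ n ] a′ ⊠ b′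
  ⊠-cong< eq eq′ .below i i<n = ⊠-cong≤ i (λ j j≤i → eq .below j (ℕ.≤-<-trans j≤i i<n))
                                           (λ j j≤i → eq′ .below j (ℕ.≤-<-trans j≤i i<n))

  difference< : ∀ {n a b} → a ≈[ n ] b → a H.- b ≈[ n ] H.0#
  difference< eq .below i i<n = trans (+-congʳ (eq .below i i<n)) (-‿inverseʳ _)

  difference<⁻¹ : ∀ {n a b} → a H.- b ≈[ n ] H.0# → a ≈[ n ] b
  difference<⁻¹ {n} {a} {b} eq .below i i<n = trans (S.solve 2 (λ a b → a S.:= (a S.:- b) S.:+ b) refl (a i) (b i))
    (trans (+-congʳ (eq .below i i<n)) (+-identityˡ _))

  eval-cong< : ∀ {n z w} p → z ≈[ n ] w → PH.eval p z ≈[ n ] PH.eval p w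
  eval-cong< {n} {z} {w} p eq = difference<⁻¹ (≈<-trans (≈ˢ⇒≈< (EH.dd-difference p z w))
    (mk≈< (⊠-zero< n (EH.dd p z w) (difference< eq .below))))

  -- The chain rule: the coefficients are themselves series, so they contribute a term of their own.
  tail-eval : ∀ p z → tail (PH.eval p z) ≈ˢ PH.eval (map tail p) z ⊞ PH.eval (PH.derivative p) z ⊠ tail z
  tail-eval []      z = HS.solve 1 (λ z → HS.:# 0 HS.:= HS.:# 0 HS.:+ HS.:# 0 HS.:* z) H.refl (tail z)
  tail-eval (a ∷ p) z = begin
    tail a ⊞ (tail z ⊠ PH.eval p z ⊞ z ⊠ tail (PH.eval p z))
      ≈⟨ H.+-congˡ {tail a} (H.+-congˡ {tail z ⊠ PH.eval p z} (H.*-congˡ {z} (tail-eval p z))) ⟩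
    tail a ⊞ (tail z ⊠ PH.eval p z ⊞ z ⊠ (PH.eval (map tail p) z ⊞ PH.eval (PH.derivative p) z ⊠ tail z))
      ≈⟨ HS.solve 6 (λ a z′ e z m d → a HS.:+ (z′ HS.:* e HS.:+ z HS.:* (m HS.:+ d HS.:* z′))
           HS.:= (a HS.:+ z HS.:* m) HS.:+ (e HS.:+ z HS.:* d) HS.:* z′) H.refl
           (tail a) (tail z) (PH.eval p z) z (PH.eval (map tail p) z) (PH.eval (PH.derivative p) z) ⟩
    (tail a ⊞ z ⊠ PH.eval (map tail p) z) ⊞ (PH.eval p z ⊞ z ⊠ PH.eval (PH.derivative p) z) ⊠ tail z
      ≈⟨ H.+-congˡ {tail a ⊞ z ⊠ PH.eval (map tail p) z} (H.*-congʳ {tail z} (H.sym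
           (H.trans (EH.eval-⊕ p (H.0# ∷ PH.derivative p) z) (H.+-congˡ {PH.eval p z} (H.+-identityˡ _))))) ⟩
    (tail a ⊞ z ⊠ PH.eval (map tail p) z) ⊞ PH.eval (PH.derivative (a ∷ p)) z ⊠ tail z ∎
    where open Relation.Binary.Reasoning.Setoid H.setoid

  module _ (X : Series) where
    private
      module RX = Poly R
      module RXY = Poly RX.ring[X]

    atX : Hom RX.ring[X] series
    atX = evalHom ιHom X

    tail-atX : ∀ c → tail (atX ⟪ c ⟫) ≈ˢ atX ⟪ RX.derivative c ⟫ ⊠ tail X
    tail-atX c = H.trans (tail-eval (map ι c) X) (H.trans (H.+-cong
      (EH.eval-zero (map tail (map ι c)) X (constants c))
      (H.*-congʳ {tail X} (EH.eval-cong (HP.sym (derivative-natural ιHom c)) (H.refl {X})))) (H.+-identityˡ _))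
      where
      constants : ∀ c → map tail (map ι c) PH.≋ []
      constants []      .PH.at n       = H.refl
      constants (a ∷ c) .PH.at zero    = H.refl
      constants (a ∷ c) .PH.at (suc n) = constants c .PH.at n

    atX-0 : ∀ c → (atX ⟪ c ⟫) 0 ≈ RX.eval c (X 0)
    atX-0 c = trans (evalHom-natural ιHom at-0 idHom X (λ _ → refl) refl c) (evalHom-id {R} (X 0) c)

    module _ (Y : Series) where
      atXY : Hom RXY.ring[X] series
      atXY = evalHom atX Y

      tail-atXY : ∀ f → tail (atXY ⟪ f ⟫) ≈ˢ
        atXY ⟪ map RX.derivative f ⟫ ⊠ tail X ⊞ atXY ⟪ RXY.derivative f ⟫ ⊠ tail Y
      tail-atXY f = H.trans (tail-eval (map (Hom.fun atX) f) Y) (H.+-cong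
        (H.trans (EH.eval-cong (coefficients f) (H.refl {Y})) (H.trans (EH.eval-scale (tail X) (map (Hom.fun atX) (map RX.derivative f)) Y)
          (H.*-comm (tail X) _)))
        (H.*-congʳ {tail Y} (EH.eval-cong (HP.sym (derivative-natural atX f)) (H.refl {Y}))))
        where
        coefficients : ∀ f → map tail (map (Hom.fun atX) f) PH.≋ map (tail X ⊠_) (map (Hom.fun atX) (map RX.derivative f))
        coefficients []      = HP.refl
        coefficients (c ∷ f) = PH.∷-cong (H.trans (tail-atX c) (H.*-comm _ (tail X))) (coefficients f)

      atXY-0 : ∀ f → (atXY ⟪ f ⟫) 0 ≈ evalHom (Evaluation.at-point R (X 0)) (Y 0) ⟪ f ⟫
      atXY-0 = evalHom-natural atX at-0 (Evaluation.at-point R (X 0)) Y atX-0 refl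

  -- The expansion of the coordinate function x at a.
  coordinate : Carrier → Series
  coordinate a zero          = a
  coordinate a (suc zero)    = 1#
  coordinate a (suc (suc n)) = 0#

  θ : Series
  θ = coordinate 0#

  tail-coordinate : ∀ a → tail (coordinate a) ≈ˢ H.1#
  tail-coordinate a .at zero    = refl
  tail-coordinate a .at (suc n) = refl

  -- The local parameter has a single nonzero derivative, so Leibniz's rule leaves one term. In
  -- characteristic 0 its factor can be cancelled, hence so can `θ`.
  θ-⊠ : ∀ b n → (θ ⊠ b) (suc n) ≈ suc n · b n
  θ-⊠ b zero    = trans (+-cong (*-identityˡ _) (zeroˡ _)) refl
  θ-⊠ b (suc n) = +-cong (trans (H.*-congʳ {b} (tail-coordinate 0#) .at (suc n)) (H.*-identityˡ b .at (suc n)))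
    (θ-⊠ (tail b) n)

  monomial : ℕ → Carrier → Series
  monomial zero    c         = ι c
  monomial (suc m) c zero    = 0#
  monomial (suc m) c (suc n) = monomial m c n

  monomial-< : ∀ m c i → i ℕ.< m → monomial m c i ≈ 0#
  monomial-< (suc m) c zero    _         = refl
  monomial-< (suc m) c (suc i) (s≤s i<m) = monomial-< m c i i<m

  monomial-≡ : ∀ m c → monomial m c m ≈ c
  monomial-≡ zero    c = refl
  monomial-≡ (suc m) c = monomial-≡ m c

dd-diagonal-natural : ∀ {A B} (φ : Hom A B) p {z w y} → CommutativeRing._≈_ B z y → CommutativeRing._≈_ B w y →
  CommutativeRing._≈_ B (Evaluation.dd B (map (Hom.fun φ) p) z w) (evalHom φ y ⟪ Poly.derivative A p ⟫)
dd-diagonal-natural {A} {B} φ p {y = y} z≈y w≈y = trans (EB.dd-cong (map (Hom.fun φ) p) z≈y w≈y)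
  (trans (EB.dd-diagonal (map (Hom.fun φ) p) y) (EB.eval-cong (PB.sym (derivative-natural φ p)) refl))
  where
  open CommutativeRing B
  module EB = Evaluation B
  module PB = CommutativeRing (Poly.ring[X] B)

module SeriesOverField (em : ExcludedMiddle 0ℓ) (𝔽 : Field) where
  open WithEM em
  open Field 𝔽
  open CommutativeRing cring hiding (zero)
  open Algebra.Properties.Semiring.Mult semiring using (×-assoc-*) renaming (_×_ to _·_)
  open Hurwitz cring public
  private
    module F where
      open Poly cring public
      open OverDomain (fieldDomain 𝔽) public
    module S = Integers cring
    module C = CommutativeRing F.ring[X]
    module FX = Poly F.ring[X]
    module EF = Evaluation cring
    module H = CommutativeRing series
    module HS = Integers series
    module PH = Poly series
    module EH = Evaluation series
    module FD = Domain (fieldDomain 𝔽)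

  point : Carrier → Carrier → Hom FX.ring[X] cring
  point x y = evalHom (EF.at-point x) y

  unit-cancel : ∀ n {a b} → ¬ a 0 ≈ 0# → b ⊠ a ≈[ n ] H.0# → b ≈[ n ] H.0#
  unit-cancel zero    a₀≉0 eq .below i ()
  unit-cancel (suc n) {a} {b} a₀≉0 eq = mk≈< λ i i≤n → by-cases i (ℕ.m≤n⇒m<n∨m≡n (ℕ.s≤s⁻¹ i≤n))
    where
    lower : b ≈[ n ] H.0#
    lower = unit-cancel n a₀≉0 (mk≈< λ i i<n → eq .below i (ℕ.m≤n⇒m≤1+n i<n))
    by-cases : ∀ i → i ℕ.< n ⊎ i ≡.≡ n → b i ≈ 0#
    by-cases i (inj₁ i<n)    = lower .below i i<n
    by-cases i (inj₂ ≡.refl) = [ (λ z → z) , (λ z → ⊥-elim (a₀≉0 z)) ]′ (FD.*-zeros (b n) (a 0)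
      (trans (sym (⊠-first n a (lower .below))) (eq .below n ℕ.≤-refl)))

  ·-zero : ∀ n {a} → suc n · a ≈ 0# → a ≈ 0#
  ·-zero n {a} eq = [ (λ z → ⊥-elim (char-0 n z)) , (λ z → z) ]′ (FD.*-zeros (suc n · 1#) a
    (trans (×-assoc-* (suc n) 1# a) (trans (×-congʳ′ (*-identityˡ a)) eq)))
    where
    ×-congʳ′ : ∀ {x y} → x ≈ y → suc n · x ≈ suc n · y
    ×-congʳ′ = Algebra.Properties.Semiring.Mult.×-congʳ semiring (suc n)

  dd-first : ∀ X {Y Ỹ} P {y} → Y 0 ≈ y → Ỹ 0 ≈ y →
    EH.dd (map (Hom.fun (atX X)) P) Y Ỹ 0 ≈ point (X 0) y ⟪ FX.derivative P ⟫
  dd-first X {Y} {Ỹ} P {y} eq eq′ = begin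
    EH.dd (map (Hom.fun (atX X)) P) Y Ỹ 0
      ≈⟨ dd-natural at-0 (map (Hom.fun (atX X)) P) Y Ỹ ⟩
    EF.dd (map (Hom.fun at-0) (map (Hom.fun (atX X)) P)) (Y 0) (Ỹ 0)
      ≡⟨ ≡.cong (λ p → EF.dd p (Y 0) (Ỹ 0)) (List.map-∘ P) ⟨
    EF.dd (map (Hom.fun (at-0 ∘H atX X)) P) (Y 0) (Ỹ 0)
      ≈⟨ dd-diagonal-natural (at-0 ∘H atX X) P eq eq′ ⟩
    evalHom (at-0 ∘H atX X) y ⟪ FX.derivative P ⟫
      ≈⟨ evalHom-natural (at-0 ∘H atX X) idHom (EF.at-point (X 0)) y (atX-0 X) refl (FX.derivative P) ⟩
    point (X 0) y ⟪ FX.derivative P ⟫ ∎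
    where open Relation.Binary.Reasoning.Setoid setoid

  -- The difference of the two values is `Y - Ỹ` times a divided difference, and the latter is a
  -- unit among series because its entry 0 is the derivative of `P` in y at the point.
  solution-unique : ∀ n X {Y Ỹ} P {y} → Y 0 ≈ y → Ỹ 0 ≈ y → ¬ point (X 0) y ⟪ FX.derivative P ⟫ ≈ 0# →
    atXY X Y ⟪ P ⟫ ≈[ n ] atXY X Ỹ ⟪ P ⟫ → Y ≈[ n ] Ỹ
  solution-unique n X {Y} {Ỹ} P eq eq′ Py≉0 P≈ = difference<⁻¹ (unit-cancel n
    (λ z → Py≉0 (trans (sym (dd-first X P eq eq′)) z))
    (≈<-trans (≈<-sym (≈ˢ⇒≈< (EH.dd-difference (map (Hom.fun (atX X)) P) Y Ỹ))) (difference< P≈)))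

  module Implicit (P : List (List Carrier)) (x y : Carrier) (on-curve : point x y ⟪ P ⟫ ≈ 0#)
                  (Py≉0 : ¬ point x y ⟪ FX.derivative P ⟫ ≈ 0#) where
    private
      X : Series
      X = coordinate x

      s⁻¹ : Carrier
      s⁻¹ = proj₁ (inverse _ Py≉0)

      approx : ℕ → Series
      correction : ℕ → Series

      approx zero    = ι y
      approx (suc n) = approx n ⊞ correction n

      -- Newton's method, one entry at a time: a change of entry `suc n` of the argument changes
      -- entry `suc n` of the value by that amount times ∂P/∂y at the point, and no earlier entry.
      correction n = monomial (suc n) (- (atXY X (approx n) ⟪ P ⟫) (suc n) * s⁻¹)

      approx-0 : ∀ n → approx n 0 ≈ y
      approx-0 zero    = refl
      approx-0 (suc n) = trans (+-identityʳ _) (approx-0 n)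

      approx-root : ∀ n → atXY X (approx n) ⟪ P ⟫ ≈[ suc n ] H.0#
      approx-root zero .below zero _ = trans (atXY-0 X (ι y) P) on-curve
      approx-root zero .below (suc _) (s≤s ())
      approx-root (suc n) = mk≈< λ i i≤1+n → by-cases i (ℕ.m≤n⇒m<n∨m≡n (ℕ.s≤s⁻¹ i≤1+n))
        where
        Z  = approx n
        p  = map (Hom.fun (atX X)) P
        ε  = correction n
        dd = EH.dd p (Z ⊞ ε) Z
        step : PH.eval p (Z ⊞ ε) H.≈ PH.eval p Z ⊞ ε ⊠ dd
        step = H.trans (HS.solve 2 (λ a b → a HS.:= b HS.:+ (a HS.:- b)) H.refl (PH.eval p (Z ⊞ ε)) (PH.eval p Z))
          (H.+-congˡ {PH.eval p Z} (H.trans (EH.dd-difference p (Z ⊞ ε) Z)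
            (H.*-congʳ {dd} (HS.solve 2 (λ Z ε → Z HS.:+ ε HS.:- Z HS.:= ε) H.refl Z ε))))
        ε< = monomial-< (suc n) (- (atXY X (approx n) ⟪ P ⟫) (suc n) * s⁻¹)
        by-cases : ∀ i → i ℕ.< suc n ⊎ i ≡.≡ suc n → PH.eval p (Z ⊞ ε) i ≈ 0#
        by-cases i (inj₁ i<1+n) = trans (step .at i) (trans (+-cong (approx-root n .below i i<1+n)
          (⊠-zero< (suc n) dd ε< i i<1+n)) (+-identityˡ _))
        by-cases _ (inj₂ ≡.refl) = trans (step .at (suc n)) (trans (+-congˡ (trans (⊠-first (suc n) dd ε<)
            (*-cong (monomial-≡ (suc n) _) (dd-first X P (trans (+-identityʳ _) (approx-0 n)) (approx-0 n)))))
          (trans (S.solve 3 (λ e i s → e S.:+ (S.:- e) S.:* i S.:* s S.:= e S.:- e S.:* (i S.:* s)) refl _ s⁻¹ _)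
            (trans (+-congˡ (-‿cong (trans (*-congˡ (proj₂ (inverse _ Py≉0))) (*-identityʳ _)))) (-‿inverseʳ _))))

      approx-stable : ∀ n i → i ℕ.≤ n → approx i i ≈ approx n i
      approx-stable n i i≤n with ℕ.m≤n⇒m<n∨m≡n i≤n
      approx-stable n       i i≤n | inj₂ ≡.refl = refl
      approx-stable (suc n) i i≤n | inj₁ i<1+n  = trans (approx-stable n i (ℕ.s≤s⁻¹ i<1+n))
        (sym (trans (+-congˡ (monomial-< (suc n) _ i i<1+n)) (+-identityʳ _)))

    -- The expansion of the branch through (x , y), as a function of the first coordinate.
    branch : Series
    branch n = approx n n

    branch-root : atXY X branch ⟪ P ⟫ ≈ˢ H.0#
    branch-root .at n = ≈<-trans (eval-cong< (map (Hom.fun (atX X)) P) branch≈) (approx-root n) .below n ℕ.≤-refl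
      where
      branch≈ : branch ≈[ suc n ] approx n
      branch≈ .below i i≤n = approx-stable n i (ℕ.s≤s⁻¹ i≤n)

  linear : Carrier → List Carrier
  linear a = F.X C.- (a ∷ [])

  linear-degree : ∀ a → F.HasDegree 1 (linear a)
  linear-degree a = 1≉0 F., λ { (suc zero) (s≤s ()) ; (suc (suc m)) _ → refl }

  linear-at : ∀ a z → F.eval (linear a) z ≈ z - a
  linear-at a z = S.solve 2 (λ a z → S.:# 0 S.:+ S.:- a S.:+ z S.:* (S.:# 1 S.:+ z S.:* S.:# 0) S.:= z S.:- a) refl a z

  -- `c` is written as its value at the variable minus its value at `a`, both in F[x]; the divided
  -- difference then splits off the linear factor.
  factor-root : ∀ c a → F.eval c a ≈ 0# → ∃ λ c₁ → c C.≈ linear a C.* c₁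
  factor-root c a root = EC.dd (map (_∷ []) c) F.X (a ∷ []) , (begin
    c
      ≈⟨ eval-unique idHom (constant cring) F.X (λ _ → C.refl) (C.refl {F.X}) c ⟩
    EC′.eval (map (_∷ []) c) F.X
      ≈⟨ C.trans (C.sym (C.+-identityʳ (EC′.eval (map (_∷ []) c) F.X))) (C.+-congˡ {EC′.eval (map (_∷ []) c) F.X} (C.sym zero-value)) ⟩
    EC′.eval (map (_∷ []) c) F.X C.- EC′.eval (map (_∷ []) c) (a ∷ [])
      ≈⟨ EC.dd-difference (map (_∷ []) c) F.X (a ∷ []) ⟩
    linear a C.* EC.dd (map (_∷ []) c) F.X (a ∷ []) ∎)
    where
    open Relation.Binary.Reasoning.Setoid C.setoid
    module EC = Evaluation F.ring[X]
    module EC′ = Poly F.ring[X]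
    module CS = Integers F.ring[X]
    zero-value : C.- EC′.eval (map (_∷ []) c) (a ∷ []) C.≈ C.0#
    zero-value = C.trans (C.-‿cong (C.trans (C.sym (eval-natural (constant cring) c a))
      (C.trans (Hom.cong (constant cring) root) (Hom.0-homo (constant cring))))) (CS.solve 0 (CS.:- CS.:# 0 CS.:= CS.:# 0) C.refl)

  factor-degree : ∀ {a c c₁ n} → ¬ c C.≈ C.0# → c C.≈ linear a C.* c₁ → Degree cring n c →
    ¬ c₁ C.≈ C.0# × ∃ λ m → m ℕ.< n × Degree cring m c₁
  factor-degree {a} {c} {c₁} {n} c≉0 eq c≤n = c₁≉0 , from (F.degree c₁ c₁≉0)
    where
    c₁≉0 : ¬ c₁ C.≈ C.0#
    c₁≉0 z = c≉0 (C.trans eq (C.trans (C.*-congˡ {linear a} z) (C.zeroʳ (linear a))))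
    from : ∃ (λ t → F.HasDegree t c₁) → ∃ λ m → m ℕ.< n × Degree cring m c₁
    from (t , h) = t , F.HasDegree⇒≤ (F.HasDegree-resp (C.sym eq) (F.HasDegree-⊗ (linear-degree a) h)) c≤n , F.above h

  roots-bound : ∀ {m e} r (f : Fin m → Carrier) → (∀ {i j} → f i ≈ f j → i ≡.≡ j) →
    ¬ r C.≈ C.0# → Degree cring e r → (∀ i → F.eval r (f i) ≈ 0#) → m ℕ.≤ e
  roots-bound {zero}  r f inj r≉0 r≤e roots = z≤n
  roots-bound {suc m} r f inj r≉0 r≤e roots =
    let r₁ , eq = factor-root r (f zero) (roots zero)
        r₁≉0 , t , t<e , r₁≤t = factor-degree {f zero} {r} {r₁} r≉0 eq r≤e
    in ℕ.≤-trans (s≤s (roots-bound r₁ (λ i → f (suc i)) (λ eq → Fin.suc-injective (inj eq)) r₁≉0 r₁≤t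
         λ i → [ (λ z → ⊥-elim (distinct i z)) , (λ z → z) ]′ (FD.*-zeros (f (suc i) - f zero) _
           (trans (*-congʳ (sym (linear-at (f zero) (f (suc i)))))
             (trans (sym (EF.eval-⊗ (linear (f zero)) r₁ (f (suc i)))) (trans (EF.eval-cong (C.sym eq) refl) (roots (suc i)))))))) t<e
    where
    distinct : ∀ i → ¬ f (suc i) - f zero ≈ 0#
    distinct i z with inj {suc i} {zero} (trans (S.solve 2 (λ a b → a S.:= (a S.:- b) S.:+ b) refl (f (suc i)) (f zero))
                        (trans (+-congʳ z) (+-identityˡ _)))
    ... | ()

  -- `c` may vanish at `a` and then is not a unit among series. Factors x - a are split off, which
  -- expand to `θ` and can be cancelled, until the value at `a` is nonzero; `n` bounds their number.
  polynomial-cancel : ∀ n a c b → ¬ c C.≈ C.0# → Degree cring n c → atX (coordinate a) ⟪ c ⟫ ⊠ b ≈ˢ H.0# → b ≈ˢ H.0#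
  polynomial-cancel n a c b c≉0 c≤n eq = by-cases em n c≤n
    where
    X = coordinate a
    by-cases : Dec (F.eval c a ≈ 0#) → ∀ n → Degree cring n c → b ≈ˢ H.0#
    by-cases (no c₀≉0) _ _ .at i = unit-cancel (suc i) {atX X ⟪ c ⟫} {b} (λ z → c₀≉0 (trans (sym (atX-0 X c)) z))
      (≈ˢ⇒≈< (H.trans (H.*-comm b _) eq)) .below i ℕ.≤-refl
    by-cases (yes root) n c≤n with factor-root c a root
    ... | c₁ , c≈ = with-degree n c≤n (factor-degree {a} {c} {c₁} c≉0 c≈ c≤n)
      where
      c₁b = atX X ⟪ c₁ ⟫ ⊠ b
      linear≈θ : atX X ⟪ linear a ⟫ ≈ˢ θ
      linear≈θ = H.trans (Hom.sub-homo (atX X) F.X (a ∷ [])) (H.trans (H.+-cong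
          (H.trans (H.+-congʳ {X ⊠ (ι 1# ⊞ X ⊠ H.0#)} (Hom.0-homo ιHom)) (EH.eval-X X)) (H.-‿cong (EH.eval-const (ι a) X)))
        (mk≈ λ { zero → -‿inverseʳ a ; (suc zero) → trans (+-congˡ (S.solve 0 (S.:- S.:# 0 S.:= S.:# 0) refl)) (+-identityʳ _)
               ; (suc (suc n)) → -‿inverseʳ 0# }))
      θc₁b≈0 : θ ⊠ c₁b ≈ˢ H.0#
      θc₁b≈0 = H.trans (H.sym (H.*-assoc θ (atX X ⟪ c₁ ⟫) b)) (H.trans (H.*-congʳ {b} (H.trans
        (H.*-congʳ {atX X ⟪ c₁ ⟫} (H.sym linear≈θ)) (H.trans (H.sym (Hom.*-homo (atX X) (linear a) c₁)) (Hom.cong (atX X) (C.sym c≈))))) eq)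
      with-degree : ∀ n → Degree cring n c → ¬ c₁ C.≈ C.0# × ∃ (λ m → m ℕ.< n × Degree cring m c₁) → b ≈ˢ H.0#
      with-degree (suc n) _ (c₁≉0 , m , s≤s m≤n , c₁≤m) = polynomial-cancel n a c₁ b c₁≉0
        (λ i n<i → c₁≤m i (ℕ.≤-<-trans m≤n n<i))
        (mk≈ λ i → ·-zero i (trans (sym (θ-⊠ c₁b i)) (θc₁b≈0 .at (suc i))))

  polynomial-nonzero : ∀ n a c → ¬ c C.≈ C.0# → Degree cring n c → ¬ atX (coordinate a) ⟪ c ⟫ ≈ˢ H.0#
  polynomial-nonzero n a c c≉0 c≤n eq = 1≉0 (polynomial-cancel n a c H.1# c≉0 c≤n
    (H.trans (H.*-congʳ {H.1#} eq) (H.zeroˡ H.1#)) .at 0)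

-- Interpolation at jets

module TabulatedPolynomials (A : CRing) where
  open CommutativeRing A hiding (zero)
  open Poly A
  open Evaluation A
  open Integers A

  eval-tabulate-cong : ∀ {n} {f g : Fin n → Carrier} {z w} → (∀ j → f j ≈ g j) → z ≈ w →
    eval (tabulate f) z ≈ eval (tabulate g) w
  eval-tabulate-cong {zero}  eq eqz = refl
  eval-tabulate-cong {suc n} eq eqz = +-cong (eq zero) (*-cong eqz (eval-tabulate-cong (λ j → eq (suc j)) eqz))

  eval-tabulate-zero : ∀ {n} {f : Fin n → Carrier} z → (∀ j → f j ≈ 0#) → eval (tabulate f) z ≈ 0#
  eval-tabulate-zero {zero}  z eq = refl
  eval-tabulate-zero {suc n} z eq = trans (+-cong (eq zero) (trans (*-congˡ (eval-tabulate-zero z (λ j → eq (suc j)))) (zeroʳ z)))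
    (+-identityˡ _)

  eval-tabulate-+ : ∀ {n} (f g : Fin n → Carrier) z →
    eval (tabulate (λ j → f j + g j)) z ≈ eval (tabulate f) z + eval (tabulate g) z
  eval-tabulate-+ {zero}  f g z = sym (+-identityˡ _)
  eval-tabulate-+ {suc n} f g z = trans (+-congˡ (*-congˡ (eval-tabulate-+ (λ j → f (suc j)) (λ j → g (suc j)) z)))
    (solve 5 (λ a b z u v → a :+ b :+ z :* (u :+ v) := a :+ z :* u :+ (b :+ z :* v)) refl _ _ _ _ _)

  eval-tabulate-* : ∀ {n} a (f : Fin n → Carrier) z → eval (tabulate (λ j → a * f j)) z ≈ a * eval (tabulate f) z
  eval-tabulate-* {zero}  a f z = sym (zeroʳ a)
  eval-tabulate-* {suc n} a f z = trans (+-congˡ (*-congˡ (eval-tabulate-* a (λ j → f (suc j)) z)))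
    (solve 4 (λ a b z u → a :* b :+ z :* (a :* u) := a :* (b :+ z :* u)) refl _ _ _ _)

module Boxes (𝔽 : Field) (e : ℕ) where
  open Field 𝔽
  private
    module F = CommutativeRing cring
    open Algebra.Properties.Semiring.Mult F.semiring using () renaming (_×_ to _·_)

  -- Polynomials in m variables whose degree in each variable is less than e.
  Box : ℕ → Set
  Box zero    = F.Carrier
  Box (suc m) = Fin e → Box m

  IsZero : ∀ m → Box m → Set
  IsZero zero    c = c F.≈ F.0#
  IsZero (suc m) Q = ∀ j → IsZero m (Q j)

  scale : F.Carrier → ∀ m → Box m → Box m
  scale a zero    c   = a F.* c
  scale a (suc m) Q j = scale a m (Q j)

  scale-nonzero : ExcludedMiddle 0ℓ → ∀ {a} → ¬ a F.≈ F.0# → ∀ m Q → IsZero m (scale a m Q) → IsZero m Q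
  scale-nonzero em a≉0 zero    c z   = [ (λ a≈0 → ⊥-elim (a≉0 a≈0)) , (λ c≈0 → c≈0) ]′
    (Domain.*-zeros (WithEM.fieldDomain em 𝔽) _ c z)
  scale-nonzero em a≉0 (suc m) Q z j = scale-nonzero em a≉0 m (Q j) (z j)

  -- The derivative in the last variable.
  ∂ : ∀ m {n} → (Fin (suc n) → Box m) → Fin n → Box m
  ∂ m Q j = scale (suc (toℕ j) · F.1#) m (Q (suc j))

  toBox : ∀ m → (Fin (e ℕ.^ m) → F.Carrier) → Box m
  toBox zero    c   = c zero
  toBox (suc m) c j = toBox m (λ i → c (combine j i))

  toBox-zero : ∀ m c → IsZero m (toBox m c) → ∀ i → c i F.≈ F.0#
  toBox-zero zero    c z zero = z
  toBox-zero (suc m) c z i with Fin.combine-surjective {e} {e ℕ.^ m} i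
  ... | j , l , ≡.refl = toBox-zero m (λ i → c (combine j i)) (z j) l

  module Evaluate {A : CRing} (ι : Hom cring A) where
    open CommutativeRing A hiding (zero)
    open Poly A using (eval; derivative)
    open Evaluation A
    open TabulatedPolynomials A
    open Integers A

    at-box : ∀ m → Box m → (ℕ → Carrier) → Carrier
    at-box zero    c v = ι ⟪ c ⟫
    at-box (suc m) Q v = eval (tabulate (λ j → at-box m (Q j) v)) (v m)

    -- The length is free, since each derivative in the last variable shortens the list of
    -- coefficients by one.
    at-poly : ∀ m {n} → (Fin n → Box m) → (ℕ → Carrier) → Carrier
    at-poly m Q v = eval (tabulate (λ j → at-box m (Q j) v)) (v m)

    at-box-scale : ∀ a m Q v → at-box m (scale a m Q) v ≈ ι ⟪ a ⟫ * at-box m Q v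
    at-box-scale a zero    c v = Hom.*-homo ι a c
    at-box-scale a (suc m) Q v = trans (eval-tabulate-cong (λ j → at-box-scale a m (Q j) v) refl)
      (eval-tabulate-* (ι ⟪ a ⟫) (λ j → at-box m (Q j) v) (v m))

    at-box-zero : ∀ m Q v → IsZero m Q → at-box m Q v ≈ 0#
    at-box-zero zero    c v z = trans (Hom.cong ι z) (Hom.0-homo ι)
    at-box-zero (suc m) Q v z = eval-tabulate-zero (v m) (λ j → at-box-zero m (Q j) v (z j))

    private
      -- The offset allows induction: removing the first coefficient shifts all later weights by
      -- one.
      weighted : ∀ {n} → ℕ → (Fin n → Carrier) → Carrier → Carrier
      weighted o f = eval (tabulate (λ j → ι ⟪ (o ℕ.+ toℕ j) · F.1# ⟫ * f j))

      weighted-suc : ∀ {n} o (f : Fin n → Carrier) z → weighted (suc o) f z ≈ weighted o f z + eval (tabulate f) z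
      weighted-suc o f z = trans
        (eval-tabulate-cong (λ j → trans (*-congʳ (trans (Hom.+-homo ι F.1# ((o ℕ.+ toℕ j) · F.1#)) (+-congʳ (Hom.1-homo ι))))
          (solve 2 (λ a b → (:# 1 :+ a) :* b := a :* b :+ b) refl (ι ⟪ (o ℕ.+ toℕ j) · F.1# ⟫) (f j))) refl)
        (eval-tabulate-+ (λ j → ι ⟪ (o ℕ.+ toℕ j) · F.1# ⟫ * f j) f z)

      weighted-0 : ∀ {n} (f : Fin (suc n) → Carrier) z → weighted 0 f z ≈ z * weighted 1 (λ j → f (suc j)) z
      weighted-0 f z = trans (+-congʳ (trans (*-congʳ (Hom.0-homo ι)) (zeroˡ _))) (+-identityˡ _)

      eval-derivative : ∀ {n} (f : Fin (suc n) → Carrier) z →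
        eval (derivative (tabulate f)) z ≈ weighted 1 (λ j → f (suc j)) z
      eval-derivative {zero}  f z = solve 1 (λ z → :# 0 :+ z :* :# 0 := :# 0) refl z
      eval-derivative {suc n} f z = trans (eval-⊕ (tabulate g) (0# ∷ derivative (tabulate g)) z)
        (trans (+-congˡ (trans (+-identityˡ _) (trans (*-congˡ (eval-derivative g z)) (sym (weighted-0 g z)))))
          (trans (+-comm _ _) (sym (weighted-suc 0 g z))))
        where
        g : Fin (suc n) → Carrier
        g j = f (suc j)

    at-poly-∂ : ∀ m {n} (Q : Fin (suc n) → Box m) v →
      eval (derivative (tabulate (λ j → at-box m (Q j) v))) (v m) ≈ at-poly m (∂ m Q) v
    at-poly-∂ m Q v = trans (eval-derivative (λ j → at-box m (Q j) v) (v m))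
      (eval-tabulate-cong (λ j → sym (at-box-scale (suc (toℕ j) · F.1#) m (Q (suc j)) v)) refl)

  module _ {A B : CRing} (ι : Hom cring A) (ψ : Hom A B) (κ : Hom cring B)
           (commute : ∀ a → CommutativeRing._≈_ B (ψ ⟪ ι ⟪ a ⟫ ⟫) (κ ⟪ a ⟫)) where
    private
      module B = CommutativeRing B
      module EA = Evaluate ι
      module EB = Evaluate κ

    at-box-natural : ∀ m Q v → ψ ⟪ EA.at-box m Q v ⟫ B.≈ EB.at-box m Q (λ j → ψ ⟪ v j ⟫)
    at-poly-natural : ∀ m {n} (Q : Fin n → Box m) v → ψ ⟪ EA.at-poly m Q v ⟫ B.≈ EB.at-poly m Q (λ j → ψ ⟪ v j ⟫)

    at-box-natural zero    c v = commute c
    at-box-natural (suc m) Q v = at-poly-natural m Q v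
    at-poly-natural m Q v = B.trans (eval-natural ψ (tabulate (λ j → EA.at-box m (Q j) v)) (v m))
      (B.trans (B.reflexive (≡.cong (λ p → Poly.eval B p (ψ ⟪ v m ⟫)) (List.map-tabulate (λ j → EA.at-box m (Q j) v) (Hom.fun ψ))))
        (TabulatedPolynomials.eval-tabulate-cong B (λ j → at-box-natural m (Q j) v) B.refl))

-- Linear systems with more unknowns than equations

module LinearAlgebra (em : ExcludedMiddle 0ℓ) (𝔽 : Field) where
  open Field 𝔽
  open CommutativeRing cring hiding (zero)
  open Integers cring

  record Functional (d : ℕ) : Set where
    field
      fun   : (Fin d → Carrier) → Carrier
      cong  : ∀ {c c′} → (∀ i → c i ≈ c′ i) → fun c ≈ fun c′
      add   : ∀ c c′ → fun (λ i → c i + c′ i) ≈ fun c + fun c′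
      scale : ∀ a c → fun (λ i → a * c i) ≈ a * fun c

  private
    infixr 5 _▸_
    _▸_ : ∀ {d} → Carrier → (Fin d → Carrier) → Fin (suc d) → Carrier
    (a ▸ c) zero    = a
    (a ▸ c) (suc i) = c i

    unit : ∀ {d} → Fin (suc d) → Carrier
    unit = 1# ▸ λ _ → 0#

  -- Gaussian elimination: a functional that is nonzero on the first unit vector is solved for the
  -- first coordinate, and the others are restricted to its kernel, which `φ` parametrises. If there
  -- is no such pivot, the unit vector itself is a common zero.
  common-zero : ∀ N d → (L : Fin N → Functional d) → N ℕ.< d →
    ∃ λ c → ¬ (∀ i → c i ≈ 0#) × ∀ j → Functional.fun (L j) c ≈ 0#
  common-zero N (suc d) L N<1+d with em {∃ λ j → ¬ Functional.fun (L j) unit ≈ 0#}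
  ... | no none = unit , (λ z → 1≉0 (z zero)) , λ j → vanish j em
    where
    vanish : ∀ j → Dec (Functional.fun (L j) unit ≈ 0#) → Functional.fun (L j) unit ≈ 0#
    vanish j (yes z) = z
    vanish j (no nz) = ⊥-elim (none (j , nz))
  common-zero (suc N) (suc d) L (s≤s N<d) | yes (p , pivot≉0) =
    φ c , (λ z → c≉0 (λ i → z (suc i))) , λ j → vanish j (p Fin.≟ j)
    where
    module Lp = Functional (L p)
    u = inverse (Lp.fun unit) pivot≉0
    t : (Fin d → Carrier) → Carrier
    t c = - (proj₁ u * Lp.fun (0# ▸ c))
    φ : (Fin d → Carrier) → Fin (suc d) → Carrier
    φ c = t c ▸ c
    t-cong : ∀ {c c′} → (∀ i → c i ≈ c′ i) → t c ≈ t c′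
    t-cong eq = -‿cong (*-congˡ (Lp.cong λ { zero → refl ; (suc i) → eq i }))
    t-add : ∀ c c′ → t (λ i → c i + c′ i) ≈ t c + t c′
    t-add c c′ = trans (-‿cong (*-congˡ (trans (Lp.cong λ { zero → sym (+-identityˡ 0#) ; (suc i) → refl }) (Lp.add (0# ▸ c) (0# ▸ c′)))))
      (solve 3 (λ u a b → :- (u :* (a :+ b)) := :- (u :* a) :+ :- (u :* b)) refl _ _ _)
    t-scale : ∀ a c → t (λ i → a * c i) ≈ a * t c
    t-scale a c = trans (-‿cong (*-congˡ (trans (Lp.cong λ { zero → sym (zeroʳ a) ; (suc i) → refl }) (Lp.scale a (0# ▸ c)))))
      (solve 3 (λ u a b → :- (u :* (a :* b)) := a :* :- (u :* b)) refl _ _ _)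
    L′ : Fin N → Functional d
    L′ j = record
      { fun   = λ c → Lj.fun (φ c)
      ; cong  = λ eq → Lj.cong λ { zero → t-cong eq ; (suc i) → eq i }
      ; add   = λ c c′ → trans (Lj.cong λ { zero → t-add c c′ ; (suc i) → refl }) (Lj.add (φ c) (φ c′))
      ; scale = λ a c → trans (Lj.cong λ { zero → t-scale a c ; (suc i) → refl }) (Lj.scale a (φ c))
      }
      where module Lj = Functional (L (punchIn p j))
    IH = common-zero N d L′ N<d
    c = proj₁ IH
    c≉0 = proj₁ (proj₂ IH)
    at-pivot : Lp.fun (φ c) ≈ 0#
    at-pivot = trans (Lp.cong split) (trans (Lp.add (λ i → t c * unit i) (0# ▸ c)) (trans (+-congʳ (Lp.scale (t c) unit))
      (trans (solve 3 (λ u a b → (:- (u :* a)) :* b :+ a := a :- a :* (u :* b)) refl (proj₁ u) (Lp.fun (0# ▸ c)) (Lp.fun unit))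
        (trans (+-congˡ (-‿cong (trans (*-congˡ (proj₂ u)) (*-identityʳ _)))) (-‿inverseʳ _)))))
      where
      split : ∀ i → φ c i ≈ t c * unit i + (0# ▸ c) i
      split zero    = sym (trans (+-identityʳ _) (*-identityʳ _))
      split (suc i) = sym (trans (+-congʳ (zeroʳ _)) (+-identityˡ _))
    vanish : ∀ j → Dec (p ≡.≡ j) → Functional.fun (L j) (φ c) ≈ 0#
    vanish j (yes ≡.refl) = at-pivot
    vanish j (no p≢j) = ≡.subst (λ j → Functional.fun (L j) (φ c) ≈ 0#) (Fin.punchIn-punchOut p≢j)
      (proj₂ (proj₂ IH) (punchOut p≢j))

module _ (𝔽 : Field) (em : ExcludedMiddle 0ℓ) (e : ℕ) where
  open Field 𝔽
  open CommutativeRing cring hiding (zero)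
  open Boxes 𝔽 e
  open LinearAlgebra em 𝔽 using (Functional; common-zero)
  open TabulatedPolynomials cring
  private module E = Evaluate (idHom {cring})

  box-functional : ∀ m (v : ℕ → Carrier) → Functional (e ℕ.^ m)
  box-functional m v = record { fun = λ c → E.at-box m (toBox m c) v ; cong = cong m ; add = add m ; scale = scale′ m }
    where
    cong : ∀ m {c c′ : Fin (e ℕ.^ m) → Carrier} → (∀ i → c i ≈ c′ i) → E.at-box m (toBox m c) v ≈ E.at-box m (toBox m c′) v
    cong zero    eq = eq zero
    cong (suc m) eq = eval-tabulate-cong {e} (λ j → cong m (λ i → eq (combine j i))) refl
    add : ∀ m c c′ → E.at-box m (toBox m (λ i → c i + c′ i)) v ≈ E.at-box m (toBox m c) v + E.at-box m (toBox m c′) v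
    add zero    c c′ = refl
    add (suc m) c c′ = trans (eval-tabulate-cong {e} (λ j → add m (λ i → c (combine j i)) (λ i → c′ (combine j i))) refl)
      (eval-tabulate-+ {e} _ _ (v m))
    scale′ : ∀ m a c → E.at-box m (toBox m (λ i → a * c i)) v ≈ a * E.at-box m (toBox m c) v
    scale′ zero    a c = refl
    scale′ (suc m) a c = trans (eval-tabulate-cong {e} (λ j → scale′ m a (λ i → c (combine j i))) refl) (eval-tabulate-* {e} a _ (v m))

  interpolate : ∀ {N} m (v : Fin N → ℕ → Carrier) → N ℕ.< e ℕ.^ m →
    ∃ λ Q → ¬ IsZero m Q × ∀ j → E.at-box m Q (v j) ≈ 0#
  interpolate m v N<e^m = let c , c≉0 , zeros = common-zero _ _ (λ j → box-functional m (v j)) N<e^m in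
    toBox m c , (λ z → c≉0 (toBox-zero m c z)) , zeros

-- Degrees of derivatives

module _ (R : CRing) where
  open CommutativeRing R hiding (zero)
  open Poly R

  coeff-derivative-∈ : ∀ (𝓕 : Filtration R) {n} p → Coefficientwise R 𝓕 n p → Coefficientwise R 𝓕 n (derivative p)
  coeff-derivative-∈ 𝓕 []      p∈ m = Filtration.zero∈ 𝓕
  coeff-derivative-∈ 𝓕 {n} (a ∷ p) p∈ m = resp (sym (coeff-⊕ p (0# ∷ derivative p) m)) (+-∈ (p∈ (suc m)) (rest m))
    where
    open Filtration 𝓕
    rest : ∀ m → Fil n (coeff (0# ∷ derivative p) m)
    rest zero    = zero∈
    rest (suc m) = coeff-derivative-∈ 𝓕 p (λ i → p∈ (suc i)) m

  vanishing-derivative : ∀ N p → (∀ m → N ℕ.≤ m → coeff p m ≈ 0#) → ∀ m → N ℕ.≤ m → coeff (derivative p) m ≈ 0#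
  vanishing-derivative N []      p< m N≤m = refl
  vanishing-derivative N (a ∷ p) p< m N≤m = trans (coeff-⊕ p (0# ∷ derivative p) m)
    (trans (+-cong (p< (suc m) (ℕ.m≤n⇒m≤1+n N≤m)) (rest N p< m N≤m)) (+-identityˡ _))
    where
    rest : ∀ N → (∀ m → N ℕ.≤ m → coeff (a ∷ p) m ≈ 0#) → ∀ m → N ℕ.≤ m → coeff (0# ∷ derivative p) m ≈ 0#
    rest N       p< zero    N≤m       = refl
    rest zero    p< (suc m) _         = vanishing-derivative 0 p (λ i _ → p< (suc i) z≤n) m z≤n
    rest (suc N) p< (suc m) (s≤s N≤m) = vanishing-derivative N p (λ i N≤i → p< (suc i) (s≤s N≤i)) m N≤m

  derivative-degree : ∀ {n} p → Degree R n p → Degree R n (derivative p)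
  derivative-degree {n} p = vanishing-derivative (suc n) p

power : ∀ R → ∣ R ∣ᶜ → ℕ → ∣ R ∣ᶜ
power R a zero    = CommutativeRing.1# R
power R a (suc n) = CommutativeRing._*_ R a (power R a n)

module BoundedDegree (R : CRing) where
  private
    module RX  = Poly R
    module RXY = Poly RX.ring[X]
    module P   = CommutativeRing RXY.ring[X]

  -- The degree in each of the two variables is bounded.
  𝓓 : Filtration RXY.ring[X]
  𝓓 = coefficientwise-filtration RX.ring[X] (degree-filtration R) ∧ᶠ degree-filtration RX.ring[X]

  open Filtration 𝓓 public

  ∂y-∈ : ∀ {n} f → Fil n f → Fil n (RXY.derivative f)
  ∂y-∈ f (f∈ , f≤) = coeff-derivative-∈ RX.ring[X] (degree-filtration R) f f∈ , derivative-degree RX.ring[X] f f≤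

  ∂x-∈ : ∀ {n} f → Fil n f → Fil n (map RX.derivative f)
  ∂x-∈ f (f∈ , f≤) = (λ j → Filtration.resp (degree-filtration R) (CommutativeRing.sym RX.ring[X] (coefficients f j)) (derivative-degree R (RXY.coeff f j) (f∈ j))) ,
                     (λ j n<j → CommutativeRing.trans RX.ring[X] (coefficients f j) (vanish (f≤ j n<j)))
    where
    coefficients : ∀ f j → RXY.coeff (map RX.derivative f) j RX.≋ RX.derivative (RXY.coeff f j)
    coefficients []      j       = CommutativeRing.refl RX.ring[X]
    coefficients (a ∷ f) zero    = CommutativeRing.refl RX.ring[X]
    coefficients (a ∷ f) (suc j) = coefficients f j
    vanish : ∀ {c} → c RX.≋ [] → RX.derivative c RX.≋ []
    vanish {c} c≈0 = RX.mk≋ λ m → vanishing-derivative R 0 c (λ i _ → c≈0 .RX.at i) m z≤n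


-- The recursion of the quotient rule: numerator and denominator of the next derivative contain two
-- factors of the present degree and one partial derivative of the curve's equation. At the start
-- are x and y, with denominator 1.
jet-degree : ℕ → ℕ → ℕ
jet-degree D zero          = 1
jet-degree D (suc zero)    = 1
jet-degree D (suc (suc l)) = D ℕ.+ (jet-degree D (suc l) ℕ.+ jet-degree D (suc l))

-- To be multiplied by `e`: each of the `m` jet coordinates enters with numerators and denominators
-- in total degree at most `e`.
box-degree : ℕ → ℕ → ℕ
box-degree D zero    = 0
box-degree D (suc m) = box-degree D m ℕ.+ jet-degree D m

-- Clearing denominators in the jet coordinates

module Numerators (em : ExcludedMiddle 0ℓ) (𝔽 : Field) (e : ℕ) where
  open Field 𝔽
  open CommutativeRing cring hiding (zero)
  open SeriesOverField em 𝔽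
  open Boxes 𝔽 e
  open BoundedDegree cring
  private
    module FX  = Poly cring
    module FXY = Poly FX.ring[X]
    module P   = CommutativeRing FXY.ring[X]
    module H   = CommutativeRing series
    module HS  = Integers series
    module FD  = Domain (WithEM.fieldDomain em 𝔽)
    module BH  = Evaluate ιHom
    module BF  = Evaluate (idHom {cring})

  -- The coordinates x, y, y′, y″, … of the jets of a curve.
  jet : Series → Series → ℕ → Series
  jet X Y zero          = X
  jet X Y (suc zero)    = Y
  jet X Y (suc (suc l)) = tail (jet X Y (suc l))

  private
    power-∈ : ∀ {b} n {f} → Fil b f → Fil (n ℕ.* b) (power FXY.ring[X] f n)
    power-∈ zero    f∈ = one∈
    power-∈ (suc n) {f} f∈ = *-∈ {a = f} {b = power FXY.ring[X] f n} f∈ (power-∈ n f∈)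

  module _ (P : List (List Carrier)) where

    private
      s Px : List (List Carrier)
      s  = FXY.derivative P
      Px = map FX.derivative P

      -- s times the derivative along the curve, since s y′ = - Px there.
      along : List (List Carrier) → List (List Carrier)
      along f = s P.* map FX.derivative f P.- Px P.* FXY.derivative f

    -- On the curve, denominator j times the j-th jet coordinate is numerator j.
    denominator numerator : ℕ → List (List Carrier)
    denominator zero          = P.1#
    denominator (suc zero)    = P.1#
    denominator (suc (suc l)) = s P.* (denominator (suc l) P.* denominator (suc l))
    numerator zero            = FX.X ∷ []
    numerator (suc zero)      = FXY.X
    numerator (suc (suc l))   =
      denominator (suc l) P.* along (numerator (suc l)) P.- along (denominator (suc l)) P.* numerator (suc l)

    -- Horner's scheme with a fraction w/d for the last variable, multiplied by d^n, where n is the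
    -- number of coefficients: the coefficient of index j receives w^j d^(n - j). `cleared` collects
    -- the factors by which the value has been multiplied.
    clear : ∀ m → Box m → List (List Carrier)
    clear-poly : ∀ m {n} → (Fin n → Box m) → List (List Carrier)
    clear zero    c = (c ∷ []) ∷ []
    clear (suc m) Q = clear-poly m Q
    clear-poly m {zero}  Q = P.0#
    clear-poly m {suc n} Q = power FXY.ring[X] (denominator m) (suc n) P.* clear m (Q zero)
                             P.+ numerator m P.* clear-poly m (λ j → Q (suc j))

    cleared : ℕ → List (List Carrier)
    cleared-poly : ℕ → ℕ → List (List Carrier)
    cleared-poly m n = power FXY.ring[X] (denominator m) n P.* cleared m
    cleared zero    = P.1#
    cleared (suc m) = cleared-poly m e

    module _ {D} (P∈ : Fil D P) where
      private
        along-∈ : ∀ {b} f → Fil b f → Fil (D ℕ.+ b) (along f)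
        along-∈ f f∈ = +-∈ {a = s P.* map FX.derivative f} (*-∈ {a = s} (∂y-∈ P P∈) (∂x-∈ f f∈))
          (neg-∈ {a = Px P.* FXY.derivative f} (*-∈ {a = Px} (∂x-∈ P P∈) (∂y-∈ f f∈)))

      denominator-∈ : ∀ j → Fil (jet-degree D j) (denominator j)
      denominator-∈ zero          = mono {a = P.1#} z≤n one∈
      denominator-∈ (suc zero)    = mono {a = P.1#} z≤n one∈
      denominator-∈ (suc (suc l)) = *-∈ {a = s} (∂y-∈ P P∈) (*-∈ {a = d} {b = d} (denominator-∈ (suc l)) (denominator-∈ (suc l)))
        where d = denominator (suc l)

      numerator-∈ : ∀ j → Fil (jet-degree D j) (numerator j)
      numerator-∈ zero          = (λ { zero (suc (suc m)) _ → refl ; zero (suc zero) (s≤s ()) ; (suc j) m _ → refl }) ,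
                                  λ { (suc j) _ → CommutativeRing.refl FX.ring[X] }
      numerator-∈ (suc zero)    = (λ { zero m _ → refl ; (suc zero) (suc m) _ → refl ; (suc (suc j)) m _ → refl }) ,
                                  λ { (suc (suc j)) _ → CommutativeRing.refl FX.ring[X] ; (suc zero) (s≤s ()) }
      numerator-∈ (suc (suc l)) = +-∈ {a = d P.* along w}
        (≡.subst (λ i → Fil i (d P.* along w)) swap (*-∈ {a = d} {b = along w} (denominator-∈ (suc l)) (along-∈ w (numerator-∈ (suc l)))))
        (neg-∈ {a = along d P.* w} (≡.subst (λ i → Fil i (along d P.* w)) (ℕ.+-assoc D _ _)
          (*-∈ {a = along d} {b = w} (along-∈ d (denominator-∈ (suc l))) (numerator-∈ (suc l)))))
        where
        d = denominator (suc l)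
        w = numerator (suc l)
        b = jet-degree D (suc l)
        swap : b ℕ.+ (D ℕ.+ b) ≡.≡ D ℕ.+ (b ℕ.+ b)
        swap = +-*-Solver.solve 2 (λ b D → b +-*-Solver.:+ (D +-*-Solver.:+ b) +-*-Solver.:= D +-*-Solver.:+ (b +-*-Solver.:+ b)) ≡.refl b D

      clear-∈ : ∀ m Q → Fil (e ℕ.* box-degree D m) (clear m Q)
      clear-poly-∈ : ∀ m {n} (Q : Fin n → Box m) → Fil (e ℕ.* box-degree D m ℕ.+ n ℕ.* jet-degree D m) (clear-poly m Q)
      clear-∈ zero    c = (λ { zero (suc m) _ → refl ; (suc j) m _ → refl }) , λ { (suc j) _ → CommutativeRing.refl FX.ring[X] }
      clear-∈ (suc m) Q = ≡.subst (λ i → Fil i (clear-poly m Q)) (≡.sym (ℕ.*-distribˡ-+ e (box-degree D m) (jet-degree D m))) (clear-poly-∈ m Q)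
      clear-poly-∈ m {zero}  Q = zero∈
      clear-poly-∈ m {suc n} Q = +-∈ {a = power FXY.ring[X] d (suc n) P.* clear m (Q zero)}
        (≡.subst (λ i → Fil i (power FXY.ring[X] d (suc n) P.* clear m (Q zero))) (ℕ.+-comm (suc n ℕ.* b) g)
          (*-∈ {a = power FXY.ring[X] d (suc n)} {b = clear m (Q zero)} (power-∈ (suc n) {d} (denominator-∈ m)) (clear-∈ m (Q zero))))
        (≡.subst (λ i → Fil i (w P.* clear-poly m (λ j → Q (suc j)))) swap
          (*-∈ {a = w} {b = clear-poly m (λ j → Q (suc j))} (numerator-∈ m) (clear-poly-∈ m (λ j → Q (suc j)))))
        where
        d = denominator m
        w = numerator m
        b = jet-degree D m
        g = e ℕ.* box-degree D m
        swap : b ℕ.+ (g ℕ.+ n ℕ.* b) ≡.≡ g ℕ.+ (b ℕ.+ n ℕ.* b)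
        swap = +-*-Solver.solve 3 (λ b g c → b +-*-Solver.:+ (g +-*-Solver.:+ c) +-*-Solver.:= g +-*-Solver.:+ (b +-*-Solver.:+ c)) ≡.refl b g (n ℕ.* b)

    module _ (a : Carrier) (Y : Series) (root : atXY (coordinate a) Y ⟪ P ⟫ ≈ˢ H.0#)
             (Py≉0 : ¬ point a (Y 0) ⟪ FXY.derivative P ⟫ ≈ 0#) where
      private
        X = coordinate a
        φ : Hom FXY.ring[X] series
        φ = atXY X Y
        v : ℕ → Series
        v = jet X Y

        -- Implicit differentiation of P(x, y(x)) = 0.
        slope : φ ⟪ s ⟫ ⊠ tail Y ≈ˢ H.- φ ⟪ Px ⟫
        slope = H.trans (HS.solve 2 (λ p q → q HS.:= (p HS.:* HS.:# 1 HS.:+ q) HS.:- p) H.refl (φ ⟪ Px ⟫) (φ ⟪ s ⟫ ⊠ tail Y))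
          (H.trans (H.+-congʳ {H.- φ ⟪ Px ⟫} (H.trans (H.+-congʳ {φ ⟪ s ⟫ ⊠ tail Y}
              (H.*-congˡ {φ ⟪ Px ⟫} (H.sym (tail-coordinate a))))
            (H.trans (H.sym (tail-atXY X Y P)) (mk≈ λ n → root .at (suc n)))))
          (H.+-identityˡ _))

        along-tail : ∀ f → φ ⟪ along f ⟫ ≈ˢ φ ⟪ s ⟫ ⊠ tail (φ ⟪ f ⟫)
        along-tail f = begin
          φ ⟪ along f ⟫
            ≈⟨ H.trans (Hom.sub-homo φ (s P.* map FX.derivative f) (Px P.* FXY.derivative f))
                 (H.+-cong (Hom.*-homo φ s (map FX.derivative f)) (H.-‿cong (Hom.*-homo φ Px (FXY.derivative f)))) ⟩
          S ⊠ fx H.- px ⊠ fy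
            ≈⟨ HS.solve 4 (λ S fx p fy → S HS.:* fx HS.:- p HS.:* fy HS.:= S HS.:* fx HS.:+ fy HS.:* (HS.:- p)) H.refl S fx px fy ⟩
          S ⊠ fx ⊞ fy ⊠ (H.- px)
            ≈⟨ H.+-congˡ {S ⊠ fx} (H.*-congˡ {fy} slope) ⟨
          S ⊠ fx ⊞ fy ⊠ (S ⊠ tail Y)
            ≈⟨ HS.solve 4 (λ S fx fy y → S HS.:* fx HS.:+ fy HS.:* (S HS.:* y) HS.:= S HS.:* (fx HS.:* HS.:# 1 HS.:+ fy HS.:* y)) H.refl S fx fy (tail Y) ⟩
          S ⊠ (fx ⊠ H.1# ⊞ fy ⊠ tail Y)
            ≈⟨ H.*-congˡ {S} (H.trans (tail-atXY X Y f) (H.+-congʳ {fy ⊠ tail Y} (H.*-congˡ {fx} (tail-coordinate a)))) ⟨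
          S ⊠ tail (φ ⟪ f ⟫) ∎
          where
          open Relation.Binary.Reasoning.Setoid H.setoid
          S  = φ ⟪ s ⟫
          fx = φ ⟪ map FX.derivative f ⟫
          fy = φ ⟪ FXY.derivative f ⟫
          px = φ ⟪ Px ⟫

      -- The quotient rule in the form S d² V′ = d · S (d V)′ - S d′ · d V. By induction d V is the
      -- image of a polynomial, and by `along-tail` so is S times the derivative of such an image.
      numerator-eq : ∀ j → φ ⟪ denominator j ⟫ ⊠ v j ≈ˢ φ ⟪ numerator j ⟫
      numerator-eq zero          = H.trans (H.*-congʳ {X} (Hom.1-homo φ)) (H.trans (H.*-identityˡ X) (H.sym (H.trans
        (Evaluation.eval-const series (atX X ⟪ FX.X ⟫) Y)
        (H.trans (H.+-congʳ {X ⊠ (ι 1# ⊞ X ⊠ H.0#)} (Hom.0-homo ιHom)) (Evaluation.eval-X series X)))))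
      numerator-eq (suc zero)    = H.trans (H.*-congʳ {Y} (Hom.1-homo φ)) (H.trans (H.*-identityˡ Y) (H.sym
        (H.trans (H.+-congˡ {atX X ⟪ [] ⟫} (H.*-congˡ {Y} (H.+-congʳ {Y ⊠ H.0#} (Hom.1-homo (atX X))))) (Evaluation.eval-X series Y))))
      numerator-eq (suc (suc l)) = begin
        φ ⟪ denominator (suc (suc l)) ⟫ ⊠ tail V
          ≈⟨ H.*-congʳ {tail V} (H.trans (Hom.*-homo φ s (den P.* den)) (H.*-congˡ {S} (Hom.*-homo φ den den))) ⟩
        S ⊠ (d ⊠ d) ⊠ tail V
          ≈⟨ HS.solve 5 (λ S d d′ V V′ → S HS.:* (d HS.:* d) HS.:* V′
               HS.:= d HS.:* (S HS.:* (d′ HS.:* V HS.:+ d HS.:* V′)) HS.:- S HS.:* d′ HS.:* (d HS.:* V)) H.refl S d (tail d) V (tail V) ⟩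
        d ⊠ (S ⊠ tail (d ⊠ V)) H.- S ⊠ tail d ⊠ (d ⊠ V)
          ≈⟨ H.+-cong (H.*-congˡ {d} (H.*-congˡ {S} (mk≈ λ n → numerator-eq (suc l) .at (suc n))))
               (H.-‿cong (H.*-congˡ {S ⊠ tail d} (numerator-eq (suc l)))) ⟩
        d ⊠ (S ⊠ tail (φ ⟪ w ⟫)) H.- S ⊠ tail d ⊠ φ ⟪ w ⟫
          ≈⟨ H.+-cong (H.*-congˡ {d} (along-tail w)) (H.-‿cong (H.*-congʳ {φ ⟪ w ⟫} (along-tail (denominator (suc l))))) ⟨
        d ⊠ φ ⟪ along w ⟫ H.- φ ⟪ along (denominator (suc l)) ⟫ ⊠ φ ⟪ w ⟫
          ≈⟨ H.trans (Hom.sub-homo φ (denominator (suc l) P.* along w) (along (denominator (suc l)) P.* w))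
               (H.+-cong (Hom.*-homo φ den (along w)) (H.-‿cong (Hom.*-homo φ (along den) w))) ⟨
        φ ⟪ numerator (suc (suc l)) ⟫ ∎
        where
        open Relation.Binary.Reasoning.Setoid H.setoid
        S = φ ⟪ s ⟫
        den = denominator (suc l)
        d = φ ⟪ den ⟫
        w = numerator (suc l)
        V = v (suc l)

      clear-eq : ∀ m Q → φ ⟪ clear m Q ⟫ ≈ˢ φ ⟪ cleared m ⟫ ⊠ BH.at-box m Q v
      clear-poly-eq : ∀ m {n} (Q : Fin n → Box m) → φ ⟪ clear-poly m Q ⟫ ≈ˢ φ ⟪ cleared-poly m n ⟫ ⊠ BH.at-poly m Q v
      clear-eq zero    c = H.trans (Evaluation.eval-const series (atX X ⟪ c ∷ [] ⟫) Y) (H.trans (Evaluation.eval-const series (ι c) X)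
        (H.trans (H.sym (H.*-identityˡ (ι c))) (H.*-congʳ {ι c} (H.sym (Hom.1-homo φ)))))
      clear-eq (suc m) Q = clear-poly-eq m Q
      clear-poly-eq m {zero}  Q = H.sym (H.zeroʳ _)
      clear-poly-eq m {suc n} Q = begin
        φ ⟪ clear-poly m Q ⟫
          ≈⟨ H.trans (Hom.+-homo φ (dd P.* clear m (Q zero)) (numerator m P.* clear-poly m (λ j → Q (suc j)))) (H.+-cong (H.trans (Hom.*-homo φ dd (clear m (Q zero))) (H.*-cong (Hom.*-homo φ d dn) (clear-eq m (Q zero))))
               (H.trans (Hom.*-homo φ (numerator m) (clear-poly m (λ j → Q (suc j)))) (H.*-cong (H.sym (numerator-eq m)) (H.trans (clear-poly-eq m (λ j → Q (suc j)))
                 (H.*-congʳ {es} (Hom.*-homo φ dn (cleared m))))))) ⟩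
        φ ⟪ d ⟫ ⊠ φ ⟪ dn ⟫ ⊠ (σ ⊠ q) ⊞ φ ⟪ d ⟫ ⊠ v m ⊠ (φ ⟪ dn ⟫ ⊠ σ ⊠ es)
          ≈⟨ HS.solve 6 (λ d dn σ q V es → d HS.:* dn HS.:* (σ HS.:* q) HS.:+ d HS.:* V HS.:* (dn HS.:* σ HS.:* es)
               HS.:= d HS.:* dn HS.:* σ HS.:* (q HS.:+ V HS.:* es)) H.refl (φ ⟪ d ⟫) (φ ⟪ dn ⟫) σ q (v m) es ⟩
        φ ⟪ d ⟫ ⊠ φ ⟪ dn ⟫ ⊠ σ ⊠ (q ⊞ v m ⊠ es)
          ≈⟨ H.*-congʳ {q ⊞ v m ⊠ es} (H.trans (Hom.*-homo φ dd (cleared m)) (H.*-congʳ {σ} (Hom.*-homo φ d dn))) ⟨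
        φ ⟪ cleared-poly m (suc n) ⟫ ⊠ (q ⊞ v m ⊠ es) ∎
        where
        open Relation.Binary.Reasoning.Setoid H.setoid
        d  = denominator m
        dn = power FXY.ring[X] d n
        dd = power FXY.ring[X] d (suc n)
        σ  = φ ⟪ cleared m ⟫
        q  = BH.at-box m (Q zero) v
        es = BH.at-poly m (λ j → Q (suc j)) v

      private
        at₀ : Hom FXY.ring[X] cring
        at₀ = at-0 ∘H φ

        s≉0 : ¬ at₀ ⟪ s ⟫ ≈ 0#
        s≉0 z = Py≉0 (trans (sym (atXY-0 X Y s)) z)

        1≉0′ : ¬ at₀ ⟪ P.1# ⟫ ≈ 0#
        1≉0′ z = 1≉0 (trans (sym (Hom.1-homo at₀)) z)

        product≉0 : ∀ {f g} → ¬ at₀ ⟪ f ⟫ ≈ 0# → ¬ at₀ ⟪ g ⟫ ≈ 0# → ¬ at₀ ⟪ f P.* g ⟫ ≈ 0#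
        product≉0 {f} {g} f≉0 g≉0 z = FD.*-nonzero f≉0 g≉0 (trans (sym (Hom.*-homo at₀ f g)) z)

        denominator≉0 : ∀ j → ¬ at₀ ⟪ denominator j ⟫ ≈ 0#
        denominator≉0 zero          = 1≉0′
        denominator≉0 (suc zero)    = 1≉0′
        denominator≉0 (suc (suc l)) = product≉0 {s} s≉0 (product≉0 {d} {d} (denominator≉0 (suc l)) (denominator≉0 (suc l)))
          where d = denominator (suc l)

        power≉0 : ∀ n {f} → ¬ at₀ ⟪ f ⟫ ≈ 0# → ¬ at₀ ⟪ power FXY.ring[X] f n ⟫ ≈ 0#
        power≉0 zero    f≉0 = 1≉0′
        power≉0 (suc n) {f} f≉0 = product≉0 {f} {power FXY.ring[X] f n} f≉0 (power≉0 n {f} f≉0)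

        cleared≉0 : ∀ m → ¬ at₀ ⟪ cleared m ⟫ ≈ 0#
        cleared-poly≉0 : ∀ m n → ¬ at₀ ⟪ cleared-poly m n ⟫ ≈ 0#
        cleared≉0 zero    = 1≉0′
        cleared≉0 (suc m) = cleared-poly≉0 m e
        cleared-poly≉0 m n = product≉0 {power FXY.ring[X] (denominator m) n} {cleared m} (power≉0 n {denominator m} (denominator≉0 m)) (cleared≉0 m)

      at-poly-0 : ∀ m {n} (Q : Fin n → Box m) → BH.at-poly m Q v 0 ≈ BF.at-poly m Q (λ j → v j 0)
      at-poly-0 m Q = at-poly-natural ιHom at-0 idHom (λ _ → refl) m Q v

      clear-root : ∀ m {n} (Q : Fin n → Box m) → BF.at-poly m Q (λ j → v j 0) ≈ 0# → point a (Y 0) ⟪ clear-poly m Q ⟫ ≈ 0#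
      clear-root m {n} Q z = trans (sym (atXY-0 X Y (clear-poly m Q))) (trans (clear-poly-eq m Q .at 0)
        (trans (*-congˡ (trans (at-poly-0 m Q) z)) (zeroʳ _)))

      -- The factor `cleared-poly` is a product of powers of ∂P/∂y, which is nonzero at the point,
      -- so it is a unit among series.
      clear-zero : ∀ m {n} (Q : Fin n → Box m) → φ ⟪ clear-poly m Q ⟫ ≈ˢ H.0# → BH.at-poly m Q v ≈ˢ H.0#
      clear-zero m {n} Q z .at i = unit-cancel (suc i) {φ ⟪ cleared-poly m n ⟫} {BH.at-poly m Q v} (cleared-poly≉0 m n)
        (≈ˢ⇒≈< (H.trans (H.*-comm (BH.at-poly m Q v) _) (H.trans (H.sym (clear-poly-eq m Q)) z))) .below i ℕ.≤-refl

first-failure : ExcludedMiddle 0ℓ → (A : ℕ → Set) → ¬ (∀ n → A n) → ∃ λ v → ¬ A v × ∀ i → i ℕ.< v → A i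
first-failure em A ¬∀ with em {∃ λ n → ¬ A n}
... | no none = ⊥-elim (¬∀ λ n → stable n em)
  where
  stable : ∀ n → Dec (A n) → A n
  stable n (yes a) = a
  stable n (no ¬a) = ⊥-elim (none (n , ¬a))
... | yes (n , ¬a) = search n n ℕ.≤-refl ¬a
  where
  search : ∀ N n → n ℕ.≤ N → ¬ A n → ∃ λ v → ¬ A v × ∀ i → i ℕ.< v → A i
  search N n n≤N ¬a with em {∃ λ m → m ℕ.< n × ¬ A m}
  search N n n≤N ¬a | no none = n , ¬a , λ i i<n → stable i i<n em
    where
    stable : ∀ i → i ℕ.< n → Dec (A i) → A i
    stable i i<n (yes a) = a
    stable i i<n (no ¬a) = ⊥-elim (none (i , i<n , ¬a))
  search zero    n n≤N ¬a | yes (m , m<n , ¬am) = ⊥-elim (ℕ.n≮0 (ℕ.≤-trans m<n n≤N))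
  search (suc N) n n≤N ¬a | yes (m , m<n , ¬am) = search N m (ℕ.s≤s⁻¹ (ℕ.≤-trans m<n n≤N)) ¬am

-- The vanishing argument

module Core (em : ExcludedMiddle 0ℓ) (𝔽 : Field) (e D k : ℕ) (1≤e : 1 ℕ.≤ e) (1≤D : 1 ℕ.≤ D) where
  open Field 𝔽
  open CommutativeRing cring hiding (zero)
  open Gauss em 𝔽 using (module FX; [_])
  open Resultants em 𝔽
  open SeriesOverField em 𝔽
  open Boxes 𝔽 e
  open BoundedDegree cring
  open Numerators em 𝔽 e
  private
    module F where
      open Poly cring public
      open WithEM.OverDomain em (WithEM.fieldDomain em 𝔽) public
    module C   = CommutativeRing F.ring[X]
    module P   = CommutativeRing FX.ring[X]
    module H   = CommutativeRing series
    module PH  = Poly series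
    module EH  = Evaluation series
    module EF  = Evaluation cring
    module FD  = Domain (WithEM.fieldDomain em 𝔽)
    module BH  = Evaluate ιHom
    module BF  = Evaluate (idHom {cring})
    module TH  = TabulatedPolynomials series

  Bivariate : Set
  Bivariate = List (List Carrier)

  Associated : Bivariate → Bivariate → Set
  Associated f g = ∃ λ w → Unit FX.ring[X] w × g P.≈ w P.* f

  record Regular (f : Bivariate) (x y : Carrier) : Set where
    field
      root : point x y ⟪ f ⟫ ≈ 0#
      ∂y≉0 : ¬ point x y ⟪ FX.derivative f ⟫ ≈ 0#

  branch : ∀ {f x y} → Regular f x y → Series
  branch {f} {x} {y} reg = Implicit.branch f x y (Regular.root reg) (Regular.∂y≉0 reg)

  branch-root : ∀ {f x y} (reg : Regular f x y) → atXY (coordinate x) (branch reg) ⟪ f ⟫ ≈ˢ H.0#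
  branch-root {f} {x} {y} reg = Implicit.branch-root f x y (Regular.root reg) (Regular.∂y≉0 reg)

  -- The degree bound of `multiple-or-elimination` for a polynomial in all k + 2 jet coordinates
  -- with denominators cleared. Being linear in `e`, it serves as `M`.
  bezout-bound : ℕ
  bezout-bound = suc (2 ℕ.* D) ℕ.^ suc D ℕ.* (e ℕ.* box-degree D (suc (suc k)))

  module _ (f : Bivariate) (irr : Irreducibleᴿ FX.ring[X] f) (f∈ : Fil D f) where
    private
      constant-derivative : ∀ p → (∀ m → 1 ℕ.≤ m → FX.coeff p m C.≈ C.0#) → FX.derivative p P.≈ P.0#
      constant-derivative []      _  = P.refl
      constant-derivative (a ∷ p) p< = FX.mk≋ λ m → C.trans (FX.coeff-⊕ p (C.0# ∷ FX.derivative p) m)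
        (C.trans (C.+-cong (p< (suc m) (s≤s z≤n)) (rest m)) (C.+-identityˡ C.0#))
        where
        rest : ∀ m → FX.coeff (C.0# ∷ FX.derivative p) m C.≈ C.0#
        rest zero    = C.refl
        rest (suc m) = vanishing-derivative F.ring[X] 0 p (λ i _ → p< (suc i) (s≤s z≤n)) m z≤n

    -- An equation free of y would have zero derivative in y, against regularity.
    degree-y : ∀ {x y} → Regular f x y → ∃ λ d → FX.HasDegree d f × 1 ℕ.≤ d × d ℕ.≤ D
    degree-y {x} {y} reg with FX.degree f f≉0
      where
      f≉0 : ¬ f P.≈ P.0#
      f≉0 z = Regular.∂y≉0 reg (trans (Hom.cong (point x y) (constant-derivative f (λ m _ → z .FX.at m))) (Hom.0-homo (point x y)))
    ... | zero  , h = ⊥-elim (Regular.∂y≉0 reg (trans (Hom.cong (point x y) (constant-derivative f (FX.above h))) (Hom.0-homo (point x y))))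
    ... | suc d , h = suc d , h , s≤s z≤n , FX.HasDegree⇒≤ h (proj₂ f∈)

    private
      [-]-at : ∀ X Y r → atXY X Y ⟪ [ r ] ⟫ ≈ˢ atX X ⟪ r ⟫
      [-]-at X Y r = EH.eval-const (atX X ⟪ r ⟫) Y

      combination : ∀ {A B} (φ : Hom A B) u a v b → CommutativeRing._≈_ B (φ ⟪ a ⟫) (CommutativeRing.0# B) →
        CommutativeRing._≈_ B (φ ⟪ b ⟫) (CommutativeRing.0# B) →
        CommutativeRing._≈_ B (φ ⟪ CommutativeRing._+_ A (CommutativeRing._*_ A u a) (CommutativeRing._*_ A v b) ⟫) (CommutativeRing.0# B)
      combination {A} {B} φ u a v b a≈0 b≈0 = B.trans (Hom.+-homo φ _ _) (B.trans (B.+-cong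
        (B.trans (Hom.*-homo φ u a) (B.trans (B.*-congˡ a≈0) (B.zeroʳ _)))
        (B.trans (Hom.*-homo φ v b) (B.trans (B.*-congˡ b≈0) (B.zeroʳ _)))) (B.+-identityˡ _))
        where module B = CommutativeRing B

      multiple-vanishes : ∀ {d} (hf : FX.HasDegree d f) (d≤D : d ℕ.≤ D) G → Multiple irr hf (proj₁ f∈) d≤D G →
        ∀ {x y} (reg : Regular f x y) → atXY (coordinate x) (branch reg) ⟪ G ⟫ ≈ˢ H.0#
      multiple-vanishes hf d≤D G mult {x} reg = from (F.degree c c≉0)
        where
        open Multiple mult
        X = coordinate x
        Y = branch reg
        φ = atXY X Y
        from : ∃ (λ t → F.HasDegree t c) → φ ⟪ G ⟫ ≈ˢ H.0#
        from (t , h) = polynomial-cancel t x c (φ ⟪ G ⟫) c≉0 (F.above h)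
          (H.trans (H.*-congʳ {φ ⟪ G ⟫} (H.sym ([-]-at X Y c))) (H.trans (H.sym (Hom.*-homo φ [ c ] G))
            (H.trans (Hom.cong φ c*G≈) (H.trans (Hom.*-homo φ q f) (H.trans (H.*-congˡ {φ ⟪ q ⟫} (branch-root reg)) (H.zeroʳ _))))))

    -- Elimination would give a nonzero polynomial in x of degree at most `bezout-bound` that
    -- vanishes at one more abscissa than that. So some `c G` is a multiple of `f`, with `c` in x
    -- alone, and `c` can be cancelled along the branch.
    bezout : ∀ G (pts : Fin (suc bezout-bound) → Carrier × Carrier) →
      (∀ {a b} → proj₁ (pts a) ≈ proj₁ (pts b) → a ≡.≡ b) →
      (∀ a → Regular f (proj₁ (pts a)) (proj₂ (pts a))) →
      (∀ a → point (proj₁ (pts a)) (proj₂ (pts a)) ⟪ G ⟫ ≈ 0#) →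
      Fil (e ℕ.* box-degree D (suc (suc k))) G →
      ∀ {x y} (reg : Regular f x y) → atXY (coordinate x) (branch reg) ⟪ G ⟫ ≈ˢ H.0#
    bezout G pts distinct regular roots G∈ {x} {y} reg = from (degree-y reg)
      where
      1≤g : 1 ℕ.≤ e ℕ.* box-degree D (suc (suc k))
      1≤g = ℕ.*-mono-≤ 1≤e (positive k)
        where
        positive : ∀ k → 1 ℕ.≤ box-degree D (suc (suc k))
        positive zero    = s≤s z≤n
        positive (suc k) = ℕ.≤-trans (positive k) (ℕ.m≤m+n _ _)
      from : ∃ (λ d → FX.HasDegree d f × 1 ℕ.≤ d × d ℕ.≤ D) → atXY (coordinate x) (branch reg) ⟪ G ⟫ ≈ˢ H.0#
      from (d , hf , 1≤d , d≤D) = by-cases (multiple-or-elimination irr hf (proj₁ f∈) d≤D G 1≤g (proj₁ G∈) (proj₂ G∈))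
        where
        by-cases : Multiple irr hf (proj₁ f∈) d≤D G ⊎ Elimination f G bezout-bound → atXY (coordinate x) (branch reg) ⟪ G ⟫ ≈ˢ H.0#
        by-cases (inj₁ mult) = multiple-vanishes hf d≤D G mult reg
        by-cases (inj₂ el) = ⊥-elim (ℕ.<-irrefl ≡.refl (roots-bound r (λ a → proj₁ (pts a)) distinct r≉0 r≤e λ a →
            let x = proj₁ (pts a) ; y = proj₂ (pts a) in
            trans (sym (EF.eval-const (F.eval r x) y)) (trans (Hom.cong (point x y) bezout′)
              (combination (point x y) u f v G (Regular.root (regular a)) (roots a)))))
          where open Elimination el renaming (bezout to bezout′)

    -- On a common branch both equations vanish, and with them every eliminant; but a nonzero
    -- polynomial in x has a nonzero expansion. The other outcome of elimination makes the two
    -- irreducible equations associated.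
    branches-differ : ∀ {g x y} → Irreducibleᴿ FX.ring[X] g → Fil D g → ¬ Associated f g →
      (reg : Regular f x y) (reg′ : Regular g x y) → ¬ branch reg ≈ˢ branch reg′
    branches-differ {g} {x} {y} irrg g∈ ¬assoc reg reg′ eq = from (degree-y reg)
      where
      from : ¬ ∃ (λ d → FX.HasDegree d f × 1 ℕ.≤ d × d ℕ.≤ D)
      from (d , hf , 1≤d , d≤D) = by-cases (multiple-or-elimination irr hf (proj₁ f∈) d≤D g 1≤D (proj₁ g∈) (proj₂ g∈))
        where
        by-cases : ¬ (Multiple irr hf (proj₁ f∈) d≤D g ⊎ Elimination f g (suc (2 ℕ.* D) ℕ.^ suc D ℕ.* D))
        by-cases (inj₁ mult) = ¬assoc (multiple⇒associated irr hf (proj₁ f∈) d≤D irrg 1≤d mult)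
        by-cases (inj₂ el) = polynomial-nonzero _ x r r≉0 r≤e (H.trans (H.sym ([-]-at X Y r)) (H.trans (Hom.cong (atXY X Y) bezout′)
            (combination (atXY X Y) u f v g (branch-root reg)
              (H.trans (evalHom-cong (atX X) eq g) (branch-root reg′)))))
          where
          open Elimination el renaming (bezout to bezout′)
          X = coordinate x
          Y = branch reg

  private
    at-box-cong< : ∀ {n} m Q {v v′ : ℕ → Series} → (∀ j → j ℕ.< m → v j ≈[ n ] v′ j) → BH.at-box m Q v ≈[ n ] BH.at-box m Q v′
    eval-tabulate-cong< : ∀ {n l} {f g : Fin l → Series} {z w} → (∀ j → f j ≈[ n ] g j) → z ≈[ n ] w →
      PH.eval (tabulate f) z ≈[ n ] PH.eval (tabulate g) w
    eval-tabulate-cong< {l = zero}  eq eqz = mk≈< λ _ _ → refl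
    eval-tabulate-cong< {l = suc l} eq eqz = ⊞-cong< (eq zero) (⊠-cong< eqz (eval-tabulate-cong< (λ j → eq (suc j)) eqz))
    at-box-cong< zero    c eq = mk≈< λ _ _ → refl
    at-box-cong< (suc m) Q eq = eval-tabulate-cong< (λ j → at-box-cong< m (Q j) (λ i i<m → eq i (ℕ.m≤n⇒m≤1+n i<m))) (eq m ℕ.≤-refl)

    jet-entry : ∀ X Y l n → jet X Y (suc l) n ≡.≡ Y (l ℕ.+ n)
    jet-entry X Y zero    n = ≡.refl
    jet-entry X Y (suc l) n = ≡.trans (jet-entry X Y l (suc n)) (≡.cong Y (ℕ.+-suc l n))

    box-degree-mono : ∀ {m n} → m ℕ.≤ n → box-degree D m ℕ.≤ box-degree D n
    box-degree-mono {n = zero}  z≤n = z≤n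
    box-degree-mono {m} {suc n} m≤1+n with ℕ.m≤n⇒m<n∨m≡n m≤1+n
    ... | inj₁ m<1+n  = ℕ.≤-trans (box-degree-mono (ℕ.s≤s⁻¹ m<1+n)) (ℕ.m≤m+n _ _)
    ... | inj₂ ≡.refl = ℕ.≤-refl

  -- If Q vanishes on the jets of two branches through a point which agree to order k but not to all
  -- orders, then comparing the first coefficients at which the two evaluations could differ shows
  -- that the derivative of Q in its last variable vanishes at the common jet.
  derivative-vanishes : ∀ {m n} X {Y Ỹ} (Q : Fin (suc n) → Box m) → m ℕ.≤ suc k → Y ≈[ suc k ] Ỹ → ¬ Y ≈ˢ Ỹ → tail X ≈ˢ H.1# →
    BH.at-poly m Q (jet X Y) ≈ˢ H.0# → BH.at-poly m Q (jet X Ỹ) ≈ˢ H.0# → BH.at-poly m (∂ m Q) (jet X Y) 0 ≈ 0#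
  -- With x as the only variable there is nothing to compare: `Q` vanishes identically along the
  -- branch, and the chain rule with x′ = 1 passes this on to its derivative.
  derivative-vanishes {zero} X {Y} Q _ _ _ tail-X vanish _ = trans (sym (*-identityʳ _))
    (trans (*-congˡ (sym (tail-X .at 0))) (trans (*-congʳ (sym (BH.at-poly-∂ 0 Q (jet X Y) .at 0)))
      (trans (sym (+-identityˡ _)) (trans (+-congʳ (sym (constants .at 0))) (trans (sym (tail-eval p X .at 0)) (vanish .at 1))))))
    where
    p = tabulate (λ j → ι (Q j))
    constants : PH.eval (map tail p) X ≈ˢ H.0#
    constants = H.trans (H.reflexive (≡.cong (λ q → PH.eval q X) (List.map-tabulate (λ j → ι (Q j)) tail)))
      (TH.eval-tabulate-zero {f = λ j → tail (ι (Q j))} X (λ j → mk≈ λ _ → refl))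
  derivative-vanishes {suc l} X {Y} {Ỹ} Q (s≤s l≤k) agree differ _ vanish vanish′ = compare (first-failure em (λ n → Y n ≈ Ỹ n) (λ eq → differ (mk≈ eq)))
    where
    m = suc l
    p = tabulate (λ j → BH.at-box m (Q j) (jet X Y))
    z z̃ : Series
    z = jet X Y m
    z̃ = jet X Ỹ m
    compare : ∃ (λ v → ¬ Y v ≈ Ỹ v × ∀ i → i ℕ.< v → Y i ≈ Ỹ i) → BH.at-poly m (∂ m Q) (jet X Y) 0 ≈ 0#
    compare (v₀ , differ₀ , agree₀) = [ (λ eq → ⊥-elim (z-differ eq)) , (λ eq → trans (sym dd-0) eq) ]′ (FD.*-zeros _ _ product)
      where
      k<v₀ : k ℕ.< v₀
      k<v₀ with suc k ℕ.≤? v₀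
      ... | yes p = p
      ... | no ¬p = ⊥-elim (differ₀ (agree .below v₀ (ℕ.≰⇒> ¬p)))
      -- The last jet coordinates first differ at this index, where all lower ones still agree. It
      -- is positive because `l` is at most `k`, so even the last coordinates have the same value at
      -- the point.
      v = v₀ ∸ l
      l≤v₀ : l ℕ.≤ v₀
      l≤v₀ = ℕ.≤-trans l≤k (ℕ.<⇒≤ k<v₀)
      l+v≡v₀ : l ℕ.+ v ≡.≡ v₀
      l+v≡v₀ = ℕ.m+[n∸m]≡n l≤v₀
      0<v : 0 ℕ.< v
      0<v = ℕ.m<n⇒0<n∸m (ℕ.≤-<-trans l≤k k<v₀)
      jets-agree : ∀ l′ n → l′ ℕ.+ n ℕ.< v₀ → jet X Y (suc l′) n ≈ jet X Ỹ (suc l′) n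
      jets-agree l′ n lt = trans (reflexive (jet-entry X Y l′ n)) (trans (agree₀ _ lt) (reflexive (≡.sym (jet-entry X Ỹ l′ n))))
      lower : ∀ j → j ℕ.< m → jet X Y j ≈[ suc v ] jet X Ỹ j
      lower zero     _                = mk≈< λ _ _ → refl
      lower (suc l′) (s≤s l′<l) .below n n≤v = jets-agree l′ n
        (≡.subst (l′ ℕ.+ n ℕ.<_) l+v≡v₀ (ℕ.+-mono-<-≤ l′<l (ℕ.s≤s⁻¹ n≤v)))
      z-agree : ∀ n → n ℕ.< v → z n ≈ z̃ n
      z-agree n n<v = jets-agree l n (≡.subst (l ℕ.+ n ℕ.<_) l+v≡v₀ (ℕ.+-monoʳ-< l n<v))
      entry : ∀ Y → jet X Y m v ≈ Y v₀
      entry Y = reflexive (≡.trans (jet-entry X Y l v) (≡.cong Y l+v≡v₀))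
      z-differ : ¬ (z H.- z̃) v ≈ 0#
      z-differ eq = differ₀ (trans (sym (entry Y)) (trans (Integers.solve cring 2 (λ a b → a S.:= (a S.:- b) S.:+ b) refl (z v) (z̃ v))
        (trans (+-congʳ eq) (trans (+-identityˡ _) (entry Ỹ)))))
        where module S = Integers cring
      equal-values : PH.eval p z ≈[ suc v ] PH.eval p z̃
      equal-values = ≈<-trans (≈ˢ⇒≈< (H.trans vanish (H.sym vanish′)))
        (≈<-sym (eval-tabulate-cong< (λ j → at-box-cong< m (Q j) lower) (mk≈< λ _ _ → refl)))
      -- The lower coordinates agree through index `v`, so up to there both evaluations may use the
      -- coefficients `p` of the first branch. Their difference is a product of two series whose
      -- entry `v` is this one term.
      product : (z H.- z̃) v * EH.dd p z z̃ 0 ≈ 0#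
      product = trans (sym (⊠-first v (EH.dd p z z̃) (difference< (mk≈< z-agree) .below)))
        (trans (sym (EH.dd-difference p z z̃ .at v)) (difference< equal-values .below v ℕ.≤-refl))
      dd-0 : EH.dd p z z̃ 0 ≈ BH.at-poly m (∂ m Q) (jet X Y) 0
      dd-0 = trans (dd-natural at-0 p z z̃) (trans (dd-diagonal-natural at-0 p refl (sym (z-agree 0 0<v)))
        (trans (sym (eval-natural at-0 (PH.derivative p) z)) (BH.at-poly-∂ m Q (jet X Y) .at 0)))

  record Tangent {f g : Bivariate} {x y} (reg : Regular f x y) : Set where
    field
      other : Regular g x y
      agree : branch reg ≈[ suc k ] branch other

  module _ {n : ℕ} (f : Fin n → Bivariate)
           (irr : ∀ i → Irreducibleᴿ FX.ring[X] (f i)) (f∈ : ∀ i → Fil D (f i))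
           (pts : Fin n → Fin (suc bezout-bound) → Carrier × Carrier)
           (distinct : ∀ i {a b} → proj₁ (pts i a) ≈ proj₁ (pts i b) → a ≡.≡ b)
           (regular : ∀ i a → Regular (f i) (proj₁ (pts i a)) (proj₂ (pts i a)))
           (tangent : ∀ i a → ∃ λ j → ¬ Associated (f i) (f j) × Tangent {f i} {f j} (regular i a)) where
    private
      jet-at : ∀ i a → ℕ → Carrier
      jet-at i a j = jet (coordinate (proj₁ (pts i a))) (branch (regular i a)) j 0

      Vanishes : ∀ m {l} → (Fin l → Box m) → Set
      Vanishes m Q = ∀ i a → BF.at-poly m Q (jet-at i a) ≈ 0#

      -- The regular point is arbitrary, as is necessary for the partner at a tangency: the tangency
      -- was chosen for one of the two curves and need not be among the points chosen for the other.
      vanishes-on-branches : ∀ m {l} (Q : Fin l → Box m) → l ℕ.≤ e → m ℕ.≤ suc k → Vanishes m Q →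
        ∀ i {x y} (reg : Regular (f i) x y) → BH.at-poly m Q (jet (coordinate x) (branch reg)) ≈ˢ H.0#
      vanishes-on-branches m {l} Q l≤e m≤1+k van i {x} {y} reg =
        clear-zero (f i) x (branch reg) (branch-root reg) (Regular.∂y≉0 reg) m Q
          (bezout (f i) (irr i) (f∈ i) (clear-poly (f i) m Q) (pts i) (distinct i) (regular i)
            (λ a → clear-root (f i) (proj₁ (pts i a)) (branch (regular i a)) (branch-root (regular i a)) (Regular.∂y≉0 (regular i a)) m Q (van i a))
            (mono {a = clear-poly (f i) m Q} bound (clear-poly-∈ (f i) (f∈ i) m Q)) reg)
        where
        bound : e ℕ.* box-degree D m ℕ.+ l ℕ.* jet-degree D m ℕ.≤ e ℕ.* box-degree D (suc (suc k))
        bound = ℕ.≤-trans (ℕ.+-monoʳ-≤ (e ℕ.* box-degree D m) (ℕ.*-monoˡ-≤ (jet-degree D m) l≤e))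
          (ℕ.≤-trans (ℕ.≤-reflexive (≡.sym (ℕ.*-distribˡ-+ e (box-degree D m) (jet-degree D m))))
            (ℕ.*-monoʳ-≤ e (box-degree-mono (s≤s m≤1+k))))

      step : ∀ m {l} (Q : Fin (suc l) → Box m) → suc l ℕ.≤ e → m ℕ.≤ suc k → Vanishes m Q → Vanishes m (∂ m Q)
      step m Q l≤e m≤1+k van i a with tangent i a
      ... | j , ¬assoc , tan = trans (sym (at-poly-0 (f i) x (branch reg) (branch-root reg) (Regular.∂y≉0 reg) m (∂ m Q)))
          (derivative-vanishes (coordinate x) Q m≤1+k agree
            (branches-differ (f i) (irr i) (f∈ i) (irr j) (f∈ j) ¬assoc reg other) (tail-coordinate x)
            (vanishes-on-branches m Q l≤e m≤1+k van i reg) (vanishes-on-branches m Q l≤e m≤1+k van j other))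
        where
        open Tangent tan
        x = proj₁ (pts i a)
        reg = regular i a

      -- By `step` the derivative of `Q` vanishes at the jets too; being shorter, it is zero by
      -- induction, and in characteristic 0 this kills every coefficient but the first. That one has
      -- one variable less and still vanishes at the jets.
      vanishing⇒zero : Fin n → ∀ m → m ℕ.≤ suc (suc k) → (Q : Box m) → (∀ i a → BF.at-box m Q (jet-at i a) ≈ 0#) → IsZero m Q
      vanishing⇒zero-poly : Fin n → ∀ m → m ℕ.≤ suc k → ∀ {l} → l ℕ.≤ e → (Q : Fin l → Box m) → Vanishes m Q → ∀ j → IsZero m (Q j)
      -- A constant is read off at a single jet, for which some curve must be given.
      vanishing⇒zero i₀ zero    _           c van = van i₀ zero
      vanishing⇒zero i₀ (suc m) (s≤s m≤1+k) Q van = vanishing⇒zero-poly i₀ m m≤1+k ℕ.≤-refl Q van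
      vanishing⇒zero-poly i₀ m m≤1+k {suc l} l≤e Q van = λ { zero → first ; (suc j) → others j }
        where
        others : ∀ j → IsZero m (Q (suc j))
        others j = scale-nonzero em (char-0 (Fin.toℕ j)) m (Q (suc j))
          (vanishing⇒zero-poly i₀ m m≤1+k (ℕ.<⇒≤ l≤e) (∂ m Q) (step m Q l≤e m≤1+k van) j)
        first : IsZero m (Q zero)
        first = vanishing⇒zero i₀ m (ℕ.m≤n⇒m≤1+n m≤1+k) (Q zero) λ i a → trans (trans (sym (+-identityʳ _)) (+-congˡ (sym
            (trans (*-congˡ (TabulatedPolynomials.eval-tabulate-zero cring (jet-at i a m) (λ j → BF.at-box-zero m (Q (suc j)) (jet-at i a) (others j)))) (zeroʳ _)))))
          (van i a)

    few-tangencies : Fin n → ¬ (n ℕ.* suc bezout-bound ℕ.< e ℕ.^ suc (suc k))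
    few-tangencies i₀ small with interpolate 𝔽 em e (suc (suc k)) (λ r → let i , a = remQuot (suc bezout-bound) r in jet-at i a) small
    ... | Q , Q≉0 , roots = Q≉0 (vanishing⇒zero i₀ (suc (suc k)) ℕ.≤-refl Q λ i a →
      ≡.subst (λ (i , a) → BF.at-box (suc (suc k)) Q (jet-at i a) ≈ 0#) (Fin.remQuot-combine i a) (roots (Fin.combine i a)))

-- Counting

module Counting (em : ExcludedMiddle 0ℓ) where
  open import Data.Nat.Base using (_+_; _*_; _≤_; _<_)
  open ≡ using (refl)

  indicator : ∀ {A : Set} → Dec A → ℕ
  indicator (yes _) = 1
  indicator (no _)  = 0

  cardinality : ∀ n → (Fin n → Set) → ℕ
  cardinality zero    A = 0
  cardinality (suc n) A = indicator (em {A zero}) + cardinality n (A ∘ suc)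

  count-tabulate : ∀ {B : Set} (A : B → Set) n (f : Fin n → B) →
    count (λ x → em {A x}) (Vec.tabulate f) ≡ cardinality n (A ∘ f)
  count-tabulate A zero    f = refl
  count-tabulate A (suc n) f with em {A (f zero)}
  ... | yes _ = ≡.cong suc (count-tabulate A n (f ∘ suc))
  ... | no _  = count-tabulate A n (f ∘ suc)

  count-allFin : ∀ n (A : Fin n → Set) → count (λ x → em {A x}) (allFin n) ≡ cardinality n A
  count-allFin n A = count-tabulate A n (λ i → i)

  indicator-mono : ∀ {A B : Set} → (A → B) → (a : Dec A) (b : Dec B) → indicator a ≤ indicator b
  indicator-mono f (yes a) (yes b) = s≤s z≤n
  indicator-mono f (yes a) (no ¬b) = ⊥-elim (¬b (f a))
  indicator-mono f (no _)  b       = z≤n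

  cardinality-mono : ∀ n {A B : Fin n → Set} → (∀ i → A i → B i) → cardinality n A ≤ cardinality n B
  cardinality-mono zero    A⊆B = z≤n
  cardinality-mono (suc n) A⊆B = ℕ.+-mono-≤ (indicator-mono (A⊆B zero) em em) (cardinality-mono n (λ i → A⊆B (suc i)))

  cardinality-but-one : ∀ n {A B : Fin n → Set} → (∀ i j → A i → ¬ B i → A j → ¬ B j → i ≡ j) →
    cardinality n A ≤ suc (cardinality n B)
  cardinality-but-one zero    unique = z≤n
  cardinality-but-one (suc n) {A} {B} unique = by-cases em em
    where
    rest : cardinality n (A ∘ suc) ≤ suc (cardinality n (B ∘ suc))
    rest = cardinality-but-one n λ i j ai bi aj bj → Fin.suc-injective (unique (suc i) (suc j) ai bi aj bj)
    by-cases : (a : Dec (A zero)) (b : Dec (B zero)) →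
      indicator a + cardinality n (A ∘ suc) ≤ suc (indicator b + cardinality n (B ∘ suc))
    by-cases (yes a) (yes b) = s≤s rest
    by-cases (no _)  b       = ℕ.≤-trans rest (s≤s (ℕ.m≤n+m _ (indicator b)))
    by-cases (yes a) (no ¬b) = s≤s (cardinality-mono n λ i ai → by-contradiction i ai em)
      where
      by-contradiction : ∀ i → A (suc i) → Dec (B (suc i)) → B (suc i)
      by-contradiction i ai (yes b) = b
      by-contradiction i ai (no ¬bi) with unique zero (suc i) a ¬b ai ¬bi
      ... | ()

  cardinality-punchIn : ∀ {n} (i : Fin (suc n)) (A : Fin (suc n) → Set) →
    cardinality (suc n) A ≡ indicator (em {A i}) + cardinality n (A ∘ punchIn i)
  cardinality-punchIn         zero    A = refl
  cardinality-punchIn {suc n} (suc i) A = ≡.trans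
    (≡.cong (indicator (em {A zero}) +_) (cardinality-punchIn i (A ∘ suc)))
    (+-*-Solver.solve 3 (λ a b c → a +-*-Solver.:+ (b +-*-Solver.:+ c) +-*-Solver.:= b +-*-Solver.:+ (a +-*-Solver.:+ c)) refl
      (indicator (em {A zero})) (indicator (em {A (suc i)})) (cardinality n (A ∘ suc ∘ punchIn i)))

  module _ {Pt : Set} where

    hits : (Pt → Set) → List Pt → ℕ
    hits A ps = sum (map (λ p → indicator (em {A p})) ps)

    -- The relation is left open because the chosen points will have to differ in their sheared
    -- abscissas.
    select : ∀ (_≈_ : Pt → Pt → Set) → (∀ {p q} → p ≈ q → q ≈ p) → ∀ A m ps → AllPairs (λ p q → ¬ p ≈ q) ps → m ≤ hits A ps →
      ∃ λ (f : Fin m → Pt) → (∀ a → A (f a)) × (∀ a → f a ∈ ps) × (∀ {a b} → f a ≈ f b → a ≡ b)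
    select _≈_ ≈-sym A zero    ps       u m≤ = (λ ()) , (λ ()) , (λ ()) , λ { {()} }
    select _≈_ ≈-sym A (suc m) (p ∷ ps) (p∉ ∷ u) m≤ with em {A p}
    ... | no _  = let f , af , f∈ , inj = select _≈_ ≈-sym A (suc m) ps u m≤ in f , af , (λ a → there (f∈ a)) , inj
    ... | yes a = let f , af , f∈ , inj = select _≈_ ≈-sym A m ps u (ℕ.s≤s⁻¹ m≤) in
      (λ { zero → p ; (suc i) → f i }) , (λ { zero → a ; (suc i) → af i }) , (λ { zero → here refl ; (suc i) → there (f∈ i) }) ,
      λ { {zero} {zero} _ → refl ; {zero} {suc j} eq → ⊥-elim (All.lookup p∉ (f∈ j) eq)
        ; {suc i} {zero} eq → ⊥-elim (All.lookup p∉ (f∈ i) (≈-sym eq)) ; {suc i} {suc j} eq → ≡.cong suc (inj eq) }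

    Touched : ∀ {N} → (Fin N → Fin N → Pt → Set) → ∀ {n} → (Fin n → Fin N) → Pt → Fin n → Set
    Touched T g p i = ∃ λ j → T (g i) (g j) p

    module _ {N : ℕ} (T : Fin N → Fin N → Pt → Set)
             (T-sym : ∀ {i j p} → T i j p → T j i p)
             (T-trans : ∀ {i j l p} → T i j p → T j l p → i ≢ l → T i l p) where

      private
        incidences : ∀ {n} → (Fin n → Fin N) → List Pt → ℕ
        incidences {n} g ps = sum (map (λ p → cardinality n (Touched T g p)) ps)

        remove-one : ∀ {n} (g : Fin (suc n) → Fin N) → (∀ {i j} → g i ≡ g j → i ≡ j) → ∀ i p →
          cardinality (suc n) (Touched T g p) ≤ 2 * indicator (em {Touched T g p i}) + cardinality n (Touched T (g ∘ punchIn i) p)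
        remove-one {n} g inj i p = ℕ.≤-trans (ℕ.≤-reflexive (cardinality-punchIn i (Touched T g p))) (by-cases em)
          where
          A B : Fin n → Set
          A = Touched T g p ∘ punchIn i
          B = Touched T (g ∘ punchIn i) p
          partner : ∀ x → A x → ¬ B x → T (g (punchIn i x)) (g i) p
          partner x (j , t) ¬b with i Fin.≟ j
          ... | yes refl = t
          ... | no i≢j   = ⊥-elim (¬b (punchOut i≢j , ≡.subst (λ j → T (g (punchIn i x)) (g j) p) (≡.sym (Fin.punchIn-punchOut i≢j)) t))
          unique : ∀ x y → A x → ¬ B x → A y → ¬ B y → x ≡ y
          unique x y ax ¬bx ay ¬by with x Fin.≟ y
          ... | yes x≡y = x≡y
          ... | no x≢y  = ⊥-elim (¬bx (y , T-trans (partner x ax ¬bx) (T-sym (partner y ay ¬by))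
                  (λ eq → x≢y (Fin.punchIn-injective i x y (inj eq)))))
          by-cases : (d : Dec (Touched T g p i)) → indicator d + cardinality n A ≤ 2 * indicator d + cardinality n B
          by-cases (yes _) = s≤s (cardinality-but-one n unique)
          by-cases (no ¬t) = cardinality-mono n λ x a → stable x a em
            where
            stable : ∀ x → A x → Dec (B x) → B x
            stable x a (yes b) = b
            stable x a (no ¬b) = ⊥-elim (¬t (punchIn i x , T-sym (partner x a ¬b)))

        sum-bound : ∀ (a b c : Pt → ℕ) → (∀ p → a p ≤ 2 * b p + c p) → ∀ ps → sum (map a ps) ≤ 2 * sum (map b ps) + sum (map c ps)
        sum-bound a b c le []       = z≤n
        sum-bound a b c le (p ∷ ps) = ℕ.≤-trans (ℕ.+-mono-≤ (le p) (sum-bound a b c le ps))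
          (ℕ.≤-reflexive (+-*-Solver.solve 4 (λ b c u v → con 2 :* b :+ c :+ (con 2 :* u :+ v) := con 2 :* (b :+ u) :+ (c :+ v)) refl
            (b p) (c p) (sum (map b ps)) (sum (map c ps))))
          where open +-*-Solver

      -- Removing a curve with at most M tangencies loses at most two incidences at each of them: its own,
      -- and that of a curve which it alone touched.  There is at most one such curve, by transitivity.
      incidences-bound : ∀ M ps → (∀ {n} (g : Fin (suc n) → Fin N) → (∀ {i j} → g i ≡ g j → i ≡ j) → suc n ≤ N →
          ∃ λ i → hits (λ p → Touched T g p i) ps ≤ M) →
        ∀ {n} (g : Fin n → Fin N) → (∀ {i j} → g i ≡ g j → i ≡ j) → n ≤ N → incidences g ps ≤ 2 * M * n
      incidences-bound M ps few {zero}  g inj n≤N = ℕ.≤-trans (ℕ.≤-reflexive (zeros ps)) z≤n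
        where
        zeros : ∀ ps → incidences g ps ≡ 0
        zeros []       = refl
        zeros (p ∷ ps) = zeros ps
      incidences-bound M ps few {suc n} g inj n≤N =
        let i , i≤M = few g inj n≤N in begin
        incidences g ps
          ≤⟨ sum-bound _ (λ p → indicator (em {Touched T g p i})) _ (remove-one g inj i) ps ⟩
        2 * hits (λ p → Touched T g p i) ps + incidences (g ∘ punchIn i) ps
          ≤⟨ ℕ.+-mono-≤ (ℕ.*-monoʳ-≤ 2 i≤M)
               (incidences-bound M ps few (g ∘ punchIn i) (λ eq → Fin.punchIn-injective i _ _ (inj eq)) (ℕ.<⇒≤ n≤N)) ⟩
        2 * M + 2 * M * n
          ≡⟨ ℕ.*-suc (2 * M) n ⟨
        2 * M * suc n ∎
        where open ℕ.≤-Reasoning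

-- Complex numbers and limits

record OrderedField : Set₁ where
  infix 4 _<_
  field
    cring : CRing
  open CommutativeRing cring hiding (zero)
  field
    _<_        : Carrier → Carrier → Set
    <-respˡ    : ∀ {x y z} → x ≈ y → x < z → y < z
    <-respʳ    : ∀ {x y z} → y ≈ z → x < y → x < z
    <-irrefl   : ∀ {x} → ¬ x < x
    <-trans    : ∀ {x y z} → x < y → y < z → x < z
    compare    : ∀ x y → x < y ⊎ x ≈ y ⊎ y < x
    +-monoˡ-<  : ∀ z {x y} → x < y → x + z < y + z
    *-positive : ∀ {x y} → 0# < x → 0# < y → 0# < x * y
    0<1        : 0# < 1#
    reciprocal : ∀ x → ¬ x ≈ 0# → ∃ λ y → y * x ≈ 1#

module Complex (R : OrderedField) where
  open OrderedField R public using (_<_; <-respˡ; <-respʳ; <-irrefl; <-trans; compare; +-monoˡ-<; *-positive; 0<1; reciprocal)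
  open CommutativeRing (OrderedField.cring R) public hiding (zero)
  module S = Integers (OrderedField.cring R)
  open S using (solve; _:=_; _:+_; _:*_; :-_; _:-_; :#_)

  infix 4 _≤_
  _≤_ : Carrier → Carrier → Set
  x ≤ y = x < y ⊎ x ≈ y

  ≮⇒≥ : ∀ {x y} → ¬ y < x → x ≤ y
  ≮⇒≥ {x} {y} ¬y<x = [ inj₁ , [ inj₂ , (λ y<x → ⊥-elim (¬y<x y<x)) ]′ ]′ (compare x y)

  <-resp : ∀ {x x′ y y′} → x ≈ x′ → y ≈ y′ → x < y → x′ < y′
  <-resp eq eq′ lt = <-respˡ eq (<-respʳ eq′ lt)

  ≤-<-trans : ∀ {x y z} → x ≤ y → y < z → x < z
  ≤-<-trans (inj₁ lt) lt′ = <-trans lt lt′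
  ≤-<-trans (inj₂ eq) lt′ = <-respˡ (sym eq) lt′

  <-≤-trans : ∀ {x y z} → x < y → y ≤ z → x < z
  <-≤-trans lt (inj₁ lt′) = <-trans lt lt′
  <-≤-trans lt (inj₂ eq)  = <-respʳ eq lt

  +-mono-< : ∀ {x y z w} → x < y → z < w → x + z < y + w
  +-mono-< {x} {y} {z} {w} lt lt′ = <-trans (+-monoˡ-< z lt) (<-resp (+-comm z y) (+-comm w y) (+-monoˡ-< y lt′))

  +-mono-≤-< : ∀ {x y z w} → x ≤ y → z < w → x + z < y + w
  +-mono-≤-< (inj₁ lt) lt′ = +-mono-< lt lt′
  +-mono-≤-< {x} {y} {z} {w} (inj₂ eq) lt′ = <-resp (+-comm z x) (trans (+-comm w x) (+-congʳ eq)) (+-monoˡ-< x lt′)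

  0<-difference : ∀ {x y} → x < y → 0# < y - x
  0<-difference {x} lt = <-respˡ (-‿inverseʳ x) (+-monoˡ-< (- x) lt)

  *-monoʳ-< : ∀ {x y z} → 0# < z → x < y → z * x < z * y
  *-monoʳ-< {x} {y} {z} 0<z lt = <-resp (+-identityˡ _)
    (solve 3 (λ x y z → z :* (y :- x) :+ z :* x := z :* y) refl x y z)
    (+-monoˡ-< (z * x) (*-positive 0<z (0<-difference lt)))

  *-monoʳ-≤ : ∀ {x y z} → 0# ≤ z → x ≤ y → z * x ≤ z * y
  *-monoʳ-≤ (inj₁ 0<z) (inj₁ lt) = inj₁ (*-monoʳ-< 0<z lt)
  *-monoʳ-≤ (inj₁ 0<z) (inj₂ eq) = inj₂ (*-congˡ eq)
  *-monoʳ-≤ (inj₂ 0≈z) _         = inj₂ (trans (*-congʳ (sym 0≈z)) (trans (zeroˡ _) (sym (trans (*-congʳ (sym 0≈z)) (zeroˡ _)))))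

  *-mono-≤-< : ∀ {x y z w} → 0# ≤ x → x < y → 0# ≤ z → z < w → x * z < y * w
  *-mono-≤-< {x} {y} {z} {w} 0≤x x<y 0≤z z<w = ≤-<-trans (*-monoʳ-≤ 0≤x (inj₁ z<w))
    (<-resp (*-comm w x) (*-comm w y) (*-monoʳ-< (≤-<-trans 0≤z z<w) x<y))

  square-positive : ∀ {x} → ¬ x ≈ 0# → 0# < x * x
  square-positive {x} x≉0 with compare 0# x
  ... | inj₁ 0<x        = *-positive 0<x 0<x
  ... | inj₂ (inj₁ eq)  = ⊥-elim (x≉0 (sym eq))
  ... | inj₂ (inj₂ x<0) = <-respʳ (solve 1 (λ x → (:# 0 :- x) :* (:# 0 :- x) := x :* x) refl x)
        (*-positive (0<-difference x<0) (0<-difference x<0))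

  0≤square : ∀ x → 0# ≤ x * x
  0≤square x with compare (x * x) 0#
  ... | inj₁ lt = ⊥-elim (<-irrefl (<-trans lt (square-positive λ x≈0 → <-irrefl (<-respˡ (trans (*-congʳ x≈0) (zeroˡ x)) lt))))
  ... | inj₂ (inj₁ eq) = inj₂ (sym eq)
  ... | inj₂ (inj₂ lt) = inj₁ lt

  0≤-+ : ∀ {x y} → 0# ≤ x → 0# ≤ y → 0# ≤ x + y
  0≤-+ {x} {y} 0≤x (inj₁ 0<y) = inj₁ (<-respˡ (+-identityˡ 0#) (+-mono-≤-< 0≤x 0<y))
  0≤-+ {x} {y} (inj₁ 0<x) (inj₂ 0≈y) = inj₁ (<-respʳ (trans (sym (+-identityʳ x)) (+-congˡ 0≈y)) 0<x)
  0≤-+ {x} {y} (inj₂ 0≈x) (inj₂ 0≈y) = inj₂ (trans (sym (+-identityˡ 0#)) (+-cong 0≈x 0≈y))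

  reciprocal-positive : ∀ {x} → 0# < x → ∃ λ y → 0# < y × y * x ≈ 1#
  reciprocal-positive {x} 0<x with reciprocal x (λ eq → <-irrefl (<-respʳ eq 0<x))
  ... | y , yx≈1 with compare 0# y
  ...   | inj₁ 0<y       = y , 0<y , yx≈1
  ...   | inj₂ (inj₁ eq) = ⊥-elim (<-irrefl (<-respʳ (trans (sym yx≈1) (trans (*-congʳ (sym eq)) (zeroˡ x))) 0<1))
  ...   | inj₂ (inj₂ y<0) = ⊥-elim (<-irrefl (<-trans 0<1 (<-respˡ yx≈1 (<-resp (*-comm x y) (zeroʳ x) (*-monoʳ-< 0<x y<0)))))

  private
    four : Carrier
    four = 1# + 1# + (1# + 1#)
    0<2 : 0# < 1# + 1#
    0<2 = <-respˡ (+-identityˡ 0#) (+-mono-< 0<1 0<1)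
    0<4 : 0# < four
    0<4 = <-respˡ (+-identityˡ 0#) (+-mono-< 0<2 0<2)

  -- `norm-+` bounds the squared modulus of a sum by twice the sum of the bounds, so both summands
  -- must be below a fourth of `ε`.
  quarter : ∀ ε → 0# < ε → ∃ λ η → 0# < η × four * η ≈ ε
  quarter ε 0<ε = let q , 0<q , q4≈1 = reciprocal-positive 0<4 in q * ε , *-positive 0<q 0<ε ,
    trans (solve 3 (λ f q e → f :* (q :* e) := (q :* f) :* e) refl four q ε) (trans (*-congʳ q4≈1) (*-identityˡ ε))

  ℂ′ : Set
  ℂ′ = Carrier × Carrier

  infix 4 _≈ᶻ_
  record _≈ᶻ_ (z w : ℂ′) : Set where
    constructor mkᶻ
    field
      re≈ : proj₁ z ≈ proj₁ w
      im≈ : proj₂ z ≈ proj₂ w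
  open _≈ᶻ_ public

  _+ᶻ_ _*ᶻ_ : ℂ′ → ℂ′ → ℂ′
  z +ᶻ w = proj₁ z + proj₁ w , proj₂ z + proj₂ w
  z *ᶻ w = proj₁ z * proj₁ w + - (proj₂ z * proj₂ w) , proj₁ z * proj₂ w + proj₂ z * proj₁ w

  private
    abstract
      isCommutativeRingᶻ : IsCommutativeRing _≈ᶻ_ _+ᶻ_ _*ᶻ_ (λ z → - proj₁ z , - proj₂ z) (0# , 0#) (1# , 0#)
      isCommutativeRingᶻ = record
        { isRing = record
          { +-isAbelianGroup = record
            { isGroup = record
              { isMonoid = record
                { isSemigroup = record
                  { isMagma = record
                    { isEquivalence = record
                      { refl = mkᶻ refl refl ; sym = λ (mkᶻ e e′) → mkᶻ (sym e) (sym e′)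
                      ; trans = λ (mkᶻ e e′) (mkᶻ f f′) → mkᶻ (trans e f) (trans e′ f′) }
                    ; ∙-cong = λ (mkᶻ e e′) (mkᶻ f f′) → mkᶻ (+-cong e f) (+-cong e′ f′) }
                  ; assoc = λ _ _ _ → mkᶻ (+-assoc _ _ _) (+-assoc _ _ _) }
                ; identity = (λ _ → mkᶻ (+-identityˡ _) (+-identityˡ _)) , (λ _ → mkᶻ (+-identityʳ _) (+-identityʳ _)) }
              ; inverse = (λ _ → mkᶻ (-‿inverseˡ _) (-‿inverseˡ _)) , (λ _ → mkᶻ (-‿inverseʳ _) (-‿inverseʳ _))
              ; ⁻¹-cong = λ (mkᶻ e e′) → mkᶻ (-‿cong e) (-‿cong e′) }
            ; comm = λ _ _ → mkᶻ (+-comm _ _) (+-comm _ _) }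
          ; *-cong = λ (mkᶻ e e′) (mkᶻ f f′) → mkᶻ (+-cong (*-cong e f) (-‿cong (*-cong e′ f′))) (+-cong (*-cong e f′) (*-cong e′ f))
          ; *-assoc = λ (a , b) (c , d) (x , y) → mkᶻ
              (solve 6 (λ a b c d x y → (a :* c :+ :- (b :* d)) :* x :+ :- ((a :* d :+ b :* c) :* y)
                := a :* (c :* x :+ :- (d :* y)) :+ :- (b :* (c :* y :+ d :* x))) refl a b c d x y)
              (solve 6 (λ a b c d x y → (a :* c :+ :- (b :* d)) :* y :+ (a :* d :+ b :* c) :* x
                := a :* (c :* y :+ d :* x) :+ b :* (c :* x :+ :- (d :* y))) refl a b c d x y)
          ; *-identity = (λ (a , b) → one a b)
                       , (λ (a , b) → mkᶻ (solve 2 (λ a b → a :* :# 1 :+ :- (b :* :# 0) := a) refl a b)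
                                           (solve 2 (λ a b → a :* :# 0 :+ b :* :# 1 := b) refl a b))
          ; distrib = (λ (a , b) (c , d) (x , y) → mkᶻ
                (solve 6 (λ a b c d x y → a :* (c :+ x) :+ :- (b :* (d :+ y)) := a :* c :+ :- (b :* d) :+ (a :* x :+ :- (b :* y))) refl a b c d x y)
                (solve 6 (λ a b c d x y → a :* (d :+ y) :+ b :* (c :+ x) := a :* d :+ b :* c :+ (a :* y :+ b :* x)) refl a b c d x y))
            , (λ (a , b) (c , d) (x , y) → mkᶻ
                (solve 6 (λ a b c d x y → (c :+ x) :* a :+ :- ((d :+ y) :* b) := c :* a :+ :- (d :* b) :+ (x :* a :+ :- (y :* b))) refl a b c d x y)
                (solve 6 (λ a b c d x y → (c :+ x) :* b :+ (d :+ y) :* a := c :* b :+ d :* a :+ (x :* b :+ y :* a)) refl a b c d x y)) }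
        ; *-comm = λ (a , b) (c , d) → mkᶻ
              (solve 4 (λ a b c d → a :* c :+ :- (b :* d) := c :* a :+ :- (d :* b)) refl a b c d)
              (solve 4 (λ a b c d → a :* d :+ b :* c := c :* b :+ d :* a) refl a b c d) }
        where
        one : ∀ a b → (1# , 0#) *ᶻ (a , b) ≈ᶻ (a , b)
        one a b = mkᶻ (solve 2 (λ a b → :# 1 :* a :+ :- (:# 0 :* b) := a) refl a b)
                      (solve 2 (λ a b → :# 1 :* b :+ :# 0 :* a := b) refl a b)

  ℂ-ring : CRing
  ℂ-ring = record
    { Carrier = ℂ′ ; _≈_ = _≈ᶻ_ ; _+_ = _+ᶻ_ ; _*_ = _*ᶻ_ ; -_ = λ z → - proj₁ z , - proj₂ z ; 0# = 0# , 0# ; 1# = 1# , 0#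
    ; isCommutativeRing = isCommutativeRingᶻ }

  private
    module Z = CommutativeRing ℂ-ring

  -- The squared modulus, matching `normSq`; estimates then need no square roots, and the order τ^e
  -- appears as (τ²)^e.
  norm : ℂ′ → Carrier
  norm z = proj₁ z * proj₁ z + proj₂ z * proj₂ z

  norm-cong : ∀ {z w} → z ≈ᶻ w → norm z ≈ norm w
  norm-cong (mkᶻ e e′) = +-cong (*-cong e e) (*-cong e′ e′)

  norm-* : ∀ z w → norm (z *ᶻ w) ≈ norm z * norm w
  norm-* (a , b) (c , d) = solve 4 (λ a b c d → (a :* c :+ :- (b :* d)) :* (a :* c :+ :- (b :* d)) :+ (a :* d :+ b :* c) :* (a :* d :+ b :* c)
    := (a :* a :+ b :* b) :* (c :* c :+ d :* d)) refl a b c d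

  0≤norm : ∀ z → 0# ≤ norm z
  0≤norm (a , b) = 0≤-+ (0≤square a) (0≤square b)

  norm-positive : ∀ {z} → ¬ z ≈ᶻ Z.0# → 0# < norm z
  norm-positive {a , b} z≉0 with compare 0# a
  ... | inj₁ 0<a = <-respˡ (+-identityˡ 0#) (<-resp (+-comm _ _) (+-comm _ _) (+-mono-≤-< (0≤square b) (*-positive 0<a 0<a)))
  ... | inj₂ (inj₂ a<0) = <-respˡ (+-identityˡ 0#) (<-resp (+-comm _ _) (+-comm _ _) (+-mono-≤-< (0≤square b)
          (square-positive λ a≈0 → <-irrefl (<-respˡ a≈0 a<0))))
  ... | inj₂ (inj₁ 0≈a) = <-respˡ (+-identityˡ 0#) (+-mono-≤-< (0≤square a) (square-positive λ b≈0 → z≉0 (mkᶻ (sym 0≈a) b≈0)))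

  norm-zero : ∀ {z} → z ≈ᶻ Z.0# → norm z ≈ 0#
  norm-zero eq = trans (norm-cong eq) (solve 0 (:# 0 :* :# 0 :+ :# 0 :* :# 0 := :# 0) refl)

  -- |z + w|² + |z - w|² = 2 |z|² + 2 |w|²
  norm-+ : ∀ {z w A B} → norm z < A → norm w < B → norm (z +ᶻ w) < (1# + 1#) * (A + B)
  norm-+ {a , b} {c , d} {A} {B} lt lt′ = ≤-<-trans (drop (0≤norm (a - c , b - d)))
    (<-respˡ (solve 4 (λ a b c d → (:# 1 :+ :# 1) :* ((a :* a :+ b :* b) :+ (c :* c :+ d :* d))
        := ((a :+ c) :* (a :+ c) :+ (b :+ d) :* (b :+ d)) :+ ((a :- c) :* (a :- c) :+ (b :- d) :* (b :- d))) refl a b c d)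
      (*-monoʳ-< 0<2 (+-mono-< lt lt′)))
    where
    drop : ∀ {x y} → 0# ≤ y → x ≤ x + y
    drop {x} {y} (inj₁ 0<y) = inj₁ (<-resp (+-identityˡ x) (+-comm y x) (+-monoˡ-< x 0<y))
    drop {x} {y} (inj₂ 0≈y) = inj₂ (trans (sym (+-identityʳ x)) (+-congˡ 0≈y))

  norm-neg : ∀ z → norm (Z.- z) ≈ norm z
  norm-neg (a , b) = solve 2 (λ a b → (:- a) :* (:- a) :+ (:- b) :* (:- b) := a :* a :+ b :* b) refl a b

  module _ where
    open Algebra.Properties.Semiring.Mult Z.semiring using () renaming (_×_ to _·ᶻ_)
    open Algebra.Properties.Semiring.Mult semiring using () renaming (_×_ to _·_)

    ℂ-field : Field
    ℂ-field = record
      { cring = ℂ-ring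
      ; 1≉0 = λ (mkᶻ e _) → <-irrefl (<-respʳ e 0<1)
      ; inverse = λ z z≉0 → let y , yn≈1 = reciprocal (norm z) (λ eq → <-irrefl (<-respʳ eq (norm-positive z≉0))) in
          (y * proj₁ z , - (y * proj₂ z)) , mkᶻ
            (trans (solve 3 (λ y a b → y :* a :* a :+ :- ((:- (y :* b)) :* b) := y :* (a :* a :+ b :* b)) refl y (proj₁ z) (proj₂ z)) yn≈1)
            (solve 3 (λ y a b → y :* a :* b :+ (:- (y :* b)) :* a := :# 0) refl y (proj₁ z) (proj₂ z))
      ; char-0 = λ n (mkᶻ e _) → <-irrefl (<-respʳ (trans (sym (real (suc n))) e) (positive n)) }
      where
      real : ∀ n → proj₁ (n ·ᶻ Z.1#) ≈ n · 1#
      real zero    = refl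
      real (suc n) = +-congˡ (real n)
      positive : ∀ n → 0# < suc n · 1#
      positive zero    = <-respʳ (sym (+-identityʳ 1#)) 0<1
      positive (suc n) = <-respˡ (+-identityˡ 0#) (+-mono-< 0<1 (positive n))

-- Limits and orders of vanishing along a ray

module Limits (R : OrderedField) where
  open Complex R
  open S using (solve; _:=_; _:+_; _:*_; :-_; _:-_; :#_)
  private
    module Z   = CommutativeRing ℂ-ring
    module ZS  = Integers ℂ-ring
    module ZX  = Poly ℂ-ring
    module ZXY = Poly ZX.ring[X]
    module EZ  = Evaluation ℂ-ring

  infixl 6 _-ᶻ_
  _-ᶻ_ : ℂ′ → ℂ′ → ℂ′
  _-ᶻ_ = Z._-_

  -- Limits are taken over positive reals tending to 0. The arcs to be followed are polynomials in
  -- such a parameter, and their order of vanishing is already determined on a ray.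
  Eventually : (Carrier → Set) → Set
  Eventually P = ∃ λ ρ → 0# < ρ × ∀ τ → 0# < τ → τ < ρ → P τ

  always : ∀ {P : Carrier → Set} → (∀ τ → 0# < τ → P τ) → Eventually P
  always p = 1# , 0<1 , λ τ 0<τ _ → p τ 0<τ

  both : ∀ {P Q} → Eventually P → Eventually Q → Eventually (λ τ → P τ × Q τ)
  both (ρ , 0<ρ , p) (ρ′ , 0<ρ′ , q) with compare ρ ρ′
  ... | inj₁ lt        = ρ , 0<ρ , λ τ 0<τ τ<ρ → p τ 0<τ τ<ρ , q τ 0<τ (<-trans τ<ρ lt)
  ... | inj₂ (inj₁ eq) = ρ , 0<ρ , λ τ 0<τ τ<ρ → p τ 0<τ τ<ρ , q τ 0<τ (<-respʳ eq τ<ρ)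
  ... | inj₂ (inj₂ gt) = ρ′ , 0<ρ′ , λ τ 0<τ τ<ρ′ → p τ 0<τ (<-trans τ<ρ′ gt) , q τ 0<τ τ<ρ′

  weaken : ∀ {P Q : Carrier → Set} → (∀ τ → 0# < τ → P τ → Q τ) → Eventually P → Eventually Q
  weaken f (ρ , 0<ρ , p) = ρ , 0<ρ , λ τ 0<τ τ<ρ → f τ 0<τ (p τ 0<τ τ<ρ)

  small : ∀ ρ → 0# < ρ → Eventually (_< ρ)
  small ρ 0<ρ = ρ , 0<ρ , λ _ _ τ<ρ → τ<ρ

  eventually-inhabited : ∀ {P : Carrier → Set} → Eventually P → ∃ λ τ → P τ
  eventually-inhabited (ρ , 0<ρ , p) = let η , 0<η , 4η≈ρ = quarter ρ 0<ρ in
    η , p η 0<η (<-respʳ 4η≈ρ (<-resp (+-identityˡ η)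
      (solve 1 (λ η → (:# 1 :+ :# 1 :+ :# 1) :* η :+ η := (:# 1 :+ :# 1 :+ (:# 1 :+ :# 1)) :* η) refl η)
      (+-monoˡ-< η (*-positive (<-respˡ (+-identityˡ 0#) (+-mono-< (<-respˡ (+-identityˡ 0#) (+-mono-< 0<1 0<1)) 0<1)) 0<η))))

  Lim : (Carrier → ℂ′) → ℂ′ → Set
  Lim f c = ∀ ε → 0# < ε → Eventually (λ τ → norm (f τ -ᶻ c) < ε)

  Bdd : (Carrier → ℂ′) → Set
  Bdd f = ∃ λ B → 0# < B × Eventually (λ τ → norm (f τ) < B)

  -- f(τ) = O(τᵉ)
  Big : ℕ → (Carrier → ℂ′) → Set
  Big e f = ∃ λ B → 0# < B × Eventually (λ τ → norm (f τ) < B * power (OrderedField.cring R) (τ * τ) e)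

  private
    pow : Carrier → ℕ → Carrier
    pow = power (OrderedField.cring R)

    pow-positive : ∀ {x} e → 0# < x → 0# < pow x e
    pow-positive zero    0<x = 0<1
    pow-positive (suc e) 0<x = *-positive 0<x (pow-positive e 0<x)

    norm+1 : ∀ c → 0# < norm c + 1#
    norm+1 c = <-respˡ (+-identityˡ 0#) (+-mono-≤-< (0≤norm c) 0<1)

    norm<norm+1 : ∀ c → norm c < norm c + 1#
    norm<norm+1 c = <-resp (+-identityˡ _) (+-comm _ _) (+-monoˡ-< (norm c) 0<1)

    two-halves : ∀ {η ε} → (1# + 1# + (1# + 1#)) * η ≈ ε → (1# + 1#) * (η + η) ≈ ε
    two-halves {η} eq = trans (solve 1 (λ η → (:# 1 :+ :# 1) :* (η :+ η) := (:# 1 :+ :# 1 :+ (:# 1 :+ :# 1)) :* η) refl η) eq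

  small-factor : ∀ B η → 0# < B → 0# < η → ∃ λ δ → 0# < δ × ∀ x y → norm x < B → norm y < δ → norm (x Z.* y) < η
  small-factor B η 0<B 0<η = let B⁻¹ , 0<B⁻¹ , eq = reciprocal-positive 0<B in
    B⁻¹ * η , *-positive 0<B⁻¹ 0<η , λ x y x<B y<δ → <-resp (sym (norm-* x y))
      (trans (solve 3 (λ B i η → B :* (i :* η) := i :* B :* η) refl B B⁻¹ η) (trans (*-congʳ eq) (*-identityˡ η)))
      (*-mono-≤-< (0≤norm x) x<B (0≤norm y) y<δ)

  Lim⇒Bdd : ∀ {f c} → Lim f c → Bdd f
  Lim⇒Bdd {f} {c} lim = (1# + 1#) * (1# + (norm c + 1#)) ,
    *-positive (<-respˡ (+-identityˡ 0#) (+-mono-< 0<1 0<1)) (<-respˡ (+-identityˡ 0#) (+-mono-< 0<1 (norm+1 c))) ,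
    weaken (λ τ _ lt → <-respˡ (norm-cong (ZS.solve 2 (λ f c → f ZS.:- c ZS.:+ c ZS.:= f) Z.refl (f τ) c)) (norm-+ lt (norm<norm+1 c))) (lim 1# 0<1)

  Lim-const : ∀ c → Lim (λ _ → c) c
  Lim-const c ε 0<ε = always λ _ _ → <-respˡ (sym (norm-zero (Z.-‿inverseʳ c))) 0<ε

  Lim-resp : ∀ {f g c d} → (∀ τ → f τ ≈ᶻ g τ) → c ≈ᶻ d → Lim f c → Lim g d
  Lim-resp eq eq′ lim ε 0<ε = weaken (λ τ _ → <-respˡ (norm-cong (Z.+-cong (eq τ) (Z.-‿cong eq′)))) (lim ε 0<ε)

  Lim-+ : ∀ {f g c d} → Lim f c → Lim g d → Lim (λ τ → f τ Z.+ g τ) (c Z.+ d)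
  Lim-+ {f} {g} {c} {d} lf lg ε 0<ε = let η , 0<η , eq = quarter ε 0<ε in
    weaken (λ τ _ (lt , lt′) → <-resp
        (norm-cong (ZS.solve 4 (λ f g c d → (f ZS.:- c) ZS.:+ (g ZS.:- d) ZS.:= (f ZS.:+ g) ZS.:- (c ZS.:+ d)) Z.refl (f τ) (g τ) c d))
        (two-halves eq) (norm-+ lt lt′))
      (both (lf η 0<η) (lg η 0<η))

  Lim-* : ∀ {f g c d} → Lim f c → Lim g d → Lim (λ τ → f τ Z.* g τ) (c Z.* d)
  Lim-* {f} {g} {c} {d} lf lg ε 0<ε =
    let η , 0<η , eq = quarter ε 0<ε
        B , 0<B , f<B = Lim⇒Bdd lf
        δ , 0<δ , use = small-factor B η 0<B 0<η
        δ′ , 0<δ′ , use′ = small-factor (norm d + 1#) η (norm+1 d) 0<η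
    in weaken (λ τ _ (f<B , lt , lt′) → <-resp
        (norm-cong (ZS.solve 4 (λ f g c d → f ZS.:* (g ZS.:- d) ZS.:+ d ZS.:* (f ZS.:- c) ZS.:= f ZS.:* g ZS.:- c ZS.:* d) Z.refl (f τ) (g τ) c d))
        (two-halves eq) (norm-+ (use (f τ) _ f<B lt) (use′ d _ (norm<norm+1 d) lt′)))
      (both f<B (both (lg δ 0<δ) (lf δ′ 0<δ′)))

  Lim-unique : ∀ {f c} → Lim f Z.0# → Lim f c → ¬ ¬ c ≈ᶻ Z.0#
  Lim-unique {f} {c} l0 lc c≉0 =
    let η , 0<η , eq = quarter (norm c) (norm-positive c≉0)
        τ , lt , lt′ = eventually-inhabited (both (l0 η 0<η) (lc η 0<η))
    in <-irrefl (<-resp (norm-cong (ZS.solve 2 (λ f c → f ZS.:- ZS.:# 0 ZS.:+ ZS.:- (f ZS.:- c) ZS.:= c) Z.refl (f τ) c)) (two-halves eq)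
         (norm-+ lt (<-respˡ (sym (norm-neg _)) lt′)))

  real : Carrier → ℂ′
  real τ = τ , 0#

  private
    norm-real : ∀ τ → norm (real τ) ≈ τ * τ
    norm-real τ = solve 1 (λ τ → τ :* τ :+ :# 0 :* :# 0 := τ :* τ) refl τ

  Lim-real : Lim real Z.0#
  Lim-real ε 0<ε = weaken (λ τ 0<τ (τ<ε , τ<1) → <-resp (trans (sym (norm-real τ)) (norm-cong (ZS.solve 1 (λ t → t ZS.:= t ZS.:- ZS.:# 0) Z.refl (real τ))))
      (*-identityʳ ε) (*-mono-≤-< (inj₁ 0<τ) τ<ε (inj₁ 0<τ) τ<1))
    (both (small ε 0<ε) (small 1# 0<1))

  Lim-eval : ∀ p {z c} → Lim z c → Lim (λ τ → ZX.eval p (z τ)) (ZX.eval p c)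
  Lim-eval []      lz = Lim-const Z.0#
  Lim-eval (a ∷ p) lz = Lim-+ (Lim-const a) (Lim-* lz (Lim-eval p lz))

  private
    fibre : List (List ℂ′) → ℂ′ → List ℂ′
    fibre P x = map (λ c → ZX.eval c x) P

  Lim-eval₂ : ∀ P {t u a b} → Lim t a → Lim u b → Lim (λ τ → ZX.eval (fibre P (t τ)) (u τ)) (ZX.eval (fibre P a) b)
  Lim-eval₂ []      lt lu = Lim-const Z.0#
  Lim-eval₂ (c ∷ P) lt lu = Lim-+ (Lim-eval c lt) (Lim-* lu (Lim-eval₂ P lt lu))

  Lim-dd : ∀ P {t u w a b c} → Lim t a → Lim u b → Lim w c → Lim (λ τ → EZ.dd (fibre P (t τ)) (u τ) (w τ)) (EZ.dd (fibre P a) b c)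
  Lim-dd []      lt lu lw = Lim-const Z.0#
  Lim-dd (c ∷ P) lt lu lw = Lim-+ (Lim-eval₂ P lt lu) (Lim-* lw (Lim-dd P lt lu lw))

  Big-resp : ∀ {e f g} → Eventually (λ τ → f τ ≈ᶻ g τ) → Big e f → Big e g
  Big-resp eq (B , 0<B , lt) = B , 0<B , weaken (λ τ _ (eq , lt) → <-respˡ (norm-cong eq) lt) (both eq lt)

  Big-+ : ∀ {e f g} → Big e f → Big e g → Big e (λ τ → f τ Z.+ g τ)
  Big-+ (B , 0<B , lt) (B′ , 0<B′ , lt′) = (1# + 1#) * (B + B′) ,
    *-positive (<-respˡ (+-identityˡ 0#) (+-mono-< 0<1 0<1)) (<-respˡ (+-identityˡ 0#) (+-mono-< 0<B 0<B′)) ,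
    weaken (λ τ _ (lt , lt′) → <-respʳ (solve 3 (λ B C p → (:# 1 :+ :# 1) :* (B :* p :+ C :* p) := (:# 1 :+ :# 1) :* (B :+ C) :* p) refl B B′ _) (norm-+ lt lt′)) (both lt lt′)

  Big-* : ∀ {e f g} → Bdd f → Big e g → Big e (λ τ → f τ Z.* g τ)
  Big-* {f = f} {g} (B , 0<B , lt) (B′ , 0<B′ , lt′) = B * B′ , *-positive 0<B 0<B′ ,
    weaken (λ τ _ (lt , lt′) → <-resp (sym (norm-* (f τ) (g τ))) (sym (*-assoc B B′ _)) (*-mono-≤-< (0≤norm (f τ)) lt (0≤norm (g τ)) lt′)) (both lt lt′)

  private
    *-cancel-< : ∀ {x y z} → 0# < z → z * x < z * y → x < y
    *-cancel-< {x} {y} {z} 0<z lt with compare x y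
    ... | inj₁ x<y        = x<y
    ... | inj₂ (inj₁ eq)  = ⊥-elim (<-irrefl (<-respˡ (*-congˡ eq) lt))
    ... | inj₂ (inj₂ y<x) = ⊥-elim (<-irrefl (<-trans lt (*-monoʳ-< 0<z y<x)))

  -- With 4η = |c|², a value of `Φ` whose squared modulus is below η and whose squared distance from
  -- `c` is also below η would give |c|² < 4η. So `Φ` is eventually bounded away from zero.
  Big-cancel : ∀ {e f Φ c} → Lim Φ c → ¬ c ≈ᶻ Z.0# → Big e (λ τ → f τ Z.* Φ τ) → Big e f
  Big-cancel {e} {f} {Φ} {c} lim c≉0 (B , 0<B , lt) =
    let η , 0<η , eq = quarter (norm c) (norm-positive c≉0)
        η⁻¹ , 0<η⁻¹ , eq′ = reciprocal-positive 0<η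
    in η⁻¹ * B , *-positive 0<η⁻¹ 0<B , weaken (λ τ _ (close , lt) →
         let η≤Φ : η ≤ norm (Φ τ)
             η≤Φ = ≮⇒≥ λ Φ<η → <-irrefl (<-resp
               (norm-cong (ZS.solve 2 (λ Φ c → Φ ZS.:+ ZS.:- (Φ ZS.:- c) ZS.:= c) Z.refl (Φ τ) c)) (two-halves eq)
               (norm-+ Φ<η (<-respˡ (sym (norm-neg _)) close)))
         in *-cancel-< 0<η (<-respʳ
              (trans (sym (*-identityˡ _)) (trans (*-congʳ (sym eq′)) (solve 4 (λ i η B p → (i :* η) :* (B :* p) := η :* (i :* B :* p)) refl η⁻¹ η B _)))
              (≤-<-trans ([ (λ lt → inj₁ (<-resp refl refl lt)) , inj₂ ]′ (raise (f τ) η≤Φ)) (<-respˡ (norm-* (f τ) (Φ τ)) lt))))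
         (both (lim η 0<η) lt)
    where
    raise : ∀ z {η φ} → η ≤ φ → η * norm z ≤ norm z * φ
    raise z {η} {φ} η≤φ with *-monoʳ-≤ (0≤norm z) η≤φ
    ... | inj₁ lt = inj₁ (<-respˡ (*-comm (norm z) η) lt)
    ... | inj₂ eq = inj₂ (trans (*-comm η (norm z)) eq)

  Big-shift : ∀ {e f} → Big e f → Big (suc e) (λ τ → real τ Z.* f τ)
  Big-shift {e} {f} (B , 0<B , lt) = B , 0<B , weaken (λ τ 0<τ lt → <-resp
    (trans (*-congʳ (sym (norm-real τ))) (sym (norm-* (real τ) (f τ)))) (solve 3 (λ t B p → t :* (B :* p) := B :* (t :* p)) refl (τ * τ) B _)
    (*-monoʳ-< (*-positive 0<τ 0<τ) lt)) lt

  Big-unshift : ∀ {e f} → Big (suc e) (λ τ → real τ Z.* f τ) → Big e f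
  Big-unshift {e} {f} (B , 0<B , lt) = B , 0<B , weaken (λ τ 0<τ lt → *-cancel-< (*-positive 0<τ 0<τ) (<-resp
    (trans (norm-* (real τ) (f τ)) (*-congʳ (norm-real τ))) (solve 3 (λ t B p → B :* (t :* p) := t :* (B :* p)) refl (τ * τ) B _) lt)) lt

  Bdd⇒Big : ∀ {f} → Bdd f → Big 0 f
  Bdd⇒Big (B , 0<B , lt) = B , 0<B , weaken (λ τ _ → <-respʳ (sym (*-identityʳ B))) lt

  Big⇒Lim : ∀ e {f} → Big (suc e) f → Lim f Z.0#
  Big⇒Lim zero {f} (B , 0<B , lt) ε 0<ε =
    let B⁻¹ , 0<B⁻¹ , eq = reciprocal-positive 0<B in
    weaken (λ τ 0<τ (lt , close) → <-respˡ (norm-cong (ZS.solve 1 (λ f → f ZS.:= f ZS.:- ZS.:# 0) Z.refl (f τ)))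
        (<-trans lt (<-resp (*-congˡ (trans (norm-cong (ZS.solve 1 (λ f → f ZS.:- ZS.:# 0 ZS.:= f) Z.refl (real τ))) (trans (norm-real τ) (sym (*-identityʳ _)))))
          (trans (sym (*-assoc B B⁻¹ ε)) (trans (*-congʳ (trans (*-comm B B⁻¹) eq)) (*-identityˡ ε))) (*-monoʳ-< 0<B close))))
      (both lt (Lim-real (B⁻¹ * ε) (*-positive 0<B⁻¹ 0<ε)))
  Big⇒Lim (suc e) {f} (B , 0<B , lt) = Big⇒Lim e (B , 0<B , weaken (λ τ 0<τ (lt , τ<1) → <-trans lt (*-monoʳ-< 0<B
      (<-respʳ (*-identityˡ _) (<-resp (*-comm _ _) (*-comm _ _) (*-monoʳ-< (pow-positive (suc e) (*-positive 0<τ 0<τ))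
        (<-respʳ (*-identityˡ 1#) (*-mono-≤-< (inj₁ 0<τ) τ<1 (inj₁ 0<τ) τ<1)))))))
    (both lt (small 1# 0<1)))

  coefficients⇒Big : ∀ e q → (∀ i → i ℕ.< e → ZX.coeff q i ≈ᶻ Z.0#) → Big e (λ τ → ZX.eval q (real τ))
  coefficients⇒Big zero    q       eq = Bdd⇒Big (Lim⇒Bdd (Lim-eval q Lim-real))
  coefficients⇒Big (suc e) []      eq = 1# , 0<1 , always λ τ 0<τ → <-respˡ (sym (norm-zero Z.refl))
    (*-positive 0<1 (pow-positive (suc e) (*-positive 0<τ 0<τ)))
  coefficients⇒Big (suc e) (a ∷ q) eq = Big-resp {suc e} (always λ τ _ → Z.sym (Z.trans (Z.+-congʳ (eq 0 (s≤s z≤n))) (Z.+-identityˡ _)))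
    (Big-shift {e} (coefficients⇒Big e q (λ i i<e → eq (suc i) (s≤s i<e))))

  -- The constant term is the limit, hence zero; a factor `τ` is then cancelled and the next
  -- coefficient becomes the constant term.
  Big⇒coefficients : (∀ z → ¬ ¬ z ≈ᶻ Z.0# → z ≈ᶻ Z.0#) → ∀ e q → Big e (λ τ → ZX.eval q (real τ)) → ∀ i → i ℕ.< e → ZX.coeff q i ≈ᶻ Z.0#
  Big⇒coefficients stable (suc e) []      big i i<e = Z.refl
  Big⇒coefficients stable (suc e) (a ∷ q) big = λ { zero _ → a≈0 ; (suc i) (s≤s i<e) →
      Big⇒coefficients stable e q (Big-unshift {e} (Big-resp {suc e} (always λ τ _ → Z.trans (Z.+-congʳ a≈0) (Z.+-identityˡ _)) big)) i i<e }
    where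
    a≈0 : a ≈ᶻ Z.0#
    a≈0 = stable a (Lim-unique (Big⇒Lim e big) (Lim-resp (λ _ → Z.refl)
      (ZS.solve 2 (λ a v → a ZS.:+ ZS.:# 0 ZS.:* v ZS.:= a) Z.refl a (ZX.eval q Z.0#)) (Lim-eval (a ∷ q) Lim-real)))

  Continuous : (ℂ′ → ℂ′) → ℂ′ → Set
  Continuous h a = ∀ ε → 0# < ε → ∃ λ r → 0# < r × ∀ s → norm (s -ᶻ a) < r → norm (h s -ᶻ h a) < ε

  -- The hypothesis is differentiability with error constant 1: the error is at most |s - a|, and
  -- the linear term is small as well.
  derivative⇒continuous : ∀ {h a} d r → 0# < r →
    (∀ s → norm (s -ᶻ a) < r → ¬ norm (s -ᶻ a) < norm (h s -ᶻ h a -ᶻ d Z.* (s -ᶻ a))) → Continuous h a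
  derivative⇒continuous {h} {a} d r 0<r close ε 0<ε =
    let η , 0<η , eq = quarter ε 0<ε
        δ , 0<δ , use = small-factor (norm d + 1#) η (norm+1 d) 0<η
        r₁ , 0<r₁ , r₁≤r , r₁≤η = minimum r η 0<r 0<η
        r₂ , 0<r₂ , r₂≤r₁ , r₂≤δ = minimum r₁ δ 0<r₁ 0<δ
    in r₂ , 0<r₂ , λ s lt →
         let lt₁ = <-≤-trans lt r₂≤r₁ in
         <-resp (norm-cong (ZS.solve 2 (λ x y → x ZS.:- y ZS.:+ y ZS.:= x) Z.refl (h s -ᶻ h a) (d Z.* (s -ᶻ a)))) (two-halves eq)
           (norm-+ (≤-<-trans (≮⇒≥ (close s (<-≤-trans lt₁ r₁≤r))) (<-≤-trans lt₁ r₁≤η))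
             (use d (s -ᶻ a) (norm<norm+1 d) (<-≤-trans lt r₂≤δ)))
    where
    minimum : ∀ x y → 0# < x → 0# < y → ∃ λ z → 0# < z × z ≤ x × z ≤ y
    minimum x y 0<x 0<y with compare x y
    ... | inj₁ lt        = x , 0<x , inj₂ refl , inj₁ lt
    ... | inj₂ (inj₁ eq) = x , 0<x , inj₂ refl , inj₂ eq
    ... | inj₂ (inj₂ gt) = y , 0<y , inj₁ gt , inj₂ refl

  record Graph (F : List (List ℂ′)) (a b : ℂ′) (h : ℂ′ → ℂ′) : Set where
    field
      root       : ZX.eval (fibre F a) b ≈ᶻ Z.0#
      continuous : Continuous h a
      radius     : Carrier
      0<radius   : 0# < radius
      unique     : ∀ t u → norm (t -ᶻ a) < radius → norm (u -ᶻ b) < radius → ZX.eval (fibre F t) u ≈ᶻ Z.0# → u ≈ᶻ h t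
      on-graph   : ∀ t → norm (t -ᶻ a) < radius → norm (h t -ᶻ b) < radius → ZX.eval (fibre F t) (h t) ≈ᶻ Z.0#

    value : h a ≈ᶻ b
    value = Z.sym (unique a b zero′ zero″ root)
      where
      zero′ : norm (a -ᶻ a) < radius
      zero′ = <-respˡ (sym (norm-zero (Z.-‿inverseʳ a))) 0<radius
      zero″ : norm (b -ᶻ b) < radius
      zero″ = <-respˡ (sym (norm-zero (Z.-‿inverseʳ b))) 0<radius

    limit : ∀ {t} → Lim t a → Lim (λ τ → h (t τ)) b
    limit lt = Lim-resp (λ _ → Z.refl) value λ ε 0<ε → let r , 0<r , close = continuous ε 0<ε in
      weaken (λ τ _ → close _) (lt r 0<r)

    vanish : ∀ {t} → Lim t a → Eventually (λ τ → ZX.eval (fibre F (t τ)) (h (t τ)) ≈ᶻ Z.0#)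
    vanish lt = weaken (λ τ _ (close , close′) → on-graph _ close close′) (both (lt radius 0<radius) (limit lt radius 0<radius))

  -- Phrased as the failure of a strict inequality: this is what `≤ℝ⇒≯` extracts from an estimate in
  -- the statement, and trichotomy turns it back into `_≤_`.
  Agree : ℕ → (h h̃ : ℂ′ → ℂ′) → ℂ′ → Set
  Agree e h h̃ a = ∃ λ A → ∃ λ r → 0# < r × ∀ s → norm (s -ᶻ a) < r →
    ¬ A * power (OrderedField.cring R) (norm (s -ᶻ a)) e < norm (h s -ᶻ h̃ s)

  private
    pow-mono : ∀ {x y} e → 0# ≤ x → x ≤ y → pow x e ≤ pow y e
    pow-mono zero    0≤x x≤y = inj₂ refl
    pow-mono {x} {y} (suc e) 0≤x x≤y = ≤-trans′ (*-monoʳ-≤ 0≤x (pow-mono e 0≤x x≤y)) (flip (*-monoʳ-≤ (0≤pow e (≤-trans′ 0≤x x≤y)) x≤y))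
      where
      ≤-trans′ : ∀ {x y z} → x ≤ y → y ≤ z → x ≤ z
      ≤-trans′ (inj₁ lt) le = inj₁ (<-≤-trans lt le)
      ≤-trans′ (inj₂ eq) (inj₁ lt) = inj₁ (<-respˡ (sym eq) lt)
      ≤-trans′ (inj₂ eq) (inj₂ eq′) = inj₂ (trans eq eq′)
      flip : ∀ {a b c d} → a * b ≤ c * d → b * a ≤ d * c
      flip (inj₁ lt) = inj₁ (<-resp (*-comm _ _) (*-comm _ _) lt)
      flip (inj₂ eq) = inj₂ (trans (*-comm _ _) (trans eq (*-comm _ _)))
      0≤pow : ∀ {x} e → 0# ≤ x → 0# ≤ pow x e
      0≤pow zero    _   = inj₁ 0<1
      0≤pow {x} (suc e) 0≤x with *-monoʳ-≤ 0≤x (0≤pow e 0≤x)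
      ... | inj₁ lt = inj₁ (<-respˡ (zeroʳ x) lt)
      ... | inj₂ eq = inj₂ (trans (sym (zeroʳ x)) eq)

    pow-* : ∀ x y e → pow (x * y) e ≈ pow x e * pow y e
    pow-* x y zero    = sym (*-identityˡ 1#)
    pow-* x y (suc e) = trans (*-congˡ (pow-* x y e)) (solve 4 (λ x y p q → x :* y :* (p :* q) := x :* p :* (y :* q)) refl x y _ _)

    -- The constant in an estimate of agreement may have any sign, whereas `Big` asks for a positive
    -- one.
    below-square : ∀ A → ∃ λ B → 0# < B × A < B
    below-square A = A * A + 1# , <-respˡ (+-identityˡ 0#) (+-mono-≤-< (0≤square A) 0<1) , bound (compare A 1#)
      where
      A²<A²+1 : A * A < A * A + 1#
      A²<A²+1 = <-resp (+-identityˡ _) (+-comm _ _) (+-monoˡ-< (A * A) 0<1)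
      bound : A < 1# ⊎ A ≈ 1# ⊎ 1# < A → A < A * A + 1#
      bound (inj₁ A<1)       = <-respˡ (+-identityˡ A) (+-mono-≤-< (0≤square A) A<1)
      bound (inj₂ (inj₁ eq)) = <-respˡ (trans (*-congˡ eq) (*-identityʳ A)) A²<A²+1
      bound (inj₂ (inj₂ 1<A)) = <-trans (<-respˡ (*-identityʳ A) (*-monoʳ-< (<-trans 0<1 1<A) 1<A)) A²<A²+1

  Agree⇒Big : ∀ {e h h̃ a t} → Agree e h h̃ a → Lim t a → Big 1 (λ τ → t τ -ᶻ a) → Big e (λ τ → h (t τ) -ᶻ h̃ (t τ))
  Agree⇒Big {e} {h} {h̃} {a} {t} (A , r , 0<r , agree) lt (C , 0<C , linear) =
    let B , 0<B , A<B = below-square A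
        0<BC = *-positive 0<B (pow-positive e 0<C)
    in B * pow C e + 1# , <-respˡ (+-identityˡ 0#) (+-mono-< 0<BC 0<1) ,
       weaken (λ τ 0<τ (close , lin) → conclude A B 0<B A<B τ 0<τ (≮⇒≥ {norm (h (t τ) -ᶻ h̃ (t τ))} (agree (t τ) close)) (<-respʳ (*-congˡ (*-identityʳ _)) lin))
         (both (lt r 0<r) linear)
    where
    conclude : ∀ A B → 0# < B → A < B → ∀ τ → 0# < τ → norm (h (t τ) -ᶻ h̃ (t τ)) ≤ A * pow (norm (t τ -ᶻ a)) e →
      norm (t τ -ᶻ a) < C * (τ * τ) → norm (h (t τ) -ᶻ h̃ (t τ)) < (B * pow C e + 1#) * pow (τ * τ) e
    conclude A B 0<B A<B τ 0<τ le lin = ≤-<-trans le (≤-<-trans (raise A<B)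
      (≤-<-trans (*-monoʳ-≤ (inj₁ 0<B) (pow-mono e (0≤norm _) (inj₁ lin)))
        (<-resp (trans (+-identityʳ _) (trans (*-assoc B (pow C e) (pow (τ * τ) e)) (*-congˡ (sym (pow-* C (τ * τ) e)))))
          (solve 2 (λ b p → b :* p :+ p := (b :+ :# 1) :* p) refl (B * pow C e) (pow (τ * τ) e))
          (<-resp (+-comm _ _) (+-comm _ _) (+-monoˡ-< (B * pow C e * pow (τ * τ) e) (pow-positive e (*-positive 0<τ 0<τ)))))))
      where
      raise : ∀ {A B} → A < B → A * pow (norm (t τ -ᶻ a)) e ≤ B * pow (norm (t τ -ᶻ a)) e
      raise {A} {B} A<B with *-monoʳ-≤ (0≤pow e) (inj₁ A<B)
        where
        0≤pow : ∀ e → 0# ≤ pow (norm (t τ -ᶻ a)) e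
        0≤pow zero    = inj₁ 0<1
        0≤pow (suc e) with *-monoʳ-≤ (0≤norm (t τ -ᶻ a)) (0≤pow e)
        ... | inj₁ lt = inj₁ (<-respˡ (zeroʳ _) lt)
        ... | inj₂ eq = inj₂ (trans (sym (zeroʳ _)) eq)
      ... | inj₁ lt = inj₁ (<-resp (*-comm _ _) (*-comm _ _) lt)
      ... | inj₂ eq = inj₂ (trans (*-comm _ _) (trans eq (*-comm _ _)))

  -- An approximate solution u of F(t , u) = 0 is close to the graph of h, since ∂F/∂y ≠ 0, hence to
  -- the graph of h̃, so it is an approximate solution of F̃(t , u) = 0.
  transfer-order : ∀ {e F F̃ a b h h̃ t u} → Graph F a b h → Graph F̃ a b h̃ → Agree e h h̃ a →
    ¬ ZX.eval (fibre (ZXY.derivative F) a) b ≈ᶻ Z.0# →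
    Lim t a → Lim u b → Big 1 (λ τ → t τ -ᶻ a) →
    Big e (λ τ → ZX.eval (fibre F (t τ)) (u τ)) → Big e (λ τ → ZX.eval (fibre F̃ (t τ)) (u τ))
  transfer-order {e} {F} {F̃} {a} {b} {h} {h̃} {t} {u} G G̃ agree Fy≉0 lt lu linear big =
    Big-resp {e} (weaken (λ τ _ root → Z.trans (Z.trans (Z.*-comm _ _) (Z.sym (EZ.dd-difference (fibre F̃ (t τ)) (u τ) (h̃ (t τ)))))
        (Z.trans (Z.+-congˡ (Z.-‿cong root)) (ZS.solve 1 (λ x → x ZS.:- ZS.:# 0 ZS.:= x) Z.refl _))) (Graph.vanish G̃ lt))
      (Big-* {e} (Lim⇒Bdd (Lim-dd F̃ lt lu (Graph.limit G̃ lt))) u-h̃)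
    where
    diagonal : EZ.dd (fibre F a) b b ≈ᶻ ZX.eval (fibre (ZXY.derivative F) a) b
    diagonal = Z.trans (EZ.dd-diagonal (fibre F a) b) (EZ.eval-cong (CommutativeRing.sym ZX.ring[X] (derivative-natural (EZ.at-point a) F)) Z.refl)
    u-h : Big e (λ τ → u τ -ᶻ h (t τ))
    u-h = Big-cancel {e} (Lim-dd F lt lu (Graph.limit G lt)) (λ eq → Fy≉0 (Z.trans (Z.sym diagonal) eq))
      (Big-resp {e} (weaken (λ τ _ root → Z.trans (Z.trans (ZS.solve 1 (λ x → x ZS.:= x ZS.:- ZS.:# 0) Z.refl _) (Z.+-congˡ (Z.-‿cong (Z.sym root))))
          (EZ.dd-difference (fibre F (t τ)) (u τ) (h (t τ)))) (Graph.vanish G lt)) big)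
    u-h̃ : Big e (λ τ → u τ -ᶻ h̃ (t τ))
    u-h̃ = Big-resp {e} (always λ τ _ → ZS.solve 3 (λ u h k → (u ZS.:- h) ZS.:+ (h ZS.:- k) ZS.:= u ZS.:- k) Z.refl (u τ) (h (t τ)) (h̃ (t τ)))
      (Big-+ {e} u-h (Agree⇒Big {e} {h = h} {h̃} agree lt linear))

-- Linear changes of coordinates

module Substitution (R : CRing) where
  open CommutativeRing R hiding (zero)
  private
    module RX  = Poly R
    module RXY = Poly RX.ring[X]
    module C   = CommutativeRing RX.ring[X]
    module P   = CommutativeRing RXY.ring[X]

  scalar : Hom R RXY.ring[X]
  scalar = constant RX.ring[X] ∘H constant R

  xᴾ yᴾ : List (List Carrier)
  xᴾ = RX.X ∷ []
  yᴾ = RXY.X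

  linear-form : Carrier → Carrier → List (List Carrier)
  linear-form α β = scalar ⟪ α ⟫ P.* xᴾ P.+ scalar ⟪ β ⟫ P.* yᴾ

  -- f(αx + βy , γx + δy)
  substitute : (α β γ δ : Carrier) → Hom RXY.ring[X] RXY.ring[X]
  substitute α β γ δ = evalHom (evalHom scalar (linear-form α β)) (linear-form γ δ)

  module _ {B : CRing} (κ : Hom R B) (x y : ∣ B ∣ᶜ) where
    private
      module B  = CommutativeRing B
      module EB = Evaluation B

    at-pair : Hom RXY.ring[X] B
    at-pair = evalHom (evalHom κ x) y

    at-scalar : ∀ a → at-pair ⟪ scalar ⟪ a ⟫ ⟫ B.≈ κ ⟪ a ⟫
    at-scalar a = B.trans (EB.eval-const (evalHom κ x ⟪ a ∷ [] ⟫) y) (EB.eval-const (κ ⟪ a ⟫) x)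

    at-x : at-pair ⟪ xᴾ ⟫ B.≈ x
    at-x = B.trans (EB.eval-const (evalHom κ x ⟪ RX.X ⟫) y)
      (B.trans (B.+-cong (Hom.0-homo κ) (B.*-congˡ (B.+-congʳ (Hom.1-homo κ)))) (EB.eval-X x))

    at-y : at-pair ⟪ yᴾ ⟫ B.≈ y
    at-y = B.trans (B.+-congˡ (B.*-congˡ (B.+-congʳ (Hom.1-homo (evalHom κ x))))) (EB.eval-X y)

    at-linear-form : ∀ α β → at-pair ⟪ linear-form α β ⟫ B.≈ κ ⟪ α ⟫ B.* x B.+ κ ⟪ β ⟫ B.* y
    at-linear-form α β = B.trans (Hom.+-homo at-pair (scalar ⟪ α ⟫ P.* xᴾ) (scalar ⟪ β ⟫ P.* yᴾ)) (B.+-cong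
      (B.trans (Hom.*-homo at-pair (scalar ⟪ α ⟫) xᴾ) (B.*-cong (at-scalar α) at-x))
      (B.trans (Hom.*-homo at-pair (scalar ⟪ β ⟫) yᴾ) (B.*-cong (at-scalar β) at-y)))

    at-substitute : ∀ {u v} α β γ δ → κ ⟪ α ⟫ B.* x B.+ κ ⟪ β ⟫ B.* y B.≈ u → κ ⟪ γ ⟫ B.* x B.+ κ ⟪ δ ⟫ B.* y B.≈ v →
      ∀ f → at-pair ⟪ substitute α β γ δ ⟪ f ⟫ ⟫ B.≈ evalHom (evalHom κ u) v ⟪ f ⟫
    at-substitute α β γ δ equ eqv = evalHom-natural (evalHom scalar (linear-form α β)) at-pair (evalHom κ _) (linear-form γ δ)
      (evalHom-natural scalar at-pair κ (linear-form α β) at-scalar (B.trans (at-linear-form α β) equ))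
      (B.trans (at-linear-form γ δ) eqv)

  at-pair-cong : ∀ {B} (κ : Hom R B) {x y x′ y′} → CommutativeRing._≈_ B x x′ → CommutativeRing._≈_ B y y′ →
    ∀ f → CommutativeRing._≈_ B (at-pair κ x y ⟪ f ⟫) (at-pair κ x′ y′ ⟪ f ⟫)
  at-pair-cong {B} κ eq eq′ f = evalHom-natural (evalHom κ _) idHom (evalHom κ _) _ (λ c → evalHom-cong κ eq c) eq′ f

module SeriesSubstitution (em : ExcludedMiddle 0ℓ) (𝔽 : Field) where
  open Field 𝔽
  open CommutativeRing cring hiding (zero)
  open SeriesOverField em 𝔽
  open Substitution cring public
  open Algebra.Properties.Semiring.Mult semiring using (×-assoc-*; ×-congʳ) renaming (_×_ to _·_)
  private
    module FX  = Poly cring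
    module FXY = Poly FX.ring[X]
    module S   = Integers cring
    module H   = CommutativeRing series
    module HS  = Integers series
    module EF  = Evaluation cring

  at-pair-point : ∀ x y f → at-pair idHom x y ⟪ f ⟫ ≈ point x y ⟪ f ⟫
  at-pair-point x y f = evalHom-natural (evalHom idHom x) idHom (EF.at-point x) y (evalHom-id {cring} x) refl f

  point-cong : ∀ {x y x′ y′} → x ≈ x′ → y ≈ y′ → ∀ f → point x y ⟪ f ⟫ ≈ point x′ y′ ⟪ f ⟫
  point-cong eq eq′ f = trans (sym (at-pair-point _ _ f)) (trans (at-pair-cong idHom eq eq′ f) (at-pair-point _ _ f))

  point-substitute : ∀ {x y u v} α β γ δ → α * x + β * y ≈ u → γ * x + δ * y ≈ v →
    ∀ f → point x y ⟪ substitute α β γ δ ⟪ f ⟫ ⟫ ≈ point u v ⟪ f ⟫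
  point-substitute {x} {y} {u} {v} α β γ δ equ eqv f = trans (sym (at-pair-point x y (substitute α β γ δ ⟪ f ⟫)))
    (trans (at-substitute idHom x y α β γ δ equ eqv f) (at-pair-point u v f))

  -- Read off from the expansion of f(αx + βy , γx + δy) along the vertical line through (x , y).
  ∂y-substitute : ∀ {x y u v} α β γ δ → α * x + β * y ≈ u → γ * x + δ * y ≈ v → ∀ f →
    point x y ⟪ FXY.derivative (substitute α β γ δ ⟪ f ⟫) ⟫ ≈ point u v ⟪ map FX.derivative f ⟫ * β + point u v ⟪ FXY.derivative f ⟫ * δ
  ∂y-substitute {x} {y} {u} {v} α β γ δ equ eqv f = begin
    point x y ⟪ FXY.derivative g ⟫
      ≈⟨ S.solve 2 (λ p q → p S.:= q S.:* S.:# 0 S.:+ p S.:* S.:# 1) refl _ _ ⟩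
    point x y ⟪ map FX.derivative g ⟫ * 0# + point x y ⟪ FXY.derivative g ⟫ * 1#
      ≈⟨ +-cong (*-congʳ (atXY-0 X Y (map FX.derivative g))) (*-congʳ (atXY-0 X Y (FXY.derivative g))) ⟨
    tailForm X Y g
      ≈⟨ tail-atXY X Y g .at 0 ⟨
    (atXY X Y ⟪ g ⟫) 1
      ≈⟨ at-substitute ιHom X Y {U} {V} α β γ δ H.refl H.refl f .at 1 ⟩
    (atXY U V ⟪ f ⟫) 1
      ≈⟨ tail-atXY U V f .at 0 ⟩
    (atXY U V ⟪ map FX.derivative f ⟫) 0 * U 1 + (atXY U V ⟪ FXY.derivative f ⟫) 0 * V 1
      ≈⟨ +-cong (*-cong (trans (atXY-0 U V (map FX.derivative f)) (point-cong equ eqv (map FX.derivative f))) (slope α β))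
           (*-cong (trans (atXY-0 U V (FXY.derivative f)) (point-cong equ eqv (FXY.derivative f))) (slope γ δ)) ⟩
    point u v ⟪ map FX.derivative f ⟫ * β + point u v ⟪ FXY.derivative f ⟫ * δ ∎
    where
    open Relation.Binary.Reasoning.Setoid setoid
    g = substitute α β γ δ ⟪ f ⟫
    X = ι x
    Y = coordinate y
    U = ι α ⊠ X ⊞ ι β ⊠ Y
    V = ι γ ⊠ X ⊞ ι δ ⊠ Y
    tailForm : Series → Series → List (List Carrier) → Carrier
    tailForm X Y g = (atXY X Y ⟪ map FX.derivative g ⟫) 0 * X 1 + (atXY X Y ⟪ FXY.derivative g ⟫) 0 * Y 1
    slope : ∀ α β → (ι α ⊠ X ⊞ ι β ⊠ Y) 1 ≈ β
    slope α β = S.solve 4 (λ α β x y → (S.:# 0 S.:* x S.:+ α S.:* S.:# 0) S.:+ (S.:# 0 S.:* y S.:+ β S.:* S.:# 1) S.:= β) refl α β x y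

  atXY-cong< : ∀ {n X X′ Y Y′} → X ≈[ n ] X′ → Y ≈[ n ] Y′ → ∀ f → atXY X Y ⟪ f ⟫ ≈[ n ] atXY X′ Y′ ⟪ f ⟫
  atXY-cong< eq eq′ []      = mk≈< λ _ _ → refl
  atXY-cong< eq eq′ (c ∷ f) = ⊞-cong< (eval-cong< (map ι c) eq) (⊠-cong< eq′ (atXY-cong< eq eq′ f))

  coefficients⇒series : ∀ n q → (∀ i → i ℕ.< n → FX.coeff q i ≈ 0#) → atX θ ⟪ q ⟫ ≈[ n ] H.0#
  coefficients⇒series n       []      eq = mk≈< λ _ _ → refl
  coefficients⇒series (suc n) (a ∷ q) eq .below zero    _ = trans (+-cong (eq 0 (s≤s z≤n)) (zeroˡ _)) (+-identityʳ 0#)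
  coefficients⇒series (suc n) (a ∷ q) eq .below (suc i) (s≤s i<n) = trans (+-identityˡ _) (trans (θ-⊠ (atX θ ⟪ q ⟫) i)
    (trans (×-congʳ (suc i) (coefficients⇒series n q (λ i i<n → eq (suc i) (s≤s i<n)) .below i i<n)) (multiple-zero (suc i))))
    where
    multiple-zero : ∀ n → n · 0# ≈ 0#
    multiple-zero zero    = refl
    multiple-zero (suc n) = trans (+-identityˡ _) (multiple-zero n)

  series⇒coefficients : ∀ n q → atX θ ⟪ q ⟫ ≈[ n ] H.0# → ∀ i → i ℕ.< n → FX.coeff q i ≈ 0#
  series⇒coefficients n       []      eq i       _         = refl
  series⇒coefficients (suc n) (a ∷ q) eq zero    _         = trans (sym (+-identityʳ a)) (trans (+-congˡ (sym (zeroˡ _))) (eq .below 0 (s≤s z≤n)))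
  series⇒coefficients (suc n) (a ∷ q) eq (suc i) (s≤s i<n) = series⇒coefficients n q (mk≈< λ j j<n →
    ·-zero j (trans (sym (θ-⊠ (atX θ ⟪ q ⟫) j)) (trans (sym (+-identityˡ _)) (eq .below (suc j) (s≤s j<n))))) i i<n

  -- Entries are derivatives, so they must be divided by factorials to become coefficients. Each
  -- stage of Horner's scheme divides by the current index and shifts, which amounts to 1/i! for
  -- entry i.
  taylor : ∀ n Y → ∃ λ q → atX θ ⟪ q ⟫ ≈[ n ] Y
  taylor zero    Y = [] , mk≈< λ _ ()
  taylor (suc n) Y = let q , q≈ = taylor n b in Y 0 ∷ q , mk≈< λ
    { zero _ → trans (+-congˡ (zeroˡ _)) (+-identityʳ _)
    ; (suc i) (s≤s i<n) → trans (+-identityˡ _) (trans (θ-⊠ (atX θ ⟪ q ⟫) i) (trans (×-congʳ (suc i) (q≈ .below i i<n)) (b-multiple i))) }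
    where
    i⁻¹ : ∀ i → ∃ λ u → u * (suc i · 1#) ≈ 1#
    i⁻¹ i = inverse (suc i · 1#) (char-0 i)
    b : Series
    b i = proj₁ (i⁻¹ i) * Y (suc i)
    b-multiple : ∀ i → suc i · b i ≈ Y (suc i)
    b-multiple i = trans (×-congʳ (suc i) (sym (*-identityˡ (b i)))) (trans (sym (×-assoc-* (suc i) 1# (b i)))
      (trans (S.solve 3 (λ m u y → m S.:* (u S.:* y) S.:= u S.:* m S.:* y) refl _ _ _)
        (trans (*-congʳ (proj₂ (i⁻¹ i))) (*-identityˡ _))))

-- Tangency as agreement of branches

module Tangency (em : ExcludedMiddle 0ℓ) (R : OrderedField) where
  open Complex R using (ℂ′; ℂ-ring; ℂ-field; _≈ᶻ_)
  open Limits R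
  open SeriesOverField em ℂ-field
  open SeriesSubstitution em ℂ-field
  private
    module Z   = CommutativeRing ℂ-ring
    module ZS  = Integers ℂ-ring
    module FX  = Poly ℂ-ring
    module FXY = Poly FX.ring[X]
    module C   = CommutativeRing FX.ring[X]
    module EZ  = Evaluation ℂ-ring
    module H   = CommutativeRing series
    module HS  = Integers series

  shear : ℂ′ → Hom FXY.ring[X] FXY.ring[X]
  shear λ′ = substitute Z.1# λ′ Z.0# Z.1#

  rotation : ℂ′ → ℂ′ → Hom FXY.ring[X] FXY.ring[X]
  rotation c s = substitute c s (Z.- s) c

  -- Three systems of coordinates meet at one point: it is `(x , y)` after the shear, in which
  -- branches are expanded, `(x + λ′ y , y)` in the plane of the statement, and `(a , b)` after the
  -- rotation, in which tangency is defined.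
  module _ (P : List (List ℂ′)) (P̃ : List (List ℂ′)) (λ′ c s : ℂ′) (unit : c Z.* c Z.+ s Z.* s Z.≈ Z.1#) (x y a b : ℂ′)
           (a≈ : c Z.* (x Z.+ λ′ Z.* y) Z.- s Z.* y Z.≈ a) (b≈ : s Z.* (x Z.+ λ′ Z.* y) Z.+ c Z.* y Z.≈ b)
           {h h̃ : ℂ′ → ℂ′} {k : ℕ}
           (G : Graph (rotation c s ⟪ P ⟫) a b h) (G̃ : Graph (rotation c s ⟪ P̃ ⟫) a b h̃) (agree : Agree (suc k) h h̃ a)
           (not-vertical : ¬ point a b ⟪ FXY.derivative (rotation c s ⟪ P ⟫) ⟫ Z.≈ Z.0#)
           {Y : Series} (Y₀ : Y 0 Z.≈ y) (Y-root : atXY (coordinate x) Y ⟪ shear λ′ ⟪ P ⟫ ⟫ ≈ˢ H.0#) where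
    private
      X = coordinate x
      ξ = X ⊞ ι λ′ ⊠ Y

      Ŷ X̂ t̂ û : List ℂ′
      -- The truncated branch as a polynomial arc, whose parameter is the sheared abscissa measured
      -- from `x`: first in the original coordinates, then in the rotated ones.
      Ŷ = proj₁ (taylor (suc k) Y)
      X̂ = (x ∷ Z.1# ∷ []) C.+ (λ′ ∷ []) C.* Ŷ
      t̂ = (c ∷ []) C.* X̂ C.- (s ∷ []) C.* Ŷ
      û = (s ∷ []) C.* X̂ C.+ (c ∷ []) C.* Ŷ

      ρ : Hom FX.ring[X] series
      ρ = atX θ

      ρŶ : ρ ⟪ Ŷ ⟫ ≈[ suc k ] Y
      ρŶ = proj₂ (taylor (suc k) Y)

      ρ-scalar : ∀ d → ρ ⟪ d ∷ [] ⟫ ≈ˢ ι d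
      ρ-scalar d = Evaluation.eval-const series (ι d) θ

      ρX̂ : ρ ⟪ X̂ ⟫ ≈[ suc k ] ξ
      ρX̂ = ≈<-trans (≈ˢ⇒≈< (H.trans (Hom.+-homo ρ (x ∷ Z.1# ∷ []) ((λ′ ∷ []) C.* Ŷ)) (H.+-cong coordinate-poly
          (H.trans (Hom.*-homo ρ (λ′ ∷ []) Ŷ) (H.*-congʳ {ρ ⟪ Ŷ ⟫} (ρ-scalar λ′))))))
        (⊞-cong< (mk≈< λ _ _ → Z.refl) (⊠-cong< (mk≈< λ _ _ → Z.refl) ρŶ))
        where
        coordinate-poly : ρ ⟪ x ∷ Z.1# ∷ [] ⟫ ≈ˢ X
        coordinate-poly = H.trans (H.+-congˡ {ι x} (H.*-congˡ {θ} (H.trans (H.+-congˡ {H.1#} (H.zeroʳ θ)) (H.+-identityʳ H.1#))))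
          (H.trans (H.+-congˡ {ι x} (H.*-identityʳ θ)) (mk≈ λ { zero → Z.+-identityʳ x ; (suc zero) → Z.+-identityˡ Z.1# ; (suc (suc n)) → Z.+-identityˡ Z.0# }))

      ρt̂ : ρ ⟪ t̂ ⟫ ≈ˢ ι c ⊠ ρ ⟪ X̂ ⟫ H.- ι s ⊠ ρ ⟪ Ŷ ⟫
      ρt̂ = H.trans (Hom.sub-homo ρ ((c ∷ []) C.* X̂) ((s ∷ []) C.* Ŷ)) (H.+-cong
        (H.trans (Hom.*-homo ρ (c ∷ []) X̂) (H.*-congʳ {ρ ⟪ X̂ ⟫} (ρ-scalar c)))
        (H.-‿cong (H.trans (Hom.*-homo ρ (s ∷ []) Ŷ) (H.*-congʳ {ρ ⟪ Ŷ ⟫} (ρ-scalar s)))))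

      ρû : ρ ⟪ û ⟫ ≈ˢ ι s ⊠ ρ ⟪ X̂ ⟫ ⊞ ι c ⊠ ρ ⟪ Ŷ ⟫
      ρû = H.trans (Hom.+-homo ρ ((s ∷ []) C.* X̂) ((c ∷ []) C.* Ŷ)) (H.+-cong
        (H.trans (Hom.*-homo ρ (s ∷ []) X̂) (H.*-congʳ {ρ ⟪ X̂ ⟫} (ρ-scalar s)))
        (H.trans (Hom.*-homo ρ (c ∷ []) Ŷ) (H.*-congʳ {ρ ⟪ Ŷ ⟫} (ρ-scalar c))))

      unitˢ : ι c ⊠ ι c ⊞ ι s ⊠ ι s ≈ˢ H.1#
      unitˢ = H.trans (H.sym (H.trans (Hom.+-homo ιHom (c Z.* c) (s Z.* s)) (H.+-cong (Hom.*-homo ιHom c c) (Hom.*-homo ιHom s s)))) (Hom.cong ιHom unit)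

      back-x : ι c ⊠ ρ ⟪ t̂ ⟫ ⊞ ι s ⊠ ρ ⟪ û ⟫ ≈ˢ ρ ⟪ X̂ ⟫
      back-x = H.trans (H.+-cong (H.*-congˡ {ι c} ρt̂) (H.*-congˡ {ι s} ρû)) (H.trans
        (HS.solve 4 (λ c s x y → c HS.:* (c HS.:* x HS.:- s HS.:* y) HS.:+ s HS.:* (s HS.:* x HS.:+ c HS.:* y) HS.:= (c HS.:* c HS.:+ s HS.:* s) HS.:* x)
          H.refl (ι c) (ι s) (ρ ⟪ X̂ ⟫) (ρ ⟪ Ŷ ⟫))
        (H.trans (H.*-congʳ {ρ ⟪ X̂ ⟫} unitˢ) (H.*-identityˡ (ρ ⟪ X̂ ⟫))))

      back-y : ι (Z.- s) ⊠ ρ ⟪ t̂ ⟫ ⊞ ι c ⊠ ρ ⟪ û ⟫ ≈ˢ ρ ⟪ Ŷ ⟫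
      back-y = H.trans (H.+-cong (H.*-cong (Hom.neg-homo ιHom s) ρt̂) (H.*-congˡ {ι c} ρû)) (H.trans
        (HS.solve 4 (λ c s x y → (HS.:- s) HS.:* (c HS.:* x HS.:- s HS.:* y) HS.:+ c HS.:* (s HS.:* x HS.:+ c HS.:* y) HS.:= (c HS.:* c HS.:+ s HS.:* s) HS.:* y)
          H.refl (ι c) (ι s) (ρ ⟪ X̂ ⟫) (ρ ⟪ Ŷ ⟫))
        (H.trans (H.*-congʳ {ρ ⟪ Ŷ ⟫} unitˢ) (H.*-identityˡ (ρ ⟪ Ŷ ⟫))))

      -- f in rotated coordinates, along the truncated expansion
      along : List (List ℂ′) → List ℂ′
      along f = at-pair (constant ℂ-ring) t̂ û ⟪ rotation c s ⟪ f ⟫ ⟫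

      along-series : ∀ f → ρ ⟪ along f ⟫ ≈[ suc k ] atXY X Y ⟪ shear λ′ ⟪ f ⟫ ⟫
      along-series f = ≈<-trans (≈ˢ⇒≈< (H.trans
          (evalHom-natural (evalHom (constant ℂ-ring) t̂) ρ (evalHom ιHom (ρ ⟪ t̂ ⟫)) û
            (evalHom-natural (constant ℂ-ring) ρ ιHom t̂ ρ-scalar H.refl) H.refl (rotation c s ⟪ f ⟫))
          (at-substitute ιHom (ρ ⟪ t̂ ⟫) (ρ ⟪ û ⟫) c s (Z.- s) c back-x back-y f)))
        (≈<-trans (atXY-cong< ρX̂ ρŶ f) (≈ˢ⇒≈< (H.sym (at-substitute ιHom X Y {ξ} {Y} Z.1# λ′ Z.0# Z.1#
          (H.+-congʳ {ι λ′ ⊠ Y} (H.*-identityˡ X))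
          (H.trans (H.+-cong (H.trans (H.*-congʳ {X} (Hom.0-homo ιHom)) (H.zeroˡ X)) (H.*-identityˡ Y)) (H.+-identityˡ Y)) f))))

      t u : CommutativeRing.Carrier (OrderedField.cring R) → ℂ′
      t τ = FX.eval t̂ (real τ)
      u τ = FX.eval û (real τ)

      along-point : ∀ f τ → FX.eval (along f) (real τ) Z.≈ FX.eval (map (λ d → FX.eval d (t τ)) (rotation c s ⟪ f ⟫)) (u τ)
      along-point f τ = evalHom-natural (evalHom (constant ℂ-ring) t̂) (EZ.at-point (real τ)) (EZ.at-point (t τ)) û
        (λ d → Z.trans (evalHom-natural (constant ℂ-ring) (EZ.at-point (real τ)) idHom t̂ (λ e → EZ.eval-const e (real τ)) Z.refl d) (evalHom-id {ℂ-ring} (t τ) d))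
        Z.refl (rotation c s ⟪ f ⟫)

      value-X̂ : (ρ ⟪ X̂ ⟫) 0 Z.≈ x Z.+ λ′ Z.* y
      value-X̂ = Z.trans (ρX̂ .below 0 (s≤s z≤n)) (Z.+-congˡ {x} (Z.*-congˡ {λ′} Y₀))

      value-Ŷ : (ρ ⟪ Ŷ ⟫) 0 Z.≈ y
      value-Ŷ = Z.trans (ρŶ .below 0 (s≤s z≤n)) Y₀

      t̂₀ : FX.eval t̂ Z.0# Z.≈ a
      t̂₀ = Z.trans (Z.sym (atX-0 θ t̂)) (Z.trans (ρt̂ .at 0) (Z.trans (Z.+-cong (Z.*-congˡ {c} value-X̂) (Z.-‿cong (Z.*-congˡ {s} value-Ŷ))) a≈))

      û₀ : FX.eval û Z.0# Z.≈ b
      û₀ = Z.trans (Z.sym (atX-0 θ û)) (Z.trans (ρû .at 0) (Z.trans (Z.+-cong (Z.*-congˡ {s} value-X̂) (Z.*-congˡ {c} value-Ŷ)) b≈))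

      lim-t : Lim t a
      lim-t = Lim-resp (λ _ → Z.refl) t̂₀ (Lim-eval t̂ Lim-real)

      lim-u : Lim u b
      lim-u = Lim-resp (λ _ → Z.refl) û₀ (Lim-eval û Lim-real)

      linear-t : Big 1 (λ τ → t τ -ᶻ a)
      linear-t = Big-resp {1} (always λ τ _ → Z.trans (Hom.sub-homo (EZ.at-point (real τ)) t̂ (a ∷ [])) (Z.+-congˡ (Z.-‿cong (EZ.eval-const a (real τ)))))
        (coefficients⇒Big 1 (t̂ C.- (a ∷ [])) λ { zero _ → Z.trans (value (t̂ C.- (a ∷ []))) (Z.trans (Hom.sub-homo (EZ.at-point Z.0#) t̂ (a ∷ []))
            (Z.trans (Z.+-cong t̂₀ (Z.-‿cong (EZ.eval-const a Z.0#))) (Z.-‿inverseʳ a))) ; (suc _) (s≤s ()) })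
        where
        value : ∀ q → FX.coeff q 0 Z.≈ FX.eval q Z.0#
        value []      = Z.refl
        value (d ∷ q) = ZS.solve 2 (λ d v → d ZS.:= d ZS.:+ ZS.:# 0 ZS.:* v) Z.refl d (FX.eval q Z.0#)

    -- To be read from the inside out. The arc agrees with a branch of `P` to order k + 1, so `P` is
    -- O(τ^(k+1)) along it; `transfer-order` carries this estimate over to `P̃`; finally the
    -- estimate is turned back into vanishing coefficients.
    other-vanishes : atXY (coordinate x) Y ⟪ shear λ′ ⟪ P̃ ⟫ ⟫ ≈[ suc k ] H.0#
    other-vanishes = ≈<-trans (≈<-sym (along-series P̃)) (coefficients⇒series (suc k) (along P̃)
      (Big⇒coefficients stable (suc k) (along P̃) (Big-resp {suc k} (always λ τ _ → Z.sym (along-point P̃ τ))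
        (transfer-order {suc k} {rotation c s ⟪ P ⟫} {rotation c s ⟪ P̃ ⟫} {t = t} {u} G G̃ agree not-vertical lim-t lim-u linear-t
          (Big-resp {suc k} (always λ τ _ → along-point P τ)
            (coefficients⇒Big (suc k) (along P) (series⇒coefficients (suc k) (along P) (≈<-trans (along-series P) (≈ˢ⇒≈< Y-root)))))))))
      where
      stable : ∀ z → ¬ ¬ z ≈ᶻ Z.0# → z ≈ᶻ Z.0#
      stable z ¬¬ with em {z ≈ᶻ Z.0#}
      ... | yes eq = eq
      ... | no neq = ⊥-elim (¬¬ neq)

    branches-agree : ∀ {Ỹ} → Ỹ 0 Z.≈ y → atXY (coordinate x) Ỹ ⟪ shear λ′ ⟪ P̃ ⟫ ⟫ ≈ˢ H.0# →
      ¬ point x y ⟪ FXY.derivative (shear λ′ ⟪ P̃ ⟫) ⟫ Z.≈ Z.0# → Y ≈[ suc k ] Ỹ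
    branches-agree Ỹ₀ Ỹ-root ∂y≉0 = solution-unique (suc k) (coordinate x) (shear λ′ ⟪ P̃ ⟫) Y₀ Ỹ₀ ∂y≉0
      (≈<-trans other-vanishes (≈ˢ⇒≈< (H.sym Ỹ-root)))

-- The raw polynomial rings of the statement differ from those used here in their equality, hence
-- their operations agree only propositionally.
module SameOperations {C : Set} (_≈₁_ _≈₂_ : C → C → Set) (_+₁_ _+₂_ _*₁_ _*₂_ : C → C → C) (-₁_ -₂_ : C → C) (0# 1# : C)
  (+≡ : ∀ x y → x +₁ y ≡ x +₂ y) (*≡ : ∀ x y → x *₁ y ≡ x *₂ y) where

  private
    R₁ R₂ : RawRing 0ℓ 0ℓ
    R₁ = record { _≈_ = _≈₁_ ; _+_ = _+₁_ ; _*_ = _*₁_ ; -_ = -₁_ ; 0# = 0# ; 1# = 1# }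
    R₂ = record { _≈_ = _≈₂_ ; _+_ = _+₂_ ; _*_ = _*₂_ ; -_ = -₂_ ; 0# = 0# ; 1# = 1# }
    module P₁ = Polynomial R₁
    module P₂ = Polynomial R₂

  coeff-same : ∀ p n → P₁.coeff p n ≡ P₂.coeff p n
  coeff-same []      n       = ≡.refl
  coeff-same (a ∷ p) zero    = ≡.refl
  coeff-same (a ∷ p) (suc n) = coeff-same p n

  ⊕-same : ∀ p q → p P₁.⊕ q ≡ p P₂.⊕ q
  ⊕-same []      q       = ≡.refl
  ⊕-same (a ∷ p) []      = ≡.refl
  ⊕-same (a ∷ p) (b ∷ q) = ≡.cong₂ _∷_ (+≡ a b) (⊕-same p q)

  ⊗-same : ∀ p q → p P₁.⊗ q ≡ p P₂.⊗ q
  ⊗-same []      q = ≡.refl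
  ⊗-same (a ∷ p) q = ≡.trans (⊕-same (map (a *₁_) q) (0# ∷ p P₁.⊗ q))
    (≡.cong₂ P₂._⊕_ (List.map-cong (*≡ a) q) (≡.cong (0# ∷_) (⊗-same p q)))

  eval-same : ∀ p x → P₁.eval p x ≡ P₂.eval p x
  eval-same []      x = ≡.refl
  eval-same (a ∷ p) x = ≡.trans (+≡ a _) (≡.cong (a +₂_) (≡.trans (*≡ x _) (≡.cong (x *₂_) (eval-same p x))))

  derivative-same : ∀ p → P₁.derivative p ≡ P₂.derivative p
  derivative-same []      = ≡.refl
  derivative-same (a ∷ p) = ≡.trans (⊕-same p _) (≡.cong (λ q → p P₂.⊕ (0# ∷ q)) (derivative-same p))

module _ {A B : CRing} (φ : Hom A B) (ψ : Hom B A)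
         (φψ : ∀ b → CommutativeRing._≈_ B (φ ⟪ ψ ⟪ b ⟫ ⟫) b) (ψφ : ∀ a → CommutativeRing._≈_ A (ψ ⟪ φ ⟪ a ⟫ ⟫) a) where
  private
    module A = CommutativeRing A

  unit-image : ∀ {C D : CRing} (χ : Hom C D) {a} → Unit C a → Unit D (χ ⟪ a ⟫)
  unit-image {C} {D} χ {a} (k , eq) = χ ⟪ k ⟫ , D.trans (D.sym (Hom.*-homo χ k a)) (D.trans (Hom.cong χ eq) (Hom.1-homo χ))
    where module D = CommutativeRing D

  unit-resp : ∀ {C : CRing} {a b} → CommutativeRing._≈_ C a b → Unit C a → Unit C b
  unit-resp {C} eq (k , ka≈1) = k , C.trans (C.*-congˡ (C.sym eq)) ka≈1
    where module C = CommutativeRing C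

  isomorphism-irreducible : ∀ {p} → Irreducibleᴿ A p → Irreducibleᴿ B (φ ⟪ p ⟫)
  isomorphism-irreducible {p} irr = record
    { nonunit = λ u → nonunit (unit-resp {A} (ψφ p) (unit-image ψ u))
    ; split = λ x y eq → [ (λ u → inj₁ (unit-resp {B} (φψ x) (unit-image φ u))) , (λ u → inj₂ (unit-resp {B} (φψ y) (unit-image φ u))) ]′
        (split (ψ ⟪ x ⟫) (ψ ⟪ y ⟫) (A.trans (A.sym (ψφ p)) (A.trans (Hom.cong ψ eq) (Hom.*-homo ψ x y))))
    }
    where open Irreducibleᴿ irr

-- Inverses, irreducibility and degrees under shears

module Shears (R : CRing) where
  open CommutativeRing R hiding (zero)
  open Substitution R
  open BoundedDegree R
  private
    module S   = Integers R
    module RX  = Poly R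
    module RXY = Poly RX.ring[X]
    module C   = CommutativeRing RX.ring[X]
    module P   = CommutativeRing RXY.ring[X]
    module PS  = Integers RXY.ring[X]

  substitute-id : ∀ f → at-pair scalar xᴾ yᴾ ⟪ f ⟫ P.≈ f
  substitute-id f = P.sym (eval-unique idHom (evalHom scalar xᴾ) yᴾ
    (eval-unique (constant RX.ring[X]) scalar xᴾ (λ _ → P.refl) (P.refl {xᴾ})) (P.refl {yᴾ}) f)

  shear-inverse : ∀ a b → a + b ≈ 0# → ∀ f → substitute 1# b 0# 1# ⟪ substitute 1# a 0# 1# ⟪ f ⟫ ⟫ P.≈ f
  shear-inverse a b a+b≈0 f = P.trans
    (at-substitute scalar (linear-form 1# b) (linear-form 0# 1#) 1# a 0# 1# u≈x v≈y f) (substitute-id f)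
    where
    v≈y′ : linear-form 0# 1# P.≈ yᴾ
    v≈y′ = P.trans (P.+-cong (P.trans (P.*-congʳ {xᴾ} (Hom.0-homo scalar)) (P.zeroˡ xᴾ))
      (P.trans (P.*-congʳ {yᴾ} (Hom.1-homo scalar)) (P.*-identityˡ yᴾ))) (P.+-identityˡ yᴾ)
    v≈y : scalar ⟪ 0# ⟫ P.* linear-form 1# b P.+ scalar ⟪ 1# ⟫ P.* linear-form 0# 1# P.≈ yᴾ
    v≈y = P.trans (P.+-cong (P.trans (P.*-congʳ {linear-form 1# b} (Hom.0-homo scalar)) (P.zeroˡ (linear-form 1# b)))
      (P.trans (P.*-congʳ {linear-form 0# 1#} (Hom.1-homo scalar)) (P.trans (P.*-identityˡ (linear-form 0# 1#)) v≈y′))) (P.+-identityˡ yᴾ)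
    u≈x : scalar ⟪ 1# ⟫ P.* linear-form 1# b P.+ scalar ⟪ a ⟫ P.* linear-form 0# 1# P.≈ xᴾ
    u≈x = P.trans (P.+-cong (P.trans (P.*-congʳ {linear-form 1# b} (Hom.1-homo scalar)) (P.trans (P.*-identityˡ (linear-form 1# b))
        (P.+-congʳ {scalar ⟪ b ⟫ P.* yᴾ} (P.trans (P.*-congʳ {xᴾ} (Hom.1-homo scalar)) (P.*-identityˡ xᴾ)))))
        (P.*-congˡ {scalar ⟪ a ⟫} v≈y′))
      (P.trans (PS.solve 4 (λ x a b y → x PS.:+ b PS.:* y PS.:+ a PS.:* y PS.:= x PS.:+ (a PS.:+ b) PS.:* y) P.refl xᴾ (scalar ⟪ a ⟫) (scalar ⟪ b ⟫) yᴾ)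
        (P.trans (P.+-congˡ {xᴾ} (P.trans (P.*-congʳ {yᴾ} (P.trans (P.sym (Hom.+-homo scalar a b)) (P.trans (Hom.cong scalar a+b≈0) (Hom.0-homo scalar)))) (P.zeroˡ yᴾ)))
          (P.+-identityʳ xᴾ)))

  shear-irreducible : ∀ a {f} → Irreducibleᴿ RXY.ring[X] f → Irreducibleᴿ RXY.ring[X] (substitute 1# a 0# 1# ⟪ f ⟫)
  shear-irreducible a = isomorphism-irreducible (substitute 1# a 0# 1#) (substitute 1# (- a) 0# 1#)
    (shear-inverse (- a) a (-‿inverseˡ a)) (shear-inverse a (- a) (-‿inverseʳ a))

  private
    eval-∈ : ∀ {A} (φ : Hom A RXY.ring[X]) {z b d} n q → (∀ j → Fil b (φ ⟪ Poly.coeff A q j ⟫)) → Fil d z → Degree A n q →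
      Fil (b ℕ.+ n ℕ.* d) (evalHom φ z ⟪ q ⟫)
    eval-∈ φ n [] q∈ z∈ q≤n = zero∈
    eval-∈ {A} φ {z} {b} zero (a ∷ q) q∈ z∈ q≤n = mono {a = evalHom φ z ⟪ a ∷ q ⟫} (ℕ.m≤m+n b 0)
      (resp (P.trans (P.sym (P.+-identityʳ (φ ⟪ a ⟫))) (P.+-congˡ {φ ⟪ a ⟫} (P.sym (P.trans (P.*-congˡ {z}
        (P.trans (Hom.cong (evalHom φ z) {q} {[]} (Poly.mk≋ λ j → q≤n (suc j) (s≤s z≤n))) (Hom.0-homo (evalHom φ z)))) (P.zeroʳ z))))) (q∈ 0))
    eval-∈ φ {z} {b} {d} (suc n) (a ∷ q) q∈ z∈ q≤n = +-∈ {a = φ ⟪ a ⟫} {b = z P.* evalHom φ z ⟪ q ⟫} (mono {a = φ ⟪ a ⟫} (ℕ.m≤m+n b _) (q∈ 0))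
      (≡.subst (λ i → Fil i (z P.* evalHom φ z ⟪ q ⟫)) swap (*-∈ {a = z} {b = evalHom φ z ⟪ q ⟫} z∈ (eval-∈ φ n q (λ j → q∈ (suc j)) z∈ (λ j n<j → q≤n (suc j) (s≤s n<j)))))
      where
      swap : d ℕ.+ (b ℕ.+ n ℕ.* d) ≡ b ℕ.+ (d ℕ.+ n ℕ.* d)
      swap = +-*-Solver.solve 3 (λ d b c → d +-*-Solver.:+ (b +-*-Solver.:+ c) +-*-Solver.:= b +-*-Solver.:+ (d +-*-Solver.:+ c)) ≡.refl d b (n ℕ.* d)

    scalar-∈ : ∀ c → Fil 0 (scalar ⟪ c ⟫)
    scalar-∈ c = (λ { zero (suc m) _ → refl ; (suc j) m _ → refl }) , λ { (suc j) _ → C.refl }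

    x-∈ : Fil 1 xᴾ
    x-∈ = (λ { zero (suc (suc m)) _ → refl ; zero (suc zero) (s≤s ()) ; (suc j) m _ → refl }) , λ { (suc j) _ → C.refl }

    y-∈ : Fil 1 yᴾ
    y-∈ = (λ { zero m _ → refl ; (suc zero) (suc m) _ → refl ; (suc (suc j)) m _ → refl }) ,
          λ { (suc (suc j)) _ → C.refl ; (suc zero) (s≤s ()) }

    linear-form-∈ : ∀ α β → Fil 1 (linear-form α β)
    linear-form-∈ α β = +-∈ {a = scalar ⟪ α ⟫ P.* xᴾ} {b = scalar ⟪ β ⟫ P.* yᴾ} (*-∈ {a = scalar ⟪ α ⟫} {b = xᴾ} (scalar-∈ α) x-∈)
      (*-∈ {a = scalar ⟪ β ⟫} {b = yᴾ} (scalar-∈ β) y-∈)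

  -- The filtration bounds the degree in each variable separately, and both linear forms contribute
  -- to each new variable, so the bound doubles. Hence the argument runs with 2D for D.
  substitute-∈ : ∀ α β γ δ {D} f → Fil D f → Fil (2 ℕ.* D) (substitute α β γ δ ⟪ f ⟫)
  substitute-∈ α β γ δ {D} f (f∈ , f≤) = ≡.subst (λ i → Fil i (substitute α β γ δ ⟪ f ⟫)) double
    (eval-∈ (evalHom scalar (linear-form α β)) {d = 1} D f
      (λ j → ≡.subst (λ i → Fil i (evalHom scalar (linear-form α β) ⟪ RXY.coeff f j ⟫)) (ℕ.*-identityʳ D)
        (eval-∈ scalar {d = 1} D (RXY.coeff f j) (λ i → scalar-∈ (RX.coeff (RXY.coeff f j) i)) (linear-form-∈ α β) (f∈ j)))
      (linear-form-∈ γ δ) f≤)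
    where
    double : D ℕ.+ D ℕ.* 1 ≡ 2 ℕ.* D
    double = ≡.cong (D ℕ.+_) (≡.trans (ℕ.*-identityʳ D) (≡.sym (ℕ.+-identityʳ D)))

-- Slopes in general position

module GenericSlopes (em : ExcludedMiddle 0ℓ) (𝔽 : Field) where
  open Field 𝔽
  open CommutativeRing cring hiding (zero)
  open Algebra.Properties.Semiring.Mult semiring using () renaming (_×_ to _·_)
  private module S = Integers cring

  -- Slopes are sought among the natural numbers. "For all large m" is preserved by finite
  -- conjunctions, so one slope will serve all curves and points at once.
  Eventuallyᴺ : (ℕ → Set) → Set
  Eventuallyᴺ A = ∃ λ M → ∀ m → M ℕ.≤ m → A m

  eventually-× : ∀ {A B : ℕ → Set} → Eventuallyᴺ A → Eventuallyᴺ B → Eventuallyᴺ (λ m → A m × B m)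
  eventually-× (M , a) (N , b) = M ℕ.⊔ N , λ m le → a m (ℕ.≤-trans (ℕ.m≤m⊔n M N) le) , b m (ℕ.≤-trans (ℕ.m≤n⊔m M N) le)

  eventually-Fin : ∀ {n} {A : Fin n → ℕ → Set} → (∀ i → Eventuallyᴺ (A i)) → Eventuallyᴺ (λ m → ∀ i → A i m)
  eventually-Fin {zero}  ev = 0 , λ _ _ ()
  eventually-Fin {suc n} ev = let M , a = eventually-× (ev zero) (eventually-Fin (λ i → ev (suc i))) in
    M , λ m le → λ { zero → proj₁ (a m le) ; (suc i) → proj₂ (a m le) i }

  eventually-All : ∀ {X : Set} {A : X → ℕ → Set} {xs} → All (λ x → Eventuallyᴺ (A x)) xs → Eventuallyᴺ (λ m → All (λ x → A x m) xs)
  eventually-All []         = 0 , λ _ _ → []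
  eventually-All (ev ∷ evs) = let M , a = eventually-× ev (eventually-All evs) in M , λ m le → proj₁ (a m le) ∷ proj₂ (a m le)

  eventually-AllPairs : ∀ {X : Set} {A : X → X → ℕ → Set} {xs} → AllPairs (λ x y → Eventuallyᴺ (A x y)) xs → Eventuallyᴺ (λ m → AllPairs (λ x y → A x y m) xs)
  eventually-AllPairs []         = 0 , λ _ _ → []
  eventually-AllPairs (ev ∷ evs) = let M , a = eventually-× (eventually-All ev) (eventually-AllPairs evs) in M , λ m le → proj₁ (a m le) ∷ proj₂ (a m le)

  -- A linear polynomial has at most one natural number as a root.
  generic-nonzero : ∀ a b → ¬ (a ≈ 0# × b ≈ 0#) → Eventuallyᴺ (λ m → ¬ a + (m · 1#) * b ≈ 0#)
  generic-nonzero a b nonzero with em {∃ λ m → a + (m · 1#) * b ≈ 0#}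
  ... | no none = 0 , λ m _ eq → none (m , eq)
  ... | yes (m₀ , root) = suc m₀ , λ m m₀<m eq → two-roots m m₀<m eq
    where
    open Algebra.Properties.Semiring.Mult semiring using (×-homo-+)
    two-roots : ∀ m → m₀ ℕ.< m → ¬ a + (m · 1#) * b ≈ 0#
    two-roots m m₀<m eq with ℕ.m≤n⇒∃[o]m+o≡n m₀<m
    ... | l , ≡.refl = nonzero (a≈0 , b≈0)
      where
      split : (suc (m₀ ℕ.+ l)) · 1# ≈ m₀ · 1# + suc l · 1#
      split = trans (reflexive (≡.cong (_· 1#) (≡.sym (ℕ.+-suc m₀ l)))) (×-homo-+ 1# m₀ (suc l))
      b≈0 : b ≈ 0#
      b≈0 = [ (λ z → ⊥-elim (char-0 l z)) , (λ z → z) ]′ (Domain.*-zeros (WithEM.fieldDomain em 𝔽) (suc l · 1#) b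
        (trans (S.solve 4 (λ a b m n → n S.:* b S.:= (a S.:+ (m S.:+ n) S.:* b) S.:- (a S.:+ m S.:* b)) refl a b (m₀ · 1#) (suc l · 1#))
          (trans (+-cong (trans (+-congˡ (*-congʳ (sym split))) eq) (-‿cong root)) (-‿inverseʳ 0#))))
      a≈0 : a ≈ 0#
      a≈0 = trans (sym (+-identityʳ a)) (trans (+-congˡ (sym (trans (*-congˡ b≈0) (zeroʳ _)))) root)

^-distrib-* : ∀ j a b → (a ℕ.* b) ℕ.^ j ≡ a ℕ.^ j ℕ.* b ℕ.^ j
^-distrib-* zero    a b = ≡.refl
^-distrib-* (suc j) a b = ≡.trans (≡.cong ((a ℕ.* b) ℕ.*_) (^-distrib-* j a b))
  (+-*-Solver.solve 4 (λ a b p q → a :* b :* (p :* q) := a :* p :* (b :* q)) ≡.refl a b (a ℕ.^ j) (b ℕ.^ j))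
  where open +-*-Solver

-- The least integer e with a < eᴶ is at most twice as large as the real root.
integer-root : ∀ j a → 1 ℕ.≤ a → ∃ λ e → 1 ℕ.≤ e × a ℕ.< e ℕ.^ suc j × e ℕ.^ suc j ℕ.≤ 2 ℕ.^ suc j ℕ.* a
integer-root j a 1≤a = search a (ℕ.≤-trans (ℕ.≤-reflexive (≡.cong suc (≡.sym (ℕ.*-identityʳ a)))) (large a))
  where
  large : ∀ a → suc (a ℕ.* 1) ℕ.≤ suc a ℕ.^ suc j
  large a = ℕ.≤-trans (ℕ.≤-reflexive (≡.trans (≡.cong suc (ℕ.*-identityʳ a)) (≡.sym (ℕ.*-identityʳ (suc a)))))
    (ℕ.*-monoʳ-≤ (suc a) (ℕ.m^n>0 (suc a) j))
  search : ∀ m → a ℕ.< suc m ℕ.^ suc j → ∃ λ e → 1 ℕ.≤ e × a ℕ.< e ℕ.^ suc j × e ℕ.^ suc j ℕ.≤ 2 ℕ.^ suc j ℕ.* a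
  search zero    lt = ⊥-elim (ℕ.<-irrefl ≡.refl (ℕ.≤-trans lt (ℕ.≤-trans (ℕ.≤-reflexive (ℕ.^-zeroˡ (suc j))) 1≤a)))
  search (suc m) lt with a ℕ.<? suc m ℕ.^ suc j
  ... | yes lt′ = search m lt′
  ... | no ≮    = suc (suc m) , s≤s z≤n , lt , (begin
    suc (suc m) ℕ.^ suc j              ≤⟨ ℕ.^-monoˡ-≤ (suc j) (s≤s (ℕ.≤-trans (ℕ.m≤n+m (suc m) m) (ℕ.≤-reflexive (≡.cong (m ℕ.+_) (≡.sym (ℕ.+-identityʳ (suc m))))))) ⟩
    (2 ℕ.* suc m) ℕ.^ suc j            ≡⟨ ^-distrib-* (suc j) 2 (suc m) ⟩
    2 ℕ.^ suc j ℕ.* suc m ℕ.^ suc j    ≤⟨ ℕ.*-monoʳ-≤ (2 ℕ.^ suc j) (ℕ.≮⇒≥ ≮) ⟩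
    2 ℕ.^ suc j ℕ.* a ∎)
    where open ℕ.≤-Reasoning

open import Defs
open import Data.List.Relation.Unary.Unique.Setoid ℂ²-setoid using (Unique)

-- Curves in the complex plane

module RealField (em : ExcludedMiddle 0ℓ) where
  open ≡ using (refl; sym; trans; cong; subst)
  open ℝ
  open ℚ-Solver using (solve; _:=_; _:+_; _:*_; :-_; _:-_)

  private
    ½-pos : ∀ {ε} → 0ℚ ℚ.< ε → 0ℚ ℚ.< ½ ℚ.* ε
    ½-pos {ε} 0<ε = subst (ℚ._< ½ ℚ.* ε) (ℚ.*-zeroʳ ½) (ℚ.*-monoʳ-<-pos ½ 0<ε)

    ½+½ : ∀ ε → ½ ℚ.* ε ℚ.+ ½ ℚ.* ε ≡ ε
    ½+½ ε = trans (sym (ℚ.*-distribʳ-+ ε ½ ½)) (ℚ.*-identityˡ ε)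

    a≤∣a∣ : ∀ a → a ℚ.≤ ∣ a ∣
    a≤∣a∣ a with ℚ.≤-total 0ℚ a
    ... | inj₁ 0≤a = ℚ.≤-reflexive (sym (ℚ.0≤p⇒∣p∣≡p 0≤a))
    ... | inj₂ a≤0 = ℚ.≤-trans a≤0 (ℚ.nonNegative⁻¹ ∣ a ∣ {{ℚ.∣-∣-nonNeg a}})

    ∣∣-upper : ∀ {η} a → ∣ a ∣ ℚ.< η → a ℚ.< η
    ∣∣-upper a = ℚ.≤-<-trans (a≤∣a∣ a)

    ∣∣-lower : ∀ {η} a → ∣ a ∣ ℚ.< η → ℚ.- a ℚ.< η
    ∣∣-lower {η} a lt = ∣∣-upper (ℚ.- a) (subst (ℚ._< η) (sym (ℚ.∣-p∣≡∣p∣ a)) lt)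

    ⊔-≤ˡ : ∀ {a b n} → a ℕ.⊔ b ℕ.≤ n → a ℕ.≤ n
    ⊔-≤ˡ {a} {b} = ℕ.≤-trans (ℕ.m≤m⊔n a b)

    ⊔-≤ʳ : ∀ {a b n} → a ℕ.⊔ b ℕ.≤ n → b ℕ.≤ n
    ⊔-≤ʳ {a} {b} = ℕ.≤-trans (ℕ.m≤n⊔m a b)

    Null : (ℕ → ℚ) → Set
    Null s = ∀ ε → 0ℚ ℚ.< ε → ∃ λ N → ∀ n → N ℕ.≤ n → ∣ s n ∣ ℚ.< ε

    null-resp : ∀ {s t} → (∀ n → s n ≡ t n) → Null s → Null t
    null-resp eq null ε 0<ε = let N , small = null ε 0<ε in N , λ n N≤n → subst (λ a → ∣ a ∣ ℚ.< ε) (eq n) (small n N≤n)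

    null-+ : ∀ {s t} → Null s → Null t → Null (λ n → s n ℚ.+ t n)
    null-+ {s} {t} ns nt ε 0<ε =
      let N , small = ns (½ ℚ.* ε) (½-pos 0<ε)
          M , small′ = nt (½ ℚ.* ε) (½-pos 0<ε)
      in N ℕ.⊔ M , λ n le → ℚ.≤-<-trans (ℚ.∣p+q∣≤∣p∣+∣q∣ (s n) (t n))
           (subst (∣ s n ∣ ℚ.+ ∣ t n ∣ ℚ.<_) (½+½ ε) (ℚ.+-mono-< (small n (⊔-≤ˡ le)) (small′ n (⊔-≤ʳ {N} le))))

    Bounded : (ℕ → ℚ) → Set
    Bounded s = ∃ λ B → ℚ.Positive B × ∃ λ N → ∀ n → N ℕ.≤ n → ∣ s n ∣ ℚ.< B

    null-* : ∀ {s b} → Null s → Bounded b → Null (λ n → b n ℚ.* s n)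
    null-* {s} {b} ns (B , B>0 , M , b<B) ε 0<ε =
      let N , small = ns δ 0<δ in
      N ℕ.⊔ M , λ n le → begin-strict
        ∣ b n ℚ.* s n ∣       ≡⟨ ℚ.∣p*q∣≡∣p∣*∣q∣ (b n) (s n) ⟩
        ∣ b n ∣ ℚ.* ∣ s n ∣   ≤⟨ ℚ.*-monoʳ-≤-nonNeg ∣ s n ∣ {{ℚ.∣-∣-nonNeg (s n)}} (ℚ.<⇒≤ (b<B n (⊔-≤ʳ {N} le))) ⟩
        B ℚ.* ∣ s n ∣         <⟨ ℚ.*-monoʳ-<-pos B {{B>0}} (small n (⊔-≤ˡ le)) ⟩
        B ℚ.* (B⁻¹ ℚ.* ε)     ≡⟨ sym (ℚ.*-assoc B B⁻¹ ε) ⟩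
        B ℚ.* B⁻¹ ℚ.* ε       ≡⟨ cong (ℚ._* ε) (ℚ.*-inverseʳ B {{ℚ.pos⇒nonZero B {{B>0}}}}) ⟩
        1ℚ ℚ.* ε              ≡⟨ ℚ.*-identityˡ ε ⟩
        ε ∎
      where
      open ℚ.≤-Reasoning
      B⁻¹ = (ℚ.1/ B) {{ℚ.pos⇒nonZero B {{B>0}}}}
      δ = B⁻¹ ℚ.* ε
      0<δ : 0ℚ ℚ.< δ
      0<δ = subst (ℚ._< δ) (ℚ.*-zeroʳ B⁻¹) (ℚ.*-monoʳ-<-pos B⁻¹ {{ℚ.1/pos⇒pos B {{B>0}}}} 0<ε)

    bounded : ∀ x → Bounded (seq x)
    bounded x = let N , close = cauchy x 1ℚ (ℚ.positive⁻¹ 1ℚ) ; c = seq x N in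
      1ℚ ℚ.+ ∣ c ∣ , ℚ.pos+nonNeg⇒pos 1ℚ ∣ c ∣ {{ℚ.∣-∣-nonNeg c}} , N , λ n N≤n → ℚ.≤-<-trans
        (subst (λ a → ∣ a ∣ ℚ.≤ ∣ seq x n ℚ.- c ∣ ℚ.+ ∣ c ∣) (solve 2 (λ a c → (a :- c) :+ c := a) refl (seq x n) c)
          (ℚ.∣p+q∣≤∣p∣+∣q∣ (seq x n ℚ.- c) c))
        (ℚ.+-monoˡ-< ∣ c ∣ (close n N N≤n ℕ.≤-refl))

  infix 4 _≈ᵣ_
  record _≈ᵣ_ (x y : ℝ) : Set where
    constructor mk≈ᵣ
    field equal : x ≈ℝ y
  open _≈ᵣ_ public

  private
    pointwise : ∀ {x y} → (∀ n → seq x n ≡ seq y n) → x ≈ᵣ y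
    pointwise {x} eq = mk≈ᵣ λ ε 0<ε → 0 , λ n _ →
      subst (ℚ._< ε) (cong ∣_∣ (trans (sym (ℚ.+-inverseʳ (seq x n))) (cong (λ a → seq x n ℚ.- a) (eq n)))) 0<ε

    +-congᵣ : ∀ {x x′ y y′} → x ≈ᵣ x′ → y ≈ᵣ y′ → x +ℝ y ≈ᵣ x′ +ℝ y′
    +-congᵣ {x} {x′} {y} {y′} eq eq′ = mk≈ᵣ (null-resp
      (λ n → solve 4 (λ a b c d → (a :- b) :+ (c :- d) := (a :+ c) :- (b :+ d)) refl (seq x n) (seq x′ n) (seq y n) (seq y′ n))
      (null-+ (equal eq) (equal eq′)))

    neg-congᵣ : ∀ {x y} → x ≈ᵣ y → -ℝ x ≈ᵣ -ℝ y
    neg-congᵣ {x} {y} eq = mk≈ᵣ λ ε 0<ε → let N , small = equal eq ε 0<ε in N , λ n N≤n →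
      subst (ℚ._< ε) (trans (sym (ℚ.∣-p∣≡∣p∣ (seq x n ℚ.- seq y n)))
        (cong ∣_∣ (solve 2 (λ a b → :- (a :- b) := :- a :- :- b) refl (seq x n) (seq y n)))) (small n N≤n)

    *-congᵣ : ∀ {x x′ y y′} → x ≈ᵣ x′ → y ≈ᵣ y′ → x *ℝ y ≈ᵣ x′ *ℝ y′
    *-congᵣ {x} {x′} {y} {y′} eq eq′ = mk≈ᵣ (null-resp
      (λ n → solve 4 (λ a b c d → a :* (c :- d) :+ d :* (a :- b) := a :* c :- b :* d) refl (seq x n) (seq x′ n) (seq y n) (seq y′ n))
      (null-+ (null-* {b = seq x} (equal eq′) (bounded x)) (null-* {b = seq y′} (equal eq) (bounded y′))))

    abstract
      isCommutativeRingᵣ : IsCommutativeRing _≈ᵣ_ _+ℝ_ _*ℝ_ -ℝ_ 0ℝ 1ℝ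
      isCommutativeRingᵣ = record
        { isRing = record
          { +-isAbelianGroup = record
            { isGroup = record
              { isMonoid = record
                { isSemigroup = record
                  { isMagma = record
                    { isEquivalence = record
                      { refl = pointwise (λ _ → refl)
                      ; sym = λ {x} {y} eq → mk≈ᵣ (Setoid.sym ℝ-setoid {x} {y} (equal eq))
                      ; trans = λ {x} {y} {z} eq eq′ → mk≈ᵣ (Setoid.trans ℝ-setoid {x} {y} {z} (equal eq) (equal eq′)) }
                    ; ∙-cong = +-congᵣ }
                  ; assoc = λ x y z → pointwise λ n → ℚ.+-assoc (seq x n) (seq y n) (seq z n) }
                ; identity = (λ x → pointwise λ n → ℚ.+-identityˡ (seq x n)) , (λ x → pointwise λ n → ℚ.+-identityʳ (seq x n)) }
              ; inverse = (λ x → pointwise λ n → ℚ.+-inverseˡ (seq x n)) , (λ x → pointwise λ n → ℚ.+-inverseʳ (seq x n))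
              ; ⁻¹-cong = neg-congᵣ }
            ; comm = λ x y → pointwise λ n → ℚ.+-comm (seq x n) (seq y n) }
          ; *-cong = *-congᵣ
          ; *-assoc = λ x y z → pointwise λ n → ℚ.*-assoc (seq x n) (seq y n) (seq z n)
          ; *-identity = (λ x → pointwise λ n → ℚ.*-identityˡ (seq x n)) , (λ x → pointwise λ n → ℚ.*-identityʳ (seq x n))
          ; distrib = (λ x y z → pointwise λ n → ℚ.*-distribˡ-+ (seq x n) (seq y n) (seq z n))
                    , (λ x y z → pointwise λ n → ℚ.*-distribʳ-+ (seq x n) (seq y n) (seq z n)) }
        ; *-comm = λ x y → pointwise λ n → ℚ.*-comm (seq x n) (seq y n) }

  ℝ-ring : CRing
  ℝ-ring = record
    { Carrier = ℝ ; _≈_ = _≈ᵣ_ ; _+_ = _+ℝ_ ; _*_ = _*ℝ_ ; -_ = -ℝ_ ; 0# = 0ℝ ; 1# = 1ℝ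
    ; isCommutativeRing = isCommutativeRingᵣ }

  private
    module R = CommutativeRing ℝ-ring

    Apart : ℝ → Set
    Apart x = ∃ λ δ → 0ℚ ℚ.< δ × ∃ λ N → (∀ n → N ℕ.≤ n → δ ℚ.< seq x n) ⊎ (∀ n → N ℕ.≤ n → δ ℚ.< ℚ.- seq x n)

    frequently-large : ∀ x → ¬ x ≈ᵣ 0ℝ → ∃ λ ε → 0ℚ ℚ.< ε × ∀ N → ∃ λ n → N ℕ.≤ n × ε ℚ.≤ ∣ seq x n ∣
    frequently-large x x≉0 with em {∃ λ ε → 0ℚ ℚ.< ε × ∀ N → ∃ λ n → N ℕ.≤ n × ε ℚ.≤ ∣ seq x n ∣}
    ... | yes p = p
    ... | no ¬p = ⊥-elim (x≉0 (mk≈ᵣ λ ε 0<ε → small ε 0<ε em))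
      where
      small : ∀ ε → 0ℚ ℚ.< ε → Dec (∃ λ N → ∀ n → N ℕ.≤ n → ∣ seq x n ℚ.- 0ℚ ∣ ℚ.< ε) → ∃ λ N → ∀ n → N ℕ.≤ n → ∣ seq x n ℚ.- 0ℚ ∣ ℚ.< ε
      small ε 0<ε (yes p) = p
      small ε 0<ε (no ¬q) = ⊥-elim (¬p (ε , 0<ε , λ N → large N em))
        where
        large : ∀ N → Dec (∃ λ n → N ℕ.≤ n × ε ℚ.≤ ∣ seq x n ∣) → ∃ λ n → N ℕ.≤ n × ε ℚ.≤ ∣ seq x n ∣
        large N (yes p) = p
        large N (no ¬r) = ⊥-elim (¬q (N , λ n N≤n → subst (λ a → ∣ a ∣ ℚ.< ε) (sym (ℚ.+-identityʳ (seq x n)))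
          (ℚ.≰⇒> (λ le → ¬r (n , N≤n , le)))))

    -- Some term beyond the index where the sequence varies by less than ε/2 has modulus at least ε.
    -- From that index on, all terms share its sign and exceed ε/2 in modulus.
    apart : ∀ x → ¬ x ≈ᵣ 0ℝ → Apart x
    apart x x≉0 = let ε , 0<ε , large = frequently-large x x≉0
                      N , close = cauchy x (½ ℚ.* ε) (½-pos 0<ε)
                      n₀ , N≤n₀ , ε≤ = large N
                  in ½ ℚ.* ε , ½-pos 0<ε , N , signs ε N close n₀ N≤n₀ ε≤ (ℚ.∣p∣≡p∨∣p∣≡-p (seq x n₀))
      where
      cancel : ∀ {ε} a b → ε ℚ.≤ a → a ℚ.- b ℚ.< ½ ℚ.* ε → ½ ℚ.* ε ℚ.< b
      cancel {ε} a b ε≤a lt = ≡.subst₂ ℚ._<_ (solve 1 (λ h → h :+ h :+ :- h := h) refl (½ ℚ.* ε))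
          (solve 2 (λ h b → h :+ b :+ :- h := b) refl (½ ℚ.* ε) b) (ℚ.+-monoˡ-< (ℚ.- (½ ℚ.* ε)) (begin-strict
        ½ ℚ.* ε ℚ.+ ½ ℚ.* ε   ≡⟨ ½+½ ε ⟩
        ε                     ≤⟨ ε≤a ⟩
        a                     ≡⟨ solve 2 (λ a b → a := (a :- b) :+ b) refl a b ⟩
        (a ℚ.- b) ℚ.+ b       <⟨ ℚ.+-monoˡ-< b lt ⟩
        ½ ℚ.* ε ℚ.+ b         ∎))
        where
        open ℚ.≤-Reasoning
      signs : ∀ ε N → (∀ m n → N ℕ.≤ m → N ℕ.≤ n → ∣ seq x m ℚ.- seq x n ∣ ℚ.< ½ ℚ.* ε) → ∀ n₀ → N ℕ.≤ n₀ → ε ℚ.≤ ∣ seq x n₀ ∣ →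
        ∣ seq x n₀ ∣ ≡ seq x n₀ ⊎ ∣ seq x n₀ ∣ ≡ ℚ.- seq x n₀ →
        (∀ n → N ℕ.≤ n → ½ ℚ.* ε ℚ.< seq x n) ⊎ (∀ n → N ℕ.≤ n → ½ ℚ.* ε ℚ.< ℚ.- seq x n)
      signs ε N close n₀ N≤n₀ ε≤ (inj₁ eq) = inj₁ λ n N≤n → cancel (seq x n₀) (seq x n) (subst (ε ℚ.≤_) eq ε≤)
        (∣∣-upper _ (close n₀ n N≤n₀ N≤n))
      signs ε N close n₀ N≤n₀ ε≤ (inj₂ eq) = inj₂ λ n N≤n → cancel (ℚ.- seq x n₀) (ℚ.- seq x n) (subst (ε ℚ.≤_) eq ε≤)
        (subst (ℚ._< ½ ℚ.* ε) (solve 2 (λ a b → :- (a :- b) := :- a :- :- b) refl (seq x n₀) (seq x n))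
          (∣∣-lower _ (close n₀ n N≤n₀ N≤n)))

    <-respˡᵣ : ∀ {x y z} → x ≈ᵣ y → x <ℝ z → y <ℝ z
    <-respˡᵣ {x} {y} {z} eq (ε , 0<ε , N , lt) =
      let M , close = equal eq (½ ℚ.* ε) (½-pos 0<ε) in
      ½ ℚ.* ε , ½-pos 0<ε , N ℕ.⊔ M , λ n le → begin-strict
        seq y n ℚ.+ ½ ℚ.* ε
          ≡⟨ solve 3 (λ y x h → y :+ h := (:- (x :- y)) :+ (x :+ h)) refl (seq y n) (seq x n) (½ ℚ.* ε) ⟩
        ℚ.- (seq x n ℚ.- seq y n) ℚ.+ (seq x n ℚ.+ ½ ℚ.* ε)
          <⟨ ℚ.+-monoˡ-< _ (∣∣-lower _ (close n (⊔-≤ʳ {N} le))) ⟩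
        ½ ℚ.* ε ℚ.+ (seq x n ℚ.+ ½ ℚ.* ε)
          ≡⟨ trans (solve 2 (λ h x → h :+ (x :+ h) := x :+ (h :+ h)) refl (½ ℚ.* ε) (seq x n)) (cong (seq x n ℚ.+_) (½+½ ε)) ⟩
        seq x n ℚ.+ ε
          <⟨ lt n (⊔-≤ˡ le) ⟩
        seq z n ∎
      where open ℚ.≤-Reasoning

    <-respʳᵣ : ∀ {x y z} → y ≈ᵣ z → x <ℝ y → x <ℝ z
    <-respʳᵣ {x} {y} {z} eq (ε , 0<ε , N , lt) =
      let M , close = equal eq (½ ℚ.* ε) (½-pos 0<ε) in
      ½ ℚ.* ε , ½-pos 0<ε , N ℕ.⊔ M , λ n le → begin-strict
        seq x n ℚ.+ ½ ℚ.* ε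
          ≡⟨ trans (solve 2 (λ x h → x :+ h := x :+ (h :+ h) :- h) refl (seq x n) (½ ℚ.* ε)) (cong (λ a → seq x n ℚ.+ a ℚ.- ½ ℚ.* ε) (½+½ ε)) ⟩
        seq x n ℚ.+ ε ℚ.- ½ ℚ.* ε
          <⟨ ℚ.+-monoˡ-< (ℚ.- (½ ℚ.* ε)) (lt n (⊔-≤ˡ le)) ⟩
        seq y n ℚ.- ½ ℚ.* ε
          ≡⟨ solve 3 (λ y z h → y :- h := (y :- z) :+ (z :- h)) refl (seq y n) (seq z n) (½ ℚ.* ε) ⟩
        (seq y n ℚ.- seq z n) ℚ.+ (seq z n ℚ.- ½ ℚ.* ε)
          <⟨ ℚ.+-monoˡ-< _ (∣∣-upper _ (close n (⊔-≤ʳ {N} le))) ⟩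
        ½ ℚ.* ε ℚ.+ (seq z n ℚ.- ½ ℚ.* ε)
          ≡⟨ solve 2 (λ h z → h :+ (z :- h) := z) refl (½ ℚ.* ε) (seq z n) ⟩
        seq z n ∎
      where open ℚ.≤-Reasoning

    <-irreflᵣ : ∀ {x} → ¬ x <ℝ x
    <-irreflᵣ {x} (ε , 0<ε , N , lt) = ℚ.<-irrefl refl (ℚ.<-trans
      (subst (ℚ._< seq x N ℚ.+ ε) (ℚ.+-identityʳ (seq x N)) (ℚ.+-monoʳ-< (seq x N) 0<ε)) (lt N ℕ.≤-refl))

    <-transᵣ : ∀ {x y z} → x <ℝ y → y <ℝ z → x <ℝ z
    <-transᵣ {x} {y} {z} (ε , 0<ε , N , lt) (ε′ , 0<ε′ , N′ , lt′) = ε , 0<ε , N ℕ.⊔ N′ , λ n le →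
      ℚ.<-trans (lt n (⊔-≤ˡ le)) (ℚ.<-trans
        (subst (ℚ._< seq y n ℚ.+ ε′) (ℚ.+-identityʳ (seq y n)) (ℚ.+-monoʳ-< (seq y n) 0<ε′)) (lt′ n (⊔-≤ʳ {N} le)))

    compareᵣ : ∀ x y → x <ℝ y ⊎ x ≈ᵣ y ⊎ y <ℝ x
    compareᵣ x y with em {x ≈ᵣ y}
    ... | yes eq = inj₂ (inj₁ eq)
    ... | no neq = signs (apart (y +ℝ -ℝ x) λ eq → neq (R.sym (R.trans (pointwise λ n →
        solve 2 (λ x y → y := (y :- x) :+ x) refl (seq x n) (seq y n)) (R.trans (R.+-congʳ {x} eq) (R.+-identityˡ x)))))
      where
      signs : Apart (y +ℝ -ℝ x) → x <ℝ y ⊎ x ≈ᵣ y ⊎ y <ℝ x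
      signs (δ , 0<δ , N , inj₁ pos) = inj₁ (δ , 0<δ , N , λ n N≤n →
        ≡.subst₂ ℚ._<_ (ℚ.+-comm δ (seq x n)) (solve 2 (λ x y → (y :- x) :+ x := y) refl (seq x n) (seq y n)) (ℚ.+-monoˡ-< (seq x n) (pos n N≤n)))
      signs (δ , 0<δ , N , inj₂ neg) = inj₂ (inj₂ (δ , 0<δ , N , λ n N≤n →
        ≡.subst₂ ℚ._<_ (ℚ.+-comm δ (seq y n)) (solve 2 (λ x y → :- (y :- x) :+ y := x) refl (seq x n) (seq y n)) (ℚ.+-monoˡ-< (seq y n) (neg n N≤n))))

    *-positiveᵣ : ∀ {x y} → 0ℝ <ℝ x → 0ℝ <ℝ y → 0ℝ <ℝ x *ℝ y
    *-positiveᵣ {x} {y} (ε , 0<ε , N , lt) (ε′ , 0<ε′ , N′ , lt′) =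
      ε ℚ.* ε′ , product 0<ε 0<ε′ , N ℕ.⊔ N′ , λ n le →
        let ε<x = subst (ℚ._< seq x n) (ℚ.+-identityˡ ε) (lt n (⊔-≤ˡ le))
            ε′<y = subst (ℚ._< seq y n) (ℚ.+-identityˡ ε′) (lt′ n (⊔-≤ʳ {N} le))
        in subst (ℚ._< seq x n ℚ.* seq y n) (sym (ℚ.+-identityˡ (ε ℚ.* ε′)))
             (ℚ.<-trans (ℚ.*-monoˡ-<-pos ε′ {{ℚ.positive 0<ε′}} ε<x)
               (ℚ.*-monoʳ-<-pos (seq x n) {{ℚ.positive (ℚ.<-trans 0<ε ε<x)}} ε′<y))
      where
      product : 0ℚ ℚ.< ε → 0ℚ ℚ.< ε′ → 0ℚ ℚ.< ε ℚ.* ε′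
      product 0<ε 0<ε′ = subst (ℚ._< ε ℚ.* ε′) (ℚ.*-zeroˡ ε′) (ℚ.*-monoˡ-<-pos ε′ {{ℚ.positive 0<ε′}} 0<ε)

    -- Early terms of a sequence for a nonzero real may be zero; they get an arbitrary inverse,
    -- which does not affect the limit.
    1/? : ℚ → ℚ
    1/? q with q ℚ.≟ 0ℚ
    ... | yes _  = 0ℚ
    ... | no q≢0 = (ℚ.1/ q) {{ℚ.≢-nonZero q≢0}}


    1/?-* : ∀ q → ¬ q ≡ 0ℚ → 1/? q ℚ.* q ≡ 1ℚ
    1/?-* q q≢0 with q ℚ.≟ 0ℚ
    ... | yes q≡0 = ⊥-elim (q≢0 q≡0)
    ... | no q≢0  = ℚ.*-inverseˡ q {{ℚ.≢-nonZero q≢0}}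

    reciprocalᵣ : ∀ x → ¬ x ≈ᵣ 0ℝ → ∃ λ y → y *ℝ x ≈ᵣ 1ℝ
    reciprocalᵣ x x≉0 = from (apart x x≉0)
      where
      from : Apart x → ∃ λ y → y *ℝ x ≈ᵣ 1ℝ
      from (δ , 0<δ , N , sign) = mkℝ inv cauchy-inv , mk≈ᵣ λ ε 0<ε → N , λ n N≤n →
          subst (λ a → ∣ a ℚ.- 1ℚ ∣ ℚ.< ε) (sym (1/?-* _ (nonzero n N≤n))) (subst (ℚ._< ε) (cong ∣_∣ (sym (ℚ.+-inverseʳ 1ℚ))) 0<ε)
        where
        inv : ℕ → ℚ
        inv n = 1/? (seq x n)
        δ<∣x∣ : ∀ n → N ℕ.≤ n → δ ℚ.< ∣ seq x n ∣
        δ<∣x∣ n N≤n = [ (λ pos → ℚ.<-≤-trans (pos n N≤n) (a≤∣a∣ (seq x n)))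
                      , (λ neg → ℚ.<-≤-trans (neg n N≤n) (subst (ℚ.- seq x n ℚ.≤_) (ℚ.∣-p∣≡∣p∣ (seq x n)) (a≤∣a∣ (ℚ.- seq x n)))) ]′ sign
        nonzero : ∀ n → N ℕ.≤ n → ¬ seq x n ≡ 0ℚ
        nonzero n N≤n eq = ℚ.<-asym 0<δ (subst (δ ℚ.<_) (cong ∣_∣ eq) (δ<∣x∣ n N≤n))
        δ⁻¹ = (ℚ.1/ δ) {{ℚ.pos⇒nonZero δ {{ℚ.positive 0<δ}}}}
        δ⁻¹>0 : ℚ.Positive δ⁻¹
        δ⁻¹>0 = ℚ.1/pos⇒pos δ {{ℚ.positive 0<δ}}
        inv≤ : ∀ n → N ℕ.≤ n → ∣ inv n ∣ ℚ.≤ δ⁻¹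
        inv≤ n N≤n = ℚ.*-cancelʳ-≤-pos δ {{ℚ.positive 0<δ}} (begin
          ∣ inv n ∣ ℚ.* δ           ≤⟨ ℚ.*-monoˡ-≤-nonNeg ∣ inv n ∣ {{ℚ.∣-∣-nonNeg (inv n)}} (ℚ.<⇒≤ (δ<∣x∣ n N≤n)) ⟩
          ∣ inv n ∣ ℚ.* ∣ seq x n ∣ ≡⟨ sym (ℚ.∣p*q∣≡∣p∣*∣q∣ (inv n) (seq x n)) ⟩
          ∣ inv n ℚ.* seq x n ∣     ≡⟨ cong ∣_∣ (1/?-* _ (nonzero n N≤n)) ⟩
          1ℚ                        ≡⟨ sym (ℚ.*-inverseˡ δ {{ℚ.pos⇒nonZero δ {{ℚ.positive 0<δ}}}}) ⟩
          δ⁻¹ ℚ.* δ ∎)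
          where open ℚ.≤-Reasoning
        difference : ∀ m n → N ℕ.≤ m → N ℕ.≤ n → inv m ℚ.- inv n ≡ inv m ℚ.* inv n ℚ.* (seq x n ℚ.- seq x m)
        difference m n N≤m N≤n = trans
          (cong₂′ (trans (sym (ℚ.*-identityʳ (inv m))) (cong (inv m ℚ.*_) (sym (1/?-* _ (nonzero n N≤n)))))
                  (trans (sym (ℚ.*-identityʳ (inv n))) (cong (inv n ℚ.*_) (sym (1/?-* _ (nonzero m N≤m))))))
          (solve 4 (λ a b x y → a :* (b :* y) :- b :* (a :* x) := a :* b :* (y :- x)) refl (inv m) (inv n) (seq x m) (seq x n))
          where
          cong₂′ : ∀ {a a′ b b′} → a ≡ a′ → b ≡ b′ → a ℚ.- b ≡ a′ ℚ.- b′
          cong₂′ refl refl = refl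
        cauchy-inv : IsCauchy inv
        cauchy-inv ε 0<ε =
          -- The difference of two inverses is a difference of terms times both inverses, each of
          -- modulus at most 1/δ.
          let M , close = cauchy x (δ ℚ.* δ ℚ.* ε) 0<δδε in N ℕ.⊔ M , λ m n Nm Nn → begin-strict
            ∣ inv m ℚ.- inv n ∣
              ≡⟨ cong ∣_∣ (difference m n (⊔-≤ˡ Nm) (⊔-≤ˡ Nn)) ⟩
            ∣ inv m ℚ.* inv n ℚ.* (seq x n ℚ.- seq x m) ∣
              ≡⟨ trans (ℚ.∣p*q∣≡∣p∣*∣q∣ (inv m ℚ.* inv n) _) (cong (ℚ._* ∣ seq x n ℚ.- seq x m ∣) (ℚ.∣p*q∣≡∣p∣*∣q∣ (inv m) (inv n))) ⟩
            ∣ inv m ∣ ℚ.* ∣ inv n ∣ ℚ.* ∣ seq x n ℚ.- seq x m ∣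
              ≤⟨ ℚ.*-monoʳ-≤-nonNeg ∣ seq x n ℚ.- seq x m ∣ {{ℚ.∣-∣-nonNeg (seq x n ℚ.- seq x m)}} (ℚ.≤-trans
                   (ℚ.*-monoʳ-≤-nonNeg ∣ inv n ∣ {{ℚ.∣-∣-nonNeg (inv n)}} (inv≤ m (⊔-≤ˡ Nm)))
                   (ℚ.*-monoˡ-≤-nonNeg δ⁻¹ {{ℚ.pos⇒nonNeg δ⁻¹ {{δ⁻¹>0}}}} (inv≤ n (⊔-≤ˡ Nn)))) ⟩
            δ⁻¹ ℚ.* δ⁻¹ ℚ.* ∣ seq x n ℚ.- seq x m ∣
              <⟨ ℚ.*-monoʳ-<-pos (δ⁻¹ ℚ.* δ⁻¹) {{ℚ.pos*pos⇒pos δ⁻¹ {{δ⁻¹>0}} δ⁻¹ {{δ⁻¹>0}}}} (close n m (⊔-≤ʳ {N} Nn) (⊔-≤ʳ {N} Nm)) ⟩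
            δ⁻¹ ℚ.* δ⁻¹ ℚ.* (δ ℚ.* δ ℚ.* ε)
              ≡⟨ solve 3 (λ i d e → i :* i :* (d :* d :* e) := (i :* d) :* (i :* d) :* e) refl δ⁻¹ δ ε ⟩
            (δ⁻¹ ℚ.* δ) ℚ.* (δ⁻¹ ℚ.* δ) ℚ.* ε
              ≡⟨ cong (λ a → a ℚ.* a ℚ.* ε) (ℚ.*-inverseˡ δ {{ℚ.pos⇒nonZero δ {{ℚ.positive 0<δ}}}}) ⟩
            1ℚ ℚ.* 1ℚ ℚ.* ε
              ≡⟨ ℚ.*-identityˡ ε ⟩
            ε ∎
          where
          open ℚ.≤-Reasoning
          0<δδε : 0ℚ ℚ.< δ ℚ.* δ ℚ.* ε
          0<δδε = ℚ.positive⁻¹ (δ ℚ.* δ ℚ.* ε) {{ℚ.pos*pos⇒pos (δ ℚ.* δ) {{ℚ.pos*pos⇒pos δ {{ℚ.positive 0<δ}} δ {{ℚ.positive 0<δ}}}} ε {{ℚ.positive 0<ε}}}}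

  ℝ-field : OrderedField
  ℝ-field = record
    { cring = ℝ-ring ; _<_ = _<ℝ_
    ; <-respˡ = λ {x} {y} {z} → <-respˡᵣ {x} {y} {z} ; <-respʳ = λ {x} {y} {z} → <-respʳᵣ {x} {y} {z}
    ; <-irrefl = λ {x} → <-irreflᵣ {x} ; <-trans = λ {x} {y} {z} → <-transᵣ {x} {y} {z} ; compare = compareᵣ
    ; +-monoˡ-< = λ z {x} {y} (ε , 0<ε , N , lt) → ε , 0<ε , N , λ n N≤n →
        subst (ℚ._< seq y n ℚ.+ seq z n) (solve 3 (λ x e z → x :+ e :+ z := x :+ z :+ e) refl (seq x n) ε (seq z n))
          (ℚ.+-monoˡ-< (seq z n) (lt n N≤n))
    ; *-positive = λ {x} {y} → *-positiveᵣ {x} {y}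
    ; 0<1 = ½ , ℚ.positive⁻¹ ½ , 0 , λ _ _ → toWitness {a? = (0ℚ ℚ.+ ½) ℚ.<? 1ℚ} tt
    ; reciprocal = reciprocalᵣ }

  ≤ℝ⇒≯ : ∀ x y → x ≤ℝ y → ¬ y <ℝ x
  ≤ℝ⇒≯ x y le (ε , 0<ε , N , lt) = let M , lt′ = le ε 0<ε in
    ℚ.<-asym (lt (N ℕ.⊔ M) (ℕ.m≤m⊔n N M)) (lt′ (N ℕ.⊔ M) (ℕ.m≤n⊔m N M))

open import Data.Nat.Base using (_+_; _*_; _^_; _≤_)
open ≡ using (refl)

-- From the curves of the statement to polynomials and branches

module Plane (em : ExcludedMiddle 0ℓ) where
  open RealField em using (ℝ-field; ℝ-ring; mk≈ᵣ; equal; ≤ℝ⇒≯)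
  open Complex ℝ-field using (ℂ-ring; ℂ-field; _≈ᶻ_; mkᶻ; re≈; im≈; <-resp; norm-cong; norm-zero; norm)
  open Limits ℝ-field using (Graph; Continuous; Agree; derivative⇒continuous)
  open SeriesOverField em ℂ-field using (point)
  open SeriesSubstitution em ℂ-field using (point-substitute; ∂y-substitute; point-cong)
  open Tangency em ℝ-field using (shear; rotation; branches-agree)
  private
    module R   = CommutativeRing ℝ-ring
    module RS  = Integers ℝ-ring
    module Z   = CommutativeRing ℂ-ring
    module ZS  = Integers ℂ-ring
    module ZX  = Poly ℂ-ring
    module ZXY = Poly ZX.ring[X]
    module P   = CommutativeRing ZXY.ring[X]
    module H   = Hurwitz ℂ-ring
    module D₁  = Polynomial ℂ-rawRing
    module D₂  = Polynomial D₁.rawRing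
    module Divisibility = Algebra.Definitions.RawSemiring (RawRing.rawSemiring ℂ[x,y]-rawRing)

    module Same₁ = SameOperations (Setoid._≈_ ℂ-setoid) _≈ᶻ_ (RawRing._+_ ℂ-rawRing) Z._+_ (RawRing._*_ ℂ-rawRing) Z._*_
      (RawRing.-_ ℂ-rawRing) (λ z → Z.- z) Z.0# Z.1# (λ _ _ → refl) (λ _ _ → refl)
    module Same₂ = SameOperations (RawRing._≈_ D₁.rawRing) ZX._≋_ D₁._⊕_ ZX._⊕_ D₁._⊗_ ZX._⊗_
      (RawRing.-_ D₁.rawRing) (CommutativeRing.-_ ZX.ring[X]) [] (Z.1# ∷ []) Same₁.⊕-same Same₁.⊗-same

  ≈⇒≈ᶻ : ∀ {z w} → Setoid._≈_ ℂ-setoid z w → z ≈ᶻ w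
  ≈⇒≈ᶻ (eq , eq′) = mkᶻ (mk≈ᵣ eq) (mk≈ᵣ eq′)

  ≈ᶻ⇒≈ : ∀ {z w} → z ≈ᶻ w → Setoid._≈_ ℂ-setoid z w
  ≈ᶻ⇒≈ eq = equal (re≈ eq) , equal (im≈ eq)

  coefficient-same : ∀ f i j → coefficient f i j ≡ ZX.coeff (ZXY.coeff f j) i
  coefficient-same f i j = ≡.trans (Same₁.coeff-same (D₂.coeff f j) i) (≡.cong (λ c → ZX.coeff c i) (Same₂.coeff-same f j))

  ⟨⟩-same : ∀ f x y → f ⟨ x , y ⟩ ≡ point x y ⟪ f ⟫
  ⟨⟩-same f x y = ≡.trans (Same₁.eval-same (map (λ p → D₁.eval p x) f) y)
    (≡.cong (λ p → ZX.eval p y) (List.map-cong (λ p → Same₁.eval-same p x) f))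

  ∂x-same : ∀ f → ∂x f ≡ map ZX.derivative f
  ∂x-same = List.map-cong Same₁.derivative-same

  ∂y-same : ∀ f → ∂y f ≡ ZXY.derivative f
  ∂y-same = Same₂.derivative-same

  private
    poly-≈ : ∀ {f g} → RawRing._≈_ ℂ[x,y]-rawRing f g → f P.≈ g
    poly-≈ {f} {g} eq = ZXY.mk≋ λ j → ZX.mk≋ λ i → ≈⇒≈ᶻ
      (≡.subst₂ (Setoid._≈_ ℂ-setoid) (coefficient-same f i j) (coefficient-same g i j) (eq j i))

    poly-≈⁻¹ : ∀ {f g} → f P.≈ g → RawRing._≈_ ℂ[x,y]-rawRing f g
    poly-≈⁻¹ {f} {g} eq j i = ≡.subst₂ (Setoid._≈_ ℂ-setoid) (≡.sym (coefficient-same f i j)) (≡.sym (coefficient-same g i j))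
      (≈ᶻ⇒≈ (eq .ZXY.at j .ZX.at i))

    unit⇒∣1 : ∀ {f} → Unit ZXY.ring[X] f → f Divisibility.∣ RawRing.1# ℂ[x,y]-rawRing
    unit⇒∣1 {f} (g , eq) = Algebra.Definitions.RawMagma._,_ g (poly-≈⁻¹ (P.trans (P.reflexive (Same₂.⊗-same g f)) eq))

    ∣1⇒unit : ∀ {f} → f Divisibility.∣ RawRing.1# ℂ[x,y]-rawRing → Unit ZXY.ring[X] f
    ∣1⇒unit {f} (Algebra.Definitions.RawMagma._,_ g eq) = g , P.trans (P.reflexive (≡.sym (Same₂.⊗-same g f))) (poly-≈ eq)

  irreducible : ∀ γ → Irreducible γ → Irreducibleᴿ ZXY.ring[X] (Curve.equation γ)
  irreducible γ irr = record
    { nonunit = λ u → p∤1 (unit⇒∣1 u)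
    ; split = λ x y eq → [ (λ d → inj₁ (∣1⇒unit d)) , (λ d → inj₂ (∣1⇒unit d)) ]′
        (split-∣1 (poly-≈⁻¹ (P.trans eq (P.reflexive (≡.sym (Same₂.⊗-same x y))))))
    }
    where open Divisibility.Irreducible irr

  degree-bound : ∀ D γ → Degree≤ D γ → BoundedDegree.Fil ℂ-ring D (Curve.equation γ)
  degree-bound D γ deg =
    (λ j i D<i → vanish i j (ℕ.≤-trans D<i (ℕ.m≤m+n i j))) , (λ j D<j → ZX.mk≋ λ i → vanish i j (ℕ.≤-trans D<j (ℕ.m≤n+m j i)))
    where
    vanish : ∀ i j → D ℕ.< i ℕ.+ j → ZX.coeff (ZXY.coeff (Curve.equation γ) j) i ≈ᶻ Z.0#
    vanish i j lt = ≈⇒≈ᶻ (≡.subst (λ z → Setoid._≈_ ℂ-setoid z Z.0#) (coefficient-same (Curve.equation γ) i j) (deg i j lt))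

  on-curve : ∀ γ {x y} → points γ (x , y) → point x y ⟪ Curve.equation γ ⟫ ≈ᶻ Z.0#
  on-curve γ {x} {y} eq = ≈⇒≈ᶻ (≡.subst (λ z → Setoid._≈_ ℂ-setoid z Z.0#) (⟨⟩-same (Curve.equation γ) x y) eq)

  on-curve⁻¹ : ∀ γ {x y} → point x y ⟪ Curve.equation γ ⟫ ≈ᶻ Z.0# → points γ (x , y)
  on-curve⁻¹ γ {x} {y} eq = ≡.subst (λ z → Setoid._≈_ ℂ-setoid z Z.0#) (≡.sym (⟨⟩-same (Curve.equation γ) x y)) (≈ᶻ⇒≈ eq)

  fx fy : Curve → ℂ² → ℂ
  fx γ (x , y) = point x y ⟪ map ZX.derivative (Curve.equation γ) ⟫
  fy γ (x , y) = point x y ⟪ ZXY.derivative (Curve.equation γ) ⟫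

  private
    ∂x-value : ∀ γ x y → proj₁ (gradient γ (x , y)) ≡ fx γ (x , y)
    ∂x-value γ x y = ≡.trans (⟨⟩-same (∂x (Curve.equation γ)) x y) (≡.cong (λ f → point x y ⟪ f ⟫) (∂x-same (Curve.equation γ)))

    ∂y-value : ∀ γ x y → proj₂ (gradient γ (x , y)) ≡ fy γ (x , y)
    ∂y-value γ x y = ≡.trans (⟨⟩-same (∂y (Curve.equation γ)) x y) (≡.cong (λ f → point x y ⟪ f ⟫) (∂y-same (Curve.equation γ)))

  smooth : ∀ γ p → SmoothPoint γ p → ¬ (fy γ p ≈ᶻ Z.0# × fx γ p ≈ᶻ Z.0#)
  smooth γ (x , y) (_ , nonzero) (y≈0 , x≈0) = nonzero
    ( ≡.subst (λ z → Setoid._≈_ ℂ-setoid z Z.0#) (≡.sym (∂x-value γ x y)) (≈ᶻ⇒≈ x≈0)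
    , ≡.subst (λ z → Setoid._≈_ ℂ-setoid z Z.0#) (≡.sym (∂y-value γ x y)) (≈ᶻ⇒≈ y≈0))

  -- The minus sign is that of the inverse shear: the equation becomes f(x + λ′ y, y), so the points
  -- move the opposite way.
  sheared-x : ℂ → ℂ² → ℂ
  sheared-x λ′ (x , y) = x Z.- λ′ Z.* y

  private
    unshear-x : ∀ λ′ x y → Z.1# Z.* (x Z.- λ′ Z.* y) Z.+ λ′ Z.* y ≈ᶻ x
    unshear-x = ZS.solve 3 (λ l x y → ZS.:# 1 ZS.:* (x ZS.:- l ZS.:* y) ZS.:+ l ZS.:* y ZS.:= x) Z.refl

    unshear-y : ∀ x y → Z.0# Z.* x Z.+ Z.1# Z.* y ≈ᶻ y
    unshear-y = ZS.solve 2 (λ x y → ZS.:# 0 ZS.:* x ZS.:+ ZS.:# 1 ZS.:* y ZS.:= y) Z.refl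

  shear-value : ∀ λ′ x y f → point (sheared-x λ′ (x , y)) y ⟪ shear λ′ ⟪ f ⟫ ⟫ ≈ᶻ point x y ⟪ f ⟫
  shear-value λ′ x y = point-substitute Z.1# λ′ Z.0# Z.1# (unshear-x λ′ x y) (unshear-y _ y)

  -- At a smooth point the gradient is nonzero, so the right-hand side vanishes for at most one
  -- `λ′`: any other shear makes the tangent non-vertical.
  shear-∂y : ∀ λ′ γ p → point (sheared-x λ′ p) (proj₂ p) ⟪ ZXY.derivative (shear λ′ ⟪ Curve.equation γ ⟫) ⟫ ≈ᶻ fy γ p Z.+ λ′ Z.* fx γ p
  shear-∂y λ′ γ (x , y) = Z.trans (∂y-substitute Z.1# λ′ Z.0# Z.1# (unshear-x λ′ x y) (unshear-y _ y) (Curve.equation γ))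
    (ZS.solve 3 (λ p l q → p ZS.:* l ZS.:+ q ZS.:* ZS.:# 1 ZS.:= q ZS.:+ l ZS.:* p) Z.refl _ λ′ _)

  -- A unit has an invertible value at every point, so it does not change the zeros.
  associated⇒≈ᶜ : ∀ λ′ γ γ̃ w → Unit ZXY.ring[X] w → shear λ′ ⟪ Curve.equation γ̃ ⟫ P.≈ w P.* shear λ′ ⟪ Curve.equation γ ⟫ → γ ≈ᶜ γ̃
  associated⇒≈ᶜ λ′ γ γ̃ w (k , kw≈1) eq = forth , back
    where
    at : ∀ x y → Hom ZXY.ring[X] ℂ-ring
    at x y = point (sheared-x λ′ (x , y)) y
    relation : ∀ x y → point x y ⟪ Curve.equation γ̃ ⟫ ≈ᶻ at x y ⟪ w ⟫ Z.* point x y ⟪ Curve.equation γ ⟫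
    relation x y = Z.trans (Z.sym (shear-value λ′ x y (Curve.equation γ̃))) (Z.trans (Hom.cong (at x y) eq)
      (Z.trans (Hom.*-homo (at x y) w (shear λ′ ⟪ Curve.equation γ ⟫)) (Z.*-congˡ (shear-value λ′ x y (Curve.equation γ)))))
    forth : ∀ {p} → points γ p → points γ̃ p
    forth {x , y} on = on-curve⁻¹ γ̃ (Z.trans (relation x y) (Z.trans (Z.*-congˡ (on-curve γ on)) (Z.zeroʳ _)))
    back : ∀ {p} → points γ̃ p → points γ p
    back {x , y} on = on-curve⁻¹ γ (Z.trans (Z.sym (Z.*-identityˡ _)) (Z.trans (Z.*-congʳ (Z.sym (Z.trans (Z.sym (Hom.*-homo (at x y) k w))
        (Z.trans (Hom.cong (at x y) kw≈1) (Hom.1-homo (at x y)))))) (Z.trans (Z.*-assoc _ _ _)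
      (Z.trans (Z.*-congˡ (Z.trans (Z.sym (relation x y)) (on-curve γ̃ on))) (Z.zeroʳ _)))))

  module _ (ρ : Rotation) where
    private
      c s : ℂ
      c = fromℝ (Rotation.cosine ρ)
      s = fromℝ (Rotation.sine ρ)

    unit : c Z.* c Z.+ s Z.* s ≈ᶻ Z.1#
    unit = mkᶻ (R.trans (RS.solve 2 (λ c s → (c RS.:* c RS.:+ RS.:- (RS.:# 0 RS.:* RS.:# 0)) RS.:+ (s RS.:* s RS.:+ RS.:- (RS.:# 0 RS.:* RS.:# 0))
                          RS.:= c RS.:* c RS.:+ s RS.:* s) R.refl (Rotation.cosine ρ) (Rotation.sine ρ)) (mk≈ᵣ (Rotation.unit ρ)))
      (RS.solve 2 (λ c s → (c RS.:* RS.:# 0 RS.:+ RS.:# 0 RS.:* c) RS.:+ (s RS.:* RS.:# 0 RS.:+ RS.:# 0 RS.:* s) RS.:= RS.:# 0) R.refl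
        (Rotation.cosine ρ) (Rotation.sine ρ))

    module _ (γ : Curve) where
      private
        f = Curve.equation γ

      rotated-value : ∀ t u → point t u ⟪ rotation c s ⟪ f ⟫ ⟫ ≈ᶻ point (c Z.* t Z.+ s Z.* u) (c Z.* u Z.- s Z.* t) ⟪ f ⟫
      rotated-value t u = point-substitute c s (Z.- s) c Z.refl
        (ZS.solve 4 (λ c s t u → (ZS.:- s) ZS.:* t ZS.:+ c ZS.:* u ZS.:= c ZS.:* u ZS.:- s ZS.:* t) Z.refl c s t u) f

      module _ (x y : ℂ) where
        private
          a = proj₁ (rotate ρ (x , y))
          b = proj₂ (rotate ρ (x , y))

          back-x : c Z.* a Z.+ s Z.* b ≈ᶻ x
          back-x = Z.trans (ZS.solve 4 (λ c s x y → c ZS.:* (c ZS.:* x ZS.:- s ZS.:* y) ZS.:+ s ZS.:* (s ZS.:* x ZS.:+ c ZS.:* y)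
              ZS.:= (c ZS.:* c ZS.:+ s ZS.:* s) ZS.:* x) Z.refl c s x y) (Z.trans (Z.*-congʳ unit) (Z.*-identityˡ x))

          back-y : (Z.- s) Z.* a Z.+ c Z.* b ≈ᶻ y
          back-y = Z.trans (ZS.solve 4 (λ c s x y → (ZS.:- s) ZS.:* (c ZS.:* x ZS.:- s ZS.:* y) ZS.:+ c ZS.:* (s ZS.:* x ZS.:+ c ZS.:* y)
              ZS.:= (c ZS.:* c ZS.:+ s ZS.:* s) ZS.:* y) Z.refl c s x y) (Z.trans (Z.*-congʳ unit) (Z.*-identityˡ y))

        -- Up to sign, the first coordinate of the rotated tangent vector and the derivative of the
        -- rotated equation in its second variable are the same linear form in the gradient.
        not-vertical : ¬ VerticalAfter ρ γ (x , y) → ¬ point a b ⟪ ZXY.derivative (rotation c s ⟪ f ⟫) ⟫ ≈ᶻ Z.0#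
        not-vertical nv eq = nv (≈ᶻ⇒≈ (Z.trans (Z.+-cong (Z.*-congˡ {c} (Z.-‿cong (Z.reflexive (∂y-value γ x y)))) (Z.-‿cong (Z.*-congˡ {s} (Z.reflexive (∂x-value γ x y)))))
          (Z.trans (ZS.solve 4 (λ c s p q → c ZS.:* (ZS.:- q) ZS.:- s ZS.:* p ZS.:= ZS.:- (p ZS.:* s ZS.:+ q ZS.:* c)) Z.refl c s (fx γ (x , y)) (fy γ (x , y)))
            (Z.trans (Z.-‿cong (Z.trans (Z.sym (∂y-substitute c s (Z.- s) c back-x back-y f)) eq)) (ZS.solve 0 (ZS.:- ZS.:# 0 ZS.:= ZS.:# 0) Z.refl)))))

        local-graph : ∀ {h} → LocalGraph (rotated ρ γ) (rotate ρ (x , y)) h → points γ (x , y) → Graph (rotation c s ⟪ f ⟫) a b h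
        local-graph {h} lg on = record
          { root       = Z.trans (point-substitute c s (Z.- s) c back-x back-y f) (on-curve γ on)
          ; continuous = continuous
          -- `Disc` compares a squared modulus with the square of its radius, `Graph` with the
          -- radius itself.
          ; radius     = r *ℝ r
          ; 0<radius   = OrderedField.*-positive ℝ-field {r} {r} 0<r 0<r
          ; unique     = λ t u t-near u-near root → ≈⇒≈ᶻ (Equivalence.to (iff t u t-near u-near) (on-curve⁻¹ γ (Z.trans (Z.sym (rotated-value t u)) root)))
          ; on-graph   = λ t t-near h-near → Z.trans (rotated-value t (h t))
              (on-curve γ (Equivalence.from (iff t (h t) t-near h-near) (Setoid.refl ℂ-setoid {h t})))
          }
          where
          open LocalGraph lg
          r = proj₁ graph
          0<r = proj₁ (proj₂ graph)
          iff = proj₂ (proj₂ graph)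
          continuous : Continuous h a
          continuous =
            let r , 0<r , derivatives = holomorphic
                d , is-derivative = derivatives a (OrderedField.<-respˡ ℝ-field {0ℝ} {normSq (a - a)} {r *ℝ r} (R.sym (norm-zero (Z.-‿inverseʳ a))) (OrderedField.*-positive ℝ-field {r} {r} 0<r 0<r))
                error = λ s → normSq (h s - h a - d Z.* (s - a))
                r′ , 0<r′ , close = is-derivative 1ℝ (OrderedField.0<1 ℝ-field)
            in derivative⇒continuous {h} {a} d (r′ *ℝ r′) (OrderedField.*-positive ℝ-field {r′} {r′} 0<r′ 0<r′) λ s near lt →
                 ≤ℝ⇒≯ (error s) (1ℝ *ℝ 1ℝ *ℝ normSq (s - a)) (close s near) (OrderedField.<-respˡ ℝ-field {normSq (s - a)} {1ℝ *ℝ 1ℝ *ℝ normSq (s - a)} {error s} (R.sym (R.trans (R.*-congʳ (R.*-identityˡ 1ℝ)) (R.*-identityˡ (normSq (s - a))))) lt)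

    agree-to-order : ∀ {e h h̃ a} → AgreeToOrder e h h̃ a → Agree e h h̃ a
    agree-to-order {e} {h} {h̃} {a} (A , r , 0<r , close) = A , r *ℝ r , OrderedField.*-positive ℝ-field {r} {r} 0<r 0<r , λ s near lt →
      ≤ℝ⇒≯ (normSq (h s - h̃ s)) (A *ℝ normSq (s - a) ^ℝ e) (close s near) (OrderedField.<-respˡ ℝ-field {A *ℝ power ℝ-ring (normSq (s - a)) e} {A *ℝ normSq (s - a) ^ℝ e} {normSq (h s - h̃ s)} (R.*-congˡ {A} (power-same (normSq (s - a)) e)) lt)
      where
      power-same : ∀ x e → power ℝ-ring x e R.≈ x ^ℝ e
      power-same x zero    = R.refl
      power-same x (suc e) = R.*-congˡ {x} (power-same x e)

    tangent-branches : ∀ {k} γ γ̃ λ′ x y → GraphsTangent k (rotated ρ γ) (rotated ρ γ̃) (rotate ρ (x , y)) → points γ (x , y) → points γ̃ (x , y) →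
      ¬ VerticalAfter ρ γ (x , y) →
      ∀ {Y Ỹ} → Y 0 ≈ᶻ y → Ỹ 0 ≈ᶻ y →
      H.atXY (H.coordinate (sheared-x λ′ (x , y))) Y ⟪ shear λ′ ⟪ Curve.equation γ ⟫ ⟫ H.≈ˢ (λ _ → Z.0#) →
      H.atXY (H.coordinate (sheared-x λ′ (x , y))) Ỹ ⟪ shear λ′ ⟪ Curve.equation γ̃ ⟫ ⟫ H.≈ˢ (λ _ → Z.0#) →
      ¬ point (sheared-x λ′ (x , y)) y ⟪ ZXY.derivative (shear λ′ ⟪ Curve.equation γ̃ ⟫) ⟫ ≈ᶻ Z.0# → Y H.≈[ suc k ] Ỹ
    tangent-branches {k} γ γ̃ λ′ x y tangent on oñ nv {Y} {Ỹ} Y₀ Ỹ₀ root root̃ ∂y≉0 =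
      branches-agree (Curve.equation γ) (Curve.equation γ̃) λ′ c s unit (sheared-x λ′ (x , y)) y (proj₁ (rotate ρ (x , y))) (proj₂ (rotate ρ (x , y)))
        (ZS.solve 5 (λ c s l x y → c ZS.:* (x ZS.:- l ZS.:* y ZS.:+ l ZS.:* y) ZS.:- s ZS.:* y ZS.:= c ZS.:* x ZS.:- s ZS.:* y) Z.refl c s λ′ x y)
        (ZS.solve 5 (λ c s l x y → s ZS.:* (x ZS.:- l ZS.:* y ZS.:+ l ZS.:* y) ZS.:+ c ZS.:* y ZS.:= s ZS.:* x ZS.:+ c ZS.:* y) Z.refl c s λ′ x y)
        {Func.to h} {Func.to h̃} {k}
        (local-graph γ x y S-is-h on) (local-graph γ̃ x y S̃-is-h̃ oñ) (agree-to-order {suc k} {Func.to h} {Func.to h̃} agree)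
        (not-vertical γ x y nv) Y₀ root Ỹ₀ root̃ ∂y≉0
      where open GraphsTangent tangent

-- `bezout-bound` for the sheared curves, of degree at most 2D in each variable, with its factor `e`
-- left out.
bezout-constant : ℕ → ℕ → ℕ
bezout-constant k D = suc (2 * (2 * D)) ^ suc (2 * D) * box-degree (2 * D) (suc (suc k))

-- The bound for one family of curves and a given `e`

module Bound (em : ExcludedMiddle 0ℓ) (k D : ℕ) (1≤D : 1 ≤ D) {N : ℕ} (𝒞 : Fin N → Curve)
             (distinct : Injective _≡_ _≈ᶜ_ 𝒞) (irr : ∀ i → Irreducible (𝒞 i)) (deg : ∀ i → Degree≤ D (𝒞 i))
             (ps : List ℂ²) (unique : Unique ps)
             (e : ℕ) (1≤e : 1 ≤ e) (e-large : N * suc (bezout-constant k D * e) ℕ.< e ^ suc (suc k)) where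
  open RealField em using (ℝ-field)
  open Complex ℝ-field using (ℂ-ring; ℂ-field; _≈ᶻ_)
  open SeriesOverField em ℂ-field using (point; coordinate; solution-unique; atXY)
  open Hurwitz ℂ-ring using (_≈[_]_; mk≈<; below; ≈<-sym; ≈<-trans; ≈ˢ⇒≈<; _≈ˢ_)
  open Tangency em ℝ-field using (shear)
  open Plane em
  open Core em ℂ-field e (2 * D) k 1≤e (ℕ.≤-trans 1≤D (ℕ.m≤m+n D _)) using (Regular; branch; branch-root; Tangent; bezout-bound; few-tangencies; Associated)
  open GenericSlopes em ℂ-field
  open Counting em
  private
    module Z   = CommutativeRing ℂ-ring
    module ZS  = Integers ℂ-ring
    module H   = CommutativeRing (Hurwitz.series ℂ-ring)
    open Algebra.Properties.Semiring.Mult Z.semiring using () renaming (_×_ to _·_)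

    M : ℕ
    M = bezout-bound

    M≡ : M ≡ bezout-constant k D * e
    M≡ = ≡.trans (≡.cong (a *_) (ℕ.*-comm e b)) (≡.sym (ℕ.*-assoc a b e))
      where
      a = suc (2 * (2 * D)) ^ suc (2 * D)
      b = box-degree (2 * D) (suc (suc k))

    GenericSlope : ℕ → Set
    GenericSlope m = All (λ p → ∀ i → SmoothPoint (𝒞 i) p → ¬ fy (𝒞 i) p Z.+ (m · Z.1#) Z.* fx (𝒞 i) p ≈ᶻ Z.0#) ps
                   × AllPairs (λ p q → ¬ sheared-x (m · Z.1#) p ≈ᶻ sheared-x (m · Z.1#) q) ps

    generic-slope : Eventuallyᴺ GenericSlope
    generic-slope = eventually-× (eventually-All (All.universal (λ p → eventually-Fin (λ i → transversal i p em)) ps))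
                                 (eventually-AllPairs (AllPairs.map (λ {p} {q} → separates p q) unique))
      where
      transversal : ∀ i p → Dec (fy (𝒞 i) p ≈ᶻ Z.0# × fx (𝒞 i) p ≈ᶻ Z.0#) →
        Eventuallyᴺ (λ m → SmoothPoint (𝒞 i) p → ¬ fy (𝒞 i) p Z.+ (m · Z.1#) Z.* fx (𝒞 i) p ≈ᶻ Z.0#)
      transversal i p (yes zeros) = 0 , λ _ _ sm → ⊥-elim (smooth (𝒞 i) p sm zeros)
      transversal i p (no nz)     = let m₀ , ok = generic-nonzero _ _ nz in m₀ , λ m le _ → ok m le
      separates : ∀ p q → ¬ Setoid._≈_ ℂ²-setoid p q → Eventuallyᴺ (λ m → ¬ sheared-x (m · Z.1#) p ≈ᶻ sheared-x (m · Z.1#) q)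
      separates (x , y) (x′ , y′) p≉q =
        let m₀ , ok = generic-nonzero (x Z.- x′) (y′ Z.- y) (λ (eq , eq′) → p≉q (≈ᶻ⇒≈ (equal eq) , ≈ᶻ⇒≈ (Z.sym (equal eq′)))) in
        m₀ , λ m le eq → ok m le (Z.trans (ZS.solve 5 (λ x x′ y y′ l → (x ZS.:- x′) ZS.:+ l ZS.:* (y′ ZS.:- y) ZS.:= (x ZS.:- l ZS.:* y) ZS.:- (x′ ZS.:- l ZS.:* y′))
          Z.refl x x′ y y′ (m · Z.1#)) (Z.trans (Z.+-congʳ eq) (Z.-‿inverseʳ _)))
        where
        equal : ∀ {z w} → z Z.- w ≈ᶻ Z.0# → z ≈ᶻ w
        equal {z} {w} eq = Z.trans (ZS.solve 2 (λ z w → z ZS.:= (z ZS.:- w) ZS.:+ w) Z.refl z w) (Z.trans (Z.+-congʳ eq) (Z.+-identityˡ w))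

  module WithSlope (slope : ℂ)
      (transversal : All (λ p → ∀ i → SmoothPoint (𝒞 i) p → ¬ fy (𝒞 i) p Z.+ slope Z.* fx (𝒞 i) p ≈ᶻ Z.0#) ps)
      (separated : AllPairs (λ p q → ¬ sheared-x slope p ≈ᶻ sheared-x slope q) ps) where

      f : Fin N → List (List ℂ)
      f i = shear slope ⟪ Curve.equation (𝒞 i) ⟫

      f-irreducible : ∀ i → Irreducibleᴿ (Poly.ring[X] (Poly.ring[X] ℂ-ring)) (f i)
      f-irreducible i = Shears.shear-irreducible ℂ-ring slope (irreducible (𝒞 i) (irr i))

      f-degree : ∀ i → BoundedDegree.Fil ℂ-ring (2 * D) (f i)
      f-degree i = Shears.substitute-∈ ℂ-ring Z.1# slope Z.0# Z.1# (Curve.equation (𝒞 i)) (degree-bound D (𝒞 i) (deg i))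

      f-associated : ∀ {i j} → Associated (f i) (f j) → i ≡ j
      f-associated {i} {j} (w , unit , eq) = distinct (associated⇒≈ᶜ slope (𝒞 i) (𝒞 j) w unit eq)

      u : ℂ² → ℂ
      u = sheared-x slope

      -- A branch is constructed from a proof of regularity; transitivity of `T` requires that two
      -- such proofs for the middle curve yield the same series.
      branch-unique : ∀ i {x y} (r r′ : Regular (f i) x y) n → branch r ≈[ n ] branch r′
      branch-unique i {x} {y} r r′ n = solution-unique n (coordinate x) (f i) Z.refl Z.refl (Regular.∂y≉0 r)
        (≈ˢ⇒≈< (H.trans (branch-root r) (H.sym (branch-root r′))))

      -- Tangency in the statement involves a rotation chosen for each pair, which obscures
      -- transitivity. Agreement of branches in the common sheared coordinates is visibly
      -- transitive, and it follows from tangency at the listed points.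
      T : Fin N → Fin N → ℂ² → Set
      T i j p = i ≢ j × ∃ λ (r : Regular (f i) (u p) (proj₂ p)) → ∃ λ (r′ : Regular (f j) (u p) (proj₂ p)) → branch r ≈[ suc k ] branch r′

      T-sym : ∀ {i j p} → T i j p → T j i p
      T-sym (i≢j , r , r′ , eq) = (λ eq → i≢j (≡.sym eq)) , r′ , r , ≈<-sym eq

      T-trans : ∀ {i j l p} → T i j p → T j l p → i ≢ l → T i l p
      T-trans {j = j} (_ , r , r₁ , eq) (_ , r₂ , r′ , eq′) i≢l = i≢l , r , r′ , ≈<-trans eq (≈<-trans (branch-unique j r₁ r₂ (suc k)) eq′)

      regular : ∀ {p} → p ∈ ps → ∀ i → SmoothPoint (𝒞 i) p → Regular (f i) (u p) (proj₂ p)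
      regular {p} p∈ i sm = record
        { root = Z.trans (shear-value slope (proj₁ p) (proj₂ p) (Curve.equation (𝒞 i))) (on-curve (𝒞 i) (proj₁ sm))
        ; ∂y≉0 = λ eq → All.lookup transversal p∈ i sm (Z.trans (Z.sym (shear-∂y slope (𝒞 i) p)) eq) }

      tangent⇒T : ∀ {p} → p ∈ ps → ∀ i j → ¬ 𝒞 j ≈ᶜ 𝒞 i → TangentToOrder≥ k (𝒞 i) (𝒞 j) p → T i j p
      tangent⇒T {p} p∈ i j ¬same (sm , sm′ , ρ , nv , _ , tangent) = (λ { refl → ¬same ((λ on → on) , (λ on → on)) }) , r , r′ ,
        tangent-branches ρ (𝒞 i) (𝒞 j) slope (proj₁ p) (proj₂ p) tangent (proj₁ sm) (proj₁ sm′) nv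
          Z.refl Z.refl (branch-root r) (branch-root r′) (Regular.∂y≉0 r′)
        where
        r = regular p∈ i sm
        r′ = regular p∈ j sm′

      Chosen : ∀ {n} → (Fin (suc n) → Fin N) → Fin (suc n) → Set
      Chosen g i = ∃ λ (h : Fin (suc M) → ℂ²) → (∀ a → Touched T g (h a) i) × (∀ a → h a ∈ ps) × (∀ {a b} → u (h a) ≈ᶻ u (h b) → a ≡ b)

      not-all-touched : ∀ {n} (g : Fin (suc n) → Fin N) → suc n ≤ N → ¬ (∀ i → Chosen g i)
      not-all-touched {n} g n≤N chosen = few-tangencies (λ i → f (g i)) (λ i → f-irreducible (g i)) (λ i → f-degree (g i))
          (λ i a → u (pt i a) , proj₂ (pt i a)) (λ i {a} {b} → proj₂ (proj₂ (proj₂ (chosen i))) {a} {b})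
          (λ i a → proj₁ (proj₂ (proj₂ (touched i a))))
          (λ i a → let j , g≢ , r , r′ , eq = touched i a in j , (λ assoc → g≢ (f-associated assoc)) , record { other = r′ ; agree = eq })
          zero (ℕ.≤-<-trans (ℕ.*-monoˡ-≤ (suc M) n≤N) (≡.subst (λ m → N * suc m ℕ.< e ^ suc (suc k)) (≡.sym M≡) e-large))
        where
        pt : Fin (suc n) → Fin (suc M) → ℂ²
        pt i = proj₁ (chosen i)
        touched : ∀ i a → Touched T g (pt i a) i
        touched i = proj₁ (proj₂ (chosen i))

      few : ∀ {n} (g : Fin (suc n) → Fin N) → suc n ≤ N → ∃ λ i → hits (λ p → Touched T g p i) ps ≤ M
      few {n} g n≤N = decide em
        where
        decide : Dec (∃ λ i → hits (λ p → Touched T g p i) ps ≤ M) → ∃ λ i → hits (λ p → Touched T g p i) ps ≤ M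
        decide (yes found) = found
        decide (no none)   = ⊥-elim (not-all-touched g n≤N λ i → select (λ p q → u p ≈ᶻ u q) Z.sym (λ p → Touched T g p i) (suc M) ps
          separated (ℕ.≰⇒> (λ le → none (i , le))))

      sum-mono : ∀ {a b : ℂ² → ℕ} qs → (∀ {p} → p ∈ qs → a p ≤ b p) → sum (map a qs) ≤ sum (map b qs)
      sum-mono []       le = z≤n
      sum-mono (p ∷ qs) le = ℕ.+-mono-≤ (le (here refl)) (sum-mono qs (λ p∈ → le (there p∈)))

      bound : sum (map (multiplicity em k 𝒞) ps) ≤ 2 * (bezout-constant k D * e) * N
      bound = ≡.subst (λ m → sum (map (multiplicity em k 𝒞) ps) ≤ 2 * m * N) M≡ (ℕ.≤-trans
        (sum-mono ps λ {p} p∈ → ℕ.≤-trans (ℕ.≤-reflexive (count-allFin N (TangentToAnother k 𝒞 p)))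
          (cardinality-mono N λ i (j , ¬same , tangent) → j , tangent⇒T p∈ i j ¬same tangent))
        (incidences-bound T (λ {i} {j} {p} → T-sym {i} {j} {p}) (λ {i} {j} {l} {p} → T-trans {i} {j} {l} {p}) M ps (λ g _ → few g) (λ i → i) (λ eq → eq) ℕ.≤-refl))

  total-multiplicity : sum (map (multiplicity em k 𝒞) ps) ≤ 2 * (bezout-constant k D * e) * N
  total-multiplicity = let m , generic = generic-slope ; transversal , separated = generic m ℕ.≤-refl in
    WithSlope.bound (m · Z.1#) transversal separated

theorem3 : (em : ExcludedMiddle 0ℓ) → (k D : ℕ) → 1 ≤ k → 1 ≤ D →
    ∃ λ (K : ℕ) → (n : ℕ) (𝒞 : Fin n → Curve) →
    Injective _≡_ _≈ᶜ_ 𝒞 →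
    (∀ i → Irreducible (𝒞 i)) →
    (∀ i → Degree≤ D (𝒞 i)) →
    (ps : List ℂ²) → Unique ps →
    sum (map (multiplicity em k 𝒞) ps) ^ suc k ≤ K ^ suc k * n ^ (k + 2)
theorem3 em k D 1≤k 1≤D = K , bound
  where
  c K : ℕ
  c = bezout-constant k D
  -- The count gives 2 c e n, and `integer-root` bounds e^(k+1) by 2^(k+1) n (c + 1). Replacing c +
  -- 1 by its (k+1)-st power makes the constant a (k+1)-st power.
  K = 4 * c * suc c
  bound : (n : ℕ) (𝒞 : Fin n → Curve) → Injective _≡_ _≈ᶜ_ 𝒞 → (∀ i → Irreducible (𝒞 i)) → (∀ i → Degree≤ D (𝒞 i)) →
    (ps : List ℂ²) → Unique ps → sum (map (multiplicity em k 𝒞) ps) ^ suc k ≤ K ^ suc k * n ^ (k + 2)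
  bound zero 𝒞 _ _ _ ps _ = ℕ.≤-trans (ℕ.≤-reflexive (≡.cong (_^ suc k) (empty ps))) z≤n
    where
    empty : ∀ ps → sum (map (multiplicity em k 𝒞) ps) ≡ 0
    empty []       = refl
    empty (p ∷ ps) = empty ps
  -- The requirement n (1 + c e) < e^(k+2) of interpolation follows from n (c + 1) < e^(k+1) on
  -- multiplying by `e`.
  bound n@(suc _) 𝒞 distinct irr deg ps unique = estimate (integer-root k (n * suc c) (s≤s z≤n))
    where
    J = suc k
    power-≥ : ∀ c k → suc c ≤ suc c ^ suc k
    power-≥ c k = ℕ.≤-trans (ℕ.≤-reflexive (≡.sym (ℕ.*-identityʳ (suc c)))) (ℕ.*-monoʳ-≤ (suc c) (ℕ.m^n>0 (suc c) k))
    estimate : ∃ (λ e → 1 ≤ e × n * suc c ℕ.< e ^ J × e ^ J ≤ 2 ^ J * (n * suc c)) →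
      sum (map (multiplicity em k 𝒞) ps) ^ J ≤ K ^ J * n ^ (k + 2)
    estimate (e , 1≤e , large , e≤) = begin
      sum (map (multiplicity em k 𝒞) ps) ^ J
        ≤⟨ ℕ.^-monoˡ-≤ J (Bound.total-multiplicity em k D 1≤D 𝒞 distinct irr deg ps unique e 1≤e e-large) ⟩
      (2 * (c * e) * n) ^ J
        ≡⟨ ≡.cong (_^ J) (solve 3 (λ c e n → con 2 :* (c :* e) :* n := con 2 :* c :* n :* e) refl c e n) ⟩
      (2 * c * n * e) ^ J
        ≡⟨ ^-distrib-* J (2 * c * n) e ⟩
      (2 * c * n) ^ J * e ^ J
        ≤⟨ ℕ.*-monoʳ-≤ ((2 * c * n) ^ J) e≤ ⟩
      (2 * c * n) ^ J * (2 ^ J * (n * suc c))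
        ≤⟨ ℕ.*-monoʳ-≤ ((2 * c * n) ^ J) (ℕ.*-monoʳ-≤ (2 ^ J) (ℕ.*-monoʳ-≤ n (power-≥ c k))) ⟩
      (2 * c * n) ^ J * (2 ^ J * (n * suc c ^ J))
        ≡⟨ ≡.cong (_* (2 ^ J * (n * suc c ^ J))) (^-distrib-* J (2 * c) n) ⟩
      (2 * c) ^ J * n ^ J * (2 ^ J * (n * suc c ^ J))
        ≡⟨ solve 5 (λ a b d n q → a :* b :* (d :* (n :* q)) := d :* a :* q :* (n :* b)) refl ((2 * c) ^ J) (n ^ J) (2 ^ J) n (suc c ^ J) ⟩
      2 ^ J * (2 * c) ^ J * suc c ^ J * (n * n ^ J)
        ≡⟨ ≡.cong (λ a → a * suc c ^ J * (n * n ^ J)) (^-distrib-* J 2 (2 * c)) ⟨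
      (2 * (2 * c)) ^ J * suc c ^ J * (n * n ^ J)
        ≡⟨ ≡.cong (_* (n * n ^ J)) (^-distrib-* J (2 * (2 * c)) (suc c)) ⟨
      (2 * (2 * c) * suc c) ^ J * n ^ suc J
        ≡⟨ ≡.cong₂ (λ a b → (a * suc c) ^ J * n ^ b) (ℕ.*-assoc 2 2 c) (ℕ.+-comm k 2) ⟨
      K ^ J * n ^ (k + 2) ∎
      where
      open ℕ.≤-Reasoning
      open +-*-Solver
      e-large : n * suc (c * e) ℕ.< e ^ suc (suc k)
      e-large = begin-strict
        n * suc (c * e)     ≤⟨ ℕ.*-monoʳ-≤ n (ℕ.+-monoˡ-≤ (c * e) 1≤e) ⟩
        n * (e + c * e)     ≡⟨ solve 3 (λ n e c → n :* (e :+ c :* e) := e :* (n :* (con 1 :+ c))) refl n e c ⟩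
        e * (n * suc c)     <⟨ ℕ.*-monoʳ-< e {{ℕ.>-nonZero 1≤e}} large ⟩
        e ^ suc (suc k)     ∎
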